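{- (a) Let $q$ be a prime power, $n = q^2+1$ and $m = qn$. Then $z(m,n,2,3) = (q^2+q)n$. (b) Let $r \ge 4$ be fixed and let $m = m(n)$ satisfy $m = (1+o(1))n^{r/2}$ for integers $n$. Then $z(m,n,2,r) = (1+o(1))\sqrt{n}\,m$ as $n \to \infty$.
   Context: The Zarankiewicz number $z(m,n,s,t)$ is the maximum number of edges in a bipartite graph with parts $A$, $B$ of sizes $m$, $n$ containing no complete bipartite subgraph with $s$ vertices in $A$ and $t$ vertices in $B$. -}

module Defs where

open import Data.Nat using (ℕ; zero; suc; _+_; _*_; _^_; _≤_; _⊔_; _≟_)
open import Data.Nat.Primality using (Prime)
open import Data.Bool using (Bool; true; false)
open import Data.Fin using (Fin)
open import Data.Fin.Subset using (Subset; _∈_; _⊆_; ∣_∣; inside; outside)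
open import Data.Fin.Subset.Properties using (anySubset?; _∈?_; _⊆?_)
open import Data.Fin.Properties using (all?)
open import Data.Vec using (Vec; []; _∷_; lookup)
open import Data.List using (List; []; _∷_; map; concatMap; foldr; filterᵇ)
open import Data.Product using (Σ; ∃; _×_; _,_)
open import Relation.Nullary using (Dec; yes; no; ¬_)
open import Relation.Nullary.Decidable using (isYes; _×-dec_)
open import Data.Empty using (⊥-elim)
open import Relation.Binary.PropositionalEquality using (_≡_)

IsPrimePower : ℕ → Set
IsPrimePower q = Σ ℕ λ p → Σ ℕ λ k → Prime p × 1 ≤ k × q ≡ p ^ k

-- A bipartite graph with parts A = Fin m and B = Fin n, given by the
-- neighbourhood (a subset of B) of each vertex of A.
BipGraph : ℕ → ℕ → Set
BipGraph m n = Vec (Subset n) m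

adj : ∀ {m n} → BipGraph m n → Fin m → Fin n → Set
adj G i j = j ∈ lookup G i

edges : ∀ {m n} → BipGraph m n → ℕ
edges [] = 0
edges (N ∷ G) = ∣ N ∣ + edges G

ContainsK : ∀ {m n} → BipGraph m n → ℕ → ℕ → Set
ContainsK {m} {n} G s t =
  Σ (Subset m) λ S → Σ (Subset n) λ T →
    ∣ S ∣ ≡ s × ∣ T ∣ ≡ t × (∀ i j → i ∈ S → j ∈ T → adj G i j)

dec→ : ∀ {P Q : Set} → Dec P → Dec Q → Dec (P → Q)
dec→ (yes p) (yes q) = yes (λ _ → q)
dec→ (yes p) (no ¬q) = no (λ f → ¬q (f p))
dec→ (no ¬p) _ = yes (λ p → ⊥-elim (¬p p))

containsK? : ∀ {m n} (G : BipGraph m n) s t → Dec (ContainsK G s t)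
containsK? {m} {n} G s t =
  anySubset? (λ S → anySubset? (λ T →
    (∣ S ∣ ≟ s) ×-dec ((∣ T ∣ ≟ t) ×-dec
      all? (λ i → all? (λ j → dec→ (i ∈? S) (dec→ (j ∈? T) (j ∈? lookup G i)))))))

allSubsets : ∀ n → List (Subset n)
allSubsets zero = [] ∷ []
allSubsets (suc n) = concatMap (λ S → (inside ∷ S) ∷ (outside ∷ S) ∷ []) (allSubsets n)

allGraphs : ∀ m n → List (BipGraph m n)
allGraphs zero n = [] ∷ []
allGraphs (suc m) n =
  concatMap (λ G → map (λ N → N ∷ G) (allSubsets n)) (allGraphs m n)

z : ℕ → ℕ → ℕ → ℕ → ℕ
z m n s t =
  foldr _⊔_ 0 (map edges (filterᵇ (λ G → Data.Bool.not (isYes (containsK? G s t))) (allGraphs m n)))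
  where import Data.Bool

{-# OPTIONS --safe #-}
module Submission where

-- Upper bounds count pairs (row, r-set of columns contained in it): without K_{2,r} every r-set lies in at most one row,
-- and Σ C(kᵢ, r) ≤ C(n, r) bounds Σ kᵢ because C(–, r) lies above its tangent line.
--
-- (a) is attained by the circles and lines of the Möbius plane F² ∪ {∞} over the field F with q elements, the circles
-- being N(x − a, y − b) = r for an anisotropic form N = x² + xy + c y²; two of these blocks share at most two points.
--
-- (b) is attained by Reed–Solomon codes: rows are polynomials of degree below r over a field with q elements, columns are
-- points of F², incidence is lying on the graph, and two polynomials agree in fewer than r places.  This needs q ~ √n,
-- hence prime powers in (x, (1 + ε) x] for large x.  These come from Selberg's formula
-- ψ(x) log x + Σ Λ(n) ψ(x/n) = 2 x log x + O(x), proved with rational approximations to log.  On a geometric grid of ratio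
-- 1 + 1/K let aᵢ be the normalised mass of Λ in the i-th cell.  If the cells near T carry no mass, the formula forces
-- Σ aᵢ (2 − a_{T−i}) to be small; comparing with the reflected sum shows that Σ aᵢ (2 − aᵢ) and the jumps Σ (aᵢ₊₁ − aᵢ)²
-- are small (aᵢ ≤ 2 + o(1), again by the formula), so that aᵢ stays near 0 or near 2 over long windows, contrary to Mertens' theorem Σ_{n ≤ x} Λ(n)/n = log x + O(1).
--
-- The field with q = p^k elements is cut out of 𝔽ₚ[X]/(X^(q−1) − 1) by a primitive idempotent below the support of
-- the product of the X^(p^d) − X, 0 < d < k: that product stays invertible, so X generates an extension of degree k.

-- No real number occurs; this shapes the proof. The logarithm is replaced by a completely additive
-- `ℓ` with rational values that tracks it up to a bound `X` fixed only after the interval under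
-- study. Identities between Λ, μ and `ℓ` are therefore exact; only estimates carry errors, with
-- explicit and deliberately loose constants. The full prime number theorem is avoided: it suffices
-- to refute an interval of three grid cells without prime powers. Three, because the reflections of
-- i to T - i and to T + 1 - i are both used, and together they compare neighbouring cells; each of
-- them needs two empty cells. The clash with Mertens' theorem is that the mean of the aᵢ over a
-- long window is near 1, hence neither at most 1/4 nor at least 7/4. In (a) the tangent bound is
-- exact because C(n, 3) = q n C(q + 1, 3). In (b), q near √n gives about q^r ~ m polynomials with q
-- points each. Square roots are avoided by comparing squares throughout.

-- Commutative rings and a reflective solver for polynomial identities.

module Rings where
  open import Data.Nat as ℕ using (ℕ; zero; suc; _+_; _*_; _<ᵇ_; _≡ᵇ_)
  import Data.Nat.Properties as ℕ
  open import Data.Bool using (Bool; true; false; _∧_; T)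
  open import Data.Fin using (Fin; toℕ; zero; suc)
  open import Data.Vec using (Vec; []; _∷_; lookup; allFin)
  open import Data.Vec.N-ary using (N-ary; _$ⁿ_)
  open import Data.List using (List; []; _∷_)
  open import Data.Product using (_×_; _,_)
  open import Data.Unit using (tt)
  open import Relation.Binary.PropositionalEquality

  record CRing : Set₁ where
    infixl 6 _⊕_
    infixl 7 _⊗_
    field
      R : Set
      _⊕_ _⊗_ : R → R → R
      ⊝_ : R → R
      # : ℕ → R
      ⊕-assoc : ∀ x y z → (x ⊕ y) ⊕ z ≡ x ⊕ (y ⊕ z)
      ⊕-comm : ∀ x y → x ⊕ y ≡ y ⊕ x
      ⊕-idˡ : ∀ x → # 0 ⊕ x ≡ x
      ⊕-invʳ : ∀ x → x ⊕ (⊝ x) ≡ # 0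
      ⊗-assoc : ∀ x y z → (x ⊗ y) ⊗ z ≡ x ⊗ (y ⊗ z)
      ⊗-comm : ∀ x y → x ⊗ y ≡ y ⊗ x
      ⊗-idˡ : ∀ x → # 1 ⊗ x ≡ x
      ⊗-distˡ : ∀ x y z → x ⊗ (y ⊕ z) ≡ x ⊗ y ⊕ x ⊗ z
      #-+ : ∀ m n → # (m + n) ≡ # m ⊕ # n
      #-* : ∀ m n → # (m * n) ≡ # m ⊗ # n

    infixl 6 _⊖_
    _⊖_ : R → R → R
    x ⊖ y = x ⊕ (⊝ y)

  infixl 6 _:+_ _:-_
  infixl 7 _:*_
  infix 4 _:=_

  data Expr (n : ℕ) : Set where
    var : Fin n → Expr n
    κ : ℕ → Expr n
    _:+_ _:*_ _:-_ : Expr n → Expr n → Expr n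

  data Equation (n : ℕ) : Set where
    _:=_ : Expr n → Expr n → Equation n

  -- Normal forms are sorted lists of monomials; the coefficient (a , b) stands for a − b.
  Mon Poly : Set
  Mon = List ℕ
  Poly = List (Mon × ℕ × ℕ)

  data Cmp (xs ys : Mon) : Set where
    less greater : Cmp xs ys
    equal : xs ≡ ys → Cmp xs ys

  compareMon : ∀ xs ys → Cmp xs ys
  compareMon [] [] = equal refl
  compareMon [] (_ ∷ _) = less
  compareMon (_ ∷ _) [] = greater
  compareMon (x ∷ xs) (y ∷ ys) with x <ᵇ y | x ≡ᵇ y in e
  ... | true | _ = less
  ... | false | false = greater
  ... | false | true with compareMon xs ys
  ... | less = less
  ... | greater = greater
  ... | equal refl = equal (cong (_∷ xs) (ℕ.≡ᵇ⇒≡ x y (subst T (sym e) tt)))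

  insertVar : ℕ → Mon → Mon
  insertVar x [] = x ∷ []
  insertVar x (y ∷ ys) with x <ᵇ y
  ... | true = x ∷ y ∷ ys
  ... | false = y ∷ insertVar x ys

  mulMon : Mon → Mon → Mon
  mulMon [] ys = ys
  mulMon (x ∷ xs) ys = insertVar x (mulMon xs ys)

  -- Sortedness only lets equal monomials meet; the soundness proof `insert-eval` holds for
  -- arbitrary lists.
  insert : Mon → ℕ → ℕ → Poly → Poly
  insert m a b [] = (m , a , b) ∷ []
  insert m a b ((m′ , a′ , b′) ∷ p) with compareMon m m′
  ... | less = (m , a , b) ∷ (m′ , a′ , b′) ∷ p
  ... | greater = (m′ , a′ , b′) ∷ insert m a b p
  ... | equal _ = (m′ , a + a′ , b + b′) ∷ p

  addP : Poly → Poly → Poly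
  addP [] q = q
  addP ((m , a , b) ∷ p) q = insert m a b (addP p q)

  negP : Poly → Poly
  negP [] = []
  negP ((m , a , b) ∷ p) = (m , b , a) ∷ negP p

  scaleP : Mon → ℕ → ℕ → Poly → Poly
  scaleP m a b [] = []
  scaleP m a b ((m′ , a′ , b′) ∷ p) = insert (mulMon m m′) (a * a′ + b * b′) (a * b′ + b * a′) (scaleP m a b p)

  mulP : Poly → Poly → Poly
  mulP [] q = []
  mulP ((m , a , b) ∷ p) q = addP (scaleP m a b q) (mulP p q)

  norm : ∀ {n} → Expr n → Poly
  norm (var i) = (toℕ i ∷ [] , 1 , 0) ∷ []
  norm (κ k) = ([] , k , 0) ∷ []
  norm (a :+ b) = addP (norm a) (norm b)
  norm (a :* b) = mulP (norm a) (norm b)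
  norm (a :- b) = addP (norm a) (negP (norm b))

  isZero : Poly → Bool
  isZero [] = true
  isZero ((_ , a , b) ∷ p) = (a ≡ᵇ b) ∧ isZero p

  ∧-elim : ∀ a {b} → a ∧ b ≡ true → a ≡ true × b ≡ true
  ∧-elim true e = refl , e

  vars : ∀ n → Vec (Expr n) n
  vars n = Data.Vec.map var (allFin n)

  identity? : ∀ {n} → Equation n → Bool
  identity? (a := b) = isZero (norm (a :- b))

  module RingSolver (𝓡 : CRing) where
    open CRing 𝓡

    ⊕-idʳ : ∀ x → x ⊕ # 0 ≡ x
    ⊕-idʳ x = trans (⊕-comm x (# 0)) (⊕-idˡ x)

    ⊗-idʳ : ∀ x → x ⊗ # 1 ≡ x
    ⊗-idʳ x = trans (⊗-comm x (# 1)) (⊗-idˡ x)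

    ⊗-distʳ : ∀ x y z → (x ⊕ y) ⊗ z ≡ x ⊗ z ⊕ y ⊗ z
    ⊗-distʳ x y z = trans (⊗-comm (x ⊕ y) z) (trans (⊗-distˡ z x y) (cong₂ _⊕_ (⊗-comm z x) (⊗-comm z y)))

    ⊕-cancelʳ : ∀ x y z → x ⊕ z ≡ y ⊕ z → x ≡ y
    ⊕-cancelʳ x y z e = begin
      x                  ≡⟨ ⊕-idʳ x ⟨
      x ⊕ # 0            ≡⟨ cong (x ⊕_) (⊕-invʳ z) ⟨
      x ⊕ (z ⊕ (⊝ z))    ≡⟨ ⊕-assoc x z (⊝ z) ⟨
      (x ⊕ z) ⊕ (⊝ z)    ≡⟨ cong (_⊕ (⊝ z)) e ⟩
      (y ⊕ z) ⊕ (⊝ z)    ≡⟨ ⊕-assoc y z (⊝ z) ⟩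
      y ⊕ (z ⊕ (⊝ z))    ≡⟨ cong (y ⊕_) (⊕-invʳ z) ⟩
      y ⊕ # 0            ≡⟨ ⊕-idʳ y ⟩
      y ∎
      where open ≡-Reasoning

    ⊗-zeroʳ : ∀ x → x ⊗ # 0 ≡ # 0
    ⊗-zeroʳ x = ⊕-cancelʳ _ _ (x ⊗ # 0) (trans (sym (⊗-distˡ x (# 0) (# 0)))
      (trans (cong (x ⊗_) (⊕-idˡ (# 0))) (sym (⊕-idˡ (x ⊗ # 0)))))

    ⊗-zeroˡ : ∀ x → # 0 ⊗ x ≡ # 0
    ⊗-zeroˡ x = trans (⊗-comm (# 0) x) (⊗-zeroʳ x)

    ⊖-⊕ : ∀ x y → (x ⊖ y) ⊕ y ≡ x
    ⊖-⊕ x y = trans (⊕-assoc x (⊝ y) y) (trans (cong (x ⊕_) (trans (⊕-comm (⊝ y) y) (⊕-invʳ y))) (⊕-idʳ x))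

    ⊖-unique : ∀ {x y z} → z ⊕ y ≡ x → x ⊖ y ≡ z
    ⊖-unique {x} {y} {z} e = ⊕-cancelʳ _ _ y (trans (⊖-⊕ x y) (sym e))

    ⊕-interchange : ∀ a b c d → (a ⊕ b) ⊕ (c ⊕ d) ≡ (a ⊕ c) ⊕ (b ⊕ d)
    ⊕-interchange a b c d = begin
      (a ⊕ b) ⊕ (c ⊕ d) ≡⟨ ⊕-assoc a b (c ⊕ d) ⟩
      a ⊕ (b ⊕ (c ⊕ d)) ≡⟨ cong (a ⊕_) (⊕-assoc b c d) ⟨
      a ⊕ ((b ⊕ c) ⊕ d) ≡⟨ cong (λ t → a ⊕ (t ⊕ d)) (⊕-comm b c) ⟩
      a ⊕ ((c ⊕ b) ⊕ d) ≡⟨ cong (a ⊕_) (⊕-assoc c b d) ⟩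
      a ⊕ (c ⊕ (b ⊕ d)) ≡⟨ ⊕-assoc a c (b ⊕ d) ⟨
      (a ⊕ c) ⊕ (b ⊕ d) ∎
      where open ≡-Reasoning

    ⊖-interchange : ∀ a b c d → (a ⊖ b) ⊕ (c ⊖ d) ≡ (a ⊕ c) ⊖ (b ⊕ d)
    ⊖-interchange a b c d = sym (⊖-unique (trans (⊕-interchange (a ⊖ b) (c ⊖ d) b d) (cong₂ _⊕_ (⊖-⊕ a b) (⊖-⊕ c d))))

    ⟦_⟧ : ∀ {n} → Expr n → Vec R n → R
    ⟦ var i ⟧ ρ = lookup ρ i
    ⟦ κ k ⟧ ρ = # k
    ⟦ a :+ b ⟧ ρ = ⟦ a ⟧ ρ ⊕ ⟦ b ⟧ ρ
    ⟦ a :* b ⟧ ρ = ⟦ a ⟧ ρ ⊗ ⟦ b ⟧ ρ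
    ⟦ a :- b ⟧ ρ = ⟦ a ⟧ ρ ⊖ ⟦ b ⟧ ρ

    module _ (at : ℕ → R) where

      evalM : Mon → R
      evalM [] = # 1
      evalM (x ∷ m) = at x ⊗ evalM m

      evalP : Poly → R
      evalP [] = # 0
      evalP ((m , a , b) ∷ p) = (# a ⊖ # b) ⊗ evalM m ⊕ evalP p

      insertVar-eval : ∀ x m → evalM (insertVar x m) ≡ at x ⊗ evalM m
      insertVar-eval x [] = refl
      insertVar-eval x (y ∷ m) with x <ᵇ y
      ... | true = refl
      ... | false = begin
        at y ⊗ evalM (insertVar x m) ≡⟨ cong (at y ⊗_) (insertVar-eval x m) ⟩
        at y ⊗ (at x ⊗ evalM m)      ≡⟨ ⊗-assoc (at y) (at x) (evalM m) ⟨
        (at y ⊗ at x) ⊗ evalM m      ≡⟨ cong (_⊗ evalM m) (⊗-comm (at y) (at x)) ⟩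
        (at x ⊗ at y) ⊗ evalM m      ≡⟨ ⊗-assoc (at x) (at y) (evalM m) ⟩
        at x ⊗ (at y ⊗ evalM m)      ∎
        where open ≡-Reasoning

      mulMon-eval : ∀ m n → evalM (mulMon m n) ≡ evalM m ⊗ evalM n
      mulMon-eval [] n = sym (⊗-idˡ (evalM n))
      mulMon-eval (x ∷ m) n = trans (insertVar-eval x (mulMon m n))
        (trans (cong (at x ⊗_) (mulMon-eval m n)) (sym (⊗-assoc (at x) (evalM m) (evalM n))))

      insert-eval : ∀ m a b p → evalP (insert m a b p) ≡ (# a ⊖ # b) ⊗ evalM m ⊕ evalP p
      insert-eval m a b [] = refl
      insert-eval m a b ((m′ , a′ , b′) ∷ p) with compareMon m m′
      ... | less = refl
      ... | greater = begin
        t′ ⊕ evalP (insert m a b p) ≡⟨ cong (t′ ⊕_) (insert-eval m a b p) ⟩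
        t′ ⊕ (t ⊕ evalP p)          ≡⟨ ⊕-assoc t′ t (evalP p) ⟨
        (t′ ⊕ t) ⊕ evalP p          ≡⟨ cong (_⊕ evalP p) (⊕-comm t′ t) ⟩
        (t ⊕ t′) ⊕ evalP p          ≡⟨ ⊕-assoc t t′ (evalP p) ⟩
        t ⊕ (t′ ⊕ evalP p)          ∎
        where
        open ≡-Reasoning
        t = (# a ⊖ # b) ⊗ evalM m
        t′ = (# a′ ⊖ # b′) ⊗ evalM m′
      ... | equal refl = begin
        (# (a + a′) ⊖ # (b + b′)) ⊗ M ⊕ evalP p             ≡⟨ cong (λ c → c ⊗ M ⊕ evalP p) (cong₂ _⊖_ (#-+ a a′) (#-+ b b′)) ⟩
        ((# a ⊕ # a′) ⊖ (# b ⊕ # b′)) ⊗ M ⊕ evalP p         ≡⟨ cong (λ c → c ⊗ M ⊕ evalP p) (⊖-interchange (# a) (# b) (# a′) (# b′)) ⟨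
        ((# a ⊖ # b) ⊕ (# a′ ⊖ # b′)) ⊗ M ⊕ evalP p         ≡⟨ cong (_⊕ evalP p) (⊗-distʳ _ _ M) ⟩
        ((# a ⊖ # b) ⊗ M ⊕ (# a′ ⊖ # b′) ⊗ M) ⊕ evalP p     ≡⟨ ⊕-assoc _ _ (evalP p) ⟩
        (# a ⊖ # b) ⊗ M ⊕ ((# a′ ⊖ # b′) ⊗ M ⊕ evalP p)     ∎
        where
        open ≡-Reasoning
        M = evalM m′

      addP-eval : ∀ p q → evalP (addP p q) ≡ evalP p ⊕ evalP q
      addP-eval [] q = sym (⊕-idˡ _)
      addP-eval ((m , a , b) ∷ p) q = trans (insert-eval m a b (addP p q))
        (trans (cong (_ ⊕_) (addP-eval p q)) (sym (⊕-assoc _ _ _)))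

      swap-neg : ∀ a b M → (# a ⊖ # b) ⊗ M ⊕ (# b ⊖ # a) ⊗ M ≡ # 0
      swap-neg a b M = trans (sym (⊗-distʳ _ _ M)) (trans (cong (_⊗ M) (trans (⊖-interchange (# a) (# b) (# b) (# a))
        (⊖-unique (trans (⊕-idˡ _) (⊕-comm (# b) (# a)))))) (⊗-zeroˡ M))

      negP-eval : ∀ p → evalP p ⊕ evalP (negP p) ≡ # 0
      negP-eval [] = ⊕-idˡ _
      negP-eval ((m , a , b) ∷ p) = trans (⊕-interchange _ _ _ _)
        (trans (cong₂ _⊕_ (swap-neg a b (evalM m)) (negP-eval p)) (⊕-idˡ _))

      -- Done by hand, since it is part of the soundness of the solver: after adding
      -- `# (a * d + b * c)` back, the differences `P` and `Q` collapse one at a time.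
      coeff-mul : ∀ a b c d → (# a ⊖ # b) ⊗ (# c ⊖ # d) ≡ # (a * c + b * d) ⊖ # (a * d + b * c)
      coeff-mul a b c d = sym (⊖-unique (begin
        P ⊗ Q ⊕ # (a * d + b * c)                       ≡⟨ cong (P ⊗ Q ⊕_) (trans (#-+ _ _) (cong₂ _⊕_ (#-* a d) (#-* b c))) ⟩
        P ⊗ Q ⊕ (# a ⊗ # d ⊕ # b ⊗ # c)                 ≡⟨ cong (λ t → P ⊗ Q ⊕ (t ⊕ # b ⊗ # c)) (trans (cong (_⊗ # d) (sym (⊖-⊕ (# a) (# b)))) (⊗-distʳ P (# b) (# d))) ⟩
        P ⊗ Q ⊕ ((P ⊗ # d ⊕ # b ⊗ # d) ⊕ # b ⊗ # c)     ≡⟨ cong (P ⊗ Q ⊕_) (⊕-assoc _ _ _) ⟩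
        P ⊗ Q ⊕ (P ⊗ # d ⊕ (# b ⊗ # d ⊕ # b ⊗ # c))     ≡⟨ ⊕-assoc _ _ _ ⟨
        (P ⊗ Q ⊕ P ⊗ # d) ⊕ (# b ⊗ # d ⊕ # b ⊗ # c)     ≡⟨ cong₂ _⊕_ (trans (sym (⊗-distˡ P Q (# d))) (cong (P ⊗_) (⊖-⊕ (# c) (# d)))) (⊕-comm _ _) ⟩
        P ⊗ # c ⊕ (# b ⊗ # c ⊕ # b ⊗ # d)               ≡⟨ ⊕-assoc _ _ _ ⟨
        (P ⊗ # c ⊕ # b ⊗ # c) ⊕ # b ⊗ # d               ≡⟨ cong (_⊕ # b ⊗ # d) (trans (sym (⊗-distʳ P (# b) (# c))) (cong (_⊗ # c) (⊖-⊕ (# a) (# b)))) ⟩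
        # a ⊗ # c ⊕ # b ⊗ # d                           ≡⟨ trans (#-+ _ _) (cong₂ _⊕_ (#-* a c) (#-* b d)) ⟨
        # (a * c + b * d)                               ∎))
        where
        open ≡-Reasoning
        P = # a ⊖ # b
        Q = # c ⊖ # d

      scaleP-eval : ∀ m a b p → evalP (scaleP m a b p) ≡ ((# a ⊖ # b) ⊗ evalM m) ⊗ evalP p
      scaleP-eval m a b [] = sym (⊗-zeroʳ _)
      scaleP-eval m a b ((m′ , a′ , b′) ∷ p) = begin
        evalP (insert (mulMon m m′) c d (scaleP m a b p))           ≡⟨ insert-eval (mulMon m m′) c d (scaleP m a b p) ⟩
        (# c ⊖ # d) ⊗ evalM (mulMon m m′) ⊕ evalP (scaleP m a b p)  ≡⟨ cong₂ _⊕_ (cong₂ _⊗_ (sym (coeff-mul a b a′ b′)) (mulMon-eval m m′)) (scaleP-eval m a b p) ⟩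
        (k ⊗ k′) ⊗ (M ⊗ M′) ⊕ (k ⊗ M) ⊗ evalP p                     ≡⟨ cong (_⊕ (k ⊗ M) ⊗ evalP p) swap ⟩
        (k ⊗ M) ⊗ (k′ ⊗ M′) ⊕ (k ⊗ M) ⊗ evalP p                     ≡⟨ ⊗-distˡ (k ⊗ M) _ _ ⟨
        (k ⊗ M) ⊗ (k′ ⊗ M′ ⊕ evalP p)                               ∎
        where
        open ≡-Reasoning
        c = a * a′ + b * b′
        d = a * b′ + b * a′
        k = # a ⊖ # b
        k′ = # a′ ⊖ # b′
        M = evalM m
        M′ = evalM m′
        swap : (k ⊗ k′) ⊗ (M ⊗ M′) ≡ (k ⊗ M) ⊗ (k′ ⊗ M′)
        swap = trans (⊗-assoc k k′ _) (trans (cong (k ⊗_) (trans (sym (⊗-assoc k′ M M′)) (trans (cong (_⊗ M′) (⊗-comm k′ M)) (⊗-assoc M k′ M′)))) (sym (⊗-assoc k M _)))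

      mulP-eval : ∀ p q → evalP (mulP p q) ≡ evalP p ⊗ evalP q
      mulP-eval [] q = sym (⊗-zeroˡ _)
      mulP-eval ((m , a , b) ∷ p) q = trans (addP-eval (scaleP m a b q) (mulP p q))
        (trans (cong₂ _⊕_ (scaleP-eval m a b q) (mulP-eval p q)) (sym (⊗-distʳ _ _ _)))

      isZero-eval : ∀ p → isZero p ≡ true → evalP p ≡ # 0
      isZero-eval [] _ = refl
      isZero-eval ((m , a , b) ∷ p) e with ∧-elim (a ≡ᵇ b) e
      ... | e₁ , e₂ with ℕ.≡ᵇ⇒≡ a b (subst T (sym e₁) tt)
      ... | refl = trans (cong₂ _⊕_ (trans (cong (_⊗ evalM m) (⊕-invʳ (# a))) (⊗-zeroˡ _)) (isZero-eval p e₂)) (⊕-idˡ _)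

    at : ∀ {n} → Vec R n → ℕ → R
    at [] _ = # 0
    at (x ∷ ρ) zero = x
    at (x ∷ ρ) (suc i) = at ρ i

    at-lookup : ∀ {n} (ρ : Vec R n) i → at ρ (toℕ i) ≡ lookup ρ i
    at-lookup (x ∷ ρ) zero = refl
    at-lookup (x ∷ ρ) (suc i) = at-lookup ρ i

    norm-correct : ∀ {n} (ρ : Vec R n) e → evalP (at ρ) (norm e) ≡ ⟦ e ⟧ ρ
    norm-correct ρ (var i) = trans (⊕-idʳ _) (trans (cong₂ _⊗_ (⊖-unique (⊕-idʳ (# 1))) (⊗-idʳ _)) (trans (⊗-idˡ _) (at-lookup ρ i)))
    norm-correct ρ (κ k) = trans (⊕-idʳ _) (trans (⊗-idʳ _) (⊖-unique (⊕-idʳ (# k))))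
    norm-correct ρ (a :+ b) = trans (addP-eval (at ρ) (norm a) (norm b)) (cong₂ _⊕_ (norm-correct ρ a) (norm-correct ρ b))
    norm-correct ρ (a :* b) = trans (mulP-eval (at ρ) (norm a) (norm b)) (cong₂ _⊗_ (norm-correct ρ a) (norm-correct ρ b))
    norm-correct ρ (a :- b) = trans (addP-eval (at ρ) (norm a) (negP (norm b))) (sym (⊖-unique (begin
      (evalP (at ρ) (norm a) ⊕ n) ⊕ ⟦ b ⟧ ρ ≡⟨ ⊕-assoc _ _ _ ⟩
      evalP (at ρ) (norm a) ⊕ (n ⊕ ⟦ b ⟧ ρ) ≡⟨ cong₂ _⊕_ (norm-correct ρ a) (trans (cong (n ⊕_) (sym (norm-correct ρ b))) (trans (⊕-comm _ _) (negP-eval (at ρ) (norm b)))) ⟩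
      ⟦ a ⟧ ρ ⊕ # 0                         ≡⟨ ⊕-idʳ _ ⟩
      ⟦ a ⟧ ρ                               ∎)))
      where
      open ≡-Reasoning
      n = evalP (at ρ) (negP (norm b))

    ⊖-zero : ∀ {x y} → x ⊖ y ≡ # 0 → x ≡ y
    ⊖-zero {x} {y} e = trans (sym (⊖-⊕ x y)) (trans (cong (_⊕ y) e) (⊕-idˡ y))

    Valid : ∀ {n} → Equation n → Vec R n → Set
    Valid (a := b) ρ = ⟦ a ⟧ ρ ≡ ⟦ b ⟧ ρ

    identity-sound : ∀ {n} (c : Equation n) ρ → identity? c ≡ true → Valid c ρ
    identity-sound (a := b) ρ q = ⊖-zero (trans (sym (norm-correct ρ (a :- b))) (isZero-eval (at ρ) (norm (a :- b)) q))

    -- The Boolean test is run by the type checker, so callers pass `refl`; `ρ` lists the subterms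
    -- that are treated as indeterminates.
    ring : ∀ n (f : N-ary n (Expr n) (Equation n)) → identity? (f $ⁿ vars n) ≡ true → ∀ ρ → Valid (f $ⁿ vars n) ρ
    ring n f ok ρ = identity-sound (f $ⁿ vars n) ρ ok

-- The rational numbers as an opaque ordered ring with inverses of natural numbers.

module Rationals where
  open import Data.Nat as ℕ using (ℕ; zero; suc; _+_; _*_; _≤_; z≤n; s≤s)
  import Data.Nat.Properties as ℕ
  open import Data.Rational as ℚ using (ℚ; 0ℚ; 1ℚ)
  import Data.Rational.Properties as ℚ
  open import Data.Sum using (_⊎_)
  open import Data.Empty using (⊥-elim)
  open import Relation.Nullary using (yes; no)
  open import Relation.Binary.PropositionalEquality

  infixl 6 _⊕_ _⊖_
  infixl 7 _⊗_
  infix 4 _≼_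

  private
    0≤1 : 0ℚ ℚ.≤ 1ℚ
    0≤1 = ℚ.nonNegative⁻¹ 1ℚ

    0<1 : 0ℚ ℚ.< 1ℚ
    0<1 = ℚ.positive⁻¹ 1ℚ

    fromℕ : ℕ → ℚ
    fromℕ zero = 0ℚ
    fromℕ (suc n) = 1ℚ ℚ.+ fromℕ n

    fromℕ-nonneg : ∀ n → 0ℚ ℚ.≤ fromℕ n
    fromℕ-nonneg zero = ℚ.≤-refl
    fromℕ-nonneg (suc n) = subst (ℚ._≤ (1ℚ ℚ.+ fromℕ n)) (ℚ.+-identityˡ 0ℚ) (ℚ.+-mono-≤ 0≤1 (fromℕ-nonneg n))

    fromℕ-mono : ∀ {m n} → m ≤ n → fromℕ m ℚ.≤ fromℕ n
    fromℕ-mono {n = n} z≤n = fromℕ-nonneg n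
    fromℕ-mono (s≤s p) = ℚ.+-monoʳ-≤ 1ℚ (fromℕ-mono p)

    suc-pos : ∀ n → 0ℚ ℚ.< fromℕ (suc n)
    suc-pos n = ℚ.<-≤-trans 0<1 (subst (ℚ._≤ (1ℚ ℚ.+ fromℕ n)) (ℚ.+-identityʳ 1ℚ) (ℚ.+-monoʳ-≤ 1ℚ (fromℕ-nonneg n)))

    suc-positive : ∀ n → ℚ.Positive (fromℕ (suc n))
    suc-positive n = ℚ.positive (suc-pos n)

    suc-nonZero : ∀ n → ℚ.NonZero (fromℕ (suc n))
    suc-nonZero n = ℚ.pos⇒nonZero (fromℕ (suc n)) ⦃ suc-positive n ⦄

    fromℕ-mono-< : ∀ {m n} → m ℕ.< n → fromℕ m ℚ.< fromℕ n
    fromℕ-mono-< {m} p = ℚ.<-≤-trans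
      (subst (ℚ._< fromℕ (suc m)) (ℚ.+-identityˡ (fromℕ m)) (ℚ.+-mono-<-≤ 0<1 (ℚ.≤-refl {fromℕ m})))
      (fromℕ-mono p)

  -- Rational numbers behind an abstraction barrier: nothing below may unfold ℚ.
  abstract
    R : Set
    R = ℚ

    _⊕_ _⊗_ : R → R → R
    _⊕_ = ℚ._+_
    _⊗_ = ℚ._*_

    ⊝_ : R → R
    ⊝_ = ℚ.-_

    _≼_ : R → R → Set
    _≼_ = ℚ._≤_

    # : ℕ → R
    # = fromℕ

    ⊕-assoc : ∀ x y z → (x ⊕ y) ⊕ z ≡ x ⊕ (y ⊕ z)
    ⊕-assoc = ℚ.+-assoc

    ⊕-comm : ∀ x y → x ⊕ y ≡ y ⊕ x
    ⊕-comm = ℚ.+-comm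

    ⊕-idˡ : ∀ x → # 0 ⊕ x ≡ x
    ⊕-idˡ = ℚ.+-identityˡ

    ⊕-invʳ : ∀ x → x ⊕ (⊝ x) ≡ # 0
    ⊕-invʳ = ℚ.+-inverseʳ

    ⊗-assoc : ∀ x y z → (x ⊗ y) ⊗ z ≡ x ⊗ (y ⊗ z)
    ⊗-assoc = ℚ.*-assoc

    ⊗-comm : ∀ x y → x ⊗ y ≡ y ⊗ x
    ⊗-comm = ℚ.*-comm

    ⊗-idˡ : ∀ x → # 1 ⊗ x ≡ x
    ⊗-idˡ x = trans (cong (ℚ._* x) (ℚ.+-identityʳ 1ℚ)) (ℚ.*-identityˡ x)

    ⊗-distˡ : ∀ x y z → x ⊗ (y ⊕ z) ≡ x ⊗ y ⊕ x ⊗ z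
    ⊗-distˡ = ℚ.*-distribˡ-+

    #-+ : ∀ m n → # (m + n) ≡ # m ⊕ # n
    #-+ zero n = sym (ℚ.+-identityˡ (# n))
    #-+ (suc m) n = trans (cong (1ℚ ℚ.+_) (#-+ m n)) (sym (ℚ.+-assoc 1ℚ (# m) (# n)))

    #-* : ∀ m n → # (m * n) ≡ # m ⊗ # n
    #-* zero n = sym (ℚ.*-zeroˡ (# n))
    #-* (suc m) n = trans (#-+ n (m * n))
      (trans (cong₂ ℚ._+_ (sym (ℚ.*-identityˡ (# n))) (#-* m n))
             (sym (ℚ.*-distribʳ-+ (# n) 1ℚ (# m))))

    ≼-refl : ∀ {x} → x ≼ x
    ≼-refl = ℚ.≤-refl

    ≼-trans : ∀ {x y z} → x ≼ y → y ≼ z → x ≼ z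
    ≼-trans = ℚ.≤-trans

    ≼-antisym : ∀ {x y} → x ≼ y → y ≼ x → x ≡ y
    ≼-antisym = ℚ.≤-antisym

    ≼-total : ∀ x y → x ≼ y ⊎ y ≼ x
    ≼-total = ℚ.≤-total

    ⊕-mono : ∀ {x y u v} → x ≼ y → u ≼ v → x ⊕ u ≼ y ⊕ v
    ⊕-mono = ℚ.+-mono-≤

    ⊗-nonneg : ∀ {x y} → # 0 ≼ x → # 0 ≼ y → # 0 ≼ x ⊗ y
    ⊗-nonneg {x} {y} p q = subst (ℚ._≤ x ℚ.* y) (ℚ.*-zeroʳ x)
      (ℚ.*-monoˡ-≤-nonNeg x ⦃ ℚ.nonNegative p ⦄ q)

    #-nonneg : ∀ n → # 0 ≼ # n
    #-nonneg = fromℕ-nonneg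

    #-mono : ∀ {m n} → m ≤ n → # m ≼ # n
    #-mono = fromℕ-mono

    #-cancel-≤ : ∀ m n → # m ≼ # n → m ≤ n
    #-cancel-≤ m n p with m ℕ.≤? n
    ... | yes q = q
    ... | no q = ⊥-elim (ℚ.<-irrefl refl (ℚ.<-≤-trans (fromℕ-mono-< (ℕ.≰⇒> q)) p))

    -- The junk value is inv 0 = 0.
    inv : ℕ → R
    inv zero = 0ℚ
    inv (suc n) = (ℚ.1/ fromℕ (suc n)) ⦃ suc-nonZero n ⦄

    inv-nonneg : ∀ n → # 0 ≼ inv n
    inv-nonneg zero = ℚ.≤-refl
    inv-nonneg (suc n) = ℚ.<⇒≤ (ℚ.positive⁻¹ (inv (suc n)) ⦃ ℚ.1/pos⇒pos (fromℕ (suc n)) ⦃ suc-positive n ⦄ ⦄)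

    #⊗inv : ∀ n → # (suc n) ⊗ inv (suc n) ≡ # 1
    #⊗inv n = trans (ℚ.*-inverseʳ (fromℕ (suc n)) ⦃ suc-nonZero n ⦄) (sym (ℚ.+-identityʳ 1ℚ))

    ⊗-cancel-suc : ∀ n {x y} → # (suc n) ⊗ x ≼ # (suc n) ⊗ y → x ≼ y
    ⊗-cancel-suc n = ℚ.*-cancelˡ-≤-pos (fromℕ (suc n)) ⦃ suc-positive n ⦄

  _⊖_ : R → R → R
  x ⊖ y = x ⊕ (⊝ y)

-- Certified proofs of rational inequalities.

module LinearArithmetic where
  open Rings public hiding (module RingSolver)
  open Rings using (module RingSolver)
  open Rationals
  open import Data.Nat as ℕ using (ℕ; suc; _≡ᵇ_)
  import Data.Nat.Properties as ℕ
  open import Data.Bool using (Bool; true; false; _∧_; T)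
  open import Data.Vec using (Vec; []; _∷_)
  open import Data.Vec.N-ary using (N-ary; _$ⁿ_)
  open import Data.List using (List; []; _∷_)
  open import Data.Product using (_×_; _,_)
  open import Data.Unit using (⊤; tt)
  open import Data.Maybe using (Maybe; just; nothing)
  open import Relation.Binary.PropositionalEquality

  rational : CRing
  rational = record
    { R = R ; _⊕_ = _⊕_ ; _⊗_ = _⊗_ ; ⊝_ = ⊝_ ; # = #
    ; ⊕-assoc = ⊕-assoc ; ⊕-comm = ⊕-comm ; ⊕-idˡ = ⊕-idˡ ; ⊕-invʳ = ⊕-invʳ
    ; ⊗-assoc = ⊗-assoc ; ⊗-comm = ⊗-comm ; ⊗-idˡ = ⊗-idˡ ; ⊗-distˡ = ⊗-distˡ
    ; #-+ = #-+ ; #-* = #-* }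

  open RingSolver rational public

  ⊕-nonneg : ∀ {x y} → # 0 ≼ x → # 0 ≼ y → # 0 ≼ x ⊕ y
  ⊕-nonneg {x} {y} p q = subst (λ t → t ≼ x ⊕ y) (⊕-idˡ (# 0)) (⊕-mono p q)

  ⊖-nonneg⁻ : ∀ {x y} → # 0 ≼ x ⊖ y → y ≼ x
  ⊖-nonneg⁻ {x} {y} p = subst₂ _≼_ (⊕-idˡ y) (⊖-⊕ x y) (⊕-mono p (≼-refl {y}))

  ⊖-nonneg : ∀ {x y} → y ≼ x → # 0 ≼ x ⊖ y
  ⊖-nonneg {x} {y} p = subst (_≼ (x ⊖ y)) (⊕-invʳ y) (⊕-mono p (≼-refl {⊝ y}))

  -- Certificates are exact: every nonconstant monomial must cancel, and only a nonnegative constant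
  -- may be left over.
  isNonneg : Poly → Bool
  isNonneg [] = true
  isNonneg (([] , a , b) ∷ p) = (b ℕ.≤ᵇ a) ∧ isNonneg p
  isNonneg ((_ ∷ _ , a , b) ∷ p) = (a ≡ᵇ b) ∧ isNonneg p

  isNonneg-eval : ∀ (at : ℕ → R) p → isNonneg p ≡ true → # 0 ≼ evalP at p
  isNonneg-eval at [] _ = ≼-refl
  isNonneg-eval at (([] , a , b) ∷ p) e with ∧-elim (b ℕ.≤ᵇ a) e
  ... | e₁ , e₂ with ℕ.m≤n⇒∃[o]m+o≡n (ℕ.≤ᵇ⇒≤ b a (subst T (sym e₁) tt))
  ... | o , refl = ⊕-nonneg
      (subst (# 0 ≼_) (sym (trans (⊗-idʳ _) (⊖-unique (trans (⊕-comm (# o) (# b)) (sym (#-+ b o)))))) (#-nonneg o))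
      (isNonneg-eval at p e₂)
  isNonneg-eval at ((x ∷ m , a , b) ∷ p) e with ∧-elim (a ≡ᵇ b) e
  ... | e₁ , e₂ with ℕ.≡ᵇ⇒≡ a b (subst T (sym e₁) tt)
  ... | refl = ⊕-nonneg
      (subst (# 0 ≼_) (sym (trans (cong (_⊗ evalM at (x ∷ m)) (⊕-invʳ (# a))) (⊗-zeroˡ _))) ≼-refl)
      (isNonneg-eval at p e₂)

  infix 4 _:≤_ _:≡_
  infix 2 _⊢_

  data Claim (n : ℕ) : Set where
    _:≤_ _:≡_ : Expr n → Expr n → Claim n

  data Sequent (n : ℕ) : Set where
    _⊢_ : List (Claim n) → Claim n → Sequent n

  Holds : ∀ {n} → Claim n → Vec R n → Set
  Holds (a :≤ b) ρ = ⟦ a ⟧ ρ ≼ ⟦ b ⟧ ρ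
  Holds (a :≡ b) ρ = ⟦ a ⟧ ρ ≡ ⟦ b ⟧ ρ

  -- Right-nested without a final unit, so that callers pass an ordinary tuple of hypotheses, or a
  -- bare proof if there is only one.
  AllHold : ∀ {n} → List (Claim n) → Vec R n → Set
  AllHold [] ρ = ⊤
  AllHold (h ∷ []) ρ = Holds h ρ
  AllHold (h ∷ hs@(_ ∷ _)) ρ = Holds h ρ × AllHold hs ρ

  combine : ∀ {n} → List ℕ → List (Claim n) → Maybe (Expr n)
  combine [] [] = just (κ 0)
  combine (c ∷ cs) ((a :≤ b) ∷ hs) with combine cs hs
  ... | just e = just (κ c :* (b :- a) :+ e)
  ... | nothing = nothing
  combine (c ∷ cs) ((a :≡ b) ∷ hs) with combine cs hs
  ... | just e = just (κ c :* (b :- a) :+ e)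
  ... | nothing = nothing
  combine [] (_ ∷ _) = nothing
  combine (_ ∷ _) [] = nothing

  AllHold-∷ : ∀ {n} h (hs : List (Claim n)) {ρ} → AllHold (h ∷ hs) ρ → Holds h ρ × AllHold hs ρ
  AllHold-∷ h [] p = p , tt
  AllHold-∷ h (_ ∷ _) p = p

  private
    nonneg-step : ∀ c {x y z} → y ≼ x → # 0 ≼ z → # 0 ≼ # c ⊗ (x ⊖ y) ⊕ z
    nonneg-step c p q = ⊕-nonneg (⊗-nonneg (#-nonneg c) (⊖-nonneg p)) q

  ≡⇒≼ : ∀ {x y} → x ≡ y → x ≼ y
  ≡⇒≼ refl = ≼-refl

  combine-nonneg : ∀ {n} cs (hs : List (Claim n)) {e} ρ → combine cs hs ≡ just e → AllHold hs ρ → # 0 ≼ ⟦ e ⟧ ρ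
  combine-nonneg [] [] ρ refl _ = ≼-refl
  combine-nonneg (c ∷ cs) ((a :≤ b) ∷ hs) ρ q p with combine cs hs in e | AllHold-∷ (a :≤ b) hs p
  combine-nonneg (c ∷ cs) ((a :≤ b) ∷ hs) ρ refl p | just _ | h , p′ = nonneg-step c h (combine-nonneg cs hs ρ e p′)
  combine-nonneg (c ∷ cs) ((a :≡ b) ∷ hs) ρ q p with combine cs hs in e | AllHold-∷ (a :≡ b) hs p
  combine-nonneg (c ∷ cs) ((a :≡ b) ∷ hs) ρ refl p | just _ | h , p′ = nonneg-step c (≡⇒≼ h) (combine-nonneg cs hs ρ e p′)
  combine-nonneg [] (_ ∷ _) ρ ()
  combine-nonneg (_ ∷ _) [] ρ ()

  -- The certificate (d , cs) for hs ⊢ a ≤ b asserts that d (b − a) − Σ cs · (right − left of hs) is a nonnegative constant.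
  check : ∀ {n} → ℕ → List ℕ → Sequent n → Bool
  check d cs (hs ⊢ (a :≤ b)) with combine cs hs
  ... | just e = isNonneg (norm (κ (suc d) :* (b :- a) :- e))
  ... | nothing = false
  check d cs (hs ⊢ (a :≡ b)) = false

  Conclusion : ∀ {n} → Sequent n → Vec R n → Set
  Conclusion (hs ⊢ c) ρ = AllHold hs ρ → Holds c ρ

  check-sound : ∀ {n} d cs (s : Sequent n) ρ → check d cs s ≡ true → Conclusion s ρ
  check-sound d cs (hs ⊢ (a :≤ b)) ρ q p with combine cs hs in e
  ... | just c = ⊗-cancel-suc d (⊖-nonneg⁻ (subst (# 0 ≼_) eq′ (⊕-nonneg
          (subst (# 0 ≼_) (norm-correct ρ whole) (isNonneg-eval (at ρ) (norm whole) q)) (combine-nonneg cs hs ρ e p))))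
    where
    whole = κ (suc d) :* (b :- a) :- c
    x = ⟦ a ⟧ ρ
    y = ⟦ b ⟧ ρ
    k = # (suc d)
    eq′ : (k ⊗ (y ⊖ x) ⊖ ⟦ c ⟧ ρ) ⊕ ⟦ c ⟧ ρ ≡ k ⊗ y ⊖ k ⊗ x
    eq′ = trans (⊖-⊕ _ _) (sym (⊖-unique (trans (sym (⊗-distˡ k (y ⊖ x) x)) (cong (k ⊗_) (⊖-⊕ y x)))))

  -- Nonlinear inequalities are covered too: the required products of nonnegative quantities are
  -- passed as hypotheses, and `cs` combines them linearly after normalisation. The common
  -- denominator of the multipliers is d + 1.
  lin/ : ∀ d n (f : N-ary n (Expr n) (Sequent n)) cs → check d cs (f $ⁿ vars n) ≡ true → ∀ ρ → Conclusion (f $ⁿ vars n) ρ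
  lin/ d n f cs ok ρ = check-sound d cs (f $ⁿ vars n) ρ ok

  lin : ∀ n (f : N-ary n (Expr n) (Sequent n)) cs → check 0 cs (f $ⁿ vars n) ≡ true → ∀ ρ → Conclusion (f $ⁿ vars n) ρ
  lin = lin/ 0

-- Finite sums, indicator functions and sums over multiples.

module Sums where
  open Rationals
  open LinearArithmetic
  open import Data.Nat using (ℕ; zero; suc; _+_; _*_; _≤_; _<_; _∸_; z≤n; s≤s; NonZero)
  import Data.Nat.Properties as ℕ
  open import Data.Nat.DivMod using (_/_; _%_; m≡m%n+[m/n]*n; m%n<n; m<n⇒m/n≡0; +-distrib-/-∣ʳ; m*n/n≡m)
  open import Data.Nat.Divisibility using (_∣_; _∣?_; divides; n∣m*n)
  open import Data.Vec using ([]; _∷_)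
  open import Data.List using ([]; _∷_)
  open import Data.Product using (_,_)
  open import Data.Sum using (inj₁; inj₂)
  open import Data.Empty using (⊥-elim)
  open import Relation.Nullary using (¬_; Dec; yes; no)
  open import Relation.Binary.PropositionalEquality

  1≼# : ∀ n → # 1 ≼ # (suc n)
  1≼# n = #-mono (s≤s z≤n)

  ⊗-monoˡ : ∀ {c x y} → # 0 ≼ c → x ≼ y → c ⊗ x ≼ c ⊗ y
  ⊗-monoˡ {c} {x} {y} p q = lin 3 (λ c x y → (κ 0 :≤ c :* (y :- x)) ∷ [] ⊢ (c :* x :≤ c :* y)) (1 ∷ []) refl
    (c ∷ x ∷ y ∷ []) (⊗-nonneg p (⊖-nonneg q))

  ⊗-monoʳ : ∀ {c x y} → # 0 ≼ c → x ≼ y → x ⊗ c ≼ y ⊗ c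
  ⊗-monoʳ {c} {x} {y} p q = subst₂ _≼_ (⊗-comm c x) (⊗-comm c y) (⊗-monoˡ p q)

  ⊗-mono : ∀ {x y u v} → # 0 ≼ x → x ≼ y → # 0 ≼ u → u ≼ v → x ⊗ u ≼ y ⊗ v
  ⊗-mono p q r s = ≼-trans (⊗-monoʳ r q) (⊗-monoˡ (≼-trans p q) s)

  square-nonneg : ∀ x → # 0 ≼ x ⊗ x
  square-nonneg x with ≼-total (# 0) x
  ... | inj₁ p = ⊗-nonneg p p
  ... | inj₂ p = lin 1 (λ x → (κ 0 :≤ (κ 0 :- x) :* (κ 0 :- x)) ∷ [] ⊢ (κ 0 :≤ x :* x)) (1 ∷ []) refl (x ∷ [])
    (⊗-nonneg (⊖-nonneg p) (⊖-nonneg p))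

  ∑₀ : ℕ → (ℕ → R) → R
  ∑₀ zero f = # 0
  ∑₀ (suc n) f = ∑₀ n f ⊕ f n

  ∑ : ℕ → (ℕ → R) → R
  ∑ n f = ∑₀ n (λ i → f (suc i))

  ∑₀-cong : ∀ n {f g : ℕ → R} → (∀ i → i < n → f i ≡ g i) → ∑₀ n f ≡ ∑₀ n g
  ∑₀-cong zero h = refl
  ∑₀-cong (suc n) h = cong₂ _⊕_ (∑₀-cong n (λ i p → h i (ℕ.m<n⇒m<1+n p))) (h n ℕ.≤-refl)

  ∑₀-mono : ∀ n {f g : ℕ → R} → (∀ i → i < n → f i ≼ g i) → ∑₀ n f ≼ ∑₀ n g
  ∑₀-mono zero h = ≼-refl
  ∑₀-mono (suc n) h = ⊕-mono (∑₀-mono n (λ i p → h i (ℕ.m<n⇒m<1+n p))) (h n ℕ.≤-refl)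

  ∑₀-⊕ : ∀ n (f g : ℕ → R) → ∑₀ n (λ i → f i ⊕ g i) ≡ ∑₀ n f ⊕ ∑₀ n g
  ∑₀-⊕ zero f g = sym (⊕-idˡ (# 0))
  ∑₀-⊕ (suc n) f g = trans (cong (_⊕ (f n ⊕ g n)) (∑₀-⊕ n f g)) (⊕-interchange _ _ _ _)

  ∑₀-⊗ : ∀ n c (f : ℕ → R) → ∑₀ n (λ i → c ⊗ f i) ≡ c ⊗ ∑₀ n f
  ∑₀-⊗ zero c f = sym (⊗-zeroʳ c)
  ∑₀-⊗ (suc n) c f = trans (cong (_⊕ (c ⊗ f n)) (∑₀-⊗ n c f)) (sym (⊗-distˡ c _ _))

  ∑₀-⊖ : ∀ n (f g : ℕ → R) → ∑₀ n (λ i → f i ⊖ g i) ≡ ∑₀ n f ⊖ ∑₀ n g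
  ∑₀-⊖ zero f g = sym (⊕-invʳ (# 0))
  ∑₀-⊖ (suc n) f g = trans (cong (_⊕ (f n ⊖ g n)) (∑₀-⊖ n f g)) (⊖-interchange _ _ _ _)

  ∑₀-const : ∀ n c → ∑₀ n (λ _ → c) ≡ # n ⊗ c
  ∑₀-const zero c = sym (⊗-zeroˡ c)
  ∑₀-const (suc n) c = begin
    ∑₀ n (λ _ → c) ⊕ c ≡⟨ cong (_⊕ c) (∑₀-const n c) ⟩
    # n ⊗ c ⊕ c        ≡⟨ ring 2 (λ n c → n :* c :+ c := (κ 1 :+ n) :* c) refl (# n ∷ c ∷ []) ⟩
    (# 1 ⊕ # n) ⊗ c    ≡⟨ cong (_⊗ c) (#-+ 1 n) ⟨
    # (suc n) ⊗ c      ∎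
    where open ≡-Reasoning

  ∑₀-zero : ∀ n {f : ℕ → R} → (∀ i → i < n → f i ≡ # 0) → ∑₀ n f ≡ # 0
  ∑₀-zero n h = trans (∑₀-cong n h) (trans (∑₀-const n (# 0)) (⊗-zeroʳ _))

  ∑₀-nonneg : ∀ n {f : ℕ → R} → (∀ i → i < n → # 0 ≼ f i) → # 0 ≼ ∑₀ n f
  ∑₀-nonneg n {f} h = subst (_≼ ∑₀ n f) (∑₀-zero n (λ _ _ → refl)) (∑₀-mono n h)

  ∑₀-swap : ∀ m n (f : ℕ → ℕ → R) → ∑₀ m (λ i → ∑₀ n (λ j → f i j)) ≡ ∑₀ n (λ j → ∑₀ m (λ i → f i j))
  ∑₀-swap zero n f = sym (∑₀-zero n (λ _ _ → refl))
  ∑₀-swap (suc m) n f = trans (cong (_⊕ ∑₀ n (f m)) (∑₀-swap m n f)) (sym (∑₀-⊕ n _ _))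

  ∑₀-+ : ∀ m n (f : ℕ → R) → ∑₀ (m + n) f ≡ ∑₀ m f ⊕ ∑₀ n (λ i → f (m + i))
  ∑₀-+ m zero f = trans (cong (λ k → ∑₀ k f) (ℕ.+-identityʳ m)) (sym (⊕-idʳ _))
  ∑₀-+ m (suc n) f = trans (cong (λ k → ∑₀ k f) (ℕ.+-suc m n))
    (trans (cong (_⊕ f (m + n)) (∑₀-+ m n f)) (⊕-assoc _ _ _))

  ∑₀-suc : ∀ n (f : ℕ → R) → ∑₀ (suc n) f ≡ f 0 ⊕ ∑₀ n (λ i → f (suc i))
  ∑₀-suc n f = trans (∑₀-+ 1 n f) (cong (_⊕ ∑₀ n (λ i → f (suc i))) (⊕-idˡ (f 0)))

  ∑₀-reverse : ∀ n (f : ℕ → R) → ∑₀ (suc n) f ≡ ∑₀ (suc n) (λ i → f (n ∸ i))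
  ∑₀-reverse zero f = refl
  ∑₀-reverse (suc n) f = begin
    ∑₀ (suc n) f ⊕ f (suc n)                       ≡⟨ ⊕-comm _ _ ⟩
    f (suc n) ⊕ ∑₀ (suc n) f                       ≡⟨ cong (f (suc n) ⊕_) (∑₀-reverse n f) ⟩
    f (suc n) ⊕ ∑₀ (suc n) (λ i → f (n ∸ i))       ≡⟨ ∑₀-suc (suc n) (λ i → f (suc n ∸ i)) ⟨
    ∑₀ (suc (suc n)) (λ i → f (suc n ∸ i))         ∎
    where open ≡-Reasoning

  ∑₀-extend : ∀ {m n} (f : ℕ → R) → m ≤ n → (∀ i → m ≤ i → i < n → f i ≡ # 0) → ∑₀ n f ≡ ∑₀ m f
  ∑₀-extend {m} f p h with ℕ.m≤n⇒∃[o]m+o≡n p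
  ... | o , refl = trans (∑₀-+ m o f) (trans (cong (∑₀ m f ⊕_) (∑₀-zero o (λ i q → h (m + i) (ℕ.m≤m+n m i) (ℕ.+-monoʳ-< m q)))) (⊕-idʳ _))

  -- A sum over a ≤ i < b is kept as a difference of two initial sums, the form in which ψ and M
  -- occur on intervals.
  range-mono : ∀ {a b} (f g : ℕ → R) → a ≤ b → (∀ i → a ≤ i → i < b → f i ≼ g i) → ∑₀ b f ⊖ ∑₀ a f ≼ ∑₀ b g ⊖ ∑₀ a g
  range-mono {a} f g p h with ℕ.m≤n⇒∃[o]m+o≡n p
  ... | o , refl = subst₂ _≼_ (sym (⊖-unique (trans (⊕-comm _ _) (sym (∑₀-+ a o f))))) (sym (⊖-unique (trans (⊕-comm _ _) (sym (∑₀-+ a o g)))))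
    (∑₀-mono o (λ i q → h (a + i) (ℕ.m≤m+n a i) (ℕ.+-monoʳ-< a q)))

  ∑₀-grow : ∀ {a b} (f : ℕ → R) → a ≤ b → (∀ i → a ≤ i → i < b → # 0 ≼ f i) → ∑₀ a f ≼ ∑₀ b f
  ∑₀-grow {a} {b} f p h = ⊖-nonneg⁻ (subst (_≼ (∑₀ b f ⊖ ∑₀ a f)) (trans (cong₂ _⊖_ (∑₀-zero b (λ _ _ → refl)) (∑₀-zero a (λ _ _ → refl))) (⊕-invʳ _)) (range-mono (λ _ → # 0) f p h))

  ∑₀-telescope : ∀ n (f : ℕ → R) → ∑₀ n (λ i → f (suc i) ⊖ f i) ≡ f n ⊖ f 0
  ∑₀-telescope zero f = sym (⊕-invʳ (f 0))
  ∑₀-telescope (suc n) f = trans (cong (_⊕ (f (suc n) ⊖ f n)) (∑₀-telescope n f))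
    (ring 3 (λ a b c → (b :- a) :+ (c :- b) := c :- a) refl (f 0 ∷ f n ∷ f (suc n) ∷ []))

  ∑₀-single : ∀ n k (f : ℕ → R) → k < n → (∀ i → i < n → i ≢ k → f i ≡ # 0) → ∑₀ n f ≡ f k
  ∑₀-single (suc n) k f p h with k ℕ.≟ n
  ... | yes refl = trans (cong (_⊕ f k) (∑₀-zero n (λ i q → h i (ℕ.m<n⇒m<1+n q) (ℕ.<⇒≢ q)))) (⊕-idˡ _)
  ... | no k≢n = trans (cong₂ _⊕_ (∑₀-single n k f (ℕ.≤∧≢⇒< (ℕ.≤-pred p) k≢n) (λ i q → h i (ℕ.m<n⇒m<1+n q)))
                   (h n ℕ.≤-refl (λ e → k≢n (sym e)))) (⊕-idʳ _)

  𝟙 : ∀ {P : Set} → Dec P → R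
  𝟙 (yes _) = # 1
  𝟙 (no _) = # 0

  𝟙-yes : ∀ {P : Set} (d : Dec P) → P → 𝟙 d ≡ # 1
  𝟙-yes (yes _) p = refl
  𝟙-yes (no ¬p) p = ⊥-elim (¬p p)

  𝟙-no : ∀ {P : Set} (d : Dec P) → ¬ P → 𝟙 d ≡ # 0
  𝟙-no (no _) _ = refl
  𝟙-no (yes p) ¬p = ⊥-elim (¬p p)

  𝟙-cong : ∀ {P Q : Set} (d : Dec P) (e : Dec Q) → (P → Q) → (Q → P) → 𝟙 d ≡ 𝟙 e
  𝟙-cong (yes p) e f g = sym (𝟙-yes e (f p))
  𝟙-cong (no ¬p) e f g = sym (𝟙-no e (λ q → ¬p (g q)))

  [r+qn]/n≡q : ∀ r q n .⦃ _ : NonZero n ⦄ → r < n → (r + q * n) / n ≡ q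
  [r+qn]/n≡q r q n p = trans (+-distrib-/-∣ʳ r (n∣m*n q)) (cong₂ _+_ (m<n⇒m/n≡0 p) (m*n/n≡m q n))

  suc-/-∤ : ∀ d x → ¬ (suc d ∣ suc x) → suc x / suc d ≡ x / suc d
  suc-/-∤ d x ∤ = trans (cong (_/ suc d) (cong suc (m≡m%n+[m/n]*n x (suc d)))) ([r+qn]/n≡q (suc r) q (suc d) (ℕ.≤∧≢⇒< (m%n<n x (suc d)) ne))
    where
    r = x % suc d
    q = x / suc d
    ne : suc r ≢ suc d
    ne e = ∤ (divides (suc q) (trans (cong suc (m≡m%n+[m/n]*n x (suc d))) (cong (_+ q * suc d) e)))

  -- Induction on x: the quotient x / (d + 1) grows by one exactly when x reaches a multiple of d +
  -- 1, and is unchanged otherwise by `suc-/-∤`.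
  ∑-multiples : ∀ d x (g : ℕ → R) → ∑ x (λ n → 𝟙 (suc d ∣? n) ⊗ g n) ≡ ∑ (x / suc d) (λ k → g (k * suc d))
  ∑-multiples d zero g = refl
  ∑-multiples d (suc x) g with suc d ∣? suc x
  ... | no ∤ = trans (cong₂ _⊕_ (∑-multiples d x g) (⊗-zeroˡ _)) (trans (⊕-idʳ _) (cong (λ q → ∑ q (λ k → g (k * suc d))) (sym (suc-/-∤ d x ∤))))
  ... | yes (divides (suc q) e) = begin
    ∑ x (λ n → 𝟙 (suc d ∣? n) ⊗ g n) ⊕ # 1 ⊗ g (suc x)    ≡⟨ cong₂ _⊕_ (∑-multiples d x g) (⊗-idˡ _) ⟩
    ∑ (x / suc d) (λ k → g (k * suc d)) ⊕ g (suc x)       ≡⟨ cong₂ (λ u v → ∑ u (λ k → g (k * suc d)) ⊕ g v) e₁ e ⟩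
    ∑ q (λ k → g (k * suc d)) ⊕ g (suc q * suc d)         ≡⟨⟩
    ∑ (suc q) (λ k → g (k * suc d))                       ≡⟨ cong (λ u → ∑ u (λ k → g (k * suc d))) e₂ ⟨
    ∑ (suc x / suc d) (λ k → g (k * suc d))               ∎
    where
    open ≡-Reasoning
    e₁ : x / suc d ≡ q
    e₁ = trans (cong (_/ suc d) (ℕ.suc-injective e)) ([r+qn]/n≡q d q (suc d) ℕ.≤-refl)
    e₂ : suc x / suc d ≡ suc q
    e₂ = trans (cong (_/ suc d) e) (m*n/n≡m (suc q) (suc d))

  ∑-count-multiples : ∀ d x → ∑ x (λ n → 𝟙 (suc d ∣? n)) ≡ # (x / suc d)
  ∑-count-multiples d x = begin
    ∑ x (λ n → 𝟙 (suc d ∣? n))        ≡⟨ ∑₀-cong x (λ i _ → sym (⊗-idʳ _)) ⟩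
    ∑ x (λ n → 𝟙 (suc d ∣? n) ⊗ # 1)  ≡⟨ ∑-multiples d x (λ _ → # 1) ⟩
    ∑ (x / suc d) (λ _ → # 1)         ≡⟨ ∑₀-const (x / suc d) (# 1) ⟩
    # (x / suc d) ⊗ # 1               ≡⟨ ⊗-idʳ _ ⟩
    # (x / suc d)                     ∎
    where open ≡-Reasoning

-- Harmonic sums and a rational, completely additive stand-in for the logarithm.

module Logarithms where
  open Rationals
  open LinearArithmetic
  open Sums
  open import Data.Nat using (ℕ; zero; suc; _+_; _*_; _≤_; _<_; z≤n; s≤s)
  import Data.Nat.Properties as ℕ
  open import Data.Nat.Primality using (Prime; prime⇒nonTrivial)
  open import Data.Nat.Base using (nonTrivial⇒n>1)
  open import Data.Nat.Primality.Factorisation using (PrimeFactorisation; factorise; factorisationUnique)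
  open import Data.Nat.ListAction using (product)
  open import Data.Nat.ListAction.Properties using (product-++)
  open import Data.Vec using ([]; _∷_)
  open import Data.List using (List; []; _∷_; _++_; length; foldr)
  open import Data.List.Relation.Unary.All using (All; []; _∷_)
  open import Data.List.Relation.Unary.All.Properties using (++⁺)
  open import Data.List.Relation.Binary.Permutation.Propositional using (_↭_; refl; prep; swap; trans)
  open import Data.Product using (_×_; _,_; proj₁; proj₂)
  open import Relation.Binary.PropositionalEquality as ≡ using (_≡_; refl; sym; cong; cong₂; subst; subst₂; module ≡-Reasoning)

  inv-antitone : ∀ {m n} → suc m ≤ suc n → inv (suc n) ≼ inv (suc m)
  inv-antitone {m} {n} p = lin 4 (λ a b x y → (κ 0 :≤ (x :* y) :* (b :- a)) ∷ (x :* (b :* y) :≡ x :* κ 1) ∷ (y :* κ 1 :≡ y :* (a :* x)) ∷ [] ⊢ (y :≤ x))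
    (1 ∷ 1 ∷ 1 ∷ []) refl (# (suc m) ∷ # (suc n) ∷ inv (suc m) ∷ inv (suc n) ∷ [])
    (⊗-nonneg (⊗-nonneg (inv-nonneg (suc m)) (inv-nonneg (suc n))) (⊖-nonneg (#-mono p)) , cong (_ ⊗_) (#⊗inv n) , cong (_ ⊗_) (sym (#⊗inv m)))

  inv-unique : ∀ n {x} → # (suc n) ⊗ x ≡ # 1 → x ≡ inv (suc n)
  inv-unique n {x} e = begin
    x                                 ≡⟨ ⊗-idʳ x ⟨
    x ⊗ # 1                           ≡⟨ cong (x ⊗_) (#⊗inv n) ⟨
    x ⊗ (# (suc n) ⊗ inv (suc n))     ≡⟨ ring 3 (λ x a y → x :* (a :* y) := (a :* x) :* y) refl (x ∷ # (suc n) ∷ inv (suc n) ∷ []) ⟩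
    (# (suc n) ⊗ x) ⊗ inv (suc n)     ≡⟨ cong (_⊗ inv (suc n)) e ⟩
    # 1 ⊗ inv (suc n)                 ≡⟨ ⊗-idˡ _ ⟩
    inv (suc n)                       ∎
    where open ≡-Reasoning

  inv-1 : inv 1 ≡ # 1
  inv-1 = sym (inv-unique 0 (⊗-idˡ (# 1)))

  inv-* : ∀ m n → inv (suc m * suc n) ≡ inv (suc m) ⊗ inv (suc n)
  inv-* m n = sym (inv-unique (n + m * suc n) (begin
    # (suc m * suc n) ⊗ (x ⊗ y)       ≡⟨ cong (_⊗ (x ⊗ y)) (#-* (suc m) (suc n)) ⟩
    (a ⊗ b) ⊗ (x ⊗ y)                 ≡⟨ ring 4 (λ a b x y → (a :* b) :* (x :* y) := (a :* x) :* (b :* y)) refl (a ∷ b ∷ x ∷ y ∷ []) ⟩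
    (a ⊗ x) ⊗ (b ⊗ y)                 ≡⟨ cong₂ _⊗_ (#⊗inv m) (#⊗inv n) ⟩
    # 1 ⊗ # 1                         ≡⟨ ⊗-idˡ _ ⟩
    # 1                               ∎))
    where
    open ≡-Reasoning
    a = # (suc m)
    b = # (suc n)
    x = inv (suc m)
    y = inv (suc n)

  #⊗inv-* : ∀ m n → # (suc m) ⊗ inv (suc m * suc n) ≡ inv (suc n)
  #⊗inv-* m n = begin
    # (suc m) ⊗ inv (suc m * suc n)              ≡⟨ cong (# (suc m) ⊗_) (inv-* m n) ⟩
    # (suc m) ⊗ (inv (suc m) ⊗ inv (suc n))      ≡⟨ ≡.trans (sym (⊗-assoc _ _ _)) (cong (_⊗ inv (suc n)) (#⊗inv m)) ⟩
    # 1 ⊗ inv (suc n)                            ≡⟨ ⊗-idˡ _ ⟩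
    inv (suc n)                                  ∎
    where open ≡-Reasoning

  inv-gap : ∀ k → inv (suc k) ⊖ inv (suc k) ⊗ inv (suc k) ≼ inv (suc (suc k))
  inv-gap k = lin 3 (λ n x y → (x :* κ 1 :≡ x :* ((κ 1 :+ n) :* y))
      ∷ (y :* (n :* x) :≡ y :* κ 1) ∷ (κ 0 :≤ x :* (x :- y)) ∷ [] ⊢ (x :- x :* x :≤ y))
    (1 ∷ 1 ∷ 1 ∷ []) refl (n ∷ x ∷ y ∷ [])
    (cong (x ⊗_) (≡.trans (sym (#⊗inv (suc k))) (cong (_⊗ y) (#-+ 1 (suc k)))) , cong (y ⊗_) (#⊗inv k) ,
     ⊗-nonneg (inv-nonneg (suc k)) (⊖-nonneg y≼x))
    where
    n = # (suc k)
    x = inv (suc k)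
    y = inv (suc (suc k))
    y≼x : y ≼ x
    y≼x = inv-antitone (ℕ.n≤1+n (suc k))

  H : ℕ → R
  H n = ∑ n inv

  H-upper : ∀ a c → H (a + c) ⊖ H a ≼ # c ⊗ inv (suc a)
  H-upper a c = subst₂ _≼_ (sym (⊖-unique (≡.trans (⊕-comm _ _) (sym (∑₀-+ a c _))))) (∑₀-const c (inv (suc a)))
    (∑₀-mono c (λ i _ → inv-antitone (s≤s (ℕ.m≤m+n a i))))

  H-lower : ∀ a c → # c ⊗ inv (a + c) ≼ H (a + c) ⊖ H a
  H-lower a c = subst₂ _≼_ (∑₀-const c (inv (a + c))) (sym (⊖-unique (≡.trans (⊕-comm _ _) (sym (∑₀-+ a c _))))) (∑₀-mono c bound)
    where
    bound : ∀ i → i < c → inv (a + c) ≼ inv (suc (a + i))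
    bound i p with a + c | ℕ.+-monoʳ-< a p
    ... | suc _ | q = inv-antitone q

  H-mono : ∀ {a b} → a ≤ b → H a ≼ H b
  H-mono p = ∑₀-grow _ p (λ i _ _ → inv-nonneg (suc i))

  H-nonneg : ∀ n → # 0 ≼ H n
  H-nonneg n = H-mono {0} {n} z≤n

  module _ (a′ : ℕ) where
    private
      a = suc a′
      D : ℕ → R
      D m = H (m * a) ⊖ H m

    -- The `a` new terms 1/(ma + 1), ..., 1/(ma + a) are each at least 1/((m + 1)a), so they
    -- outweigh the subtracted 1/(m + 1). Together with `dilate-step-hi` this traps the limit log a
    -- between D(m) and D(m) + 1/m.
    dilate-step-lo : ∀ m → D m ≼ D (suc m)
    dilate-step-lo m = lin 5 (λ h h′ k x c → (x :≤ h′ :- h) ∷ [] ⊢ (h :- k :≤ h′ :- (k :+ x))) (1 ∷ []) refl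
      (H (m * a) ∷ H (suc m * a) ∷ H m ∷ inv (suc m) ∷ # a ∷ [])
      (subst₂ (λ s t → s ≼ H t ⊖ H (m * a)) (≡.trans (cong (λ t → # a ⊗ inv t) (≡.trans (ℕ.+-comm (m * a) a) (ℕ.*-comm (suc m) a))) (#⊗inv-* a′ m)) (ℕ.+-comm (m * a) a) (H-lower (m * a) a))

    dilate-step-hi : ∀ k → D (suc (suc k)) ⊕ inv (suc (suc k)) ≼ D (suc k) ⊕ inv (suc k)
    dilate-step-hi k = lin 5 (λ h h′ c x y → (h′ :- h :≤ x) ∷ [] ⊢ ((h′ :- (c :+ y)) :+ y :≤ (h :- c) :+ x)) (1 ∷ []) refl
      (H (m * a) ∷ H (suc m * a) ∷ H m ∷ inv m ∷ inv (suc m) ∷ [])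
      (≼-trans (subst (λ t → H t ⊖ H (m * a) ≼ # a ⊗ inv (suc (m * a))) (ℕ.+-comm (m * a) a) (H-upper (m * a) a))
        (subst (# a ⊗ inv (suc (m * a)) ≼_) (≡.trans (cong (λ t → # a ⊗ inv t) (ℕ.*-comm m a)) (#⊗inv-* a′ k))
          (⊗-monoˡ (#-nonneg a) (inv-antitone (ℕ.n≤1+n (m * a))))))
      where m = suc k

    dilate-lo : ∀ m o → D m ≼ D (m + o)
    dilate-lo m zero = ≡⇒≼ (cong D (sym (ℕ.+-identityʳ m)))
    dilate-lo m (suc o) = ≼-trans (dilate-lo m o) (subst (λ t → D (m + o) ≼ D t) (sym (ℕ.+-suc m o)) (dilate-step-lo (m + o)))

    dilate-hi : ∀ k o → D (suc k + o) ⊕ inv (suc k + o) ≼ D (suc k) ⊕ inv (suc k)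
    dilate-hi k zero = ≡⇒≼ (cong (λ t → D (suc t) ⊕ inv (suc t)) (ℕ.+-identityʳ k))
    dilate-hi k (suc o) = ≼-trans (subst (λ t → D (suc t) ⊕ inv (suc t) ≼ D (suc k + o) ⊕ inv (suc k + o)) (sym (ℕ.+-suc k o)) (dilate-step-hi (k + o))) (dilate-hi k o)

  -- A completely additive function that tracks the natural logarithm up to X.
  record LogApprox (X : ℕ) : Set where
    field
      ℓ : ℕ → R
      ℓ-* : ∀ m n → ℓ (suc m * suc n) ≡ ℓ (suc m) ⊕ ℓ (suc n)
      ℓ-nonneg : ∀ n → # 0 ≼ ℓ n
      ℓ-lo : ∀ k → suc k < X → inv (suc k) ⊖ # 2 ⊗ (inv (suc k) ⊗ inv (suc k)) ≼ ℓ (suc (suc k)) ⊖ ℓ (suc k)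
      ℓ-hi : ∀ k → suc k < X → ℓ (suc (suc k)) ⊖ ℓ (suc k) ≼ inv (suc k) ⊕ inv (suc k) ⊗ inv (suc k)

  -- The harmonic sum over (M, nM] approximates log n; its values at the primes determine ℓ.
  module Harmonic (M′ : ℕ) where
    private
      M = suc M′

    S : ℕ → R
    S n = H (n * M) ⊖ H M

    S-mono : ∀ {m n} → m ≤ n → S m ≼ S n
    S-mono {m} {n} p = ⊕-mono (H-mono {m * M} {n * M} (ℕ.*-monoˡ-≤ M p)) (≼-refl {⊝ H M})

    S-1 : S 1 ≡ # 0
    S-1 = ≡.trans (cong (λ t → H t ⊖ H M) (ℕ.*-identityˡ M)) (⊕-invʳ (H M))

    S-nonneg : ∀ n → # 0 ≼ S (suc n)
    S-nonneg n = subst (_≼ S (suc n)) S-1 (S-mono {1} {suc n} (s≤s z≤n))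

    private
      shape : ∀ a b → H (b * M * a) ≡ H (a * b * M)
      shape a b = cong H (≡.trans (ℕ.*-comm (b * M) a) (sym (ℕ.*-assoc a b M)))

    -- S(ab) - S(b) is the dilation difference by `a` taken at bM, while S(a) is the same difference
    -- taken at M; `dilate-lo` compares them. `S-*-hi` uses `dilate-hi` in the same way.
    S-*-lo : ∀ a b → S (suc a) ⊕ S (suc b) ≼ S (suc a * suc b)
    S-*-lo a b = lin 4 (λ p q r s → (q :- p :≤ s :- r) ∷ [] ⊢ ((q :- p) :+ (r :- p) :≤ s :- p)) (1 ∷ []) refl
      (H M ∷ H (suc a * M) ∷ H (suc b * M) ∷ H (suc a * suc b * M) ∷ [])
      (subst₂ (λ u v → u ⊖ H M ≼ v ⊖ H (suc b * M)) (cong H (ℕ.*-comm M (suc a))) (shape (suc a) (suc b)) (dilate-lo a M (b * M)))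

    S-*-hi : ∀ a b → S (suc a * suc b) ≼ (S (suc a) ⊕ S (suc b)) ⊕ inv M
    S-*-hi a b = lin 6 (λ p q r s x y → ((s :- r) :+ y :≤ (q :- p) :+ x) ∷ (κ 0 :≤ y) ∷ [] ⊢ (s :- p :≤ ((q :- p) :+ (r :- p)) :+ x)) (1 ∷ 1 ∷ []) refl
      (H M ∷ H (suc a * M) ∷ H (suc b * M) ∷ H (suc a * suc b * M) ∷ inv M ∷ inv (M + b * M) ∷ [])
      (subst₂ (λ u v → (v ⊖ H (suc b * M)) ⊕ inv (M + b * M) ≼ (u ⊖ H M) ⊕ inv M) (cong H (ℕ.*-comm M (suc a))) (shape (suc a) (suc b)) (dilate-hi a M′ (b * M)) , inv-nonneg (M + b * M))

    S-suc-lo : ∀ n → inv (suc n) ≼ S (suc n) ⊖ S n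
    S-suc-lo n = lin 4 (λ h m h′ x → (x :≤ h′ :- h) ∷ [] ⊢ (x :≤ (h′ :- m) :- (h :- m))) (1 ∷ []) refl (H (n * M) ∷ H M ∷ H (suc n * M) ∷ inv (suc n) ∷ [])
      (subst₂ (λ s t → s ≼ H t ⊖ H (n * M)) (≡.trans (cong (λ t → # M ⊗ inv t) (≡.trans (ℕ.+-comm (n * M) M) (ℕ.*-comm (suc n) M))) (#⊗inv-* M′ n)) (ℕ.+-comm (n * M) M) (H-lower (n * M) M))

    S-suc-hi : ∀ k → S (suc (suc k)) ⊖ S (suc k) ≼ inv (suc k)
    S-suc-hi k = lin 4 (λ h m h′ x → (h′ :- h :≤ x) ∷ [] ⊢ ((h′ :- m) :- (h :- m) :≤ x)) (1 ∷ []) refl (H (n * M) ∷ H M ∷ H (suc n * M) ∷ inv n ∷ [])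
      (≼-trans (subst (λ t → H t ⊖ H (n * M) ≼ # M ⊗ inv (suc (n * M))) (ℕ.+-comm (n * M) M) (H-upper (n * M) M))
        (subst (# M ⊗ inv (suc (n * M)) ≼_) (≡.trans (cong (λ t → # M ⊗ inv t) (ℕ.*-comm n M)) (#⊗inv-* M′ k))
          (⊗-monoˡ (#-nonneg M) (inv-antitone (ℕ.n≤1+n (n * M))))))
      where n = suc k

    total : List ℕ → R
    total = foldr (λ p s → S p ⊕ s) (# 0)

    total-++ : ∀ ps qs → total (ps ++ qs) ≡ total ps ⊕ total qs
    total-++ [] qs = sym (⊕-idˡ _)
    total-++ (p ∷ ps) qs = ≡.trans (cong (S p ⊕_) (total-++ ps qs)) (sym (⊕-assoc _ _ _))

    total-↭ : ∀ {ps qs} → ps ↭ qs → total ps ≡ total qs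
    total-↭ refl = refl
    total-↭ (prep x p) = cong (S x ⊕_) (total-↭ p)
    total-↭ (swap {_} {qs} x y p) = ≡.trans (cong (λ t → S x ⊕ (S y ⊕ t)) (total-↭ p))
      (ring 3 (λ a b c → a :+ (b :+ c) := b :+ (a :+ c)) refl (S x ∷ S y ∷ total qs ∷ []))
    total-↭ (trans p q) = ≡.trans (total-↭ p) (total-↭ q)

    length<product : ∀ {ps} → All Prime ps → suc (length ps) ≤ product ps
    length<product [] = ℕ.≤-refl
    length<product {p ∷ ps} (pp ∷ pps) = begin
      suc (suc (length ps))       ≤⟨ s≤s (ℕ.m≤n+m (suc (length ps)) (length ps)) ⟩
      suc (length ps) + suc (length ps) ≡⟨ cong (suc (length ps) +_) (ℕ.+-identityʳ (suc (length ps))) ⟨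
      2 * suc (length ps)         ≤⟨ ℕ.*-mono-≤ (nonTrivial⇒n>1 p ⦃ prime⇒nonTrivial pp ⦄) (length<product pps) ⟩
      p * product ps              ∎
      where open ℕ.≤-Reasoning

    total-nonneg : ∀ {ps} → All Prime ps → # 0 ≼ total ps
    total-nonneg [] = ≼-refl
    total-nonneg {suc p ∷ ps} (_ ∷ pps) = ⊕-nonneg (S-nonneg p) (total-nonneg pps)
    total-nonneg {zero ∷ ps} (pp ∷ _) with nonTrivial⇒n>1 0 ⦃ prime⇒nonTrivial pp ⦄
    ... | ()

    total-close : ∀ {ps} → All Prime ps → total ps ≼ S (product ps) × S (product ps) ≼ total ps ⊕ # (length ps) ⊗ inv M
    total-close [] = ≡⇒≼ (sym S-1) , ≡⇒≼ (≡.trans S-1 (ring 1 (λ x → κ 0 := κ 0 :+ κ 0 :* x) refl (inv M ∷ [])))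
    total-close {zero ∷ ps} (pp ∷ _) with nonTrivial⇒n>1 0 ⦃ prime⇒nonTrivial pp ⦄
    ... | ()
    total-close {suc p ∷ ps} (_ ∷ pps) with product ps | length<product pps | total-close pps
    ... | suc q | _ | lo , hi =
      ≼-trans (⊕-mono ≼-refl lo) (S-*-lo p q) ,
      lin 6 (λ t sp sq spq n m → (spq :≤ (sp :+ sq) :+ m) ∷ (sq :≤ t :+ n :* m) ∷ [] ⊢ (spq :≤ (sp :+ t) :+ (κ 1 :+ n) :* m)) (1 ∷ 1 ∷ []) refl
        (total ps ∷ S (suc p) ∷ S (suc q) ∷ S (suc p * suc q) ∷ # (length ps) ∷ inv M ∷ []) (S-*-hi p q , hi) ▸
      where
      _▸ : S (suc p * suc q) ≼ (S (suc p) ⊕ total ps) ⊕ (# 1 ⊕ # (length ps)) ⊗ inv M → S (suc p * suc q) ≼ (S (suc p) ⊕ total ps) ⊕ # (suc (length ps)) ⊗ inv M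
      h ▸ = subst (λ t → S (suc p * suc q) ≼ (S (suc p) ⊕ total ps) ⊕ t ⊗ inv M) (sym (#-+ 1 (length ps))) h

    open PrimeFactorisation

    ℓ : ℕ → R
    ℓ zero = # 0
    ℓ (suc n) = total (factors (factorise (suc n)))

    -- `S` is only additive up to 1/M; summing it over the prime factorisation makes additivity
    -- exact, by uniqueness of the factorisation.
    ℓ-* : ∀ m n → ℓ (suc m * suc n) ≡ ℓ (suc m) ⊕ ℓ (suc n)
    ℓ-* m n = ≡.trans (total-↭ (factorisationUnique (factorise (suc m * suc n)) mn)) (total-++ (factors fm) (factors fn))
      where
      fm = factorise (suc m)
      fn = factorise (suc n)
      mn : PrimeFactorisation (suc m * suc n)
      mn = record
        { factors = factors fm ++ factors fn
        ; isFactorisation = ≡.trans (cong₂ _*_ (isFactorisation fm) (isFactorisation fn)) (sym (product-++ (factors fm) (factors fn)))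
        ; factorsPrime = ++⁺ (factorsPrime fm) (factorsPrime fn)
        }

    ℓ-nonneg : ∀ n → # 0 ≼ ℓ n
    ℓ-nonneg zero = ≼-refl
    ℓ-nonneg (suc n) = total-nonneg (factorsPrime (factorise (suc n)))

    -- Every multiplication loses at most 1/M, and n + 1 has fewer than n + 1 prime factors.
    ℓ-close : ∀ n → ℓ (suc n) ≼ S (suc n) × S (suc n) ≼ ℓ (suc n) ⊕ # (suc n) ⊗ inv M
    ℓ-close n with factorise (suc n)
    ... | f with total-close (factorsPrime f) | length<product (factorsPrime f)
    ... | lo , hi | len rewrite sym (isFactorisation f) = lo , ≼-trans hi (⊕-mono ≼-refl (⊗-monoʳ (inv-nonneg M) (#-mono (ℕ.≤-trans (ℕ.n≤1+n _) len))))

  logApprox : ∀ X′ → LogApprox (suc X′)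
  logApprox X′ = record { ℓ = ℓ ; ℓ-* = ℓ-* ; ℓ-nonneg = ℓ-nonneg ; ℓ-lo = ℓ-lo ; ℓ-hi = ℓ-hi }
    where
    X = suc X′
    -- The argument is the predecessor of X³. With M = X³ the error (k + 2)/M is at most 1/X², hence
    -- below the 1/(k + 1)² that `ℓ-lo` and `ℓ-hi` allow.
    open Harmonic (X′ + (X′ + X′ * X) * X)
    M = suc (X′ + (X′ + X′ * X) * X)

    small : ∀ k → suc (suc k) ≤ X → # (suc (suc k)) ⊗ inv M ≼ inv (suc k) ⊗ inv (suc k)
    small k p = ≼-trans (⊗-monoʳ (inv-nonneg M) (#-mono p)) (≼-trans (≡⇒≼ e) (⊗-mono (inv-nonneg X) x≤ (inv-nonneg X) x≤))
      where
      x≤ : inv X ≼ inv (suc k)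
      x≤ = inv-antitone (ℕ.≤-trans (ℕ.n≤1+n _) p)
      e : # X ⊗ inv M ≡ inv X ⊗ inv X
      e = ≡.trans (cong (λ t → # X ⊗ inv t) (ℕ.*-assoc X X X)) (≡.trans (#⊗inv-* X′ (X′ + X′ * X)) (inv-* X′ X′))

    ℓ-lo : ∀ k → suc k < X → inv (suc k) ⊖ # 2 ⊗ (inv (suc k) ⊗ inv (suc k)) ≼ ℓ (suc (suc k)) ⊖ ℓ (suc k)
    ℓ-lo k p = lin 8 (λ x y l l′ s s′ e q → (x :- q :≤ y) ∷ (y :≤ s′ :- s) ∷ (l :≤ s) ∷ (s′ :≤ l′ :+ e) ∷ (e :≤ q) ∷ [] ⊢ (x :- κ 2 :* q :≤ l′ :- l))
      (1 ∷ 1 ∷ 1 ∷ 1 ∷ 1 ∷ []) refl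
      (inv (suc k) ∷ inv (suc (suc k)) ∷ ℓ (suc k) ∷ ℓ (suc (suc k)) ∷ S (suc k) ∷ S (suc (suc k)) ∷ # (suc (suc k)) ⊗ inv M ∷ inv (suc k) ⊗ inv (suc k) ∷ [])
      (inv-gap k , S-suc-lo (suc k) , proj₁ (ℓ-close k) , proj₂ (ℓ-close (suc k)) , small k p)

    ℓ-hi : ∀ k → suc k < X → ℓ (suc (suc k)) ⊖ ℓ (suc k) ≼ inv (suc k) ⊕ inv (suc k) ⊗ inv (suc k)
    ℓ-hi k p = lin 8 (λ x l l′ s s′ d e q → (s′ :- s :≤ x) ∷ (l′ :≤ s′) ∷ (s :≤ l :+ d) ∷ (d :≤ e) ∷ (e :≤ q) ∷ [] ⊢ (l′ :- l :≤ x :+ q))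
      (1 ∷ 1 ∷ 1 ∷ 1 ∷ 1 ∷ []) refl
      (inv (suc k) ∷ ℓ (suc k) ∷ ℓ (suc (suc k)) ∷ S (suc k) ∷ S (suc (suc k)) ∷ # (suc k) ⊗ inv M ∷ # (suc (suc k)) ⊗ inv M ∷ inv (suc k) ⊗ inv (suc k) ∷ [])
      (S-suc-hi k , proj₁ (ℓ-close (suc k)) , proj₂ (ℓ-close k) , ⊗-monoʳ (inv-nonneg M) (#-mono (ℕ.n≤1+n (suc k))) , small k p)

-- The Möbius function, the von Mangoldt function and Möbius inversion.

module Multiplicative where
  open Rationals
  open LinearArithmetic
  open Sums
  open Logarithms
  open import Defs using (IsPrimePower)
  open import Data.Nat using (ℕ; zero; suc; _*_; _^_; _≤_; _<_; z≤n; s≤s; _≟_)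
  import Data.Nat.Properties as ℕ
  open import Data.Nat.DivMod using (_/_; m≡m%n+[m/n]*n; m%n<n; m/n≤m)
  open import Data.Nat.Divisibility
  open import Data.Nat.Coprimality using (Coprime; coprime-divisor)
  open import Data.Nat.Primality using (Prime; prime?; ¬prime[1]; ¬prime[0]; prime⇒irreducible; prime⇒nonZero; euclidsLemma)
  open import Data.Nat.Primality.Factorisation using (PrimeFactorisation; factorise; factorisationUnique; factorisationHasAllPrimeFactors)
  open import Data.Nat.ListAction using (product)
  open import Data.Vec using ([]; _∷_)
  open import Data.List using ([]; _∷_; length)
  open import Data.List.Relation.Unary.All as All using (All; []; _∷_)
  open import Data.List.Relation.Binary.Permutation.Propositional.Properties using (↭-length)
  open import Data.Product using (_×_; _,_; ∃)
  open import Data.Sum using (_⊎_; inj₁; inj₂)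
  open import Data.Empty using (⊥-elim)
  open import Relation.Nullary using (¬_; Dec; yes; no)
  open import Relation.Nullary.Decidable using (¬?; _×-dec_)
  open import Relation.Binary.PropositionalEquality

  open PrimeFactorisation

  prime∤⇒coprime : ∀ {p e} → Prime p → ¬ (p ∣ e) → Coprime e p
  prime∤⇒coprime pp ∤ (d∣e , d∣p) with prime⇒irreducible pp d∣p
  ... | inj₁ d≡1 = d≡1
  ... | inj₂ refl = ⊥-elim (∤ d∣e)

  prime∣prime : ∀ {p q} → Prime p → Prime q → p ∣ q → p ≡ q
  prime∣prime pp pq p∣q with prime⇒irreducible pq p∣q
  ... | inj₁ refl = ⊥-elim (¬prime[1] pp)
  ... | inj₂ e = e

  cofactor-∣ : ∀ {p e n} → Prime p → p ∣ n → ¬ (p ∣ e) → e ∣ n → e * p ∣ n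
  cofactor-∣ {p} {e} pp (divides m refl) ∤ e∣n = *-monoˡ-∣ p (coprime-divisor (prime∤⇒coprime pp ∤) (subst (e ∣_) (ℕ.*-comm m p) e∣n))

  SquareDivisor : ℕ → Set
  SquareDivisor n = ∃ λ p → p < suc n × (Prime p × p * p ∣ n)

  squareDivisor? : ∀ n → Dec (SquareDivisor n)
  squareDivisor? n = ℕ.anyUpTo? (λ p → prime? p ×-dec (p * p ∣? n)) (suc n)

  squareDivisor : ∀ {p n} → Prime p → p * p ∣ suc n → SquareDivisor (suc n)
  squareDivisor {p} pp d = p , s≤s (ℕ.≤-trans (ℕ.m≤m*n p p ⦃ prime⇒nonZero pp ⦄) (∣⇒≤ d)) , pp , d

  Ω : ℕ → ℕ
  Ω zero = 0
  Ω (suc n) = length (factors (factorise (suc n)))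

  Ω-prime* : ∀ p e → Prime (suc p) → Ω (suc e * suc p) ≡ suc (Ω (suc e))
  Ω-prime* p e pp = ↭-length (factorisationUnique (factorise (suc e * suc p)) pe)
    where
    fe = factorise (suc e)
    pe : PrimeFactorisation (suc e * suc p)
    pe = record
      { factors = suc p ∷ factors fe
      ; isFactorisation = trans (ℕ.*-comm (suc e) (suc p)) (cong (suc p *_) (isFactorisation fe))
      ; factorsPrime = pp ∷ factorsPrime fe
      }

  sign : ℕ → R
  sign zero = # 1
  sign (suc k) = # 0 ⊖ sign k

  sign-bounded : ∀ k → # 0 ⊖ # 1 ≼ sign k × sign k ≼ # 1
  sign-bounded zero = lin 0 ([] ⊢ (κ 0 :- κ 1 :≤ κ 1)) [] refl [] _ , ≼-refl
  sign-bounded (suc k) with sign-bounded k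
  ... | lo , hi = lin 1 (λ s → (s :≤ κ 1) ∷ [] ⊢ (κ 0 :- κ 1 :≤ κ 0 :- s)) (1 ∷ []) refl (sign k ∷ []) hi ,
                  lin 1 (λ s → (κ 0 :- κ 1 :≤ s) ∷ [] ⊢ (κ 0 :- s :≤ κ 1)) (1 ∷ []) refl (sign k ∷ []) lo

  abstract
    μ : ℕ → R
    μ n with squareDivisor? n
    ... | yes _ = # 0
    ... | no _ = sign (Ω n)

    μ-bounded : ∀ n → # 0 ⊖ # 1 ≼ μ n × μ n ≼ # 1
    μ-bounded n with squareDivisor? n
    ... | yes _ = lin 0 ([] ⊢ (κ 0 :- κ 1 :≤ κ 0)) [] refl [] _ , #-nonneg 1
    ... | no _ = sign-bounded (Ω n)

    μ-1 : μ 1 ≡ # 1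
    μ-1 with squareDivisor? 1
    ... | no _ = refl
    ... | yes (p , _ , pp , d) = ⊥-elim (¬prime[1] (subst Prime (ℕ.m*n≡1⇒m≡1 p p (∣1⇒≡1 d)) pp))

    μ-square : ∀ {p n} → Prime p → p * p ∣ suc n → μ (suc n) ≡ # 0
    μ-square {p} {n} pp d with squareDivisor? (suc n)
    ... | yes _ = refl
    ... | no ¬s = ⊥-elim (¬s (squareDivisor pp d))

    μ-prime* : ∀ p e → Prime (suc p) → ¬ (suc p ∣ suc e) → μ (suc e * suc p) ≡ # 0 ⊖ μ (suc e)
    μ-prime* p e pp ∤ with squareDivisor? (suc e) | squareDivisor? (suc e * suc p)
    ... | yes _ | yes _ = sym (⊖-unique (⊕-idˡ (# 0)))
    ... | no _ | no _ = cong sign (Ω-prime* p e pp)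
    ... | yes (r , _ , pr , d) | no ¬s = ⊥-elim (¬s (squareDivisor pr (∣m⇒∣m*n (suc p) d)))
    ... | no ¬s | yes (r , _ , pr , d) with r ≟ suc p
    ... | yes refl = ⊥-elim (∤ (*-cancelʳ-∣ (suc p) d))
    ... | no r≢ = ⊥-elim (¬s (squareDivisor pr r²∣e))
      where
      r²∣e : r * r ∣ suc e
      r²∣e = coprime-divisor cop (subst (r * r ∣_) (ℕ.*-comm (suc e) (suc p)) d)
        where
        cop : Coprime (r * r) (suc p)
        cop (x , y) with prime⇒irreducible pp y
        ... | inj₁ e = e
        ... | inj₂ refl with euclidsLemma r r pp x
        ... | inj₁ z = ⊥-elim (r≢ (sym (prime∣prime pp pr z)))
        ... | inj₂ z = ⊥-elim (r≢ (sym (prime∣prime pp pr z)))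

  -- Pairing d with pd: a sum of μ over the divisors of a multiple of p becomes a sum of differences over the divisors prime to p.
  ∑μ-pairing : ∀ p n N → Prime (suc p) → suc p ∣ suc n → suc n ≤ N → (g : ℕ → R) →
    ∑ N (λ d → 𝟙 (d ∣? suc n) ⊗ (μ d ⊗ g d)) ≡
    ∑ N (λ d → 𝟙 (¬? (suc p ∣? d)) ⊗ (𝟙 (d ∣? suc n) ⊗ (μ d ⊗ (g d ⊖ g (d * suc p)))))
  ∑μ-pairing p′ n′ N pp p∣n n≤N g = begin
    ∑ N t                                        ≡⟨ ∑₀-cong N (λ i _ → split (suc i)) ⟩
    ∑ N (λ d → 𝟙 (¬? (p ∣? d)) ⊗ t d ⊕ 𝟙 (p ∣? d) ⊗ t d) ≡⟨ ∑₀-⊕ N _ _ ⟩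
    A ⊕ ∑ N (λ d → 𝟙 (p ∣? d) ⊗ t d)            ≡⟨ cong (A ⊕_) (∑-multiples p′ N t) ⟩
    A ⊕ ∑ (N / p) (λ e → t (e * p))             ≡⟨ cong (A ⊕_) (∑₀-cong (N / p) (λ i _ → term i)) ⟩
    A ⊕ ∑ (N / p) u                             ≡⟨ cong (A ⊕_) (∑₀-extend _ (m/n≤m N p) far) ⟨
    A ⊕ ∑ N u                                   ≡⟨ ∑₀-⊕ N _ _ ⟨
    ∑ N (λ d → 𝟙 (¬? (p ∣? d)) ⊗ t d ⊕ u d)     ≡⟨ ∑₀-cong N (λ i _ → join (suc i)) ⟩
    ∑ N (λ d → 𝟙 (¬? (p ∣? d)) ⊗ (𝟙 (d ∣? n) ⊗ (μ d ⊗ (g d ⊖ g (d * p))))) ∎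
    where
    open ≡-Reasoning
    p = suc p′
    n = suc n′
    t u : ℕ → R
    t d = 𝟙 (d ∣? n) ⊗ (μ d ⊗ g d)
    u d = 𝟙 (¬? (p ∣? d)) ⊗ (𝟙 (d ∣? n) ⊗ (# 0 ⊖ μ d ⊗ g (d * p)))
    A = ∑ N (λ d → 𝟙 (¬? (p ∣? d)) ⊗ t d)
    split : ∀ d → t d ≡ 𝟙 (¬? (p ∣? d)) ⊗ t d ⊕ 𝟙 (p ∣? d) ⊗ t d
    split d with p ∣? d
    ... | yes _ = ring 1 (λ x → x := κ 0 :* x :+ κ 1 :* x) refl (t d ∷ [])
    ... | no _ = ring 1 (λ x → x := κ 1 :* x :+ κ 0 :* x) refl (t d ∷ [])
    join : ∀ d → 𝟙 (¬? (p ∣? d)) ⊗ t d ⊕ u d ≡ 𝟙 (¬? (p ∣? d)) ⊗ (𝟙 (d ∣? n) ⊗ (μ d ⊗ (g d ⊖ g (d * p))))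
    join d = ring 5 (λ a b m x y → a :* (b :* (m :* x)) :+ a :* (b :* (κ 0 :- m :* y)) := a :* (b :* (m :* (x :- y)))) refl
      (𝟙 (¬? (p ∣? d)) ∷ 𝟙 (d ∣? n) ∷ μ d ∷ g d ∷ g (d * p) ∷ [])
    term : ∀ i → t (suc i * p) ≡ u (suc i)
    term i with p ∣? suc i
    ... | yes q = trans (cong (λ x → 𝟙 (suc i * p ∣? n) ⊗ (x ⊗ g (suc i * p))) (μ-square pp (*-monoˡ-∣ p q)))
      (ring 3 (λ a b c → a :* (κ 0 :* b) := κ 0 :* c) refl (_ ∷ _ ∷ _ ∷ []))
    ... | no q = trans (cong₂ (λ x y → x ⊗ (y ⊗ g (suc i * p)))
        (𝟙-cong (suc i * p ∣? n) (suc i ∣? n) (∣-trans (m∣m*n p)) (cofactor-∣ pp p∣n q)) (μ-prime* p′ i pp q))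
      (ring 3 (λ a m b → a :* ((κ 0 :- m) :* b) := κ 1 :* (a :* (κ 0 :- m :* b))) refl (𝟙 (suc i ∣? n) ∷ μ (suc i) ∷ g (suc i * p) ∷ []))
    -- By `term` this is a value of `t` at a number exceeding N, which cannot divide n.
    far : ∀ i → N / p ≤ i → i < N → u (suc i) ≡ # 0
    far i q _ = trans (sym (term i)) (trans (cong (_⊗ (μ (suc i * p) ⊗ g (suc i * p))) (𝟙-no (suc i * p ∣? n) (λ d → ℕ.<⇒≱ big (ℕ.≤-trans (∣⇒≤ d) n≤N)))) (⊗-zeroˡ _))
      where
      big : N < suc i * p
      big = ℕ.≤-trans (s≤s (ℕ.≤-reflexive (m≡m%n+[m/n]*n N p))) (ℕ.+-mono-≤ (m%n<n N p) (ℕ.*-monoˡ-≤ p q))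

  ∃prime∣ : ∀ n → ∃ λ p → Prime (suc p) × suc p ∣ suc (suc n)
  ∃prime∣ n with factorise (suc (suc n))
  ... | record { factors = [] ; isFactorisation = () }
  ... | record { factors = zero ∷ _ ; factorsPrime = pp ∷ _ } = ⊥-elim (¬prime[0] pp)
  ... | record { factors = suc p ∷ ps ; isFactorisation = e ; factorsPrime = pp ∷ _ } = p , pp , subst (suc p ∣_) (sym e) (m∣m*n (product ps))

  -- For an argument above 1, pairing along any prime divisor leaves differences of the constant 1.
  ∑μ : ∀ n N → suc n ≤ N → ∑ N (λ d → 𝟙 (d ∣? suc n) ⊗ μ d) ≡ 𝟙 (suc n ≟ 1)
  ∑μ zero N@(suc N′) _ = begin
    ∑ N (λ d → 𝟙 (d ∣? 1) ⊗ μ d) ≡⟨ ∑₀-single N 0 _ (s≤s z≤n) (λ i _ i≢0 → trans (cong (_⊗ μ (suc i)) (𝟙-no (suc i ∣? 1) (λ d → i≢0 (ℕ.suc-injective (∣1⇒≡1 d))))) (⊗-zeroˡ _)) ⟩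
    𝟙 (1 ∣? 1) ⊗ μ 1             ≡⟨ cong₂ _⊗_ (𝟙-yes (1 ∣? 1) (∣-refl {1})) μ-1 ⟩
    # 1 ⊗ # 1                    ≡⟨ ⊗-idˡ _ ⟩
    # 1                          ∎
    where open ≡-Reasoning
  ∑μ (suc n) N n≤N with ∃prime∣ n
  ... | p , pp , p∣n = trans (∑₀-cong N (λ i _ → cong (𝟙 (suc i ∣? suc (suc n)) ⊗_) (sym (⊗-idʳ (μ (suc i))))))
    (trans (∑μ-pairing p (suc n) N pp p∣n n≤N (λ _ → # 1))
      (∑₀-zero N (λ i _ → ring 3 (λ a b c → a :* (b :* (c :* (κ 1 :- κ 1))) := κ 0) refl (_ ∷ _ ∷ _ ∷ []))))

  all-equal-product : ∀ {p} ps → All (_≡ p) ps → product ps ≡ p ^ length ps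
  all-equal-product [] [] = refl
  all-equal-product (p ∷ ps) (refl ∷ es) = cong (p *_) (all-equal-product ps es)

  -- The second alternative supplies a second prime instead of a bare negation, because `Q-two`
  -- pairs the divisors along it.
  primePower⊎ : ∀ n → ∃ λ p → Prime (suc p) × suc p ∣ suc (suc n) ×
    ((IsPrimePower (suc (suc n)) × (∀ {r} → Prime r → r ∣ suc (suc n) → r ≡ suc p)) ⊎ (∃ λ q → Prime (suc q) × suc q ∣ suc (suc n) × suc q ≢ suc p))
  primePower⊎ n with factorise (suc (suc n))
  ... | record { factors = [] ; isFactorisation = () }
  ... | record { factors = zero ∷ _ ; factorsPrime = pp ∷ _ } = ⊥-elim (¬prime[0] pp)
  ... | record { factors = fs@(suc p ∷ ps) ; isFactorisation = e ; factorsPrime = pp ∷ pps } = p , pp , subst (suc p ∣_) (sym e) (m∣m*n (product ps)) , decide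
    where
    other : ∀ qs → All Prime qs → product qs ∣ suc (suc n) → ¬ All (_≡ suc p) qs → ∃ λ q → Prime (suc q) × suc q ∣ suc (suc n) × suc q ≢ suc p
    other [] _ _ ¬all = ⊥-elim (¬all [])
    other (zero ∷ qs) (pq ∷ _) _ _ = ⊥-elim (¬prime[0] pq)
    other (suc q ∷ qs) (pq ∷ pqs) d ¬all with suc q ≟ suc p
    ... | no ne = q , pq , ∣-trans (m∣m*n (product qs)) d , ne
    ... | yes refl = other qs pqs (∣-trans (n∣m*n (suc q)) d) (λ es → ¬all (refl ∷ es))
    decide : _ ⊎ _
    decide with All.all? (_≟ suc p) ps
    ... | yes es = inj₁ ((suc p , length fs , pp , s≤s z≤n , trans e (all-equal-product fs (refl ∷ es))) ,
                         (λ {r} pr d → All.lookup (refl ∷ es) (factorisationHasAllPrimeFactors {p = r} pr (subst (r ∣_) e d) (pp ∷ pps))))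
    ... | no ¬es = inj₂ (other ps pps (subst (product ps ∣_) (sym e) (n∣m*n (suc p))) ¬es)

  module VonMangoldt {X} (L : LogApprox X) where
    open LogApprox L

    ℓ-1 : ℓ 1 ≡ # 0
    ℓ-1 = ⊕-cancelʳ _ _ (ℓ 1) (trans (sym (ℓ-* 0 0)) (sym (⊕-idˡ (ℓ 1))))

    abstract
      -- The form -∑ μ(d) log d given by Möbius inversion. What follows uses only complete
      -- additivity of `ℓ`, so all identities for Λ are exact although `ℓ` merely approximates log.
      Λ : ℕ → R
      Λ n = # 0 ⊖ ∑ n (λ d → 𝟙 (d ∣? n) ⊗ (μ d ⊗ ℓ d))

      Λ-def : ∀ n → Λ n ≡ # 0 ⊖ ∑ n (λ d → 𝟙 (d ∣? n) ⊗ (μ d ⊗ ℓ d))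
      Λ-def n = refl

    Λ-extend : ∀ n N → suc n ≤ N → Λ (suc n) ≡ # 0 ⊖ ∑ N (λ d → 𝟙 (d ∣? suc n) ⊗ (μ d ⊗ ℓ d))
    Λ-extend n N n≤N = trans (Λ-def (suc n)) (cong (# 0 ⊖_) (sym (∑₀-extend _ n≤N (λ i q _ → trans (cong (_⊗ _) (𝟙-no (suc i ∣? suc n) (>⇒∤ (s≤s q)))) (⊗-zeroˡ _)))))

    Λ-1 : Λ 1 ≡ # 0
    Λ-1 = trans (trans (Λ-def 1) (cong (λ x → # 0 ⊖ (# 0 ⊕ 𝟙 (1 ∣? 1) ⊗ (μ 1 ⊗ x))) ℓ-1)) (ring 2 (λ a b → κ 0 :- (κ 0 :+ a :* (b :* κ 0)) := κ 0) refl (_ ∷ _ ∷ []))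

    private
      Q : ℕ → ℕ → R
      Q p n = ∑ n (λ d → 𝟙 (¬? (suc p ∣? d)) ⊗ (𝟙 (d ∣? n) ⊗ μ d))

      -- Pairing d with pd leaves the differences ℓ(d) - ℓ(pd) = -ℓ(p), which do not depend on d.
      Λ≡ℓ⊗Q : ∀ p n → Prime (suc p) → suc p ∣ suc n → Λ (suc n) ≡ ℓ (suc p) ⊗ Q p (suc n)
      Λ≡ℓ⊗Q p n pp p∣n = trans (trans (Λ-def (suc n)) (cong (# 0 ⊖_) (trans (∑μ-pairing p n (suc n) pp p∣n ℕ.≤-refl ℓ)
          (trans (∑₀-cong (suc n) (λ i _ → trans (cong (λ l → 𝟙 (¬? (suc p ∣? suc i)) ⊗ (𝟙 (suc i ∣? suc n) ⊗ (μ (suc i) ⊗ (ℓ (suc i) ⊖ l)))) (ℓ-* i p))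
            (ring 5 (λ a b m l k → a :* (b :* (m :* (l :- (l :+ k)))) := (κ 0 :- k) :* (a :* (b :* m))) refl
              (𝟙 (¬? (suc p ∣? suc i)) ∷ 𝟙 (suc i ∣? suc n) ∷ μ (suc i) ∷ ℓ (suc i) ∷ ℓ (suc p) ∷ []))))
          (∑₀-⊗ (suc n) (# 0 ⊖ ℓ (suc p)) _)))))
        (ring 2 (λ a q → κ 0 :- (κ 0 :- a) :* q := a :* q) refl (ℓ (suc p) ∷ Q p (suc n) ∷ []))

      -- Pairing along the second prime q: whether p divides d is not affected by a factor q, so all
      -- differences vanish.
      Q-two : ∀ p q n → Prime (suc p) → Prime (suc q) → suc q ∣ suc n → suc q ≢ suc p → Q p (suc n) ≡ # 0
      Q-two p q n pp pq q∣n ne = begin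
        Q p (suc n)                                                              ≡⟨ ∑₀-cong (suc n) (λ i _ → ring 3 (λ a b c → a :* (b :* c) := b :* (c :* a)) refl (_ ∷ _ ∷ _ ∷ [])) ⟩
        ∑ (suc n) (λ d → 𝟙 (d ∣? suc n) ⊗ (μ d ⊗ 𝟙 (¬? (suc p ∣? d))))        ≡⟨ ∑μ-pairing q n (suc n) pq q∣n ℕ.≤-refl (λ d → 𝟙 (¬? (suc p ∣? d))) ⟩
        ∑ (suc n) (λ d → 𝟙 (¬? (suc q ∣? d)) ⊗ (𝟙 (d ∣? suc n) ⊗ (μ d ⊗ (𝟙 (¬? (suc p ∣? d)) ⊖ 𝟙 (¬? (suc p ∣? (d * suc q)))))))
          ≡⟨ ∑₀-zero (suc n) (λ i _ → trans (cong (λ t → _ ⊗ (_ ⊗ (_ ⊗ (𝟙 (¬? (suc p ∣? suc i)) ⊖ t)))) (χ i))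
               (ring 4 (λ a b c x → a :* (b :* (c :* (x :- x))) := κ 0) refl (_ ∷ _ ∷ _ ∷ _ ∷ []))) ⟩
        # 0 ∎
        where
        open ≡-Reasoning
        χ : ∀ i → 𝟙 (¬? (suc p ∣? (suc i * suc q))) ≡ 𝟙 (¬? (suc p ∣? suc i))
        χ i = 𝟙-cong (¬? (suc p ∣? (suc i * suc q))) (¬? (suc p ∣? suc i)) (λ ∤ d → ∤ (∣m⇒∣m*n (suc q) d)) back
          where
          back : ¬ (suc p ∣ suc i) → ¬ (suc p ∣ suc i * suc q)
          back ∤ d with euclidsLemma (suc i) (suc q) pp d
          ... | inj₁ x = ∤ x
          ... | inj₂ y = ne (sym (prime∣prime pp pq y))

      Q-one : ∀ p n → Prime (suc p) → (∀ {r} → Prime r → r ∣ suc n → r ≡ suc p) → Q p (suc n) ≡ # 1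
      Q-one p n pp only = trans (∑₀-single (suc n) 0 _ (s≤s z≤n) (λ i _ → vanish i))
        (trans (cong₂ (λ a b → a ⊗ (b ⊗ μ 1)) (𝟙-yes (¬? (suc p ∣? 1)) (λ d → ¬prime[1] (subst Prime (∣1⇒≡1 d) pp))) (𝟙-yes (1 ∣? suc n) (1∣ suc n)))
          (trans (cong (λ m → # 1 ⊗ (# 1 ⊗ m)) μ-1) (trans (⊗-idˡ _) (⊗-idˡ _))))
        where
        vanish : ∀ i → i ≢ 0 → 𝟙 (¬? (suc p ∣? suc i)) ⊗ (𝟙 (suc i ∣? suc n) ⊗ μ (suc i)) ≡ # 0
        vanish zero ne = ⊥-elim (ne refl)
        vanish (suc i) _ with suc (suc i) ∣? suc n
        ... | no _ = trans (cong (𝟙 (¬? (suc p ∣? suc (suc i))) ⊗_) (⊗-zeroˡ (μ (suc (suc i))))) (⊗-zeroʳ _)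
        ... | yes d with ∃prime∣ i
        ... | r , pr , r∣i with only pr (∣-trans r∣i d)
        ... | refl = trans (cong (_⊗ (# 1 ⊗ μ (suc (suc i)))) (𝟙-no (¬? (suc p ∣? suc (suc i))) (λ ∤ → ∤ r∣i))) (⊗-zeroˡ _)

    Λ-nonneg : ∀ n → # 0 ≼ Λ (suc n)
    Λ-nonneg zero = ≡⇒≼ (sym Λ-1)
    Λ-nonneg (suc n) with primePower⊎ n
    ... | p , pp , p∣n , inj₁ (_ , only) = subst (# 0 ≼_) (sym (trans (Λ≡ℓ⊗Q p (suc n) pp p∣n) (trans (cong (ℓ (suc p) ⊗_) (Q-one p (suc n) pp only)) (⊗-idʳ _)))) (ℓ-nonneg (suc p))
    ... | p , pp , p∣n , inj₂ (q , pq , q∣n , ne) = ≡⇒≼ (sym (trans (Λ≡ℓ⊗Q p (suc n) pp p∣n) (trans (cong (ℓ (suc p) ⊗_) (Q-two p q (suc n) pp pq q∣n ne)) (⊗-zeroʳ _))))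

    Λ-support : ∀ n → ¬ IsPrimePower (suc n) → Λ (suc n) ≡ # 0
    Λ-support zero _ = Λ-1
    Λ-support (suc n) ¬pp with primePower⊎ n
    ... | p , pp , p∣n , inj₁ (yes′ , _) = ⊥-elim (¬pp yes′)
    ... | p , pp , p∣n , inj₂ (q , pq , q∣n , ne) = trans (Λ≡ℓ⊗Q p (suc n) pp p∣n) (trans (cong (ℓ (suc p) ⊗_) (Q-two p q (suc n) pp pq q∣n ne)) (⊗-zeroʳ _))

    -- The weight c - ℓ(d) combines ∑ μ, which detects n + 1 = 1, with the definition of Λ. With c =
    -- log x this is the inner sum of the Tatuzawa-Iseki argument.
    ∑μ-log : ∀ n N c → suc n ≤ N → ∑ N (λ d → 𝟙 (d ∣? suc n) ⊗ (μ d ⊗ (c ⊖ ℓ d))) ≡ c ⊗ 𝟙 (suc n ≟ 1) ⊕ Λ (suc n)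
    ∑μ-log n N c n≤N = begin
      ∑ N (λ d → 𝟙 (d ∣? suc n) ⊗ (μ d ⊗ (c ⊖ ℓ d)))   ≡⟨ ∑₀-cong N (λ i _ → ring 4 (λ a m c l → a :* (m :* (c :- l)) := c :* (a :* m) :- a :* (m :* l)) refl (𝟙 (suc i ∣? suc n) ∷ μ (suc i) ∷ c ∷ ℓ (suc i) ∷ [])) ⟩
      ∑ N (λ d → c ⊗ (𝟙 (d ∣? suc n) ⊗ μ d) ⊖ 𝟙 (d ∣? suc n) ⊗ (μ d ⊗ ℓ d)) ≡⟨ ∑₀-⊖ N _ _ ⟩
      ∑ N (λ d → c ⊗ (𝟙 (d ∣? suc n) ⊗ μ d)) ⊖ B       ≡⟨ cong (_⊖ B) (trans (∑₀-⊗ N c _) (cong (c ⊗_) (∑μ n N n≤N))) ⟩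
      c ⊗ 𝟙 (suc n ≟ 1) ⊖ B                            ≡⟨ ring 2 (λ x b → x :- b := x :+ (κ 0 :- b)) refl (_ ∷ B ∷ []) ⟩
      c ⊗ 𝟙 (suc n ≟ 1) ⊕ (# 0 ⊖ B)                    ≡⟨ cong (c ⊗ 𝟙 (suc n ≟ 1) ⊕_) (Λ-extend n N n≤N) ⟨
      c ⊗ 𝟙 (suc n ≟ 1) ⊕ Λ (suc n)                    ∎
      where
      open ≡-Reasoning
      B = ∑ N (λ d → 𝟙 (d ∣? suc n) ⊗ (μ d ⊗ ℓ d))

    Λ-conv : ∀ n N → suc n ≤ N → Λ (suc n) ≡ ∑ N (λ e → 𝟙 (e ∣? suc n) ⊗ (μ e ⊗ (ℓ (suc n) ⊖ ℓ e)))
    Λ-conv n N n≤N = sym (trans (∑μ-log n N (ℓ (suc n)) n≤N) (trans (cong (_⊕ Λ (suc n)) (zero′ n)) (⊕-idˡ _)))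
      where
      zero′ : ∀ n → ℓ (suc n) ⊗ 𝟙 (suc n ≟ 1) ≡ # 0
      zero′ zero = trans (cong (_⊗ # 1) ℓ-1) (⊗-zeroˡ _)
      zero′ (suc n) = ⊗-zeroʳ _

    -- Insert `Λ-conv` and write d = ke: then ℓ(d) - ℓ(e) = ℓ(k), and for fixed k the sum of μ over
    -- the divisors e of n/k leaves only k = n.
    ∑Λ : ∀ n N → suc n ≤ N → ∑ N (λ d → 𝟙 (d ∣? suc n) ⊗ Λ d) ≡ ℓ (suc n)
    ∑Λ n′ N n≤N = begin
      ∑ N (λ d → 𝟙 (d ∣? n) ⊗ Λ d)
        ≡⟨ ∑₀-cong N (λ i q → trans (cong (𝟙 (suc i ∣? n) ⊗_) (Λ-conv i N q)) (sym (∑₀-⊗ N _ _))) ⟩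
      ∑ N (λ d → ∑ N (λ e → 𝟙 (d ∣? n) ⊗ (𝟙 (e ∣? d) ⊗ (μ e ⊗ (ℓ d ⊖ ℓ e)))))
        ≡⟨ ∑₀-swap N N _ ⟩
      ∑ N (λ e → ∑ N (λ d → 𝟙 (d ∣? n) ⊗ (𝟙 (e ∣? d) ⊗ (μ e ⊗ (ℓ d ⊖ ℓ e)))))
        ≡⟨ ∑₀-cong N (λ i _ → inner i) ⟩
      ∑ N (λ e → ∑ N (λ k → 𝟙 (k * e ∣? n) ⊗ (μ e ⊗ ℓ k)))
        ≡⟨ ∑₀-swap N N _ ⟩
      ∑ N (λ k → ∑ N (λ e → 𝟙 (k * e ∣? n) ⊗ (μ e ⊗ ℓ k)))
        ≡⟨ ∑₀-cong N (λ i _ → trans (∑₀-cong N (λ j _ → ring 3 (λ a b c → a :* (b :* c) := c :* (a :* b)) refl (_ ∷ _ ∷ _ ∷ []))) (trans (∑₀-⊗ N (ℓ (suc i)) _) (cong (ℓ (suc i) ⊗_) (indicator i)))) ⟩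
      ∑ N (λ k → ℓ k ⊗ 𝟙 (k ≟ n))
        ≡⟨ ∑₀-single N n′ _ n≤N (λ i _ ne → trans (cong (ℓ (suc i) ⊗_) (𝟙-no (suc i ≟ n) (λ e → ne (ℕ.suc-injective e)))) (⊗-zeroʳ _)) ⟩
      ℓ n ⊗ 𝟙 (n ≟ n)
        ≡⟨ trans (cong (ℓ n ⊗_) (𝟙-yes (n ≟ n) refl)) (⊗-idʳ _) ⟩
      ℓ n ∎
      where
      open ≡-Reasoning
      n = suc n′
      inner : ∀ i → ∑ N (λ d → 𝟙 (d ∣? n) ⊗ (𝟙 (suc i ∣? d) ⊗ (μ (suc i) ⊗ (ℓ d ⊖ ℓ (suc i))))) ≡ ∑ N (λ k → 𝟙 (k * suc i ∣? n) ⊗ (μ (suc i) ⊗ ℓ k))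
      inner i = begin
        ∑ N (λ d → 𝟙 (d ∣? n) ⊗ (𝟙 (suc i ∣? d) ⊗ (μ (suc i) ⊗ (ℓ d ⊖ ℓ (suc i)))))
          ≡⟨ ∑₀-cong N (λ _ _ → ring 3 (λ a b c → a :* (b :* c) := b :* (a :* c)) refl (_ ∷ _ ∷ _ ∷ [])) ⟩
        ∑ N (λ d → 𝟙 (suc i ∣? d) ⊗ (𝟙 (d ∣? n) ⊗ (μ (suc i) ⊗ (ℓ d ⊖ ℓ (suc i)))))
          ≡⟨ ∑-multiples i N (λ d → 𝟙 (d ∣? n) ⊗ (μ (suc i) ⊗ (ℓ d ⊖ ℓ (suc i)))) ⟩
        ∑ (N / suc i) (λ k → 𝟙 (k * suc i ∣? n) ⊗ (μ (suc i) ⊗ (ℓ (k * suc i) ⊖ ℓ (suc i))))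
          ≡⟨ ∑₀-cong (N / suc i) (λ k _ → cong (λ t → 𝟙 (suc k * suc i ∣? n) ⊗ (μ (suc i) ⊗ t)) (trans (cong (_⊖ ℓ (suc i)) (ℓ-* k i)) (⊖-unique refl))) ⟩
        ∑ (N / suc i) (λ k → 𝟙 (k * suc i ∣? n) ⊗ (μ (suc i) ⊗ ℓ k))
          ≡⟨ ∑₀-extend _ (m/n≤m N (suc i)) (λ k q _ → trans (cong (_⊗ _) (𝟙-no (suc k * suc i ∣? n) (λ d → ℕ.<⇒≱ (big k q) (ℕ.≤-trans (∣⇒≤ d) n≤N)))) (⊗-zeroˡ _)) ⟨
        ∑ N (λ k → 𝟙 (k * suc i ∣? n) ⊗ (μ (suc i) ⊗ ℓ k)) ∎
        where
        big : ∀ k → N / suc i ≤ k → N < suc k * suc i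
        big k q = ℕ.≤-trans (s≤s (ℕ.≤-reflexive (m≡m%n+[m/n]*n N (suc i)))) (ℕ.+-mono-≤ (m%n<n N (suc i)) (ℕ.*-monoˡ-≤ (suc i) q))
      indicator : ∀ i → ∑ N (λ e → 𝟙 (suc i * e ∣? n) ⊗ μ e) ≡ 𝟙 (suc i ≟ n)
      indicator i with suc i ∣? n
      ... | no ∤ = trans (∑₀-zero N (λ j _ → trans (cong (_⊗ _) (𝟙-no (suc i * suc j ∣? n) (λ d → ∤ (∣-trans (m∣m*n (suc j)) d)))) (⊗-zeroˡ _)))
                     (sym (𝟙-no (suc i ≟ n) (λ e → ∤ (∣-reflexive e))))
      ... | yes (divides (suc m) e) = trans (∑₀-cong N (λ j _ → cong (_⊗ μ (suc j)) (𝟙-cong (suc i * suc j ∣? n) (suc j ∣? suc m) (to j) (from j))))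
          (trans (∑μ m N (ℕ.≤-trans (ℕ.≤-trans (ℕ.m≤m*n (suc m) (suc i)) (ℕ.≤-reflexive (sym e))) n≤N)) (𝟙-cong (suc m ≟ 1) (suc i ≟ n) one one′))
        where
        n≡ : n ≡ suc i * suc m
        n≡ = trans e (ℕ.*-comm (suc m) (suc i))
        to : ∀ j → suc i * suc j ∣ n → suc j ∣ suc m
        to j d = *-cancelˡ-∣ (suc i) (subst (suc i * suc j ∣_) n≡ d)
        from : ∀ j → suc j ∣ suc m → suc i * suc j ∣ n
        from j d = subst (suc i * suc j ∣_) (sym n≡) (*-monoʳ-∣ (suc i) d)
        one : suc m ≡ 1 → suc i ≡ n
        one refl = sym (trans n≡ (ℕ.*-identityʳ (suc i)))
        one′ : suc i ≡ n → suc m ≡ 1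
        one′ q = ℕ.*-cancelˡ-≡ (suc m) 1 (suc i) (trans (sym n≡) (trans (sym q) (sym (ℕ.*-identityʳ (suc i)))))

-- Integer division, Euler's constant and Stirling-type estimates for `ℓ`.

module Stirling where
  open Rationals
  open LinearArithmetic
  open Sums
  open Logarithms
  open Multiplicative
  open import Data.Nat using (ℕ; zero; suc; _+_; _*_; _≤_; _<_; z≤n; s≤s; _≤?_)
  import Data.Nat.Properties as ℕ
  open import Data.Nat.DivMod using (_/_; m≡m%n+[m/n]*n; m%n<n; m/n≤m; m/n*n≤m; /-monoˡ-≤; m*n/n≡m)
  open import Data.Vec using ([]; _∷_)
  open import Data.List using ([]; _∷_)
  open import Data.Product using (_×_; _,_; proj₁; proj₂)
  open import Relation.Binary.PropositionalEquality

  -- Division with the junk value x div 0 = 0, so that it can occur under sums.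
  infixl 7 _div_
  _div_ : ℕ → ℕ → ℕ
  x div zero = 0
  x div suc n = x / suc n

  div-suc-lower : ∀ x n → x < suc (x / suc n) * suc n
  div-suc-lower x n = ℕ.≤-trans (s≤s (ℕ.≤-reflexive (m≡m%n+[m/n]*n x (suc n)))) (ℕ.+-monoˡ-≤ _ (m%n<n x (suc n)))

  div-galois : ∀ {k} x m → k * suc m ≤ x → k ≤ x div suc m
  div-galois {k} x m p = subst (_≤ x / suc m) (m*n/n≡m k (suc m)) (/-monoˡ-≤ (suc m) p)

  div-galois⁻ : ∀ {k} x m → k ≤ x div suc m → k * suc m ≤ x
  div-galois⁻ x m p = ℕ.≤-trans (ℕ.*-monoˡ-≤ (suc m) p) (m/n*n≤m x (suc m))

  div≤ : ∀ x n → x div n ≤ x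
  div≤ x zero = z≤n
  div≤ x (suc n) = m/n≤m x (suc n)

  div-upper : ∀ x n → # (x div suc n) ≼ # x ⊗ inv (suc n)
  div-upper x n = lin 5 (λ a x b y c → (κ 0 :≤ y :* (x :- a :* b)) ∷ (a :* κ 1 :≡ a :* (b :* y)) ∷ [] ⊢ (a :≤ x :* y)) (1 ∷ 1 ∷ []) refl
    (# (x / suc n) ∷ # x ∷ # (suc n) ∷ inv (suc n) ∷ # 0 ∷ [])
    (⊗-nonneg (inv-nonneg (suc n)) (⊖-nonneg (subst (_≼ # x) (#-* _ (suc n)) (#-mono (m/n*n≤m x (suc n))))) , cong (# (x / suc n) ⊗_) (sym (#⊗inv n)))

  div-lower : ∀ x n → # x ⊗ inv (suc n) ≼ # (x div suc n) ⊕ # 1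
  div-lower x n = lin 4 (λ a x b y → (κ 0 :≤ y :* ((κ 1 :+ a) :* b :- x)) ∷ ((κ 1 :+ a) :* (b :* y) :≡ (κ 1 :+ a) :* κ 1) ∷ [] ⊢ (x :* y :≤ a :+ κ 1)) (1 ∷ 1 ∷ []) refl
    (# (x / suc n) ∷ # x ∷ # (suc n) ∷ inv (suc n) ∷ [])
    (⊗-nonneg (inv-nonneg (suc n)) (⊖-nonneg (subst (# x ≼_) (trans (#-* (suc (x / suc n)) (suc n)) (cong (_⊗ # (suc n)) (#-+ 1 _))) (#-mono (ℕ.<⇒≤ (div-suc-lower x n))))) , cong ((# 1 ⊕ # (x / suc n)) ⊗_) (#⊗inv n))

  -- Since (a - u)(b + v) + (a + u)(b - v) = 2 (ab - uv). There is no absolute value in use, hence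
  -- the four one-sided hypotheses.
  product-bound : ∀ {u v a b} → # 0 ⊖ a ≼ u → u ≼ a → # 0 ⊖ b ≼ v → v ≼ b → u ⊗ v ≼ a ⊗ b
  product-bound {u} {v} {a} {b} p q r s = lin/ 1 4 (λ u v a b → (κ 0 :≤ (a :- u) :* (v :- (κ 0 :- b))) ∷ (κ 0 :≤ (u :- (κ 0 :- a)) :* (b :- v)) ∷ [] ⊢ (u :* v :≤ a :* b))
    (1 ∷ 1 ∷ []) refl (u ∷ v ∷ a ∷ b ∷ []) (⊗-nonneg (⊖-nonneg q) (⊖-nonneg r) , ⊗-nonneg (⊖-nonneg p) (⊖-nonneg s))

  neg-bounds : ∀ {u a} → # 0 ⊖ a ≼ u → u ≼ a → # 0 ⊖ a ≼ # 0 ⊖ u × # 0 ⊖ u ≼ a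
  neg-bounds {u} {a} p q = lin 2 (λ u a → (u :≤ a) ∷ [] ⊢ (κ 0 :- a :≤ κ 0 :- u)) (1 ∷ []) refl (u ∷ a ∷ []) q ,
    lin 2 (λ u a → (κ 0 :- a :≤ u) ∷ [] ⊢ (κ 0 :- u :≤ a)) (1 ∷ []) refl (u ∷ a ∷ []) p

  product-bound′ : ∀ {u v a b} → # 0 ⊖ a ≼ u → u ≼ a → # 0 ⊖ b ≼ v → v ≼ b → # 0 ⊖ a ⊗ b ≼ u ⊗ v
  product-bound′ {u} {v} {a} {b} p q r s = lin 4 (λ u v a b → ((κ 0 :- u) :* v :≤ a :* b) ∷ [] ⊢ (κ 0 :- a :* b :≤ u :* v)) (1 ∷ []) refl
    (u ∷ v ∷ a ∷ b ∷ []) (product-bound (proj₁ (neg-bounds p q)) (proj₂ (neg-bounds p q)) r s)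

  H-le : ∀ n → H n ≼ # n
  H-le n = subst (H n ≼_) (trans (∑₀-const n (# 1)) (⊗-idʳ _)) (∑₀-mono n (λ i _ → subst (inv (suc i) ≼_) inv-1 (inv-antitone (s≤s z≤n))))

  inv≤1 : ∀ k → inv (suc k) ≼ # 1
  inv≤1 k = subst (inv (suc k) ≼_) inv-1 (inv-antitone (s≤s z≤n))

  inv-diff : ∀ k → inv (suc k) ⊗ inv (suc (suc k)) ≡ inv (suc k) ⊖ inv (suc (suc k))
  inv-diff k = sym (⊖-unique (begin
    x ⊗ y ⊕ y                ≡⟨ cong (x ⊗ y ⊕_) (trans (sym (⊗-idʳ y)) (cong (y ⊗_) (sym (#⊗inv k)))) ⟩
    x ⊗ y ⊕ y ⊗ (n ⊗ x)      ≡⟨ ring 3 (λ x y n → x :* y :+ y :* (n :* x) := x :* ((κ 1 :+ n) :* y)) refl (x ∷ y ∷ n ∷ []) ⟩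
    x ⊗ ((# 1 ⊕ n) ⊗ y)      ≡⟨ cong (x ⊗_) (trans (cong (_⊗ y) (sym (#-+ 1 (suc k)))) (#⊗inv (suc k))) ⟩
    x ⊗ # 1                  ≡⟨ ⊗-idʳ x ⟩
    x                        ∎))
    where
    open ≡-Reasoning
    n = # (suc k)
    x = inv (suc k)
    y = inv (suc (suc k))

  inv-suc≤ : ∀ k → inv (suc (suc k)) ≼ inv (suc k)
  inv-suc≤ k = inv-antitone (ℕ.n≤1+n (suc k))

  inv≤2inv-suc : ∀ k → inv (suc k) ≼ # 2 ⊗ inv (suc (suc k))
  inv≤2inv-suc k = lin 2 (λ x y → (x :- y :≡ x :* y) ∷ (κ 0 :≤ y :* (κ 1 :- x)) ∷ [] ⊢ (x :≤ κ 2 :* y)) (1 ∷ 1 ∷ []) refl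
    (inv (suc k) ∷ inv (suc (suc k)) ∷ []) (sym (inv-diff k) , ⊗-nonneg (inv-nonneg _) (⊖-nonneg (inv≤1 k)))

  inv²≤ : ∀ k → inv (suc k) ⊗ inv (suc k) ≼ # 2 ⊗ (inv (suc k) ⊖ inv (suc (suc k)))
  inv²≤ k = lin 2 (λ x y → (x :* y :≡ x :- y) ∷ (κ 0 :≤ x :* (κ 2 :* y :- x)) ∷ [] ⊢ (x :* x :≤ κ 2 :* (x :- y))) (2 ∷ 1 ∷ []) refl
    (inv (suc k) ∷ inv (suc (suc k)) ∷ []) (inv-diff k , ⊗-nonneg (inv-nonneg _) (⊖-nonneg (inv≤2inv-suc k)))

  ∑-truncate : ∀ {n N} (f : ℕ → R) → n ≤ N → ∑ n f ≡ ∑ N (λ m → 𝟙 (m ≤? n) ⊗ f m)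
  ∑-truncate {n} {N} f n≤N = trans (∑₀-cong n (λ i q → sym (trans (cong (_⊗ f (suc i)) (𝟙-yes (suc i ≤? n) q)) (⊗-idˡ _))))
    (sym (∑₀-extend _ n≤N (λ i q _ → trans (cong (_⊗ f (suc i)) (𝟙-no (suc i ≤? n) (ℕ.≤⇒≯ q))) (⊗-zeroˡ _))))

  module Logarithm {X} (L : LogApprox X) where
    open LogApprox L
    open VonMangoldt L

    -- Its values approach Euler's constant, for which `C X` will stand.
    C : ℕ → R
    C n = H n ⊖ ℓ n

    -- The increments of `C` are O(1/n²), and 1/n² ≤ 2 (1/n - 1/(n + 1)) telescopes; so `C` becomes
    -- monotone in either direction after a correction by 6/n. The 6 leaves slack.
    C-step : ∀ k → suc k < X → (C (suc (suc k)) ⊕ # 6 ⊗ inv (suc (suc k)) ≼ C (suc k) ⊕ # 6 ⊗ inv (suc k)) ×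
                               (C (suc k) ⊖ # 6 ⊗ inv (suc k) ≼ C (suc (suc k)) ⊖ # 6 ⊗ inv (suc (suc k)))
    C-step k p =
      lin 5 (λ h l l′ x y → (x :- κ 2 :* (x :* x) :≤ l′ :- l) ∷ (x :* x :≤ κ 2 :* (x :- y)) ∷ (y :≤ x) ∷ [] ⊢ (((h :+ y) :- l′) :+ κ 6 :* y :≤ (h :- l) :+ κ 6 :* x)) (1 ∷ 2 ∷ 3 ∷ []) refl ρ (ℓ-lo k p , inv²≤ k , inv-suc≤ k) ,
      lin 5 (λ h l l′ x y → (l′ :- l :≤ x :+ x :* x) ∷ (x :* x :≤ κ 2 :* (x :- y)) ∷ (y :≤ x) ∷ [] ⊢ ((h :- l) :- κ 6 :* x :≤ ((h :+ y) :- l′) :- κ 6 :* y)) (1 ∷ 1 ∷ 3 ∷ []) refl ρ (ℓ-hi k p , inv²≤ k , inv-suc≤ k)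
      where ρ = H (suc k) ∷ ℓ (suc k) ∷ ℓ (suc (suc k)) ∷ inv (suc k) ∷ inv (suc (suc k)) ∷ []

    private
      Drift : ℕ → ℕ → Set
      Drift k n = (C n ⊕ # 6 ⊗ inv n ≼ C (suc k) ⊕ # 6 ⊗ inv (suc k)) × (C (suc k) ⊖ # 6 ⊗ inv (suc k) ≼ C n ⊖ # 6 ⊗ inv n)

    C-drift : ∀ k o → suc k + o ≤ X → Drift k (suc k + o)
    C-drift k zero p = subst (Drift k) (sym (ℕ.+-identityʳ (suc k))) (≼-refl , ≼-refl)
    C-drift k (suc o) p = subst (Drift k) (sym (ℕ.+-suc (suc k) o)) (≼-trans (proj₁ step) (proj₁ ih) , ≼-trans (proj₂ ih) (proj₂ step))
      where
      q : suc (suc k + o) ≤ X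
      q = subst (_≤ X) (ℕ.+-suc (suc k) o) p
      ih = C-drift k o (ℕ.<⇒≤ q)
      step = C-step (k + o) q

    C-near : ∀ {k n} → suc k ≤ n → n ≤ X → C n ≼ C (suc k) ⊕ # 6 ⊗ inv (suc k) × C (suc k) ≼ C n ⊕ # 6 ⊗ inv (suc k)
    C-near {k} p q with ℕ.m≤n⇒∃[o]m+o≡n p
    ... | o , refl with C-drift k o q
    ... | a , b = lin 4 (λ c d x y → (c :+ κ 6 :* y :≤ d :+ κ 6 :* x) ∷ (κ 0 :≤ y) ∷ [] ⊢ (c :≤ d :+ κ 6 :* x)) (1 ∷ 6 ∷ []) refl ρ (a , inv-nonneg _) ,
                  lin 4 (λ c d x y → (d :- κ 6 :* x :≤ c :- κ 6 :* y) ∷ (κ 0 :≤ y) ∷ [] ⊢ (d :≤ c :+ κ 6 :* x)) (1 ∷ 6 ∷ []) refl ρ (b , inv-nonneg _)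
      where ρ = C (suc k + o) ∷ C (suc k) ∷ inv (suc k) ∷ inv (suc k + o) ∷ []

    private
      C-1 : C 1 ≡ # 1
      C-1 = trans (cong₂ _⊖_ (trans (⊕-idˡ _) inv-1) ℓ-1) (⊖-unique (⊕-idʳ _))

    ℓ≤H : ∀ {n} → suc n ≤ X → ℓ (suc n) ≼ H (suc n) ⊕ # 5
    ℓ≤H {n} p = lin 4 (λ h l c i → (c :≤ (h :- l) :+ κ 6 :* i) ∷ (κ 1 :≡ c) ∷ (i :≡ κ 1) ∷ [] ⊢ (l :≤ h :+ κ 5)) (1 ∷ 1 ∷ 6 ∷ []) refl
      (H (suc n) ∷ ℓ (suc n) ∷ C 1 ∷ inv 1 ∷ []) (proj₂ (C-near {0} (s≤s z≤n) p) , sym C-1 , inv-1)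

    H≤ℓ : ∀ {n} → suc n ≤ X → H (suc n) ≼ ℓ (suc n) ⊕ # 7
    H≤ℓ {n} p = lin 4 (λ h l c i → (h :- l :≤ c :+ κ 6 :* i) ∷ (c :≡ κ 1) ∷ (i :≡ κ 1) ∷ [] ⊢ (h :≤ l :+ κ 7)) (1 ∷ 1 ∷ 6 ∷ []) refl
      (H (suc n) ∷ ℓ (suc n) ∷ C 1 ∷ inv 1 ∷ []) (proj₁ (C-near {0} (s≤s z≤n) p) , C-1 , inv-1)

    -- The lower bound on increments is negative at first, so it does not give monotonicity. Passing
    -- through the harmonic sum does, at a cost of 5 + 7.
    ℓ-mono : ∀ {a b} → suc a ≤ b → b ≤ X → ℓ (suc a) ≼ ℓ b ⊕ # 12
    ℓ-mono {a} {suc b} p q = lin 4 (λ l h h′ l′ → (l :≤ h :+ κ 5) ∷ (h :≤ h′) ∷ (h′ :≤ l′ :+ κ 7) ∷ [] ⊢ (l :≤ l′ :+ κ 12)) (1 ∷ 1 ∷ 1 ∷ []) refl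
      (ℓ (suc a) ∷ H (suc a) ∷ H (suc b) ∷ ℓ (suc b) ∷ []) (ℓ≤H (ℕ.≤-trans p q) , H-mono p , H≤ℓ q)

    ℓ≤ : ∀ {n} → suc n ≤ X → ℓ (suc n) ≼ # (suc n) ⊕ # 5
    ℓ≤ p = ≼-trans (ℓ≤H p) (⊕-mono (H-le _) ≼-refl)

    -- From H(b) − H(a) ≤ (b − a)/(a + 1).
    ℓ-diff : ∀ a c → suc a + c ≤ X → # (suc a) ⊗ (ℓ (suc a + c) ⊖ ℓ (suc a)) ≼ # c ⊕ # 6
    ℓ-diff a c p = lin 8 (λ n c i j h h′ l l′ → (κ 0 :≤ n :* (c :* j :- (h′ :- h))) ∷ (κ 0 :≤ n :* (((h′ :- l′) :+ κ 6 :* i) :- (h :- l))) ∷ (n :* i :≡ κ 1) ∷ (κ 0 :≤ c :* (n :* (i :- j))) ∷ (c :* (n :* i) :≡ c :* κ 1) ∷ [] ⊢ (n :* (l′ :- l) :≤ c :+ κ 6))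
      (1 ∷ 1 ∷ 6 ∷ 1 ∷ 1 ∷ []) refl (# (suc a) ∷ # c ∷ inv (suc a) ∷ inv (suc (suc a)) ∷ H (suc a) ∷ H (suc a + c) ∷ ℓ (suc a) ∷ ℓ (suc a + c) ∷ [])
      (⊗-nonneg (#-nonneg _) (⊖-nonneg (H-upper (suc a) c)) , ⊗-nonneg (#-nonneg _) (⊖-nonneg (proj₂ (C-near (ℕ.m≤m+n (suc a) c) p))) , #⊗inv a ,
       ⊗-nonneg (#-nonneg c) (⊗-nonneg (#-nonneg (suc a)) (⊖-nonneg (inv-suc≤ a))) , cong (# c ⊗_) (#⊗inv a))

    T : ℕ → R
    T n = ∑ n ℓ

    private
      δ-hi : ∀ k → suc k < X → # (suc k) ⊗ (ℓ (suc (suc k)) ⊖ ℓ (suc k)) ≼ # 1 ⊕ inv (suc k)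
      δ-hi k p = lin 3 (λ n x d → (κ 0 :≤ n :* ((x :+ x :* x) :- d)) ∷ (n :* x :≡ κ 1) ∷ (x :* (n :* x) :≡ x :* κ 1) ∷ [] ⊢ (n :* d :≤ κ 1 :+ x)) (1 ∷ 1 ∷ 1 ∷ []) refl
        (# (suc k) ∷ inv (suc k) ∷ ℓ (suc (suc k)) ⊖ ℓ (suc k) ∷ []) (⊗-nonneg (#-nonneg _) (⊖-nonneg (ℓ-hi k p)) , #⊗inv k , cong (inv (suc k) ⊗_) (#⊗inv k))

      δ-lo : ∀ k → suc k < X → # 1 ⊖ # 2 ⊗ inv (suc k) ≼ # (suc k) ⊗ (ℓ (suc (suc k)) ⊖ ℓ (suc k))
      δ-lo k p = lin 3 (λ n x d → (κ 0 :≤ n :* (d :- (x :- κ 2 :* (x :* x)))) ∷ (κ 1 :≡ n :* x) ∷ (x :* (n :* x) :≡ x :* κ 1) ∷ [] ⊢ (κ 1 :- κ 2 :* x :≤ n :* d)) (1 ∷ 1 ∷ 2 ∷ []) refl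
        (# (suc k) ∷ inv (suc k) ∷ ℓ (suc (suc k)) ⊖ ℓ (suc k) ∷ []) (⊗-nonneg (#-nonneg _) (⊖-nonneg (ℓ-lo k p)) , sym (#⊗inv k) , cong (inv (suc k) ⊗_) (#⊗inv k))

    -- From n to n + 1 the quantity n ℓ(n) - n changes by ℓ(n + 1) + n (ℓ(n + 1) - ℓ(n)) - 1, that
    -- is by ℓ(n + 1) up to O(1/n). The errors add up to the harmonic sum.
    T-bounds : ∀ n → suc n ≤ X → (# (suc n) ⊗ ℓ (suc n) ⊖ # (suc n) ⊖ (# 1 ⊕ # 4 ⊗ H (suc n)) ≼ T (suc n)) ×
                                 (T (suc n) ≼ # (suc n) ⊗ ℓ (suc n) ⊖ # (suc n) ⊕ (# 1 ⊕ # 4 ⊗ H (suc n)))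
    T-bounds zero p = lin 2 (λ l i → (κ 0 :≤ i) ∷ [] ⊢ (κ 1 :* l :- κ 1 :- (κ 1 :+ κ 4 :* (κ 0 :+ i)) :≤ κ 0 :+ l)) (4 ∷ []) refl (ℓ 1 ∷ inv 1 ∷ []) (inv-nonneg 1) ,
                      lin 2 (λ l i → (κ 0 :≤ i) ∷ [] ⊢ (κ 0 :+ l :≤ κ 1 :* l :- κ 1 :+ (κ 1 :+ κ 4 :* (κ 0 :+ i)))) (4 ∷ []) refl (ℓ 1 ∷ inv 1 ∷ []) (inv-nonneg 1)
    T-bounds (suc k) p with T-bounds k (ℕ.<⇒≤ p)
    ... | lo , hi = subst (λ m → m ⊗ ℓ (suc (suc k)) ⊖ m ⊖ (# 1 ⊕ # 4 ⊗ H (suc (suc k))) ≼ T (suc (suc k))) (sym (#-+ 1 (suc k)))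
        (lin 7 (λ n l l′ t h x y → (n :* l :- n :- (κ 1 :+ κ 4 :* h) :≤ t) ∷ (n :* (l′ :- l) :≤ κ 1 :+ x) ∷ (x :≤ κ 2 :* y) ∷ (κ 0 :≤ y) ∷ []
            ⊢ ((κ 1 :+ n) :* l′ :- (κ 1 :+ n) :- (κ 1 :+ κ 4 :* (h :+ y)) :≤ t :+ l′)) (1 ∷ 1 ∷ 1 ∷ 2 ∷ []) refl ρ (lo , δ-hi k p , inv≤2inv-suc k , inv-nonneg _)) ,
      subst (λ m → T (suc (suc k)) ≼ m ⊗ ℓ (suc (suc k)) ⊖ m ⊕ (# 1 ⊕ # 4 ⊗ H (suc (suc k)))) (sym (#-+ 1 (suc k)))
        (lin 7 (λ n l l′ t h x y → (t :≤ n :* l :- n :+ (κ 1 :+ κ 4 :* h)) ∷ (κ 1 :- κ 2 :* x :≤ n :* (l′ :- l)) ∷ (x :≤ κ 2 :* y) ∷ []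
            ⊢ (t :+ l′ :≤ (κ 1 :+ n) :* l′ :- (κ 1 :+ n) :+ (κ 1 :+ κ 4 :* (h :+ y)))) (1 ∷ 1 ∷ 2 ∷ []) refl ρ (hi , δ-lo k p , inv≤2inv-suc k))
      where ρ = # (suc k) ∷ ℓ (suc k) ∷ ℓ (suc (suc k)) ∷ T (suc k) ∷ H (suc k) ∷ inv (suc k) ∷ inv (suc (suc k)) ∷ []

    -- First and second moments of log(n/d) over d ≤ n. Both are O(n), which pays for the error
    -- terms in Selberg's formula.
    V W : ℕ → R
    V n = ∑ n (λ d → ℓ n ⊖ ℓ d)
    W n = ∑ n (λ d → (ℓ n ⊖ ℓ d) ⊗ (ℓ n ⊖ ℓ d))

    V≡ : ∀ n → V n ≡ # n ⊗ ℓ n ⊖ T n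
    V≡ n = trans (∑₀-⊖ n _ _) (cong (_⊖ T n) (∑₀-const n (ℓ n)))

    V-bounds : ∀ n → suc n ≤ X → # 0 ⊖ # 6 ⊗ # (suc n) ≼ V (suc n) × V (suc n) ≼ # 6 ⊗ # (suc n)
    V-bounds n p =
      lin 5 (λ n l t h v → (n :* l :- t :≡ v) ∷ (t :≤ n :* l :- n :+ (κ 1 :+ κ 4 :* h)) ∷ (h :≤ n) ∷ (κ 1 :≤ n) ∷ [] ⊢ (κ 0 :- κ 6 :* n :≤ v)) (1 ∷ 1 ∷ 4 ∷ 3 ∷ []) refl ρ
        (sym (V≡ (suc n)) , proj₂ (T-bounds n p) , H-le (suc n) , 1≼# n) ,
      lin 5 (λ n l t h v → (v :≡ n :* l :- t) ∷ (n :* l :- n :- (κ 1 :+ κ 4 :* h) :≤ t) ∷ (h :≤ n) ∷ (κ 1 :≤ n) ∷ [] ⊢ (v :≤ κ 6 :* n)) (1 ∷ 1 ∷ 4 ∷ 1 ∷ []) refl ρ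
        (V≡ (suc n) , proj₁ (T-bounds n p) , H-le (suc n) , 1≼# n)
      where ρ = # (suc n) ∷ ℓ (suc n) ∷ T (suc n) ∷ H (suc n) ∷ V (suc n) ∷ []

    W-suc : ∀ k → W (suc (suc k)) ≡ W (suc k) ⊕ # 2 ⊗ ((ℓ (suc (suc k)) ⊖ ℓ (suc k)) ⊗ V (suc k)) ⊕ # (suc k) ⊗ ((ℓ (suc (suc k)) ⊖ ℓ (suc k)) ⊗ (ℓ (suc (suc k)) ⊖ ℓ (suc k)))
    W-suc k = begin
      ∑ n (λ d → (l′ ⊖ ℓ d) ⊗ (l′ ⊖ ℓ d)) ⊕ (l′ ⊖ l′) ⊗ (l′ ⊖ l′)
        ≡⟨ cong₂ _⊕_ (∑₀-cong n (λ i _ → ring 3 (λ l′ l x → (l′ :- x) :* (l′ :- x) := ((l :- x) :* (l :- x) :+ κ 2 :* (l′ :- l) :* (l :- x)) :+ (l′ :- l) :* (l′ :- l)) refl (l′ ∷ l ∷ ℓ (suc i) ∷ [])))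
            (ring 1 (λ l → (l :- l) :* (l :- l) := κ 0) refl (l′ ∷ [])) ⟩
      ∑ n (λ d → ((l ⊖ ℓ d) ⊗ (l ⊖ ℓ d) ⊕ # 2 ⊗ δ ⊗ (l ⊖ ℓ d)) ⊕ δ ⊗ δ) ⊕ # 0
        ≡⟨ trans (⊕-idʳ _) (trans (∑₀-⊕ n _ _) (cong₂ _⊕_ (trans (∑₀-⊕ n _ _) (cong (W n ⊕_) (trans (∑₀-⊗ n (# 2 ⊗ δ) _) (⊗-assoc _ _ _)))) (∑₀-const n (δ ⊗ δ)))) ⟩
      W n ⊕ # 2 ⊗ (δ ⊗ V n) ⊕ # n ⊗ (δ ⊗ δ) ∎
      where
      open ≡-Reasoning
      n = suc k
      l = ℓ n
      l′ = ℓ (suc n)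
      δ = l′ ⊖ l

    -- One step adds at most 2 · 2 · 6 + 4 = 28: the increment δ of `ℓ` satisfies |δ| ≤ 2/n and n δ²
    -- ≤ 4, and |V(n)| ≤ 6n.
    W-bound : ∀ n → suc n ≤ X → W (suc n) ≼ # 28 ⊗ # (suc n)
    W-bound zero p = ≼-trans (≡⇒≼ (ring 1 (λ l → κ 0 :+ (l :- l) :* (l :- l) := κ 0) refl (ℓ 1 ∷ []))) (⊗-nonneg (#-nonneg 28) (#-nonneg 1))
    W-bound (suc k) p = subst₂ _≼_ (sym (W-suc k)) (cong (# 28 ⊗_) (sym (#-+ 1 (suc k))))
      (lin 6 (λ w n x d v dv → (w :≤ κ 28 :* n) ∷ (dv :≤ (κ 2 :* x) :* (κ 6 :* n)) ∷ (n :* x :≡ κ 1) ∷ (κ 0 :≤ (n :* d :- (κ 0 :- κ 2)) :* (κ 2 :* x :- d)) ∷ (d :* (n :* x) :≡ d :* κ 1) ∷ (x :≤ κ 1) ∷ []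
          ⊢ (w :+ κ 2 :* dv :+ n :* (d :* d) :≤ κ 28 :* (κ 1 :+ n))) (1 ∷ 2 ∷ 24 ∷ 1 ∷ 2 ∷ 4 ∷ []) refl
        (W n ∷ # n ∷ x ∷ δ ∷ V n ∷ δ ⊗ V n ∷ [])
        (W-bound k (ℕ.<⇒≤ p) , product-bound δ≥ δ≤ (proj₁ vb) (proj₂ vb) , #⊗inv k , ⊗-nonneg (⊖-nonneg nδ≥) (⊖-nonneg δ≤) , cong (δ ⊗_) (#⊗inv k) , inv≤1 k))
      where
      n = suc k
      x = inv n
      δ = ℓ (suc n) ⊖ ℓ n
      vb = V-bounds k (ℕ.<⇒≤ p)
      δ≤ : δ ≼ # 2 ⊗ x
      δ≤ = lin 2 (λ x d → (d :≤ x :+ x :* x) ∷ (κ 0 :≤ x :* (κ 1 :- x)) ∷ [] ⊢ (d :≤ κ 2 :* x)) (1 ∷ 1 ∷ []) refl (x ∷ δ ∷ []) (ℓ-hi k p , ⊗-nonneg (inv-nonneg n) (⊖-nonneg (inv≤1 k)))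
      δ≥ : # 0 ⊖ # 2 ⊗ x ≼ δ
      δ≥ = lin 2 (λ x d → (x :- κ 2 :* (x :* x) :≤ d) ∷ (κ 0 :≤ x :* (κ 1 :- x)) ∷ (κ 0 :≤ x) ∷ [] ⊢ (κ 0 :- κ 2 :* x :≤ d)) (1 ∷ 2 ∷ 1 ∷ []) refl (x ∷ δ ∷ []) (ℓ-lo k p , ⊗-nonneg (inv-nonneg n) (⊖-nonneg (inv≤1 k)) , inv-nonneg n)
      nδ≥ : # 0 ⊖ # 2 ≼ # n ⊗ δ
      nδ≥ = lin 2 (λ x d → (κ 1 :- κ 2 :* x :≤ d) ∷ (x :≤ κ 1) ∷ [] ⊢ (κ 0 :- κ 2 :≤ d)) (1 ∷ 2 ∷ []) refl (x ∷ # n ⊗ δ ∷ []) (δ-lo k p , inv≤1 k)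

-- Chebyshev's and Mertens' estimates and Selberg's formula.

module SelbergFormula where
  open Rationals
  open LinearArithmetic
  open Sums
  open Logarithms
  open Multiplicative
  open Stirling
  open import Data.Nat using (ℕ; zero; suc; _+_; _*_; _≤_; _<_; z≤n; s≤s; _≟_; _≤?_)
  import Data.Nat.Properties as ℕ
  open import Data.Nat.DivMod using (_/_; m≡m%n+[m/n]*n; m%n<n; m/n≤m; m/n*n≤m; m/n/o≡m/[n*o]; m<n⇒m/n≡0; m≥n⇒m/n>0)
  open import Data.Nat.Divisibility using (_∣?_)
  open import Data.Nat.Induction using (<-rec)
  open import Data.Vec using ([]; _∷_)
  open import Data.List using ([]; _∷_)
  open import Data.Product using (_×_; _,_; proj₁; proj₂; ∃)
  open import Data.Empty using (⊥-elim)
  open import Relation.Nullary using (yes; no)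
  open import Relation.Binary.PropositionalEquality

  half-cases : ∀ x → ∃ λ e → e ≤ 1 × x ≡ e + (x / 2) * 2
  half-cases x = _ , ℕ.≤-pred (m%n<n x 2) , m≡m%n+[m/n]*n x 2

  module Selberg {X} (L : LogApprox X) where
    open LogApprox L
    open VonMangoldt L
    open Logarithm L

    ψ M : ℕ → R
    ψ n = ∑ n Λ
    M n = ∑ n (λ d → Λ d ⊗ inv d)

    ψ-mono : ∀ {m n} → m ≤ n → ψ m ≼ ψ n
    ψ-mono p = ∑₀-grow _ p (λ i _ _ → Λ-nonneg i)

    ψ-nonneg : ∀ n → # 0 ≼ ψ n
    ψ-nonneg n = ψ-mono {0} {n} z≤n

    T≡∑Λ : ∀ x → T x ≡ ∑ x (λ d → Λ d ⊗ # (x div d))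
    T≡∑Λ x = begin
      ∑ x ℓ                                          ≡⟨ ∑₀-cong x (λ i q → sym (∑Λ i x q)) ⟩
      ∑ x (λ n → ∑ x (λ d → 𝟙 (d ∣? n) ⊗ Λ d))       ≡⟨ ∑₀-swap x x _ ⟩
      ∑ x (λ d → ∑ x (λ n → 𝟙 (d ∣? n) ⊗ Λ d))       ≡⟨ ∑₀-cong x (λ i _ → trans (∑₀-cong x (λ j _ → ⊗-comm _ (Λ (suc i)))) (trans (∑₀-⊗ x (Λ (suc i)) _) (cong (Λ (suc i) ⊗_) (∑-count-multiples i x)))) ⟩
      ∑ x (λ d → Λ d ⊗ # (x div d))                  ∎
      where open ≡-Reasoning

    -- The condition mk ≤ x is symmetric: reading it as m ≤ x/k or as k ≤ x/m gives the two sums.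
    ∑ψ≡T : ∀ x → ∑ x (λ k → ψ (x div k)) ≡ T x
    ∑ψ≡T x = begin
      ∑ x (λ k → ψ (x div k))                                 ≡⟨ ∑₀-cong x (λ i _ → ∑-truncate Λ (div≤ x (suc i))) ⟩
      ∑ x (λ k → ∑ x (λ m → 𝟙 (m ≤? x div k) ⊗ Λ m))          ≡⟨ ∑₀-swap x x _ ⟩
      ∑ x (λ m → ∑ x (λ k → 𝟙 (m ≤? x div k) ⊗ Λ m))          ≡⟨ ∑₀-cong x (λ i _ → trans (∑₀-cong x (λ j _ → trans (⊗-comm _ (Λ (suc i))) (cong (Λ (suc i) ⊗_) (trans (flip i j) (sym (⊗-idʳ _)))))) (trans (∑₀-⊗ x (Λ (suc i)) _) (cong (Λ (suc i) ⊗_) (count i)))) ⟩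
      ∑ x (λ d → Λ d ⊗ # (x div d))                           ≡⟨ T≡∑Λ x ⟨
      T x                                                     ∎
      where
      open ≡-Reasoning
      flip : ∀ i j → 𝟙 (suc i ≤? x div suc j) ≡ 𝟙 (suc j ≤? x div suc i)
      flip i j = 𝟙-cong (suc i ≤? x div suc j) (suc j ≤? x div suc i)
        (λ p → div-galois x i (subst (_≤ x) (ℕ.*-comm (suc i) (suc j)) (div-galois⁻ x j p)))
        (λ p → div-galois x j (subst (_≤ x) (ℕ.*-comm (suc j) (suc i)) (div-galois⁻ x i p)))
      count : ∀ i → ∑ x (λ k → 𝟙 (k ≤? x div suc i) ⊗ # 1) ≡ # (x div suc i)
      count i = trans (sym (∑-truncate (λ _ → # 1) (div≤ x (suc i)))) (trans (∑₀-const (x div suc i) (# 1)) (⊗-idʳ _))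

    -- Chebyshev's argument: T(x) − 2 T(x/2) dominates the sum of Λ over (x/2, x].
    ψ-dyadic : ∀ x h → x / 2 ≡ h → ψ x ⊖ ψ h ≼ T x ⊖ # 2 ⊗ T h
    ψ-dyadic x h refl = subst₂ _≼_ e₁ e₂ (∑₀-mono x (λ i q → term i q))
      where
      h≤x : h ≤ x
      h≤x = m/n≤m x 2
      e₁ : ∑ x (λ d → Λ d ⊖ 𝟙 (d ≤? h) ⊗ Λ d) ≡ ψ x ⊖ ψ h
      e₁ = trans (∑₀-⊖ x _ _) (cong (ψ x ⊖_) (sym (∑-truncate Λ h≤x)))
      Th : ∑ x (λ d → Λ d ⊗ # (h div d)) ≡ T h
      Th = trans (∑₀-extend _ h≤x (λ i q _ → trans (cong (λ t → Λ (suc i) ⊗ # t) (m<n⇒m/n≡0 (s≤s q))) (⊗-zeroʳ _))) (sym (T≡∑Λ h))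
      e₂ : ∑ x (λ d → Λ d ⊗ # (x div d) ⊖ # 2 ⊗ (Λ d ⊗ # (h div d))) ≡ T x ⊖ # 2 ⊗ T h
      e₂ = trans (∑₀-⊖ x _ _) (cong₂ _⊖_ (sym (T≡∑Λ x)) (trans (∑₀-⊗ x (# 2) _) (cong (# 2 ⊗_) Th)))
      term : ∀ i → i < x → Λ (suc i) ⊖ 𝟙 (suc i ≤? h) ⊗ Λ (suc i) ≼ Λ (suc i) ⊗ # (x div suc i) ⊖ # 2 ⊗ (Λ (suc i) ⊗ # (h div suc i))
      term i q with suc i ≤? h
      ... | yes p = lin 3 (λ l a b → (κ 0 :≤ l :* (a :- κ 2 :* b)) ∷ [] ⊢ (l :- κ 1 :* l :≤ l :* a :- κ 2 :* (l :* b))) (1 ∷ []) refl (Λ (suc i) ∷ # (x div suc i) ∷ # (h div suc i) ∷ [])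
          (⊗-nonneg (Λ-nonneg i) (⊖-nonneg (subst (_≼ # (x div suc i)) (#-* 2 (h div suc i)) (#-mono (div-galois x i (ℕ.≤-trans le (m/n*n≤m x 2)))))))
        where
        le : 2 * (h div suc i) * suc i ≤ h * 2
        le = ℕ.≤-trans (ℕ.≤-reflexive (trans (ℕ.*-assoc 2 (h div suc i) (suc i)) (ℕ.*-comm 2 ((h div suc i) * suc i)))) (ℕ.*-monoˡ-≤ 2 {(h div suc i) * suc i} {h} (m/n*n≤m h (suc i)))
      ... | no ¬p = lin 3 (λ l a b → (κ 0 :≤ l :* (a :- κ 1)) ∷ (b :≡ κ 0) ∷ [] ⊢ (l :- κ 0 :* l :≤ l :* a :- κ 2 :* b)) (1 ∷ 2 ∷ []) refl (Λ (suc i) ∷ # (x div suc i) ∷ Λ (suc i) ⊗ # (h div suc i) ∷ [])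
          (⊗-nonneg (Λ-nonneg i) (⊖-nonneg (#-mono (m≥n⇒m/n>0 q))) , trans (cong (λ t → Λ (suc i) ⊗ # t) (m<n⇒m/n≡0 (ℕ.≰⇒> ¬p))) (⊗-zeroʳ _))

    -- With x = ε + 2h, ε the parity, the terms x log x of T(x) - 2 T(h) reduce to 2h (log x - log
    -- h), which `ℓ-diff` bounds by O(x), and to ε log x.
    chebyshev-step : ∀ x h → x / 2 ≡ suc h → x ≤ X → ψ x ⊖ ψ (suc h) ≼ # 30 ⊗ # x
    chebyshev-step x h e p with half-cases x
    ... | ε , ε≤1 , x≡ with x / 2 in eq
    chebyshev-step x h refl p | ε , ε≤1 , x≡ | .(suc h) = ≼-trans (ψ-dyadic x (suc h) eq)
      (lin 8 (λ x h ε t t′ l l′ hl →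
          (t :≤ x :* l :- x :+ (κ 1 :+ κ 4 :* x)) ∷ (h :* l′ :- h :- (κ 1 :+ κ 4 :* h) :≤ t′) ∷ (h :* (l :- l′) :≡ hl) ∷ (hl :≤ (ε :+ h) :+ κ 6)
            ∷ (x :* l :≡ (ε :+ h :+ h) :* l) ∷ (ε :* l :≤ x :+ κ 5) ∷ (κ 1 :≤ h) ∷ (κ 0 :≤ ε) ∷ (ε :+ h :+ h :≡ x) ∷ []
          ⊢ (t :- κ 2 :* t′ :≤ κ 30 :* x))
        (1 ∷ 2 ∷ 2 ∷ 2 ∷ 1 ∷ 1 ∷ 40 ∷ 24 ∷ 26 ∷ []) refl
        (# x ∷ # (suc h) ∷ # ε ∷ T x ∷ T (suc h) ∷ ℓ x ∷ ℓ (suc h) ∷ # (suc h) ⊗ (ℓ x ⊖ ℓ (suc h)) ∷ [])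
        (≼-trans (proj₂ (Tx x x≢0 p)) (⊕-mono ≼-refl (⊕-mono ≼-refl (⊗-monoˡ (#-nonneg 4) (H-le x)))) ,
         ≼-trans (⊖-monoʳ′ (H-le (suc h))) (proj₁ (T-bounds h (ℕ.≤-trans h≤x p))) , refl ,
         subst₂ (λ a b → # (suc h) ⊗ (ℓ a ⊖ ℓ (suc h)) ≼ b ⊕ # 6) x≡′ (#-+ ε (suc h)) (ℓ-diff h (ε + suc h) (subst (_≤ X) (sym x≡′) p)) ,
         cong (_⊗ ℓ x) #x , εl , #-mono (s≤s z≤n) , #-nonneg ε , sym #x))
      where
      x≡′ : suc h + (ε + suc h) ≡ x
      x≡′ = trans (ℕ.+-comm (suc h) (ε + suc h)) (trans (ℕ.+-assoc ε (suc h) (suc h)) (trans (cong (ε +_) (trans (cong (suc h +_) (sym (ℕ.+-identityʳ (suc h)))) (ℕ.*-comm 2 (suc h)))) (sym x≡)))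
      #x : # x ≡ # ε ⊕ # (suc h) ⊕ # (suc h)
      #x = trans (cong # (trans (sym x≡′) (ℕ.+-comm (suc h) (ε + suc h)))) (trans (#-+ (ε + suc h) (suc h)) (cong (_⊕ # (suc h)) (#-+ ε (suc h))))
      h≤x : suc h ≤ x
      h≤x = subst (suc h ≤_) x≡′ (ℕ.m≤m+n (suc h) _)
      x≢0 : 1 ≤ x
      x≢0 = ℕ.≤-trans (s≤s z≤n) h≤x
      Tx : ∀ n → 1 ≤ n → n ≤ X → (# n ⊗ ℓ n ⊖ # n ⊖ (# 1 ⊕ # 4 ⊗ H n) ≼ T n) × (T n ≼ # n ⊗ ℓ n ⊖ # n ⊕ (# 1 ⊕ # 4 ⊗ H n))
      Tx (suc n) _ q = T-bounds n q
      ⊖-monoʳ′ : ∀ {a b c} → a ≼ b → c ⊖ (# 1 ⊕ # 4 ⊗ b) ≼ c ⊖ (# 1 ⊕ # 4 ⊗ a)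
      ⊖-monoʳ′ {a} {b} {c} q = lin 3 (λ a b c → (a :≤ b) ∷ [] ⊢ (c :- (κ 1 :+ κ 4 :* b) :≤ c :- (κ 1 :+ κ 4 :* a))) (4 ∷ []) refl (a ∷ b ∷ c ∷ []) q
      εl : # ε ⊗ ℓ x ≼ # x ⊕ # 5
      εl = ≼-trans (⊗-monoʳ (ℓ-nonneg x) (#-mono ε≤1)) (subst (_≼ # x ⊕ # 5) (sym (⊗-idˡ _)) (ℓ≤′ x≢0 p))
        where
        ℓ≤′ : ∀ {n} → 1 ≤ n → n ≤ X → ℓ n ≼ # n ⊕ # 5
        ℓ≤′ {suc n} _ q = ℓ≤ q

    -- Halving repeatedly: 30 x + 60 · x/2 = 60 x.
    chebyshev : ∀ x → x ≤ X → ψ x ≼ # 60 ⊗ # x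
    chebyshev = <-rec (λ x → x ≤ X → ψ x ≼ # 60 ⊗ # x) go
      where
      go : ∀ x → (∀ {y} → y < x → y ≤ X → ψ y ≼ # 60 ⊗ # y) → x ≤ X → ψ x ≼ # 60 ⊗ # x
      go zero rec p = ≡⇒≼ (sym (⊗-zeroʳ _))
      go (suc zero) rec p = ≼-trans (≡⇒≼ (trans (⊕-idˡ _) Λ-1)) (⊗-nonneg (#-nonneg 60) (#-nonneg 1))
      go x@(suc (suc x′)) rec p with x / 2 in e
      ... | zero = ⊥-elim (ℕ.<⇒≢ (m≥n⇒m/n>0 {x} {2} (s≤s (s≤s z≤n))) (sym e))
      ... | suc h = lin 4 (λ a b h x → (a :- b :≤ κ 30 :* x) ∷ (b :≤ κ 60 :* h) ∷ (h :* κ 2 :≤ x) ∷ [] ⊢ (a :≤ κ 60 :* x)) (1 ∷ 1 ∷ 30 ∷ []) refl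
          (ψ x ∷ ψ (suc h) ∷ # (suc h) ∷ # x ∷ [])
          (chebyshev-step x h e p , rec lt (ℕ.≤-trans (ℕ.<⇒≤ lt) p) , subst (_≼ # x) (#-* (suc h) 2) (#-mono le))
        where
        le : suc h * 2 ≤ x
        le = subst (λ t → t * 2 ≤ x) e (m/n*n≤m x 2)
        lt : suc h < x
        lt = ℕ.<-≤-trans (ℕ.m<m*n (suc h) 2 (s≤s (s≤s z≤n))) le

    -- Replacing ⌊x/d⌋ by x/d in `T≡∑Λ` costs between 0 and Λ(d) for each d.
    xM-bounds : ∀ x → (T x ≼ # x ⊗ M x) × (# x ⊗ M x ≼ T x ⊕ ψ x)
    xM-bounds x = subst₂ _≼_ (sym (T≡∑Λ x)) (∑₀-⊗ x (# x) _) (∑₀-mono x (λ i _ → lo i)) ,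
                  subst₂ _≼_ (∑₀-⊗ x (# x) _) (trans (∑₀-⊕ x _ _) (cong (_⊕ ψ x) (sym (T≡∑Λ x)))) (∑₀-mono x (λ i _ → hi i))
      where
      lo : ∀ i → Λ (suc i) ⊗ # (x div suc i) ≼ # x ⊗ (Λ (suc i) ⊗ inv (suc i))
      lo i = subst (Λ (suc i) ⊗ # (x div suc i) ≼_) (ring 3 (λ l x y → l :* (x :* y) := x :* (l :* y)) refl (Λ (suc i) ∷ # x ∷ inv (suc i) ∷ [])) (⊗-monoˡ (Λ-nonneg i) (div-upper x i))
      hi : ∀ i → # x ⊗ (Λ (suc i) ⊗ inv (suc i)) ≼ Λ (suc i) ⊗ # (x div suc i) ⊕ Λ (suc i)
      hi i = subst₂ _≼_ (ring 3 (λ l x y → l :* (x :* y) := x :* (l :* y)) refl (Λ (suc i) ∷ # x ∷ inv (suc i) ∷ []))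
        (ring 2 (λ l d → l :* (d :+ κ 1) := l :* d :+ l) refl (Λ (suc i) ∷ # (x div suc i) ∷ [])) (⊗-monoˡ (Λ-nonneg i) (div-lower x i))

    -- Stirling's bounds for T divided by n + 1. The constants are 6 = 1 + 1 + 4, and 64 = -1 + 1 +
    -- 4 + 60 with the 60 from Chebyshev.
    mertens : ∀ n → suc n ≤ X → (ℓ (suc n) ≼ M (suc n) ⊕ # 6) × (M (suc n) ≼ ℓ (suc n) ⊕ # 64)
    mertens n p =
      ⊗-cancel-suc n (lin 5 (λ x l m t h → (t :≤ x :* m) ∷ (x :* l :- x :- (κ 1 :+ κ 4 :* h) :≤ t) ∷ (h :≤ x) ∷ (κ 1 :≤ x) ∷ [] ⊢ (x :* l :≤ x :* (m :+ κ 6))) (1 ∷ 1 ∷ 4 ∷ 1 ∷ []) refl ρ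
        (proj₁ (xM-bounds (suc n)) , proj₁ (T-bounds n p) , H-le (suc n) , 1≼# n)) ,
      ⊗-cancel-suc n (lin 6 (λ x l m t h s → (x :* m :≤ t :+ s) ∷ (t :≤ x :* l :- x :+ (κ 1 :+ κ 4 :* h)) ∷ (h :≤ x) ∷ (κ 1 :≤ x) ∷ (s :≤ κ 60 :* x) ∷ [] ⊢ (x :* m :≤ x :* (l :+ κ 64))) (1 ∷ 1 ∷ 4 ∷ 1 ∷ 1 ∷ []) refl (# (suc n) ∷ ℓ (suc n) ∷ M (suc n) ∷ T (suc n) ∷ H (suc n) ∷ ψ (suc n) ∷ [])
        (proj₂ (xM-bounds (suc n)) , proj₂ (T-bounds n p) , H-le (suc n) , 1≼# n , chebyshev (suc n) p))
      where ρ = # (suc n) ∷ ℓ (suc n) ∷ M (suc n) ∷ T (suc n) ∷ H (suc n) ∷ []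

    -- The Tatuzawa–Iseki argument, applied to n ↦ ψ(x/n) − x/n + κ with κ = 1 + H(X) − log X.
    module Fixed (x′ : ℕ) (p : suc x′ ≤ X) where
      x = suc x′
      γ = C X
      F : ℕ → R
      F n = ψ (x div n) ⊖ # x ⊗ inv n ⊕ (# 1 ⊕ γ)

      u A : ℕ → R
      u d = ℓ x ⊖ ℓ d
      A d = ∑ x (λ n → 𝟙 (d ∣? n) ⊗ F n)

      A≡ : ∀ d′ → A (suc d′) ≡ T (x / suc d′) ⊖ (# x ⊗ inv (suc d′)) ⊗ H (x / suc d′) ⊕ # (x / suc d′) ⊗ (# 1 ⊕ γ)
      A≡ d′ = trans (∑-multiples d′ x F) (trans (∑₀-cong y (λ k _ → cong₂ (λ a b → ψ a ⊖ # x ⊗ b ⊕ (# 1 ⊕ γ)) (nested k) (inv-* k d′)))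
        (trans (∑₀-⊕ y _ _) (cong₂ _⊕_ (trans (∑₀-⊖ y _ _) (cong₂ _⊖_ (∑ψ≡T y)
          (trans (∑₀-cong y (λ k _ → ring 3 (λ x a b → x :* (a :* b) := (x :* b) :* a) refl (# x ∷ inv (suc k) ∷ inv (suc d′) ∷ []))) (∑₀-⊗ y (# x ⊗ inv (suc d′)) _))))
          (∑₀-const y (# 1 ⊕ γ)))))
        where
        y = x / suc d′
        nested : ∀ k → x div (suc k * suc d′) ≡ y div suc k
        nested k = trans (cong (x div_) (ℕ.*-comm (suc k) (suc d′))) (sym (m/n/o≡m/[n*o] x (suc d′) (suc k)))

      -- With y = ⌊x/d⌋ the main terms of `A≡` are y log y - y - y (log y + γ) + y (1 + γ) = 0; the
      -- constant in `F` is chosen for this cancellation. What remains is of the order 1 + log y,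
      -- and log y ≤ log(x/d) + 12.
      A-bounds : ∀ d′ → suc d′ ≤ x → (# 0 ⊖ (# 102 ⊕ # 5 ⊗ u (suc d′)) ≼ A (suc d′)) × (A (suc d′) ≼ # 102 ⊕ # 5 ⊗ u (suc d′))
      A-bounds d′ q = bounds (x / suc d′) refl (A≡ d′)
        where
        bounds : ∀ y → x / suc d′ ≡ y → A (suc d′) ≡ T y ⊖ (# x ⊗ inv (suc d′)) ⊗ H y ⊕ # y ⊗ (# 1 ⊕ γ) →
          (# 0 ⊖ (# 102 ⊕ # 5 ⊗ u (suc d′)) ≼ A (suc d′)) × (A (suc d′) ≼ # 102 ⊕ # 5 ⊗ u (suc d′))
        bounds zero eq _ = ⊥-elim (ℕ.<⇒≢ (m≥n⇒m/n>0 {x} {suc d′} q) (sym eq))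
        bounds (suc y′) eq A≡y =
          (subst (λ a → # 0 ⊖ (# 102 ⊕ # 5 ⊗ u (suc d′)) ≼ a) (sym A≡y)
            (lin 9 (λ y l t h w g i lx ld →
              (y :* l :- y :- (κ 1 :+ κ 4 :* h) :≤ t) ∷ (κ 0 :≤ h :* ((y :+ κ 1) :- w)) ∷ (y :* (h :- l) :≤ y :* (g :+ κ 6 :* i)) ∷ (y :* i :≡ κ 1) ∷ (h :≤ l :+ κ 7) ∷ (l :+ ld :≤ lx :+ κ 12) ∷ []
              ⊢ (κ 0 :- (κ 102 :+ κ 5 :* (lx :- ld)) :≤ t :- w :* h :+ y :* (κ 1 :+ g))) (1 ∷ 1 ∷ 1 ∷ 6 ∷ 5 ∷ 5 ∷ []) refl ρ
              (proj₁ (T-bounds y′ y≤X) , ⊗-nonneg (H-nonneg (suc y′)) (⊖-nonneg w≤) , ⊗-monoˡ (#-nonneg _) (proj₂ cn) , #⊗inv y′ , H≤ℓ y≤X , ℓyd))) ,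
          subst (_≼ # 102 ⊕ # 5 ⊗ u (suc d′)) (sym A≡y)
            (lin 9 (λ y l t h w g i lx ld →
              (t :≤ y :* l :- y :+ (κ 1 :+ κ 4 :* h)) ∷ (κ 0 :≤ h :* (w :- y)) ∷ (y :* g :≤ y :* ((h :- l) :+ κ 6 :* i)) ∷ (y :* i :≡ κ 1) ∷ (h :≤ l :+ κ 7) ∷ (l :+ ld :≤ lx :+ κ 12) ∷ (κ 0 :≤ h) ∷ []
              ⊢ (t :- w :* h :+ y :* (κ 1 :+ g) :≤ κ 102 :+ κ 5 :* (lx :- ld))) (1 ∷ 1 ∷ 1 ∷ 6 ∷ 5 ∷ 5 ∷ 1 ∷ []) refl ρ
              (proj₂ (T-bounds y′ y≤X) , ⊗-nonneg (H-nonneg (suc y′)) (⊖-nonneg w≥) , ⊗-monoˡ (#-nonneg _) (proj₁ cn) , #⊗inv y′ , H≤ℓ y≤X , ℓyd , H-nonneg (suc y′)))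
          where
          y≤X : suc y′ ≤ X
          y≤X = ℕ.≤-trans (subst (_≤ x) eq (m/n≤m x (suc d′))) p
          w≤ : # x ⊗ inv (suc d′) ≼ # (suc y′) ⊕ # 1
          w≤ = subst (λ t → # x ⊗ inv (suc d′) ≼ # t ⊕ # 1) eq (div-lower x d′)
          w≥ : # (suc y′) ≼ # x ⊗ inv (suc d′)
          w≥ = subst (λ t → # t ≼ # x ⊗ inv (suc d′)) eq (div-upper x d′)
          cn = C-near {y′} {X} y≤X ℕ.≤-refl
          ℓyd : ℓ (suc y′) ⊕ ℓ (suc d′) ≼ ℓ x ⊕ # 12
          ℓyd = subst (_≼ ℓ x ⊕ # 12) (ℓ-* y′ d′) (ℓ-mono (subst (λ t → t * suc d′ ≤ x) eq (m/n*n≤m x (suc d′))) p)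
          ρ = # (suc y′) ∷ ℓ (suc y′) ∷ T (suc y′) ∷ H (suc y′) ∷ # x ⊗ inv (suc d′) ∷ γ ∷ inv (suc y′) ∷ ℓ x ∷ ℓ (suc d′) ∷ []

      u-lower : ∀ d′ → suc d′ ≤ x → # 0 ⊖ # 12 ≼ u (suc d′)
      u-lower d′ q = lin 2 (λ a b → (b :≤ a :+ κ 12) ∷ [] ⊢ (κ 0 :- κ 12 :≤ a :- b)) (1 ∷ []) refl (ℓ x ∷ ℓ (suc d′) ∷ []) (ℓ-mono q p)

      -- Since u ≥ -12, the quantity 24 + u bounds |u|, and it stays polynomial in u, so that the
      -- majorant can be summed exactly.
      μuA-bounds : ∀ d′ → suc d′ ≤ x → (# 0 ⊖ (# 24 ⊕ u (suc d′)) ⊗ (# 102 ⊕ # 5 ⊗ u (suc d′)) ≼ (μ (suc d′) ⊗ u (suc d′)) ⊗ A (suc d′)) ×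
                                      ((μ (suc d′) ⊗ u (suc d′)) ⊗ A (suc d′) ≼ (# 24 ⊕ u (suc d′)) ⊗ (# 102 ⊕ # 5 ⊗ u (suc d′)))
      μuA-bounds d′ q = product-bound′ (proj₁ μu) (proj₂ μu) (proj₁ (A-bounds d′ q)) (proj₂ (A-bounds d′ q)) , product-bound (proj₁ μu) (proj₂ μu) (proj₁ (A-bounds d′ q)) (proj₂ (A-bounds d′ q))
        where
        ud = u (suc d′)
        bd : # 0 ⊖ (# 24 ⊕ ud) ≼ ud × ud ≼ # 24 ⊕ ud
        bd = lin 1 (λ u → (κ 0 :- κ 12 :≤ u) ∷ [] ⊢ (κ 0 :- (κ 24 :+ u) :≤ u)) (2 ∷ []) refl (ud ∷ []) (u-lower d′ q) , lin 1 (λ u → [] ⊢ (u :≤ κ 24 :+ u)) [] refl (ud ∷ []) _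
        μu : # 0 ⊖ (# 24 ⊕ ud) ≼ μ (suc d′) ⊗ ud × μ (suc d′) ⊗ ud ≼ # 24 ⊕ ud
        μu with μ-bounded (suc d′)
        ... | a , b = subst (λ t → # 0 ⊖ t ≼ μ (suc d′) ⊗ ud) (⊗-idˡ _) (product-bound′ a b (proj₁ bd) (proj₂ bd)) , subst (μ (suc d′) ⊗ ud ≼_) (⊗-idˡ _) (product-bound a b (proj₁ bd) (proj₂ bd))

      Z : R
      Z = ∑ x (λ d → (# 24 ⊕ u d) ⊗ (# 102 ⊕ # 5 ⊗ u d))

      -- (24 + u)(102 + 5u) = 5u² + 222u + 2448, and 5 · 28 + 222 · 6 + 2448 = 3920 by the bounds on
      -- W and V.
      majorant : Z ≼ # 3920 ⊗ # x
      majorant = subst (_≼ # 3920 ⊗ # x) (sym expand) (lin 3 (λ w v x → (w :≤ κ 28 :* x) ∷ (v :≤ κ 6 :* x) ∷ [] ⊢ (κ 5 :* w :+ κ 222 :* v :+ x :* κ 2448 :≤ κ 3920 :* x)) (5 ∷ 222 ∷ []) refl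
        (W x ∷ V x ∷ # x ∷ []) (W-bound x′ p , proj₂ (V-bounds x′ p)))
        where
        expand : Z ≡ # 5 ⊗ W x ⊕ # 222 ⊗ V x ⊕ # x ⊗ # 2448
        expand = trans (∑₀-cong x (λ i _ → ring 1 (λ u → (κ 24 :+ u) :* (κ 102 :+ κ 5 :* u) := κ 5 :* (u :* u) :+ κ 222 :* u :+ κ 2448) refl (u (suc i) ∷ [])))
          (trans (∑₀-⊕ x _ _) (cong₂ _⊕_ (trans (∑₀-⊕ x _ _) (cong₂ _⊕_ (∑₀-⊗ x (# 5) _) (∑₀-⊗ x (# 222) _))) (∑₀-const x (# 2448))))

      -- After interchanging the sums, the inner sum of μ(d) (log x - log d) over the divisors of n
      -- is log x at n = 1 plus Λ(n), by `∑μ-log`.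
      main : ∑ x (λ d → (μ d ⊗ u d) ⊗ A d) ≡ F 1 ⊗ ℓ x ⊕ ∑ x (λ n → F n ⊗ Λ n)
      main = begin
        ∑ x (λ d → (μ d ⊗ u d) ⊗ A d)                                   ≡⟨ ∑₀-cong x (λ i _ → sym (∑₀-⊗ x (μ (suc i) ⊗ u (suc i)) _)) ⟩
        ∑ x (λ d → ∑ x (λ n → (μ d ⊗ u d) ⊗ (𝟙 (d ∣? n) ⊗ F n)))        ≡⟨ ∑₀-swap x x _ ⟩
        ∑ x (λ n → ∑ x (λ d → (μ d ⊗ u d) ⊗ (𝟙 (d ∣? n) ⊗ F n)))        ≡⟨ ∑₀-cong x (λ i q → trans (∑₀-cong x (λ j _ → ring 4 (λ m u a f → (m :* u) :* (a :* f) := f :* (a :* (m :* u))) refl (μ (suc j) ∷ u (suc j) ∷ 𝟙 (suc j ∣? suc i) ∷ F (suc i) ∷ [])))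
                                                                            (trans (∑₀-⊗ x (F (suc i)) _) (cong (F (suc i) ⊗_) (∑μ-log i x (ℓ x) q)))) ⟩
        ∑ x (λ n → F n ⊗ (ℓ x ⊗ 𝟙 (n ≟ 1) ⊕ Λ n))                       ≡⟨ trans (∑₀-cong x (λ i _ → ⊗-distˡ (F (suc i)) _ _)) (∑₀-⊕ x _ _) ⟩
        ∑ x (λ n → F n ⊗ (ℓ x ⊗ 𝟙 (n ≟ 1))) ⊕ ∑ x (λ n → F n ⊗ Λ n)     ≡⟨ cong (_⊕ ∑ x (λ n → F n ⊗ Λ n)) (trans (∑₀-single x 0 _ (s≤s z≤n) (λ i _ ne → trans (cong (λ t → F (suc i) ⊗ (ℓ x ⊗ t)) (𝟙-no (suc i ≟ 1) (λ e → ne (ℕ.suc-injective e)))) (ring 2 (λ a b → a :* (b :* κ 0) := κ 0) refl (F (suc i) ∷ ℓ x ∷ [])))) (cong (F 1 ⊗_) (⊗-idʳ _))) ⟩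
        F 1 ⊗ ℓ x ⊕ ∑ x (λ n → F n ⊗ Λ n)                               ∎
        where open ≡-Reasoning

      G : R
      G = ∑ x (λ n → Λ n ⊗ ψ (x div n))

      ∑FΛ : ∑ x (λ n → F n ⊗ Λ n) ≡ G ⊖ # x ⊗ M x ⊕ (# 1 ⊕ γ) ⊗ ψ x
      ∑FΛ = trans (∑₀-cong x (λ i _ → ring 5 (λ s x y g l → ((s :- x :* y) :+ g) :* l := (l :* s :- x :* (l :* y)) :+ g :* l) refl (ψ (x div suc i) ∷ # x ∷ inv (suc i) ∷ # 1 ⊕ γ ∷ Λ (suc i) ∷ [])))
        (trans (∑₀-⊕ x _ _) (cong₂ _⊕_ (trans (∑₀-⊖ x _ _) (cong (G ⊖_) (∑₀-⊗ x (# x) _))) (∑₀-⊗ x (# 1 ⊕ γ) _)))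

      F1≡ : F 1 ≡ ψ x ⊖ # x ⊕ (# 1 ⊕ γ)
      F1≡ = cong₂ (λ a b → ψ a ⊖ b ⊕ (# 1 ⊕ γ)) (n/1 x) (trans (cong (# x ⊗_) inv-1) (⊗-idʳ _))
        where open import Data.Nat.DivMod using () renaming (n/1≡n to n/1)

      main≡ : ∑ x (λ d → (μ d ⊗ u d) ⊗ A d) ≡ (ψ x ⊖ # x ⊕ (# 1 ⊕ γ)) ⊗ ℓ x ⊕ (G ⊖ # x ⊗ M x ⊕ (# 1 ⊕ γ) ⊗ ψ x)
      main≡ = trans main (cong₂ _⊕_ (cong (_⊗ ℓ x) F1≡) ∑FΛ)

      κ-bounds : # 0 ⊖ # 8 ≼ # 1 ⊕ γ × # 1 ⊕ γ ≼ # 8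
      κ-bounds =
        lin 3 (λ g c i → (c :≤ g :+ κ 6 :* i) ∷ (κ 1 :≤ c) ∷ (i :≤ κ 1) ∷ [] ⊢ (κ 0 :- κ 8 :≤ κ 1 :+ g)) (1 ∷ 1 ∷ 6 ∷ []) refl (γ ∷ C 1 ∷ inv 1 ∷ []) (proj₂ near , ≡⇒≼ (sym C1) , inv≤1 0) ,
        lin 3 (λ g c i → (g :≤ c :+ κ 6 :* i) ∷ (c :≤ κ 1) ∷ (i :≤ κ 1) ∷ [] ⊢ (κ 1 :+ g :≤ κ 8)) (1 ∷ 1 ∷ 6 ∷ []) refl (γ ∷ C 1 ∷ inv 1 ∷ []) (proj₁ near , ≡⇒≼ C1 , inv≤1 0)
        where
        near = C-near {0} {X} (ℕ.≤-trans (s≤s z≤n) p) ℕ.≤-refl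
        C1 : C 1 ≡ # 1
        C1 = trans (cong₂ _⊖_ (trans (⊕-idˡ _) inv-1) ℓ-1) (⊖-unique (⊕-idʳ _))

      private
        ℓ≤6x : ℓ x ≼ # 6 ⊗ # x
        ℓ≤6x = lin 2 (λ l x → (l :≤ x :+ κ 5) ∷ (κ 1 :≤ x) ∷ [] ⊢ (l :≤ κ 6 :* x)) (1 ∷ 5 ∷ []) refl (ℓ x ∷ # x ∷ []) (ℓ≤ p , 1≼# x′)
        ℓ≥ : # 0 ⊖ # 6 ⊗ # x ≼ ℓ x
        ℓ≥ = lin 2 (λ l x → (κ 0 :≤ l) ∷ (κ 0 :≤ x) ∷ [] ⊢ (κ 0 :- κ 6 :* x :≤ l)) (1 ∷ 6 ∷ []) refl (ℓ x ∷ # x ∷ []) (ℓ-nonneg x , #-nonneg x)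
        ψ≥ : # 0 ⊖ # 60 ⊗ # x ≼ ψ x
        ψ≥ = lin 2 (λ l x → (κ 0 :≤ l) ∷ (κ 0 :≤ x) ∷ [] ⊢ (κ 0 :- κ 60 :* x :≤ l)) (1 ∷ 60 ∷ []) refl (ψ x ∷ # x ∷ []) (ψ-nonneg x , #-nonneg x)

      -- In `main≡` the term x M(x) is replaced by x ℓ(x). The errors are 3920 from `majorant`, 6
      -- from Mertens (64 in `selberg-hi`), and 8 · 6 and 8 · 60 from the constant times `ℓ` and ψ;
      -- 5000 rounds up their sum.
      selberg-lo : # 2 ⊗ (# x ⊗ ℓ x) ⊖ # 5000 ⊗ # x ≼ ψ x ⊗ ℓ x ⊕ G
      selberg-lo = lin 9 (λ s s′ x l g m k kl ks →
          (κ 0 :- s′ :≤ (s :- x :+ k) :* l :+ (g :- x :* m :+ k :* s)) ∷ (s′ :≤ κ 3920 :* x) ∷ (x :* l :≤ x :* (m :+ κ 6)) ∷ (kl :≤ κ 8 :* (κ 6 :* x)) ∷ (ks :≤ κ 8 :* (κ 60 :* x)) ∷ (k :* l :≡ kl) ∷ (k :* s :≡ ks) ∷ (κ 0 :≤ x) ∷ []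
          ⊢ (κ 2 :* (x :* l) :- κ 5000 :* x :≤ s :* l :+ g)) (1 ∷ 1 ∷ 1 ∷ 1 ∷ 1 ∷ 1 ∷ 1 ∷ 546 ∷ []) refl
        (ψ x ∷ Z ∷ # x ∷ ℓ x ∷ G ∷ M x ∷ # 1 ⊕ γ ∷ (# 1 ⊕ γ) ⊗ ℓ x ∷ (# 1 ⊕ γ) ⊗ ψ x ∷ [])
        (subst₂ _≼_ (trans (∑₀-⊖ x (λ _ → # 0) (λ i → (# 24 ⊕ u (suc i)) ⊗ (# 102 ⊕ # 5 ⊗ u (suc i)))) (cong (_⊖ Z) (∑₀-zero x (λ _ _ → refl)))) main≡ (∑₀-mono x (λ i q → proj₁ (μuA-bounds i q))) ,
         majorant , ⊗-monoˡ (#-nonneg x) (proj₁ (mertens x′ p)) , product-bound (proj₁ κ-bounds) (proj₂ κ-bounds) ℓ≥ ℓ≤6x , product-bound (proj₁ κ-bounds) (proj₂ κ-bounds) ψ≥ (chebyshev x p) , refl , refl , #-nonneg x)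

      selberg-hi : ψ x ⊗ ℓ x ⊕ G ≼ # 2 ⊗ (# x ⊗ ℓ x) ⊕ # 5000 ⊗ # x
      selberg-hi = lin 9 (λ s s′ x l g m k kl ks →
          ((s :- x :+ k) :* l :+ (g :- x :* m :+ k :* s) :≤ s′) ∷ (s′ :≤ κ 3920 :* x) ∷ (x :* m :≤ x :* (l :+ κ 64)) ∷ (κ 0 :- κ 8 :* (κ 6 :* x) :≤ kl) ∷ (κ 0 :- κ 8 :* (κ 60 :* x) :≤ ks) ∷ (kl :≡ k :* l) ∷ (ks :≡ k :* s) ∷ (κ 0 :≤ x) ∷ []
          ⊢ (s :* l :+ g :≤ κ 2 :* (x :* l) :+ κ 5000 :* x)) (1 ∷ 1 ∷ 1 ∷ 1 ∷ 1 ∷ 1 ∷ 1 ∷ 488 ∷ []) refl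
        (ψ x ∷ Z ∷ # x ∷ ℓ x ∷ G ∷ M x ∷ # 1 ⊕ γ ∷ (# 1 ⊕ γ) ⊗ ℓ x ∷ (# 1 ⊕ γ) ⊗ ψ x ∷ [])
        (subst (_≼ Z) main≡ (∑₀-mono x (λ i q → proj₂ (μuA-bounds i q))) ,
         majorant , ⊗-monoˡ (#-nonneg x) (proj₂ (mertens x′ p)) , product-bound′ (proj₁ κ-bounds) (proj₂ κ-bounds) ℓ≥ ℓ≤6x , product-bound′ (proj₁ κ-bounds) (proj₂ κ-bounds) ψ≥ (chebyshev x p) , refl , refl , #-nonneg x)

    S : ℕ → R
    S x = ψ x ⊗ ℓ x ⊕ ∑ x (λ n → Λ n ⊗ ψ (x div n))

    selberg : ∀ x → suc x ≤ X → (# 2 ⊗ (# (suc x) ⊗ ℓ (suc x)) ⊖ # 5000 ⊗ # (suc x) ≼ S (suc x)) × (S (suc x) ≼ # 2 ⊗ (# (suc x) ⊗ ℓ (suc x)) ⊕ # 5000 ⊗ # (suc x))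
    selberg x p = Fixed.selberg-lo x p , Fixed.selberg-hi x p

-- Selberg's formula on intervals: twice the expected density as an upper bound, and the effect of a
-- gap.

module ShortIntervals where
  open Rationals
  open LinearArithmetic
  open Sums
  open Logarithms
  open Multiplicative
  open Stirling
  open SelbergFormula
  open import Data.Nat using (ℕ; zero; suc; _+_; _*_; _^_; _≤_; s≤s; _≤?_)
  import Data.Nat.Properties as ℕ
  open import Data.Nat.DivMod using (m<n⇒m/n≡0; /-monoˡ-≤)
  open import Data.Vec using ([]; _∷_)
  open import Data.List using ([]; _∷_)
  open import Data.Product using (_,_; proj₁; proj₂)
  open import Data.Sum using (inj₁; inj₂)
  open import Relation.Nullary using (yes; no)
  open import Relation.Binary.PropositionalEquality

  -- Doubling m adds at least m · 1/(2m) = 1/2 to the harmonic sum. This is the only source of a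
  -- lower bound for `ℓ` at large arguments.
  H-power-of-2 : ∀ e → # e ≼ # 2 ⊗ H (2 ^ e)
  H-power-of-2 zero = ⊗-nonneg (#-nonneg 2) (H-nonneg 1)
  H-power-of-2 (suc e) with 2 ^ e | ℕ.m^n>0 2 e | H-power-of-2 e
  ... | m@(suc m′) | _ | ih = subst₂ (λ t k → t ≼ # 2 ⊗ H k) (sym (#-+ 1 e)) (cong (m +_) (sym (ℕ.+-identityʳ m)))
    (lin 4 (λ e h h′ x → (e :≤ κ 2 :* h) ∷ (x :≤ h′ :- h) ∷ (κ 1 :≡ κ 2 :* x) ∷ [] ⊢ (κ 1 :+ e :≤ κ 2 :* h′)) (1 ∷ 2 ∷ 1 ∷ []) refl
      (# e ∷ H m ∷ H (m + m) ∷ # m ⊗ inv (m + m) ∷ []) (ih , H-lower m m , sym two))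
    where
    two : # 2 ⊗ (# m ⊗ inv (m + m)) ≡ # 1
    two = trans (ring 3 (λ a m i → a :* (m :* i) := (m :* a) :* i) refl (# 2 ∷ # m ∷ inv (m + m) ∷ []))
      (trans (cong₂ _⊗_ (trans (sym (#-* m 2)) (cong # (trans (ℕ.*-comm m 2) (cong (m +_) (ℕ.+-identityʳ m))))) refl) (#⊗inv (m′ + m)))

  -- Abstract, since normalising these numbers is infeasible.
  abstract
    exponent : ℕ → ℕ
    exponent j = 22000 * j + 14

    #exponent : ∀ j → # (exponent j) ≡ # 22000 ⊗ # j ⊕ # 14
    #exponent j = trans (#-+ (22000 * j) 14) (cong (_⊕ # 14) (#-* 22000 j))

    threshold : ℕ → ℕ
    threshold j = 60 * 2 ^ exponent j

    #threshold : ∀ j → # (threshold j) ≡ # 60 ⊗ # (2 ^ exponent j)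
    #threshold j = #-* 60 (2 ^ exponent j)

  module Intervals {X} (L : LogApprox X) where
    open LogApprox L
    open VonMangoldt L
    open Logarithm L
    open Selberg L

    G : ℕ → R
    G x = ∑ x (λ n → Λ n ⊗ ψ (x div n))

    G-mono : ∀ {u v} → u ≤ v → G u ≼ G v
    G-mono {u} {v} p = ≼-trans (∑₀-mono u (λ i _ → ⊗-monoˡ (Λ-nonneg i) (ψ-mono (/-monoˡ-≤ (suc i) p))))
      (∑₀-grow _ p (λ i _ _ → ⊗-nonneg (Λ-nonneg i) (ψ-nonneg (v div suc i))))

    private
      u[ℓv-ℓu] : ∀ {u v} → suc u ≤ v → v ≤ X → # (suc u) ⊗ (ℓ v ⊖ ℓ (suc u)) ≼ # v ⊖ # (suc u) ⊕ # 6
      u[ℓv-ℓu] {u} {v} p q with ℕ.m≤n⇒∃[o]m+o≡n p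
      ... | o , refl = subst (λ t → # (suc u) ⊗ (ℓ v ⊖ ℓ (suc u)) ≼ t ⊕ # 6) (sym (⊖-unique (trans (⊕-comm (# o) _) (sym (#-+ (suc u) o))))) (ℓ-diff u o q)

    -- Selberg's formula at v minus the formula at u. The convolution sum `G` only grows, so it may
    -- be dropped; this loses the factor 2.
    ψ-diff : ∀ {u v} → suc u ≤ v → v ≤ X → (ψ v ⊖ ψ (suc u)) ⊗ ℓ v ≼ # 2 ⊗ ((# v ⊖ # (suc u)) ⊗ ℓ v) ⊕ # 11000 ⊗ # v
    ψ-diff {u} {suc v′} p q = lin 10 (λ u v lu lv pu pv gu gv a b →
        (pv :* lv :+ gv :≤ κ 2 :* (v :* lv) :+ κ 5000 :* v) ∷ (κ 2 :* (u :* lu) :- κ 5000 :* u :≤ pu :* lu :+ gu) ∷ (gu :≤ gv) ∷ (κ 0 :≤ pu :* (lv :+ κ 12 :- lu)) ∷ (pu :≤ κ 60 :* u) ∷ (u :* (lv :- lu) :≤ v :- u :+ κ 6) ∷ (u :≤ v) ∷ (κ 1 :≤ v) ∷ []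
        ⊢ ((pv :- pu) :* lv :≤ κ 2 :* ((v :- u) :* lv) :+ κ 11000 :* v))
      (1 ∷ 1 ∷ 1 ∷ 1 ∷ 12 ∷ 2 ∷ 5718 ∷ 280 ∷ []) refl
      (# (suc u) ∷ # v ∷ ℓ (suc u) ∷ ℓ v ∷ ψ (suc u) ∷ ψ v ∷ G (suc u) ∷ G v ∷ # 0 ∷ # 0 ∷ [])
      (proj₂ (selberg v′ q) , proj₁ (selberg u (ℕ.≤-trans p q)) , G-mono p , ⊗-nonneg (ψ-nonneg (suc u)) (⊖-nonneg (ℓ-mono p q)) , chebyshev (suc u) (ℕ.≤-trans p q) , u[ℓv-ℓu] p q , #-mono p , 1≼# v′)
      where v = suc v′

    ψ-diff₀ : ∀ {u v} → u ≤ v → 1 ≤ v → v ≤ X → (ψ v ⊖ ψ u) ⊗ ℓ v ≼ # 2 ⊗ ((# v ⊖ # u) ⊗ ℓ v) ⊕ # 11000 ⊗ # v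
    ψ-diff₀ {zero} {v} p 1≤v q = lin 5 (λ p1 p0 pv v l → ((pv :- p1) :* l :≤ κ 2 :* ((v :- κ 1) :* l) :+ κ 11000 :* v) ∷ (p1 :* l :≡ p0 :* l) ∷ (κ 0 :≤ l) ∷ []
        ⊢ ((pv :- p0) :* l :≤ κ 2 :* ((v :- κ 0) :* l) :+ κ 11000 :* v)) (1 ∷ 1 ∷ 2 ∷ []) refl (ψ 1 ∷ ψ 0 ∷ ψ v ∷ # v ∷ ℓ v ∷ [])
      (ψ-diff 1≤v q , cong (_⊗ ℓ v) (trans (cong (# 0 ⊕_) Λ-1) (⊕-idˡ _)) , ℓ-nonneg v)
    ψ-diff₀ {suc u} p _ q = ψ-diff p q

    -- Divide `ψ-diff₀` by ℓ(v). From v = 2^`exponent` on, the logarithm is at least 11000 (j + 1),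
    -- which turns the error 11000 v into v/(j + 1); below that size Chebyshev's 60 v is absorbed by
    -- `threshold`.
    ψ-density : ∀ j {u v} → u ≤ v → v ≤ X → ψ v ≼ ψ u ⊕ # 2 ⊗ (# v ⊖ # u) ⊕ (# v ⊗ inv (suc j) ⊕ # (threshold (suc j)))
    ψ-density j {u} {v} p q with 2 ^ exponent (suc j) ≤? v
    ... | no v< = lin 7 (λ a b u v w c t → (a :≤ κ 60 :* v) ∷ (v :≤ t) ∷ (κ 0 :≤ b) ∷ (u :≤ v) ∷ (κ 0 :≤ w) ∷ (κ 60 :* t :≡ c) ∷ [] ⊢ (a :≤ b :+ κ 2 :* (v :- u) :+ (w :+ c))) (1 ∷ 60 ∷ 1 ∷ 2 ∷ 1 ∷ 1 ∷ []) refl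
        (ψ v ∷ ψ u ∷ # u ∷ # v ∷ # v ⊗ inv (suc j) ∷ # (threshold (suc j)) ∷ # (2 ^ exponent (suc j)) ∷ [])
        (chebyshev v q , #-mono (ℕ.<⇒≤ (ℕ.≰⇒> v<)) , ψ-nonneg u , #-mono p , ⊗-nonneg (#-nonneg v) (inv-nonneg (suc j)) , sym (#threshold (suc j)))
    ... | yes v≥ with ≼-total (ψ v ⊖ ψ u ⊖ # 2 ⊗ (# v ⊖ # u)) (# 0)
    ... | inj₁ Δ≤0 = lin 6 (λ a b u v w c → (a :- b :- κ 2 :* (v :- u) :≤ κ 0) ∷ (κ 0 :≤ w) ∷ (κ 0 :≤ c) ∷ [] ⊢ (a :≤ b :+ κ 2 :* (v :- u) :+ (w :+ c))) (1 ∷ 1 ∷ 1 ∷ []) refl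
        (ψ v ∷ ψ u ∷ # u ∷ # v ∷ # v ⊗ inv (suc j) ∷ # (threshold (suc j)) ∷ []) (Δ≤0 , ⊗-nonneg (#-nonneg v) (inv-nonneg (suc j)) , #-nonneg (threshold (suc j)))
    ... | inj₂ Δ≥0 = lin 6 (λ a b u v w c → (a :- b :- κ 2 :* (v :- u) :≤ w) ∷ (κ 0 :≤ c) ∷ [] ⊢ (a :≤ b :+ κ 2 :* (v :- u) :+ (w :+ c))) (1 ∷ 1 ∷ []) refl
        (ψ v ∷ ψ u ∷ # u ∷ # v ∷ # v ⊗ inv (suc j) ∷ # (threshold (suc j)) ∷ []) (Δ≤ , #-nonneg (threshold (suc j)))
      where
      e = exponent (suc j)
      1≤v : 1 ≤ v
      1≤v = ℕ.≤-trans (ℕ.m^n>0 2 e) v≥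
      𝕛 = # (suc j)
      Δ = ψ v ⊖ ψ u ⊖ # 2 ⊗ (# v ⊖ # u)
      H≤ℓ′ : ∀ {n} → 1 ≤ n → n ≤ X → H n ≼ ℓ n ⊕ # 7
      H≤ℓ′ {suc n} _ = H≤ℓ
      -- For e = 22000 (j + 1) + 14 one has e/2 ≤ H(v) ≤ ℓ(v) + 7; the 14 compensates for the 7.
      ℓ≥ : # 11000 ⊗ 𝕛 ≼ ℓ v
      ℓ≥ = lin/ 1 5 (λ e j h h′ l → (e :≤ κ 2 :* h) ∷ (h :≤ h′) ∷ (h′ :≤ l :+ κ 7) ∷ (κ 22000 :* j :+ κ 14 :≡ e) ∷ [] ⊢ (κ 11000 :* j :≤ l)) (1 ∷ 2 ∷ 2 ∷ 1 ∷ []) refl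
        (# e ∷ 𝕛 ∷ H (2 ^ e) ∷ H v ∷ ℓ v ∷ []) (H-power-of-2 e , H-mono v≥ , H≤ℓ′ 1≤v q , sym (#exponent (suc j)))
      Δℓ : Δ ⊗ ℓ v ≼ # 11000 ⊗ # v
      Δℓ = lin 5 (λ a b u v l → ((a :- b) :* l :≤ κ 2 :* ((v :- u) :* l) :+ κ 11000 :* v) ∷ [] ⊢ ((a :- b :- κ 2 :* (v :- u)) :* l :≤ κ 11000 :* v)) (1 ∷ []) refl
        (ψ v ∷ ψ u ∷ # u ∷ # v ∷ ℓ v ∷ []) (ψ-diff₀ p 1≤v q)
      Δ𝕛 : 𝕛 ⊗ Δ ≼ # v
      Δ𝕛 = lin/ 10999 4 (λ j d v l → (κ 0 :≤ d :* (l :- κ 11000 :* j)) ∷ (d :* l :≤ κ 11000 :* v) ∷ [] ⊢ (j :* d :≤ v)) (1 ∷ 1 ∷ []) refl (𝕛 ∷ Δ ∷ # v ∷ ℓ v ∷ [])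
        (⊗-nonneg Δ≥0 (⊖-nonneg ℓ≥) , Δℓ)
      Δ≤ : Δ ≼ # v ⊗ inv (suc j)
      Δ≤ = ⊗-cancel-suc j (≼-trans Δ𝕛 (≡⇒≼ (sym (trans (ring 3 (λ j v i → j :* (v :* i) := v :* (j :* i)) refl (𝕛 ∷ # v ∷ inv (suc j) ∷ [])) (trans (cong (# v ⊗_) (#⊗inv j)) (⊗-idʳ _))))))

    -- If (x, y] carries no mass of Λ, Selberg's formula forces the sum over the products to fill the main term.
    gap-mass : ∀ {x y} → suc x ≤ y → y ≤ X → ψ y ≡ ψ (suc x) →
      # 2 ⊗ ((# y ⊖ # (suc x)) ⊗ ℓ (suc x)) ⊖ # 12000 ⊗ # y ≼ ∑ y (λ n → Λ n ⊗ (ψ (y div n) ⊖ ψ (suc x div n)))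
    gap-mass {x′} {y@(suc y′)} p q e = subst (_ ≼_) (sym Gdiff) (lin 8 (λ x y lx ly px py gx gy →
        (κ 2 :* (y :* ly) :- κ 5000 :* y :≤ py :* ly :+ gy) ∷ (px :* lx :+ gx :≤ κ 2 :* (x :* lx) :+ κ 5000 :* x) ∷ (py :* ly :≡ px :* ly) ∷ (κ 0 :≤ (κ 60 :* x :- px) :* (ly :+ κ 12 :- lx)) ∷ (κ 0 :≤ px) ∷ (x :* (ly :- lx) :≤ y :- x :+ κ 6)
          ∷ (κ 0 :≤ y :* (ly :+ κ 12 :- lx)) ∷ (x :≤ y) ∷ (κ 1 :≤ y) ∷ []
        ⊢ (κ 2 :* ((y :- x) :* lx) :- κ 12000 :* y :≤ gy :- gx)) (1 ∷ 1 ∷ 1 ∷ 1 ∷ 12 ∷ 60 ∷ 2 ∷ 5660 ∷ 1256 ∷ []) refl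
        (# x ∷ # y ∷ ℓ x ∷ ℓ y ∷ ψ x ∷ ψ y ∷ G x ∷ G y ∷ [])
        (proj₁ (selberg y′ q) , proj₂ (selberg x′ (ℕ.≤-trans p q)) , cong (_⊗ ℓ y) e , ⊗-nonneg (⊖-nonneg (chebyshev x (ℕ.≤-trans p q))) (⊖-nonneg (ℓ-mono p q)) , ψ-nonneg x , u[ℓv-ℓu] p q ,
         ⊗-nonneg (#-nonneg y) (⊖-nonneg (ℓ-mono p q)) , #-mono p , 1≼# y′))
      where
      x = suc x′
      Gdiff : ∑ y (λ n → Λ n ⊗ (ψ (y div n) ⊖ ψ (x div n))) ≡ G y ⊖ G x
      Gdiff = trans (∑₀-cong y (λ i _ → ring 3 (λ l a b → l :* (a :- b) := l :* a :- l :* b) refl (Λ (suc i) ∷ ψ (y div suc i) ∷ ψ (x div suc i) ∷ [])))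
        (trans (∑₀-⊖ y _ _) (cong (G y ⊖_) (∑₀-extend _ p (λ i r _ → trans (cong (λ t → Λ (suc i) ⊗ ψ t) (m<n⇒m/n≡0 (s≤s r))) (⊗-zeroʳ _)))))

-- A geometric grid and the convolution inequality that a gap forces on the cell masses.

module GeometricGrid where
  open Rationals
  open LinearArithmetic
  open Sums
  open Logarithms
  open Multiplicative
  open Stirling
  open SelbergFormula
  open ShortIntervals
  open import Data.Nat using (ℕ; zero; suc; _+_; _*_; _^_; _≤_; _<_; s≤s; _∸_)
  import Data.Nat.Properties as ℕ
  open import Data.Nat.DivMod using (_/_; m/n*n≤m; /-monoˡ-≤; m*n/n≡m)
  open import Data.Vec using ([]; _∷_)
  open import Data.List using ([]; _∷_)
  open import Data.Product using (_,_; proj₂; ∃)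
  open import Relation.Binary.PropositionalEquality

  ⊗-cancel-pos : ∀ {n x y} → 1 ≤ n → # n ⊗ x ≼ # n ⊗ y → x ≼ y
  ⊗-cancel-pos {suc n} _ = ⊗-cancel-suc n

  *-interchange : ∀ a b c d → (a * b) * (c * d) ≡ (a * c) * (b * d)
  *-interchange a b c d = begin
    (a * b) * (c * d) ≡⟨ ℕ.*-assoc a b (c * d) ⟩
    a * (b * (c * d)) ≡⟨ cong (a *_) (trans (sym (ℕ.*-assoc b c d)) (trans (cong (_* d) (ℕ.*-comm b c)) (ℕ.*-assoc c b d))) ⟩
    a * (c * (b * d)) ≡⟨ ℕ.*-assoc a c (b * d) ⟨
    (a * c) * (b * d) ∎
    where open ≡-Reasoning

  ^-distrib-* : ∀ a b i → (a * b) ^ i ≡ a ^ i * b ^ i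
  ^-distrib-* a b zero = refl
  ^-distrib-* a b (suc i) = trans (cong (a * b *_) (^-distrib-* a b i)) (*-interchange a b (a ^ i) (b ^ i))

  -- The grid points g i = ⌊ρ ^ i⌋ with ratio ρ = 1 + 1/K; r i = ρ ^ i and s i = ρ ^ (− i).
  module Grid (K′ : ℕ) where
    K = suc K′
    K₁ = suc K

    abstract
      g : ℕ → ℕ
      g i = _/_ (K₁ ^ i) (K ^ i) ⦃ ℕ.m^n≢0 K i ⦄

      ≤g⁻ : ∀ {a} i → a ≤ g i → a * K ^ i ≤ K₁ ^ i
      ≤g⁻ i p = ℕ.≤-trans (ℕ.*-monoˡ-≤ (K ^ i) p) (m/n*n≤m (K₁ ^ i) (K ^ i) ⦃ ℕ.m^n≢0 K i ⦄)

      ≤g⁺ : ∀ {a} i → a * K ^ i ≤ K₁ ^ i → a ≤ g i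
      ≤g⁺ {a} i p = subst (_≤ g i) (m*n/n≡m a (K ^ i) ⦃ ℕ.m^n≢0 K i ⦄) (/-monoˡ-≤ (K ^ i) ⦃ ℕ.m^n≢0 K i ⦄ p)

    <g⁻ : ∀ {a} i → g i < a → K₁ ^ i < a * K ^ i
    <g⁻ i p = ℕ.≰⇒> (λ q → ℕ.<⇒≱ p (≤g⁺ i q))

    ^-shape : ∀ c a b i j → (a * c ^ i) * (b * c ^ j) ≡ a * b * c ^ (i + j)
    ^-shape c a b i j = trans (*-interchange a (c ^ i) b (c ^ j)) (cong (a * b *_) (sym (ℕ.^-distribˡ-+-* c i j)))

    -- Together with `g-product-<` this is what rounding down leaves of ρ^i ρ^j = ρ^(i + j). It
    -- suffices to locate quotients on the grid.
    g-product-≤ : ∀ {a b} i j → a ≤ g i → b ≤ g j → a * b ≤ g (i + j)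
    g-product-≤ {a} {b} i j p q = ≤g⁺ (i + j) (subst₂ _≤_ (^-shape K a b i j) (sym (ℕ.^-distribˡ-+-* K₁ i j)) (ℕ.*-mono-≤ (≤g⁻ i p) (≤g⁻ j q)))

    g-product-< : ∀ {a b} i j → g i < a → g j < b → g (i + j) < a * b
    g-product-< {a} {b} i j p q = ℕ.≰⇒> (λ r → ℕ.<⇒≱ (subst₂ _<_ (sym (ℕ.^-distribˡ-+-* K₁ i j)) (^-shape K a b i j) (ℕ.*-mono-< (<g⁻ i p) (<g⁻ j q))) (≤g⁻ (i + j) r))

    g≥1 : ∀ i → 1 ≤ g i
    g≥1 i = ≤g⁺ i (subst (_≤ K₁ ^ i) (sym (ℕ.*-identityˡ (K ^ i))) (ℕ.^-monoˡ-≤ i (ℕ.n≤1+n K)))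

    g-mono : ∀ {i j} → i ≤ j → g i ≤ g j
    g-mono {i} p with ℕ.m≤n⇒∃[o]m+o≡n p
    ... | o , refl = subst (_≤ g (i + o)) (ℕ.*-identityʳ (g i)) (g-product-≤ i o ℕ.≤-refl (g≥1 o))

    g≤2^ : ∀ i → g i ≤ 2 ^ i
    g≤2^ i = ℕ.*-cancelʳ-≤ (g i) (2 ^ i) (K ^ i) ⦃ ℕ.m^n≢0 K i ⦄ (ℕ.≤-trans (≤g⁻ i ℕ.≤-refl)
      (subst (K₁ ^ i ≤_) (^-distrib-* 2 K i) (ℕ.^-monoˡ-≤ i (s≤s (ℕ.≤-trans (s≤s (ℕ.m≤n+m K′ K′)) (ℕ.≤-reflexive (trans (sym (ℕ.+-suc K′ K′)) (cong (K′ +_) (sym (ℕ.+-identityʳ K))))))))))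

    g≤K₁^ : ∀ i → g i ≤ K₁ ^ i
    g≤K₁^ i = ℕ.≤-trans (ℕ.m≤m*n (g i) (K ^ i) ⦃ ℕ.m^n≢0 K i ⦄) (≤g⁻ i ℕ.≤-refl)

    ρ σ : R
    ρ = # 1 ⊕ inv K
    σ = # K ⊗ inv K₁

    r s : ℕ → R
    r zero = # 1
    r (suc i) = r i ⊗ ρ
    s zero = # 1
    s (suc i) = s i ⊗ σ

    Kρ : # K ⊗ ρ ≡ # K₁
    Kρ = trans (⊗-distˡ (# K) (# 1) (inv K)) (trans (cong₂ _⊕_ (⊗-idʳ (# K)) (#⊗inv K′)) (trans (⊕-comm _ _) (sym (#-+ 1 K))))

    ρσ : ρ ⊗ σ ≡ # 1
    ρσ = trans (ring 3 (λ a k i → a :* (k :* i) := (k :* a) :* i) refl (ρ ∷ # K ∷ inv K₁ ∷ [])) (trans (cong (_⊗ inv K₁) Kρ) (#⊗inv K))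

    ρ-nonneg : # 0 ≼ ρ
    ρ-nonneg = ⊕-nonneg (#-nonneg 1) (inv-nonneg K)

    ρ≤2 : ρ ≼ # 2
    ρ≤2 = lin 1 (λ i → (i :≤ κ 1) ∷ [] ⊢ (κ 1 :+ i :≤ κ 2)) (1 ∷ []) refl (inv K ∷ []) (inv≤1 K′)

    r-nonneg : ∀ i → # 0 ≼ r i
    r-nonneg zero = #-nonneg 1
    r-nonneg (suc i) = ⊗-nonneg (r-nonneg i) ρ-nonneg

    s-nonneg : ∀ i → # 0 ≼ s i
    s-nonneg zero = #-nonneg 1
    s-nonneg (suc i) = ⊗-nonneg (s-nonneg i) (⊗-nonneg (#-nonneg K) (inv-nonneg K₁))

    rs : ∀ i → r i ⊗ s i ≡ # 1
    rs zero = ⊗-idˡ _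
    rs (suc i) = trans (ring 4 (λ a b c d → (a :* b) :* (c :* d) := (a :* c) :* (b :* d)) refl (r i ∷ ρ ∷ s i ∷ σ ∷ [])) (trans (cong₂ _⊗_ (rs i) ρσ) (⊗-idˡ _))

    r-+ : ∀ i j → r (i + j) ≡ r i ⊗ r j
    r-+ i zero = trans (cong r (ℕ.+-identityʳ i)) (sym (⊗-idʳ _))
    r-+ i (suc j) = trans (cong r (ℕ.+-suc i j)) (trans (cong (_⊗ ρ) (r-+ i j)) (⊗-assoc _ _ _))

    K^r : ∀ i → # (K ^ i) ⊗ r i ≡ # (K₁ ^ i)
    K^r zero = ⊗-idˡ _
    K^r (suc i) = begin
      # (K ^ suc i) ⊗ (r i ⊗ ρ)        ≡⟨ cong (_⊗ (r i ⊗ ρ)) (#-* K (K ^ i)) ⟩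
      (# K ⊗ # (K ^ i)) ⊗ (r i ⊗ ρ)    ≡⟨ ring 4 (λ a b c d → (a :* b) :* (c :* d) := (a :* d) :* (b :* c)) refl (# K ∷ # (K ^ i) ∷ r i ∷ ρ ∷ []) ⟩
      (# K ⊗ ρ) ⊗ (# (K ^ i) ⊗ r i)    ≡⟨ cong₂ _⊗_ Kρ (K^r i) ⟩
      # K₁ ⊗ # (K₁ ^ i)                ≡⟨ #-* K₁ (K₁ ^ i) ⟨
      # (K₁ ^ suc i)                   ∎
      where open ≡-Reasoning

    K^≥1 : ∀ i → 1 ≤ K ^ i
    K^≥1 i = ℕ.m^n>0 K i

    g≤r : ∀ i → # (g i) ≼ r i
    g≤r i = ⊗-cancel-pos (K^≥1 i) (subst₂ _≼_ (trans (#-* (g i) (K ^ i)) (⊗-comm _ _)) (sym (K^r i)) (#-mono (≤g⁻ i ℕ.≤-refl)))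

    r≤g+1 : ∀ i → r i ≼ # 1 ⊕ # (g i)
    r≤g+1 i = ⊗-cancel-pos (K^≥1 i) (subst₂ _≼_ (sym (K^r i)) (trans (#-* (suc (g i)) (K ^ i)) (trans (⊗-comm _ _) (cong (# (K ^ i) ⊗_) (#-+ 1 (g i))))) (#-mono (ℕ.<⇒≤ (<g⁻ i ℕ.≤-refl))))

    -- A telescoping geometric series, since s(i) = (K + 1) (s(i) - s(i + 1)).
    ∑s≤ : ∀ n → ∑₀ n s ≼ # K₁
    ∑s≤ n = subst₂ _≼_ (sym e) (⊗-idʳ _) (⊗-monoˡ (#-nonneg K₁) (lin 1 (λ s → (κ 0 :≤ s) ∷ [] ⊢ (κ 1 :- s :≤ κ 1)) (1 ∷ []) refl (s n ∷ []) (s-nonneg n)))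
      where
      step : ∀ i → s i ≡ # K₁ ⊗ (s i ⊖ s (suc i))
      step i = begin
        s i                                            ≡⟨ trans (sym (⊗-idˡ _)) (cong (_⊗ s i) (sym (⊖-unique (sym (#-+ 1 K))))) ⟩
        (# K₁ ⊖ # K) ⊗ s i                             ≡⟨ cong (λ t → (# K₁ ⊖ t) ⊗ s i) (trans (sym (⊗-idʳ _)) (cong (# K ⊗_) (sym (#⊗inv K)))) ⟩
        (# K₁ ⊖ # K ⊗ (# K₁ ⊗ inv K₁)) ⊗ s i           ≡⟨ ring 4 (λ a k i s → (a :- k :* (a :* i)) :* s := a :* (s :- s :* (k :* i))) refl (# K₁ ∷ # K ∷ inv K₁ ∷ s i ∷ []) ⟩
        # K₁ ⊗ (s i ⊖ s i ⊗ (# K ⊗ inv K₁))            ∎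
        where open ≡-Reasoning
      e : ∑₀ n s ≡ # K₁ ⊗ (# 1 ⊖ s n)
      e = trans (∑₀-cong n (λ i _ → step i)) (trans (∑₀-⊗ n (# K₁) _) (cong (# K₁ ⊗_)
        (trans (∑₀-cong n (λ i _ → ring 2 (λ a b → a :- b := (κ 0 :- b) :- (κ 0 :- a)) refl (s i ∷ s (suc i) ∷ []))) (trans (∑₀-telescope n (λ i → # 0 ⊖ s i)) (ring 1 (λ a → (κ 0 :- a) :- (κ 0 :- κ 1) := κ 1 :- a) refl (s n ∷ []))))))

  module Cells {X} (L : LogApprox X) (K′ : ℕ) where
    open LogApprox L
    open VonMangoldt L
    open Logarithm L hiding (T; V; W)
    open Selberg L
    open Intervals L
    open Grid K′

    -- `a i` is the Λ-mass of the cell divided by ρ^i / K, the length of the cell before rounding.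
    -- The prime number theorem would make it tend to 1.
    𝕁 a : ℕ → R
    𝕁 i = ψ (g (suc i)) ⊖ ψ (g i)
    a i = # K ⊗ (𝕁 i ⊗ s i)

    𝕁-nonneg : ∀ i → # 0 ≼ 𝕁 i
    𝕁-nonneg i = ⊖-nonneg (ψ-mono (g-mono (ℕ.n≤1+n i)))

    𝕁≡ : ∀ i → 𝕁 i ≡ inv K ⊗ (a i ⊗ r i)
    𝕁≡ i = sym (trans (ring 5 (λ v k j s r → v :* ((k :* (j :* s)) :* r) := j :* ((k :* v) :* (r :* s))) refl (inv K ∷ # K ∷ 𝕁 i ∷ s i ∷ r i ∷ []))
      (trans (cong (𝕁 i ⊗_) (trans (cong₂ _⊗_ (#⊗inv K′) (rs i)) (⊗-idˡ _))) (⊗-idʳ _)))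

    a-nonneg : ∀ i → # 0 ≼ a i
    a-nonneg i = ⊗-nonneg (#-nonneg K) (⊗-nonneg (𝕁-nonneg i) (s-nonneg i))

    -- Crude, from Chebyshev's bound alone; it serves only as a multiplier of small errors.
    a≤120K : ∀ i → g (suc i) ≤ X → a i ≼ # 120 ⊗ # K
    a≤120K i p = subst (a i ≼_) e (⊗-monoˡ (#-nonneg K) (⊗-monoʳ (s-nonneg i) 𝕁≤))
      where
      𝕁≤ : 𝕁 i ≼ # 120 ⊗ r i
      𝕁≤ = lin 5 (λ p q g r ρ → (κ 0 :≤ p) ∷ (q :≤ κ 60 :* g) ∷ (g :≤ r :* ρ) ∷ (κ 0 :≤ r :* (κ 2 :- ρ)) ∷ [] ⊢ (q :- p :≤ κ 120 :* r)) (1 ∷ 1 ∷ 60 ∷ 60 ∷ []) refl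
        (ψ (g i) ∷ ψ (g (suc i)) ∷ # (g (suc i)) ∷ r i ∷ ρ ∷ []) (ψ-nonneg (g i) , chebyshev (g (suc i)) p , g≤r (suc i) , ⊗-nonneg (r-nonneg i) (⊖-nonneg ρ≤2))
      e : # K ⊗ ((# 120 ⊗ r i) ⊗ s i) ≡ # 120 ⊗ # K
      e = trans (ring 3 (λ k r s → k :* ((κ 120 :* r) :* s) := (κ 120 :* k) :* (r :* s)) refl (# K ∷ r i ∷ s i ∷ [])) (trans (cong ((# 120 ⊗ # K) ⊗_) (rs i)) (⊗-idʳ _))

    -- `ψ-density` on a single cell, with a constant lost to rounding. Beyond 2, one term is small
    -- when j is large compared with K, the other when i is large.
    a-density : ∀ j i → g (suc i) ≤ X → a i ≼ # 2 ⊕ (# 2 ⊗ # K ⊗ inv (suc j) ⊕ (# (threshold (suc j)) ⊕ # 2) ⊗ # K ⊗ s i)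
    a-density j i p = subst (a i ≼_) e (⊗-monoˡ (#-nonneg K) (⊗-monoʳ (s-nonneg i) 𝕁≤))
      where
      w = inv (suc j)
      V = # (threshold (suc j))
      𝕁≤ : 𝕁 i ≼ # 2 ⊗ (r i ⊗ inv K) ⊕ # 2 ⊕ # 2 ⊗ r i ⊗ w ⊕ V
      𝕁≤ = lin 8 (λ p q x y r v w V → (q :≤ p :+ κ 2 :* (y :- x) :+ (y :* w :+ V)) ∷ (y :≤ r :* (κ 1 :+ v)) ∷ (r :≤ κ 1 :+ x) ∷ (κ 0 :≤ w :* (r :* (κ 1 :+ v) :- y)) ∷ (κ 0 :≤ (w :* r) :* (κ 1 :- v)) ∷ []
          ⊢ (q :- p :≤ κ 2 :* (r :* v) :+ κ 2 :+ κ 2 :* r :* w :+ V)) (1 ∷ 2 ∷ 2 ∷ 1 ∷ 1 ∷ []) refl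
        (ψ (g i) ∷ ψ (g (suc i)) ∷ # (g i) ∷ # (g (suc i)) ∷ r i ∷ inv K ∷ w ∷ V ∷ [])
        (ψ-density j (g-mono (ℕ.n≤1+n i)) p , g≤r (suc i) , r≤g+1 i , ⊗-nonneg (inv-nonneg (suc j)) (⊖-nonneg (g≤r (suc i))) , ⊗-nonneg (⊗-nonneg (inv-nonneg (suc j)) (r-nonneg i)) (⊖-nonneg (inv≤1 K′)))
      e : # K ⊗ ((# 2 ⊗ (r i ⊗ inv K) ⊕ # 2 ⊕ # 2 ⊗ r i ⊗ w ⊕ V) ⊗ s i) ≡ # 2 ⊕ (# 2 ⊗ # K ⊗ w ⊕ (V ⊕ # 2) ⊗ # K ⊗ s i)
      e = trans (ring 6 (λ k r v w V s → k :* ((κ 2 :* (r :* v) :+ κ 2 :+ κ 2 :* r :* w :+ V) :* s) := κ 2 :* ((r :* s) :* (k :* v)) :+ ((κ 2 :* k :* w) :* (r :* s) :+ (V :+ κ 2) :* k :* s)) refl (# K ∷ r i ∷ inv K ∷ w ∷ V ∷ s i ∷ []))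
        (trans (cong₂ (λ t u → # 2 ⊗ (t ⊗ u) ⊕ (# 2 ⊗ # K ⊗ w ⊗ t ⊕ (V ⊕ # 2) ⊗ # K ⊗ s i)) (rs i) (#⊗inv K′))
         (ring 2 (λ a b → κ 2 :* (κ 1 :* κ 1) :+ (a :* κ 1 :+ b) := κ 2 :+ (a :+ b)) refl (# 2 ⊗ # K ⊗ w ∷ (V ⊕ # 2) ⊗ # K ⊗ s i ∷ [])))

    E : ℕ → R
    E T = ∑₀ (suc T) (λ i → a i ⊗ (# 2 ⊖ a (T ∸ i)))

    module _ (j T : ℕ) (y≤X : g (suc (suc T)) ≤ X) (gap : ψ (g (suc (suc T))) ≡ ψ (g T)) where
      private
        x = g T
        y = g (suc (suc T))
        w = inv (suc j)
        V = # (threshold (suc j))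
        -- `B` majorises `Φ` by `ψ-density`, so the summands `f` are nonnegative and their sum can
        -- be bounded below cell by cell. `D o` measures how far the cell o falls short of density
        -- 2.
        Φ B f D : ℕ → R
        Φ n = ψ (y div n) ⊖ ψ (x div n)
        B n = # 2 ⊗ (# y ⊗ inv n ⊖ # x ⊗ inv n) ⊕ # 2 ⊕ # 2 ⊗ (# y ⊗ inv n ⊗ w) ⊕ # 2 ⊗ V
        f n = Λ n ⊗ (B n ⊖ Φ n)
        D o = # 2 ⊗ (# (g (suc o)) ⊖ # (g o)) ⊖ 𝕁 o

        x≤y : x ≤ y
        x≤y = g-mono (ℕ.≤-trans (ℕ.n≤1+n T) (ℕ.n≤1+n (suc T)))

        general : ∀ k → Φ (suc k) ≼ B (suc k)
        general k = lin 9 (λ p q u v yn xn w V t → (q :≤ p :+ κ 2 :* (v :- u) :+ (v :* w :+ V)) ∷ (v :≤ yn) ∷ (xn :≤ u :+ κ 1) ∷ (κ 0 :≤ w :* (yn :- v)) ∷ (κ 0 :≤ V) ∷ (κ 0 :≤ yn :* w) ∷ []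
            ⊢ (q :- p :≤ κ 2 :* (yn :- xn) :+ κ 2 :+ κ 2 :* (yn :* w) :+ κ 2 :* V)) (1 ∷ 2 ∷ 2 ∷ 1 ∷ 1 ∷ 1 ∷ []) refl
          (ψ (x div suc k) ∷ ψ (y div suc k) ∷ # (x div suc k) ∷ # (y div suc k) ∷ # y ⊗ inv (suc k) ∷ # x ⊗ inv (suc k) ∷ w ∷ V ∷ # 0 ∷ [])
          (ψ-density j (/-monoˡ-≤ (suc k) x≤y) (ℕ.≤-trans (div≤ y (suc k)) y≤X) , div-upper y k , div-lower x k , ⊗-nonneg (inv-nonneg (suc j)) (⊖-nonneg (div-upper y k)) , #-nonneg (threshold (suc j)) ,
           ⊗-nonneg (⊗-nonneg (#-nonneg y) (inv-nonneg (suc k))) (inv-nonneg (suc j)))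

        -- For g(i) < n ≤ g(i + 1) the interval from x/n to y/n contains the whole cell o; this is
        -- why y lies two grid steps above x. The shortfall of that cell survives, and `ψ-density`
        -- takes care of the two pieces left over on either side.
        within-cell : ∀ i o k → i + o ≡ T → g i ≤ k → k < g (suc i) → D o ≼ B (suc k) ⊖ Φ (suc k)
        within-cell i o k refl lo hi = 
          lin 12 (λ px py pu pv gu gv dx dy yn xn w V →
              (py :≤ pv :+ κ 2 :* (dy :- gv) :+ (dy :* w :+ V)) ∷ (pu :≤ px :+ κ 2 :* (gu :- dx) :+ (gu :* w :+ V)) ∷ (dy :≤ yn) ∷ (xn :≤ dx :+ κ 1) ∷ (κ 0 :≤ w :* (yn :- dy)) ∷ (κ 0 :≤ w :* (yn :- gu)) ∷ []
              ⊢ (κ 2 :* (gv :- gu) :- (pv :- pu) :≤ (κ 2 :* (yn :- xn) :+ κ 2 :+ κ 2 :* (yn :* w) :+ κ 2 :* V) :- (py :- px)))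
            (1 ∷ 1 ∷ 2 ∷ 2 ∷ 1 ∷ 1 ∷ []) refl
            (ψ (x div n) ∷ ψ (y div n) ∷ ψ (g o) ∷ ψ (g (suc o)) ∷ # (g o) ∷ # (g (suc o)) ∷ # (x div n) ∷ # (y div n) ∷ # y ⊗ inv n ∷ # x ⊗ inv n ∷ w ∷ V ∷ [])
            (ψ-density j upper (ℕ.≤-trans (div≤ y n) y≤X) , ψ-density j lower (ℕ.≤-trans (ℕ.≤-trans go≤ (div≤ y n)) y≤X) , div-upper y k , div-lower x k ,
             ⊗-nonneg (inv-nonneg (suc j)) (⊖-nonneg (div-upper y k)) , ⊗-nonneg (inv-nonneg (suc j)) (⊖-nonneg (≼-trans (#-mono go≤) (div-upper y k))))
          where
          n = suc k
          upper : g (suc o) ≤ y div n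
          upper = div-galois y k (subst (g (suc o) * n ≤_) (cong g (trans (cong suc (ℕ.+-suc o i)) (cong (λ t → suc (suc t)) (ℕ.+-comm o i)))) (g-product-≤ (suc o) (suc i) ℕ.≤-refl hi))
          lower : x div n ≤ g o
          lower = ℕ.≮⇒≥ (λ q → ℕ.<⇒≱ (g-product-< i o (s≤s lo) q) (subst (_≤ x) (ℕ.*-comm (x div n) n) (div-galois⁻ x k ℕ.≤-refl)))
          go≤ : g o ≤ y div n
          go≤ = ℕ.≤-trans (g-mono (ℕ.n≤1+n o)) upper

        f-nonneg : ∀ k → # 0 ≼ f (suc k)
        f-nonneg k = ⊗-nonneg (Λ-nonneg k) (⊖-nonneg (general k))

        cell : ∀ i o → i + o ≡ T → D o ⊗ 𝕁 i ≼ ∑ (g (suc i)) f ⊖ ∑ (g i) f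
        cell i o e = subst (_≼ ∑ (g (suc i)) f ⊖ ∑ (g i) f)
          (trans (cong₂ _⊖_ (∑₀-⊗ (g (suc i)) (D o) _) (∑₀-⊗ (g i) (D o) _)) (ring 3 (λ d p q → d :* q :- d :* p := d :* (q :- p)) refl (D o ∷ ψ (g i) ∷ ψ (g (suc i)) ∷ [])))
          (range-mono (λ k → D o ⊗ Λ (suc k)) (λ k → f (suc k)) (g-mono (ℕ.n≤1+n i))
            (λ k p q → subst (_≼ f (suc k)) (⊗-comm _ _) (⊗-monoˡ (Λ-nonneg k) (within-cell i o k e p q))))

        ∑D𝕁 : ∑₀ (suc T) (λ i → D (T ∸ i) ⊗ 𝕁 i) ≼ ∑ y f
        ∑D𝕁 = ≼-trans (∑₀-mono (suc T) (λ i p → cell i (T ∸ i) (ℕ.m+[n∸m]≡n (ℕ.≤-pred p))))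
          (subst (_≼ ∑ y f) (sym (∑₀-telescope (suc T) (λ i → ∑ (g i) f)))
            (lin 3 (λ u v z → (v :≤ z) ∷ (κ 0 :≤ u) ∷ [] ⊢ (v :- u :≤ z)) (1 ∷ 1 ∷ []) refl (∑ (g 0) f ∷ ∑ (g (suc T)) f ∷ ∑ y f ∷ [])
              (∑₀-grow _ (g-mono (ℕ.n≤1+n (suc T))) (λ i _ _ → f-nonneg i) , ∑₀-nonneg (g 0) (λ i _ → f-nonneg i))))

        c₁ c₂ : R
        c₁ = # 2 ⊗ (# y ⊖ # x) ⊕ # 2 ⊗ (# y ⊗ w)
        c₂ = # 2 ⊕ # 2 ⊗ V

        ∑f : ∑ y f ≡ (c₁ ⊗ M y ⊕ c₂ ⊗ ψ y) ⊖ ∑ y (λ n → Λ n ⊗ Φ n)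
        ∑f = trans (∑₀-cong y (λ i _ → ring 7 (λ l y x v w V p → l :* ((κ 2 :* (y :* v :- x :* v) :+ κ 2 :+ κ 2 :* (y :* v :* w) :+ κ 2 :* V) :- p) :=
              ((κ 2 :* (y :- x) :+ κ 2 :* (y :* w)) :* (l :* v) :+ (κ 2 :+ κ 2 :* V) :* l) :- l :* p) refl (Λ (suc i) ∷ # y ∷ # x ∷ inv (suc i) ∷ w ∷ V ∷ Φ (suc i) ∷ [])))
          (trans (∑₀-⊖ y _ _) (cong (_⊖ ∑ y (λ n → Λ n ⊗ Φ n)) (trans (∑₀-⊕ y _ _) (cong₂ _⊕_ (∑₀-⊗ y c₁ _) (∑₀-⊗ y c₂ _)))))

        positive : ∀ {n} → 1 ≤ n → ∃ λ m → n ≡ suc m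
        positive {suc m} _ = m , refl

        mertens′ : ∀ {n} → 1 ≤ n → n ≤ X → M n ≼ ℓ n ⊕ # 64
        mertens′ {suc n} _ q = proj₂ (mertens n q)

        y≤4r : # y ≼ # 4 ⊗ r T
        y≤4r = lin 3 (λ y r ρ → (y :≤ r :* ρ :* ρ) ∷ (κ 0 :≤ (r :* ρ) :* (κ 2 :- ρ)) ∷ (κ 0 :≤ r :* (κ 2 :- ρ)) ∷ [] ⊢ (y :≤ κ 4 :* r)) (1 ∷ 1 ∷ 2 ∷ []) refl (# y ∷ r T ∷ ρ ∷ [])
          (g≤r (suc (suc T)) , ⊗-nonneg (⊗-nonneg (r-nonneg T) ρ-nonneg) (⊖-nonneg ρ≤2) , ⊗-nonneg (r-nonneg T) (⊖-nonneg ρ≤2))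

        1≤x : # 1 ≼ # x
        1≤x = #-mono (g≥1 T)

        ℓy≤ : ℓ y ≼ ℓ x ⊕ # 13
        ℓy≤ with ℕ.m≤n⇒∃[o]m+o≡n x≤y | positive (g≥1 T)
        ... | o , e | x′ , e′ = ⊗-cancel-pos (g≥1 T) (lin 6 (λ x y lx ly o r → (x :* (ly :- lx) :≤ o :+ κ 6) ∷ (o :≤ y :- x) ∷ (y :≤ κ 4 :* r) ∷ (r :≤ κ 1 :+ x) ∷ (κ 1 :≤ x) ∷ [] ⊢ (x :* ly :≤ x :* (lx :+ κ 13))) (1 ∷ 1 ∷ 1 ∷ 4 ∷ 10 ∷ []) refl
            (# x ∷ # y ∷ ℓ x ∷ ℓ y ∷ # o ∷ r T ∷ [])
            (subst₂ (λ u v → # u ⊗ (ℓ v ⊖ ℓ u) ≼ # o ⊕ # 6) (sym e′) (trans (cong (_+ o) (sym e′)) e) (ℓ-diff x′ o (subst (_≤ X) (trans (sym e) (cong (_+ o) e′)) y≤X)) ,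
             ≡⇒≼ (sym (⊖-unique (trans (⊕-comm _ _) (trans (sym (#-+ x o)) (cong # e))))) , y≤4r , r≤g+1 T , 1≤x))

        1≤y : 1 ≤ y
        1≤y = g≥1 (suc (suc T))

        w≤1 : w ≼ # 1
        w≤1 = inv≤1 j

        gap′ : # 2 ⊗ ((# y ⊖ # x) ⊗ ℓ x) ⊖ # 12000 ⊗ # y ≼ ∑ y (λ n → Λ n ⊗ Φ n)
        gap′ with positive (g≥1 T)
        ... | x′ , e = subst (λ t → # 2 ⊗ ((# y ⊖ # t) ⊗ ℓ t) ⊖ # 12000 ⊗ # y ≼ ∑ y (λ n → Λ n ⊗ (ψ (y div n) ⊖ ψ (t div n)))) (sym e) (gap-mass (subst (_≤ y) e x≤y) y≤X (trans gap (cong ψ e)))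

        -- The main terms 2 (y - x) log x of c₁ M(y) and of `gap′` cancel. The constant 12428 is
        -- 12000 from `gap-mass`, twice 2 · 77 from Mertens, and 2 · 60 from Chebyshev.
        ∑f≤ : ∑ y f ≼ # y ⊗ (# 12428 ⊕ # 120 ⊗ V ⊕ # 2 ⊗ (w ⊗ ℓ x))
        ∑f≤ = subst (_≼ # y ⊗ (# 12428 ⊕ # 120 ⊗ V ⊕ # 2 ⊗ (w ⊗ ℓ x))) (sym ∑f)
          (lin 9 (λ x y w V lx m s p ly →
              (κ 2 :* ((y :- x) :* lx) :- κ 12000 :* y :≤ p) ∷ (κ 0 :≤ (κ 2 :* (y :- x) :+ κ 2 :* (y :* w)) :* (lx :+ κ 77 :- m)) ∷ (κ 0 :≤ (κ 2 :+ κ 2 :* V) :* (κ 60 :* y :- s)) ∷ (κ 0 :≤ y :* (κ 1 :- w)) ∷ (κ 0 :≤ x) ∷ []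
              ⊢ (((κ 2 :* (y :- x) :+ κ 2 :* (y :* w)) :* m :+ (κ 2 :+ κ 2 :* V) :* s) :- p :≤ y :* (κ 12428 :+ κ 120 :* V :+ κ 2 :* (w :* lx))))
            (1 ∷ 1 ∷ 1 ∷ 154 ∷ 154 ∷ []) refl
            (# x ∷ # y ∷ w ∷ V ∷ ℓ x ∷ M y ∷ ψ y ∷ ∑ y (λ n → Λ n ⊗ Φ n) ∷ ℓ y ∷ [])
            (gap′ , ⊗-nonneg (⊕-nonneg (⊗-nonneg (#-nonneg 2) (⊖-nonneg (#-mono x≤y))) (⊗-nonneg (#-nonneg 2) (⊗-nonneg (#-nonneg y) (inv-nonneg (suc j))))) (⊖-nonneg M≤) ,
             ⊗-nonneg (⊕-nonneg (#-nonneg 2) (⊗-nonneg (#-nonneg 2) (#-nonneg (threshold (suc j))))) (⊖-nonneg (chebyshev y y≤X)) , ⊗-nonneg (#-nonneg y) (⊖-nonneg w≤1) , #-nonneg x))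
          where
          M≤ : M y ≼ ℓ x ⊕ # 77
          M≤ = lin 3 (λ m ly lx → (m :≤ ly :+ κ 64) ∷ (ly :≤ lx :+ κ 13) ∷ [] ⊢ (m :≤ lx :+ κ 77)) (1 ∷ 1 ∷ []) refl (M y ∷ ℓ y ∷ ℓ x ∷ []) (mertens′ 1≤y y≤X , ℓy≤)

        -- The mass 𝕁(i) equals aᵢ ρ^i / K, and `D o` is at least ρ^o (2 - a_o)/K up to an error 2
        -- from rounding the grid points.
        product : ∀ i o → i + o ≡ T → (inv K ⊗ inv K ⊗ r T) ⊗ (a i ⊗ (# 2 ⊖ a o)) ⊖ # 2 ⊗ 𝕁 i ≼ D o ⊗ 𝕁 i
        product i o refl = subst (λ t → (inv K ⊗ inv K ⊗ t) ⊗ (a i ⊗ (# 2 ⊖ a o)) ⊖ # 2 ⊗ 𝕁 i ≼ D o ⊗ 𝕁 i) (sym (r-+ i o))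
          (lin 7 (λ v ri ro ai ao ji d → (κ 0 :≤ ji :* (d :- (ro :* v :* (κ 2 :- ao) :- κ 2))) ∷ (ro :* v :* (κ 2 :- ao) :* (v :* (ai :* ri)) :≡ ro :* v :* (κ 2 :- ao) :* ji) ∷ []
              ⊢ ((v :* v :* (ri :* ro)) :* (ai :* (κ 2 :- ao)) :- κ 2 :* ji :≤ d :* ji)) (1 ∷ 1 ∷ []) refl
            (inv K ∷ r i ∷ r o ∷ a i ∷ a o ∷ 𝕁 i ∷ D o ∷ [])
            (⊗-nonneg (𝕁-nonneg i) (⊖-nonneg D≥) , cong (r o ⊗ inv K ⊗ (# 2 ⊖ a o) ⊗_) (sym (𝕁≡ i))))
          where
          D≥ : r o ⊗ inv K ⊗ (# 2 ⊖ a o) ⊖ # 2 ≼ D o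
          D≥ = lin 6 (λ v r a gu gv j → (r :* (κ 1 :+ v) :≤ κ 1 :+ gv) ∷ (gu :≤ r) ∷ (j :≡ v :* (a :* r)) ∷ [] ⊢ (r :* v :* (κ 2 :- a) :- κ 2 :≤ κ 2 :* (gv :- gu) :- j)) (2 ∷ 2 ∷ 1 ∷ []) refl
            (inv K ∷ r o ∷ a o ∷ # (g o) ∷ # (g (suc o)) ∷ 𝕁 o ∷ []) (r≤g+1 (suc o) , g≤r o , 𝕁≡ o)

        ∑𝕁 : ∑₀ (suc T) 𝕁 ≼ # 60 ⊗ # y
        ∑𝕁 = subst (_≼ # 60 ⊗ # y) (sym (∑₀-telescope (suc T) (λ i → ψ (g i)))) (lin 4 (λ p q s y → (q :≤ s) ∷ (κ 0 :≤ p) ∷ (s :≤ κ 60 :* y) ∷ [] ⊢ (q :- p :≤ κ 60 :* y)) (1 ∷ 1 ∷ 1 ∷ []) refl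
          (ψ (g 0) ∷ ψ (g (suc T)) ∷ ψ y ∷ # y ∷ []) (ψ-mono (g-mono (ℕ.n≤1+n (suc T))) , ψ-nonneg (g 0) , chebyshev y y≤X))

        scaled : (inv K ⊗ inv K ⊗ r T) ⊗ E T ≼ # y ⊗ (# 12548 ⊕ # 120 ⊗ V ⊕ # 2 ⊗ (w ⊗ ℓ x))
        scaled = lin 7 (λ e d j f y V wl → (e :- κ 2 :* j :≤ d) ∷ (d :≤ f) ∷ (f :≤ y :* (κ 12428 :+ κ 120 :* V :+ κ 2 :* wl)) ∷ (j :≤ κ 60 :* y) ∷ [] ⊢ (e :≤ y :* (κ 12548 :+ κ 120 :* V :+ κ 2 :* wl))) (1 ∷ 1 ∷ 1 ∷ 2 ∷ []) refl
          ((inv K ⊗ inv K ⊗ r T) ⊗ E T ∷ ∑₀ (suc T) (λ i → D (T ∸ i) ⊗ 𝕁 i) ∷ ∑₀ (suc T) 𝕁 ∷ ∑ y f ∷ # y ∷ V ∷ w ⊗ ℓ x ∷ [])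
          (subst (_≼ ∑₀ (suc T) (λ i → D (T ∸ i) ⊗ 𝕁 i)) (trans (∑₀-⊖ (suc T) _ _) (cong₂ _⊖_ (∑₀-⊗ (suc T) (inv K ⊗ inv K ⊗ r T) (λ i → a i ⊗ (# 2 ⊖ a (T ∸ i)))) (∑₀-⊗ (suc T) (# 2) 𝕁)))
             (∑₀-mono (suc T) (λ i p → product i (T ∸ i) (ℕ.m+[n∸m]≡n (ℕ.≤-pred p)))) ,
           ∑D𝕁 , ∑f≤ , ∑𝕁)

      -- The sum on the left has T + 1 terms, whereas the only term on the right that grows with T
      -- carries the factor 1/(j + 1), which can be made small after K is fixed.
      E-bound : ℓ (g T) ≼ # 2 ⊗ # T ⊕ # 12 → E T ≼ # 4 ⊗ (# K ⊗ # K) ⊗ (# 12600 ⊕ # 120 ⊗ V ⊕ # 4 ⊗ (w ⊗ # T))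
      E-bound ℓ≤ = subst₂ _≼_ eL eR (⊗-monoˡ (⊗-nonneg (⊗-nonneg (#-nonneg K) (#-nonneg K)) (s-nonneg T)) (≼-trans scaled upper))
        where
        Q = # 12600 ⊕ # 120 ⊗ V ⊕ # 4 ⊗ (w ⊗ # T)
        eL : (# K ⊗ # K ⊗ s T) ⊗ ((inv K ⊗ inv K ⊗ r T) ⊗ E T) ≡ E T
        eL = trans (ring 5 (λ k v r s e → (k :* k :* s) :* ((v :* v :* r) :* e) := (k :* v) :* (k :* v) :* (r :* s) :* e) refl (# K ∷ inv K ∷ r T ∷ s T ∷ E T ∷ []))
          (trans (cong₂ (λ p q → p ⊗ p ⊗ q ⊗ E T) (#⊗inv K′) (rs T)) (ring 1 (λ e → κ 1 :* κ 1 :* κ 1 :* e := e) refl (E T ∷ [])))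
        eR : (# K ⊗ # K ⊗ s T) ⊗ ((# 4 ⊗ r T) ⊗ Q) ≡ # 4 ⊗ (# K ⊗ # K) ⊗ Q
        eR = trans (ring 4 (λ k r s q → (k :* k :* s) :* ((κ 4 :* r) :* q) := (κ 4 :* (k :* k) :* q) :* (r :* s)) refl (# K ∷ r T ∷ s T ∷ Q ∷ [])) (trans (cong ((# 4 ⊗ (# K ⊗ # K) ⊗ Q) ⊗_) (rs T)) (⊗-idʳ _))
        Q-nonneg : # 0 ≼ Q
        Q-nonneg = ⊕-nonneg (⊕-nonneg (#-nonneg 12600) (⊗-nonneg (#-nonneg 120) (#-nonneg (threshold (suc j))))) (⊗-nonneg (#-nonneg 4) (⊗-nonneg (inv-nonneg (suc j)) (#-nonneg T)))
        upper : # y ⊗ (# 12548 ⊕ # 120 ⊗ V ⊕ # 2 ⊗ (w ⊗ ℓ x)) ≼ (# 4 ⊗ r T) ⊗ Q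
        upper = ≼-trans (⊗-monoˡ (#-nonneg y) (lin 4 (λ V w l t → (κ 0 :≤ w :* (κ 2 :* t :+ κ 12 :- l)) ∷ (w :≤ κ 1) ∷ [] ⊢ (κ 12548 :+ κ 120 :* V :+ κ 2 :* (w :* l) :≤ κ 12600 :+ κ 120 :* V :+ κ 4 :* (w :* t))) (2 ∷ 24 ∷ []) refl
            (V ∷ w ∷ ℓ x ∷ # T ∷ []) (⊗-nonneg (inv-nonneg (suc j)) (⊖-nonneg ℓ≤) , w≤1)))
          (⊗-monoʳ Q-nonneg y≤4r)

-- Decidability of prime powers, and windows of cells under Mertens' theorem.

module Windows where
  open Rationals
  open LinearArithmetic
  open Sums
  open Logarithms
  open Multiplicative
  open Stirling
  open SelbergFormula
  open ShortIntervals
  open GeometricGrid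
  open import Defs using (IsPrimePower)
  open import Data.Nat using (ℕ; zero; suc; _+_; _*_; _^_; _≤_; _<_; z≤n; s≤s; _∸_)
  import Data.Nat.Properties as ℕ
  open import Data.Nat.Divisibility using (_∣_; ∣1⇒≡1)
  open import Data.Nat.Primality using (Prime; euclidsLemma; ¬prime[1]; prime⇒nonTrivial)
  open import Data.Nat.Base using (nonTrivial⇒n>1; >-nonZero)
  open import Data.Vec using ([]; _∷_)
  open import Data.List using ([]; _∷_)
  open import Data.Product using (_×_; _,_; proj₁; proj₂; ∃)
  open import Data.Sum using (_⊎_; inj₁; inj₂)
  open import Data.Empty using (⊥-elim)
  open import Relation.Nullary using (Dec; yes; no)
  open import Relation.Binary.PropositionalEquality

  prime∣^ : ∀ {p r} k → Prime p → Prime r → p ∣ r ^ k → p ≡ r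
  prime∣^ zero pp pr d = ⊥-elim (¬prime[1] (subst Prime (∣1⇒≡1 d) pp))
  prime∣^ {r = r} (suc k) pp pr d with euclidsLemma r (r ^ k) pp d
  ... | inj₁ x = prime∣prime pp pr x
  ... | inj₂ y = prime∣^ k pp pr y

  primePower>1 : ∀ {n} → IsPrimePower n → 1 < n
  primePower>1 (p , suc k , pp , _ , refl) = ℕ.≤-trans (nonTrivial⇒n>1 p ⦃ prime⇒nonTrivial pp ⦄)
    (ℕ.m≤m*n p (p ^ k) ⦃ ℕ.m^n≢0 p k ⦃ >-nonZero (ℕ.<⇒≤ (nonTrivial⇒n>1 p ⦃ prime⇒nonTrivial pp ⦄)) ⦄ ⦄)

  primePower? : ∀ n → Dec (IsPrimePower n)
  primePower? zero = no λ pp → ℕ.<⇒≱ (primePower>1 pp) z≤n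
  primePower? (suc zero) = no λ pp → ℕ.<-irrefl refl (primePower>1 pp)
  primePower? (suc (suc n)) with primePower⊎ n
  ... | p , pp , p∣n , inj₁ (yes′ , _) = yes yes′
  ... | p , pp , p∣n , inj₂ (q , pq , q∣n , ne) = no λ { (r , k , pr , _ , e) →
    ne (trans (prime∣^ k pq pr (subst (suc q ∣_) e q∣n)) (sym (prime∣^ k pp pr (subst (suc p ∣_) e p∣n)))) }

  extend : ∀ (P : ℕ → Set) {n} → (∀ i → i < n → P i) → P n → ∀ i → i < suc n → P i
  extend P f x i p with ℕ.m≤n⇒m<n∨m≡n (ℕ.≤-pred p)
  ... | inj₁ q = f i q
  ... | inj₂ refl = x

  abstract
    -- The bounded error in Mertens' theorem becomes O(K) in the sum of the aᵢ. Excluding windows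
    -- that are low, or high, throughout needs more than 192 K, respectively 6912 K / 31, cells.
    windowLength : ℕ → ℕ
    windowLength K = 400 * K

    #windowLength : ∀ K → # (windowLength K) ≡ # 400 ⊗ # K
    #windowLength K = #-* 400 K

    windowLength≥1 : ∀ K → 1 ≤ windowLength (suc K)
    windowLength≥1 K = s≤s z≤n

  ∸-suc : ∀ {i T} → i ≤ T → suc T ∸ i ≡ suc (T ∸ i)
  ∸-suc z≤n = refl
  ∸-suc (s≤s p) = ∸-suc p

  module Window {X} (L : LogApprox X) (K′ : ℕ) (K≥8 : 8 ≤ suc K′) where
    open LogApprox L
    open VonMangoldt L
    open Logarithm L hiding (T; V; W)
    open Selberg L
    open Intervals L
    open Grid K′
    open Cells L K′

    private
      invK≤ : # 8 ⊗ inv K ≼ # 1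
      invK≤ = subst (# 8 ⊗ inv K ≼_) (#⊗inv K′) (⊗-monoʳ (inv-nonneg K) (#-mono K≥8))

    ℓ-^ : ∀ m i → ℓ (suc m ^ i) ≡ # i ⊗ ℓ (suc m)
    ℓ-^ m zero = trans ℓ-1 (sym (⊗-zeroˡ _))
    ℓ-^ m (suc i) with suc m ^ i | ℕ.m^n>0 (suc m) i | ℓ-^ m i
    ... | suc k | _ | ih = trans (ℓ-* m k) (trans (cong (ℓ (suc m) ⊕_) ih) (trans (ring 2 (λ l i → l :+ i :* l := (κ 1 :+ i) :* l) refl (ℓ (suc m) ∷ # i ∷ [])) (cong (_⊗ ℓ (suc m)) (sym (#-+ 1 i)))))

    ℓ-*′ : ∀ {m n} → 1 ≤ m → 1 ≤ n → ℓ (m * n) ≡ ℓ m ⊕ ℓ n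
    ℓ-*′ {suc m} {suc n} _ _ = ℓ-* m n

    ℓ-mono′ : ∀ {m n} → 1 ≤ m → m ≤ n → n ≤ X → ℓ m ≼ ℓ n ⊕ # 12
    ℓ-mono′ {suc m} _ = ℓ-mono

    ℓ2≤2 : 2 ≤ X → ℓ 2 ≼ # 2
    ℓ2≤2 p = lin 3 (λ a b i → (a :- b :≤ i :+ i :* i) ∷ (b :≡ κ 0) ∷ (i :≡ κ 1) ∷ (i :* i :≡ i :* κ 1) ∷ [] ⊢ (a :≤ κ 2)) (1 ∷ 1 ∷ 2 ∷ 1 ∷ []) refl (ℓ 2 ∷ ℓ 1 ∷ inv 1 ∷ []) (ℓ-hi 0 p , ℓ-1 , inv-1 , cong (inv 1 ⊗_) inv-1)

    ℓg≤ : ∀ i → 2 ≤ X → 2 ^ i ≤ X → ℓ (g i) ≼ # 2 ⊗ # i ⊕ # 12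
    ℓg≤ i p q = ≼-trans (ℓ-mono′ (g≥1 i) (g≤2^ i) q) (⊕-mono (≼-trans (≡⇒≼ (ℓ-^ 1 i)) (subst (# i ⊗ ℓ 2 ≼_) (⊗-comm _ _) (⊗-monoˡ (#-nonneg i) (ℓ2≤2 p)))) ≼-refl)

    -- Logarithm of the grid ratio, about 1/K. For K ≥ 8 the product with K lies between 1 - 2/8 =
    -- 3/4 and 1 + 1/8 = 9/8.
    rate : R
    rate = ℓ K₁ ⊖ ℓ K

    rate-lo : suc K ≤ X → # 3 ≼ # 4 ⊗ (# K ⊗ rate)
    rate-lo p = lin 3 (λ k v d → (κ 0 :≤ k :* (d :- (v :- κ 2 :* (v :* v)))) ∷ (κ 1 :≡ k :* v) ∷ (v :* (k :* v) :≡ v :* κ 1) ∷ (κ 8 :* v :≤ κ 1) ∷ [] ⊢ (κ 3 :≤ κ 4 :* (k :* d))) (4 ∷ 4 ∷ 8 ∷ 1 ∷ []) refl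
      (# K ∷ inv K ∷ rate ∷ []) (⊗-nonneg (#-nonneg K) (⊖-nonneg (ℓ-lo K′ p)) , sym (#⊗inv K′) , cong (inv K ⊗_) (#⊗inv K′) , invK≤)

    rate-hi : suc K ≤ X → # 8 ⊗ (# K ⊗ rate) ≼ # 9
    rate-hi p = lin 3 (λ k v d → (κ 0 :≤ k :* ((v :+ v :* v) :- d)) ∷ (k :* v :≡ κ 1) ∷ (v :* (k :* v) :≡ v :* κ 1) ∷ (κ 8 :* v :≤ κ 1) ∷ [] ⊢ (κ 8 :* (k :* d) :≤ κ 9)) (8 ∷ 8 ∷ 8 ∷ 1 ∷ []) refl
      (# K ∷ inv K ∷ rate ∷ []) (⊗-nonneg (#-nonneg K) (⊖-nonneg (ℓ-hi K′ p)) , #⊗inv K′ , cong (inv K ⊗_) (#⊗inv K′) , invK≤)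

    -- Apply `ℓ` to g(i) K^i ≤ (K + 1)^i ≤ 2 g(i) K^i. Its imperfect monotonicity costs 12, and the
    -- factor 2 costs ℓ(2) ≤ 2 more on one side.
    ℓg-bounds : ∀ i → 2 * K₁ ^ i ≤ X → 2 ≤ X → (# i ⊗ rate ⊖ # 14 ≼ ℓ (g i)) × (ℓ (g i) ≼ # i ⊗ rate ⊕ # 12)
    ℓg-bounds i p 2≤X =
      lin 6 (λ i a b lg l2 t → (i :* a :≤ (l2 :+ (lg :+ i :* b)) :+ κ 12) ∷ (l2 :≤ κ 2) ∷ [] ⊢ (i :* (a :- b) :- κ 14 :≤ lg)) (1 ∷ 1 ∷ []) refl ρs
        (subst₂ _≼_ (ℓ-^ K i) (cong (_⊕ # 12) (trans (ℓ-*′ (s≤s z≤n) 1≤gK) (cong (ℓ 2 ⊕_) ℓgK))) (ℓ-mono′ (ℕ.m^n>0 K₁ i) up (ℕ.≤-trans (ℕ.*-monoʳ-≤ 2 (≤g⁻ i ℕ.≤-refl)) p)) , ℓ2≤2 2≤X) ,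
      lin 6 (λ i a b lg l2 t → (lg :+ i :* b :≤ i :* a :+ κ 12) ∷ [] ⊢ (lg :≤ i :* (a :- b) :+ κ 12)) (1 ∷ []) refl ρs
        (subst₂ _≼_ ℓgK (cong (_⊕ # 12) (ℓ-^ K i)) (ℓ-mono′ 1≤gK (≤g⁻ i ℕ.≤-refl) (ℕ.≤-trans (ℕ.m≤m+n (K₁ ^ i) _) p)))
      where
      ρs = # i ∷ ℓ K₁ ∷ ℓ K ∷ ℓ (g i) ∷ ℓ 2 ∷ # 0 ∷ []
      1≤gK : 1 ≤ g i * K ^ i
      1≤gK = ℕ.*-mono-≤ (g≥1 i) (K^≥1 i)
      ℓgK : ℓ (g i * K ^ i) ≡ ℓ (g i) ⊕ # i ⊗ ℓ K
      ℓgK = trans (ℓ-*′ (g≥1 i) (K^≥1 i)) (cong (ℓ (g i) ⊕_) (ℓ-^ K′ i))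
      up : K₁ ^ i ≤ 2 * (g i * K ^ i)
      up = ℕ.≤-trans (ℕ.<⇒≤ (<g⁻ i ℕ.≤-refl)) (ℕ.≤-trans (ℕ.*-monoˡ-≤ (K ^ i) (ℕ.+-monoˡ-≤ (g i) (g≥1 i))) (ℕ.≤-reflexive (trans (ℕ.*-distribʳ-+ (K ^ i) (g i) (g i)) (cong (g i * K ^ i +_) (sym (ℕ.+-identityʳ _))))))

    -- On the cell (g i, g (i+1)] the weight 1/n agrees with s i up to the factor ρ.
    cell-weight : ∀ i → (M (g (suc i)) ⊖ M (g i) ≼ 𝕁 i ⊗ s i) × (𝕁 i ⊗ s i ≼ ρ ⊗ (M (g (suc i)) ⊖ M (g i)))
    cell-weight i =
      subst (M (g (suc i)) ⊖ M (g i) ≼_) lhs (range-mono (λ k → Λ (suc k) ⊗ inv (suc k)) (λ k → s i ⊗ Λ (suc k)) (g-mono (ℕ.n≤1+n i)) (λ k p _ → subst (Λ (suc k) ⊗ inv (suc k) ≼_) (⊗-comm _ _) (⊗-monoˡ (Λ-nonneg k) (lo k p)))) ,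
      subst₂ _≼_ lhs rhs (range-mono (λ k → s i ⊗ Λ (suc k)) (λ k → ρ ⊗ (Λ (suc k) ⊗ inv (suc k))) (g-mono (ℕ.n≤1+n i)) (λ k _ q → subst (s i ⊗ Λ (suc k) ≼_) (ring 3 (λ r v l → (r :* v) :* l := r :* (l :* v)) refl (ρ ∷ inv (suc k) ∷ Λ (suc k) ∷ [])) (⊗-monoʳ (Λ-nonneg k) (hi k q))))
      where
      lhs : ∑ (g (suc i)) (λ n → s i ⊗ Λ n) ⊖ ∑ (g i) (λ n → s i ⊗ Λ n) ≡ 𝕁 i ⊗ s i
      lhs = trans (cong₂ _⊖_ (∑₀-⊗ (g (suc i)) (s i) _) (∑₀-⊗ (g i) (s i) _)) (ring 3 (λ s p q → s :* q :- s :* p := (q :- p) :* s) refl (s i ∷ ψ (g i) ∷ ψ (g (suc i)) ∷ []))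
      rhs : ∑ (g (suc i)) (λ n → ρ ⊗ (Λ n ⊗ inv n)) ⊖ ∑ (g i) (λ n → ρ ⊗ (Λ n ⊗ inv n)) ≡ ρ ⊗ (M (g (suc i)) ⊖ M (g i))
      rhs = trans (cong₂ _⊖_ (∑₀-⊗ (g (suc i)) ρ _) (∑₀-⊗ (g i) ρ _)) (ring 3 (λ s p q → s :* q :- s :* p := s :* (q :- p)) refl (ρ ∷ M (g i) ∷ M (g (suc i)) ∷ []))
      lo : ∀ k → g i ≤ k → inv (suc k) ≼ s i
      lo k p = lin 4 (λ n v r s → (κ 0 :≤ (v :* s) :* (n :- r)) ∷ (s :* (n :* v) :≡ s :* κ 1) ∷ (v :* κ 1 :≡ v :* (r :* s)) ∷ [] ⊢ (v :≤ s)) (1 ∷ 1 ∷ 1 ∷ []) refl (# (suc k) ∷ inv (suc k) ∷ r i ∷ s i ∷ [])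
        (⊗-nonneg (⊗-nonneg (inv-nonneg (suc k)) (s-nonneg i)) (⊖-nonneg (≼-trans (r≤g+1 i) (subst (_≼ # (suc k)) (#-+ 1 (g i)) (#-mono (s≤s p))))) , cong (s i ⊗_) (#⊗inv k) , cong (inv (suc k) ⊗_) (sym (rs i)))
      hi : ∀ k → k < g (suc i) → s i ≼ ρ ⊗ inv (suc k)
      hi k q = lin 5 (λ n v r s ρ → (κ 0 :≤ (v :* s) :* (r :* ρ :- n)) ∷ (s :* κ 1 :≡ s :* (n :* v)) ∷ ((ρ :* v) :* (r :* s) :≡ (ρ :* v) :* κ 1) ∷ [] ⊢ (s :≤ ρ :* v)) (1 ∷ 1 ∷ 1 ∷ []) refl (# (suc k) ∷ inv (suc k) ∷ r i ∷ s i ∷ ρ ∷ [])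
        (⊗-nonneg (⊗-nonneg (inv-nonneg (suc k)) (s-nonneg i)) (⊖-nonneg (≼-trans (#-mono q) (g≤r (suc i)))) , cong (s i ⊗_) (sym (#⊗inv k)) , cong (ρ ⊗ inv (suc k) ⊗_) (rs i))

    mertens-diff : ∀ {m n} → 1 ≤ m → 1 ≤ n → m ≤ X → n ≤ X → (ℓ n ⊖ ℓ m ⊖ # 70 ≼ M n ⊖ M m) × (M n ⊖ M m ≼ ℓ n ⊖ ℓ m ⊕ # 70)
    mertens-diff {suc m} {suc n} _ _ p q =
      lin 4 (λ a b c d → (b :≤ d :+ κ 6) ∷ (c :≤ a :+ κ 64) ∷ [] ⊢ (b :- a :- κ 70 :≤ d :- c)) (1 ∷ 1 ∷ []) refl ρs (proj₁ (mertens n q) , proj₂ (mertens m p)) ,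
      lin 4 (λ a b c d → (d :≤ b :+ κ 64) ∷ (a :≤ c :+ κ 6) ∷ [] ⊢ (d :- c :≤ b :- a :+ κ 70)) (1 ∷ 1 ∷ []) refl ρs (proj₂ (mertens n q) , proj₁ (mertens m p))
      where ρs = ℓ (suc m) ∷ ℓ (suc n) ∷ M (suc m) ∷ M (suc n) ∷ []

    module _ (2≤X : 2 ≤ X) (b : ℕ) (n : ℕ) (X≥ : 2 * K₁ ^ (b + n) ≤ X) (K₁≤X : suc K ≤ X) where
      private
        N : R
        N = # n
        Q : R
        Q = ∑₀ n (λ i → 𝕁 (b + i) ⊗ s (b + i))
        ∑a : R
        ∑a = ∑₀ n (λ i → a (b + i))
        Δ : R
        Δ = M (g (b + n)) ⊖ M (g b)

        X≥b : 2 * K₁ ^ b ≤ X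
        X≥b = ℕ.≤-trans (ℕ.*-monoʳ-≤ 2 (ℕ.^-monoʳ-≤ K₁ (ℕ.m≤m+n b n))) X≥

        g≤X : ∀ i → 2 * K₁ ^ i ≤ X → g i ≤ X
        g≤X i p = ℕ.≤-trans (g≤K₁^ i) (ℕ.≤-trans (ℕ.m≤m+n _ _) p)

        tele : ∑₀ n (λ i → M (g (suc (b + i))) ⊖ M (g (b + i))) ≡ Δ
        tele = trans (∑₀-cong n (λ i _ → cong (λ t → M (g t) ⊖ M (g (b + i))) (sym (ℕ.+-suc b i)))) (trans (∑₀-telescope n (λ i → M (g (b + i)))) (cong (λ t → M (g (b + n)) ⊖ M (g t)) (ℕ.+-identityʳ b)))

        ∑a≡ : ∑a ≡ # K ⊗ Q
        ∑a≡ = ∑₀-⊗ n (# K) _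

        Δ≤Q : Δ ≼ Q
        Δ≤Q = subst (_≼ Q) tele (∑₀-mono n (λ i _ → proj₁ (cell-weight (b + i))))

        Q≤ρΔ : Q ≼ ρ ⊗ Δ
        Q≤ρΔ = subst (Q ≼_) (trans (∑₀-⊗ n ρ _) (cong (ρ ⊗_) tele)) (∑₀-mono n (λ i _ → proj₂ (cell-weight (b + i))))

        Δ-lo : N ⊗ rate ⊖ # 96 ≼ Δ
        Δ-lo = lin 7 (λ b n t lb lt d z → (lt :- lb :- κ 70 :≤ d) ∷ ((b :+ n) :* t :- κ 14 :≤ lt) ∷ (lb :≤ b :* t :+ κ 12) ∷ [] ⊢ (n :* t :- κ 96 :≤ d)) (1 ∷ 1 ∷ 1 ∷ []) refl
          (# b ∷ N ∷ rate ∷ ℓ (g b) ∷ ℓ (g (b + n)) ∷ Δ ∷ # 0 ∷ [])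
          (proj₁ (mertens-diff (g≥1 b) (g≥1 (b + n)) (g≤X b X≥b) (g≤X (b + n) X≥)) , subst (λ t → t ⊗ rate ⊖ # 14 ≼ ℓ (g (b + n))) (#-+ b n) (proj₁ (ℓg-bounds (b + n) X≥ 2≤X)) , proj₂ (ℓg-bounds b X≥b 2≤X))

        Δ-hi : Δ ≼ N ⊗ rate ⊕ # 96
        Δ-hi = lin 7 (λ b n t lb lt d z → (d :≤ lt :- lb :+ κ 70) ∷ (lt :≤ (b :+ n) :* t :+ κ 12) ∷ (b :* t :- κ 14 :≤ lb) ∷ [] ⊢ (d :≤ n :* t :+ κ 96)) (1 ∷ 1 ∷ 1 ∷ []) refl
          (# b ∷ N ∷ rate ∷ ℓ (g b) ∷ ℓ (g (b + n)) ∷ Δ ∷ # 0 ∷ [])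
          (proj₂ (mertens-diff (g≥1 b) (g≥1 (b + n)) (g≤X b X≥b) (g≤X (b + n) X≥)) , subst (λ t → ℓ (g (b + n)) ≼ t ⊗ rate ⊕ # 12) (#-+ b n) (proj₂ (ℓg-bounds (b + n) X≥ 2≤X)) , proj₁ (ℓg-bounds b X≥b 2≤X))

      -- Telescoping M over the cells gives N · `rate` up to 96 = 70 + 14 + 12, where 70 is the
      -- error of `mertens-diff`; then K · `rate` ≥ 3/4. In `window-hi` two factors 9/8 arise, from
      -- `rate` and from ρ, hence 81/64.
      window-lo : # 3 ⊗ N ⊖ # 384 ⊗ # K ≼ # 4 ⊗ ∑a
      window-lo = subst (λ t → # 3 ⊗ N ⊖ # 384 ⊗ # K ≼ # 4 ⊗ t) (sym ∑a≡)
        (lin 5 (λ n k t d q → (κ 0 :≤ k :* (d :- (n :* t :- κ 96))) ∷ (κ 0 :≤ k :* (q :- d)) ∷ (κ 0 :≤ n :* (κ 4 :* (k :* t) :- κ 3)) ∷ [] ⊢ (κ 3 :* n :- κ 384 :* k :≤ κ 4 :* (k :* q))) (4 ∷ 4 ∷ 1 ∷ []) refl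
          (N ∷ # K ∷ rate ∷ Δ ∷ Q ∷ []) (⊗-nonneg (#-nonneg K) (⊖-nonneg Δ-lo) , ⊗-nonneg (#-nonneg K) (⊖-nonneg Δ≤Q) , ⊗-nonneg (#-nonneg n) (⊖-nonneg (rate-lo K₁≤X))))

      window-hi : # 64 ⊗ ∑a ≼ # 81 ⊗ N ⊕ # 6912 ⊗ # K
      window-hi = subst (λ t → # 64 ⊗ t ≼ # 81 ⊗ N ⊕ # 6912 ⊗ # K) (sym ∑a≡)
        (lin 6 (λ n k t d q v → (κ 0 :≤ k :* ((κ 1 :+ v) :* d :- q)) ∷ (κ 0 :≤ (k :* (κ 1 :+ v)) :* (n :* t :+ κ 96 :- d)) ∷ (κ 0 :≤ ((κ 1 :+ v) :* n) :* (κ 9 :- κ 8 :* (k :* t))) ∷ (κ 0 :≤ (κ 9 :* n :+ κ 768 :* k) :* (κ 1 :- κ 8 :* v)) ∷ []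
            ⊢ (κ 64 :* (k :* q) :≤ κ 81 :* n :+ κ 6912 :* k)) (64 ∷ 64 ∷ 8 ∷ 1 ∷ []) refl
          (N ∷ # K ∷ rate ∷ Δ ∷ Q ∷ inv K ∷ [])
          (⊗-nonneg (#-nonneg K) (⊖-nonneg Q≤ρΔ) , ⊗-nonneg (⊗-nonneg (#-nonneg K) ρ-nonneg) (⊖-nonneg Δ-hi) , ⊗-nonneg (⊗-nonneg ρ-nonneg (#-nonneg n)) (⊖-nonneg (rate-hi K₁≤X)) ,
           ⊗-nonneg (⊕-nonneg (⊗-nonneg (#-nonneg 9) (#-nonneg n)) (⊗-nonneg (#-nonneg 768) (#-nonneg K))) (⊖-nonneg invK≤)))

    -- Small when aᵢ is near 0 or 2 and its successor is close to it. It equals 2aᵢ(1 - aᵢ₊₁) +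
    -- aᵢ₊₁², so values slightly above 2 do no harm.
    c : ℕ → R
    c i = a i ⊗ (# 2 ⊖ a i) ⊕ (a i ⊖ a (suc i)) ⊗ (a i ⊖ a (suc i))

    Low High Event : ℕ → Set
    Low i = # 4 ⊗ a i ≼ # 1
    High i = # 7 ≼ # 4 ⊗ a i
    Event i = # 7 ≼ # 16 ⊗ c i

    private
      split-at-1 : ∀ x → # 0 ≼ (# 1 ⊖ # 4 ⊗ x) ⊗ (# 7 ⊖ # 4 ⊗ x) → # 4 ⊗ x ≼ # 1 ⊎ # 7 ≼ # 4 ⊗ x
      split-at-1 x p with ≼-total (# 4 ⊗ x) (# 4)
      ... | inj₁ x≤1 with ≼-total (# 4 ⊗ x) (# 1)
      ... | inj₁ q = inj₁ q
      ... | inj₂ q = inj₁ (lin/ 2 1 (λ x → (κ 0 :≤ (κ 1 :- κ 4 :* x) :* (κ 7 :- κ 4 :* x)) ∷ (κ 0 :≤ (κ 4 :* x :- κ 1) :* (κ 4 :- κ 4 :* x)) ∷ [] ⊢ (κ 4 :* x :≤ κ 1)) (1 ∷ 1 ∷ []) refl (x ∷ []) (p , ⊗-nonneg (⊖-nonneg q) (⊖-nonneg x≤1)))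
      split-at-1 x p | inj₂ x≥1 with ≼-total (# 7) (# 4 ⊗ x)
      ... | inj₁ q = inj₂ q
      ... | inj₂ q = inj₂ (lin/ 2 1 (λ x → (κ 0 :≤ (κ 1 :- κ 4 :* x) :* (κ 7 :- κ 4 :* x)) ∷ (κ 0 :≤ (κ 4 :* x :- κ 4) :* (κ 7 :- κ 4 :* x)) ∷ [] ⊢ (κ 7 :≤ κ 4 :* x)) (1 ∷ 1 ∷ []) refl (x ∷ []) (p , ⊗-nonneg (⊖-nonneg x≥1) (⊖-nonneg q)))

    -- The threshold 7/16 is the value of x (2 - x) at x = 1/4 and at x = 7/4.
    classify : ∀ i → Event i ⊎ Low i ⊎ High i
    classify i with ≼-total (# 7) (# 16 ⊗ c i)
    ... | inj₁ e = inj₁ e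
    ... | inj₂ ¬e = inj₂ (split-at-1 (a i) (lin 2 (λ a b → (κ 16 :* (a :* (κ 2 :- a) :+ (a :- b) :* (a :- b)) :≤ κ 7) ∷ (κ 0 :≤ (a :- b) :* (a :- b)) ∷ [] ⊢ (κ 0 :≤ (κ 1 :- κ 4 :* a) :* (κ 7 :- κ 4 :* a))) (1 ∷ 16 ∷ []) refl
        (a i ∷ a (suc i) ∷ []) (¬e , square-nonneg _)))

    -- The squares of aᵢ cancel in `c i`; what remains, 2aᵢ(1 - aᵢ₊₁) + aᵢ₊₁², is at least 43/16 for
    -- such values.
    jump-up : ∀ i → Low i → High (suc i) → Event i
    jump-up i lo hi = lin 2 (λ a b → (κ 0 :≤ (κ 1 :- κ 4 :* a) :* (κ 4 :* b :- κ 7)) ∷ (κ 0 :≤ (κ 4 :* b :- κ 7) :* (κ 4 :* b :- κ 7)) ∷ (κ 4 :* a :≤ κ 1) ∷ (κ 7 :≤ κ 4 :* b) ∷ [] ⊢ (κ 7 :≤ κ 16 :* (a :* (κ 2 :- a) :+ (a :- b) :* (a :- b)))) (2 ∷ 1 ∷ 6 ∷ 12 ∷ []) refl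
      (a i ∷ a (suc i) ∷ []) (⊗-nonneg (⊖-nonneg lo) (⊖-nonneg hi) , ⊗-nonneg (⊖-nonneg hi) (⊖-nonneg hi) , lo , hi)

    jump-down : ∀ i → High i → Low (suc i) → Event i
    jump-down i hi lo = lin 2 (λ a b → (κ 0 :≤ (κ 4 :* a :- κ 7) :* (κ 1 :- κ 4 :* b)) ∷ (κ 0 :≤ b :* b) ∷ (κ 7 :≤ κ 4 :* a) ∷ (κ 4 :* b :≤ κ 1) ∷ [] ⊢ (κ 7 :≤ κ 16 :* (a :* (κ 2 :- a) :+ (a :- b) :* (a :- b)))) (2 ∷ 16 ∷ 6 ∷ 14 ∷ []) refl
      (a i ∷ a (suc i) ∷ []) (⊗-nonneg (⊖-nonneg hi) (⊖-nonneg lo) , square-nonneg _ , hi , lo)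

    -- Without an event every index is low or high, and the side cannot change from one index to the
    -- next.
    scan : ∀ b n → (∃ λ i → i < n × Event (b + i)) ⊎ ((∀ i → i < n → Low (b + i)) ⊎ (∀ i → i < n → High (b + i)))
    scan b zero = inj₂ (inj₁ λ _ ())
    scan b (suc zero) with classify (b + 0)
    ... | inj₁ e = inj₁ (0 , s≤s z≤n , e)
    ... | inj₂ (inj₁ lo) = inj₂ (inj₁ λ { zero _ → lo ; (suc _) (s≤s ()) })
    ... | inj₂ (inj₂ hi) = inj₂ (inj₂ λ { zero _ → hi ; (suc _) (s≤s ()) })
    scan b (suc (suc n)) with scan b (suc n) | classify (b + suc n)
    ... | inj₁ (i , p , e) | _ = inj₁ (i , ℕ.m<n⇒m<1+n p , e)
    ... | inj₂ _ | inj₁ e = inj₁ (suc n , ℕ.≤-refl , e)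
    ... | inj₂ (inj₁ los) | inj₂ (inj₁ lo) = inj₂ (inj₁ λ i p → extend (λ i → Low (b + i)) los lo i p)
    ... | inj₂ (inj₂ his) | inj₂ (inj₂ hi) = inj₂ (inj₂ λ i p → extend (λ i → High (b + i)) his hi i p)
    ... | inj₂ (inj₁ los) | inj₂ (inj₂ hi) = inj₁ (n , ℕ.m≤n⇒m≤1+n ℕ.≤-refl , jump-up (b + n) (los n ℕ.≤-refl) (subst High (ℕ.+-suc b n) hi))
    ... | inj₂ (inj₂ his) | inj₂ (inj₁ lo) = inj₁ (n , ℕ.m≤n⇒m≤1+n ℕ.≤-refl , jump-down (b + n) (his n ℕ.≤-refl) (subst Low (ℕ.+-suc b n) lo))

    len : ℕ
    len = windowLength K

    -- Mertens' theorem excludes a window that is low or high throughout: in units of K, 3 · 400 -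
    -- 384 > 400 and 81 · 400 + 6912 < 112 · 400.
    window-event : 2 ≤ X → suc K ≤ X → ∀ b → 2 * K₁ ^ (b + len) ≤ X → ∃ λ i → i < len × Event (b + i)
    window-event 2≤X K₁≤X b X≥ with scan b len
    ... | inj₁ e = e
    ... | inj₂ (inj₁ los) = ⊥-elim (ℕ.<⇒≱ (s≤s z≤n) (#-cancel-≤ 1 0 (lin/ 415 3 (λ k n s → (κ 3 :* n :- κ 384 :* k :≤ κ 4 :* s) ∷ (κ 4 :* s :≤ n :* κ 1) ∷ (κ 400 :* k :≡ n) ∷ (κ 1 :≤ k) ∷ [] ⊢ (κ 1 :≤ κ 0)) (1 ∷ 1 ∷ 2 ∷ 416 ∷ []) refl
        (# K ∷ # len ∷ ∑₀ len (λ i → a (b + i)) ∷ [])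
        (window-lo 2≤X b len X≥ K₁≤X , subst₂ _≼_ (∑₀-⊗ len (# 4) _) (∑₀-const len (# 1)) (∑₀-mono len los) , sym (#windowLength K) , 1≼# K′))))
    ... | inj₂ (inj₂ his) = ⊥-elim (ℕ.<⇒≱ (s≤s z≤n) (#-cancel-≤ 1 0 (lin/ 5487 3 (λ k n s → (κ 64 :* s :≤ κ 81 :* n :+ κ 6912 :* k) ∷ (n :* κ 7 :≤ κ 4 :* s) ∷ (κ 400 :* k :≡ n) ∷ (κ 1 :≤ k) ∷ [] ⊢ (κ 1 :≤ κ 0)) (1 ∷ 16 ∷ 31 ∷ 5488 ∷ []) refl
        (# K ∷ # len ∷ ∑₀ len (λ i → a (b + i)) ∷ [])
        (window-hi 2≤X b len X≥ K₁≤X , subst₂ _≼_ (∑₀-const len (# 7)) (∑₀-⊗ len (# 4) _) (∑₀-mono len his) , sym (#windowLength K) , 1≼# K′))))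

-- The energy argument: every large grid interval of three cells contains a prime power.

module PrimePowers where
  open Rationals
  open LinearArithmetic
  open Sums
  open Logarithms
  open Multiplicative
  open Stirling
  open SelbergFormula
  open ShortIntervals
  open GeometricGrid
  open Windows
  open import Defs using (IsPrimePower)
  open import Data.Nat using (ℕ; zero; suc; _+_; _*_; _^_; _≤_; _<_; z≤n; s≤s; _<?_; _∸_; pred)
  import Data.Nat.Properties as ℕ
  open import Data.Nat.DivMod using (_/_; m/n*n≤m; m≡m%n+[m/n]*n; m%n<n; m*n/n≡m; /-monoˡ-≤)
  open import Data.Nat.Base using (>-nonZero)
  open import Data.Vec using ([]; _∷_)
  open import Data.List using ([]; _∷_)
  open import Data.Product using (_×_; _,_; ∃)
  open import Data.Empty using (⊥-elim)
  open import Relation.Nullary using (yes; no)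
  open import Relation.Nullary.Decidable using (_×-dec_)
  open import Relation.Binary.PropositionalEquality

  module Energy {X} (L : LogApprox X) (K′ : ℕ) (K≥8 : 8 ≤ suc K′) (j T : ℕ) (X≥ : 2 * suc (suc K′) ^ (3 + T) ≤ X) where
    open LogApprox L
    open VonMangoldt L
    open Logarithm L hiding (T; V; W)
    open Selberg L
    open Intervals L
    open Grid K′
    open Cells L K′
    open Window L K′ K≥8

    private
      w = inv (suc j)
      V = # (threshold (suc j))

      K₁^≤X : ∀ {i} → i ≤ 3 + T → 2 * K₁ ^ i ≤ X
      K₁^≤X p = ℕ.≤-trans (ℕ.*-monoʳ-≤ 2 (ℕ.^-monoʳ-≤ K₁ p)) X≥

      g≤X : ∀ {i} → i ≤ 3 + T → g i ≤ X
      g≤X {i} p = ℕ.≤-trans (g≤K₁^ i) (ℕ.≤-trans (ℕ.m≤m+n _ _) (K₁^≤X p))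

      K₁≤X : suc K ≤ X
      K₁≤X = ℕ.≤-trans (ℕ.≤-reflexive (sym (ℕ.^-identityʳ K₁))) (ℕ.≤-trans (ℕ.m≤m+n _ _) (K₁^≤X {1} (s≤s z≤n)))

      2≤X : 2 ≤ X
      2≤X = ℕ.≤-trans (s≤s (s≤s z≤n)) K₁≤X

      2^≤X : ∀ {i} → i ≤ 3 + T → 2 ^ i ≤ X
      2^≤X {i} p = ℕ.≤-trans (ℕ.^-monoˡ-≤ i (s≤s (s≤s z≤n))) (ℕ.≤-trans (ℕ.m≤m+n _ _) (K₁^≤X p))

    -- `δ` is the excess over 2 that `a-density` permits. Since aᵢ (2 - aᵢ) can be as low as -aᵢ δᵢ,
    -- multiplying by the crude bound 120 K on aᵢ gives a correction `e` that restores
    -- nonnegativity.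
    δ e : ℕ → R
    δ i = # 2 ⊗ # K ⊗ w ⊕ (V ⊕ # 2) ⊗ # K ⊗ s i
    e i = # 120 ⊗ # K ⊗ δ i

    δ-nonneg : ∀ i → # 0 ≼ δ i
    δ-nonneg i = ⊕-nonneg (⊗-nonneg (⊗-nonneg (#-nonneg 2) (#-nonneg K)) (inv-nonneg (suc j))) (⊗-nonneg (⊗-nonneg (⊕-nonneg (#-nonneg (threshold (suc j))) (#-nonneg 2)) (#-nonneg K)) (s-nonneg i))

    e-nonneg : ∀ i → # 0 ≼ e i
    e-nonneg i = ⊗-nonneg (⊗-nonneg (#-nonneg 120) (#-nonneg K)) (δ-nonneg i)

    defect : ∀ i → i ≤ suc T → # 0 ≼ a i ⊗ (# 2 ⊖ a i) ⊕ e i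
    defect i p = lin 3 (λ a d k → (κ 0 :≤ a :* ((κ 2 :+ d) :- a)) ∷ (κ 0 :≤ d :* (κ 120 :* k :- a)) ∷ [] ⊢ (κ 0 :≤ a :* (κ 2 :- a) :+ κ 120 :* k :* d)) (1 ∷ 1 ∷ []) refl (a i ∷ δ i ∷ # K ∷ [])
      (⊗-nonneg (a-nonneg i) (⊖-nonneg (a-density j i q)) , ⊗-nonneg (δ-nonneg i) (⊖-nonneg (a≤120K i q)))
      where
      q : g (suc i) ≤ X
      q = g≤X (s≤s (ℕ.m≤n⇒m≤1+n p))

    c-defect : ∀ i → i ≤ suc T → # 0 ≼ c i ⊕ e i
    c-defect i p = lin 3 (λ p q e → (κ 0 :≤ p :+ e) ∷ (κ 0 :≤ q) ∷ [] ⊢ (κ 0 :≤ (p :+ q) :+ e)) (1 ∷ 1 ∷ []) refl (_ ∷ _ ∷ e i ∷ []) (defect i p , square-nonneg (a i ⊖ a (suc i)))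

    P S₂ : ℕ → R
    P n = ∑₀ n (λ i → a i ⊗ (# 2 ⊖ a i))
    S₂ m = ∑₀ (suc m) (λ i → (a i ⊖ a (m ∸ i)) ⊗ (a i ⊖ a (m ∸ i)))

    E-symmetric : ∀ m → E m ≡ ∑₀ (suc m) (λ i → a (m ∸ i) ⊗ (# 2 ⊖ a i))
    E-symmetric m = trans (∑₀-reverse m (λ i → a i ⊗ (# 2 ⊖ a (m ∸ i)))) (∑₀-cong (suc m) (λ i p → cong (λ t → a (m ∸ i) ⊗ (# 2 ⊖ a t)) (ℕ.m∸[m∸n]≡n (ℕ.≤-pred p))))

    -- a(2 − b) + b(2 − a) = a(2 − a) + b(2 − b) + (a − b)², summed over the reflected pairs.
    energy : ∀ m → # 2 ⊗ P (suc m) ⊕ S₂ m ≡ # 2 ⊗ E m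
    energy m = begin
      # 2 ⊗ P (suc m) ⊕ S₂ m
        ≡⟨ ring 2 (λ p s → κ 2 :* p :+ s := (p :+ p) :+ s) refl (P (suc m) ∷ S₂ m ∷ []) ⟩
      (P (suc m) ⊕ P (suc m)) ⊕ S₂ m
        ≡⟨ cong (λ t → (P (suc m) ⊕ t) ⊕ S₂ m) (∑₀-reverse m (λ i → a i ⊗ (# 2 ⊖ a i))) ⟩
      (P (suc m) ⊕ ∑₀ (suc m) (λ i → a (m ∸ i) ⊗ (# 2 ⊖ a (m ∸ i)))) ⊕ S₂ m
        ≡⟨ trans (cong (_⊕ S₂ m) (sym (∑₀-⊕ (suc m) _ _))) (sym (∑₀-⊕ (suc m) _ _)) ⟩
      ∑₀ (suc m) (λ i → (a i ⊗ (# 2 ⊖ a i) ⊕ a (m ∸ i) ⊗ (# 2 ⊖ a (m ∸ i))) ⊕ (a i ⊖ a (m ∸ i)) ⊗ (a i ⊖ a (m ∸ i)))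
        ≡⟨ ∑₀-cong (suc m) (λ i _ → ring 2 (λ a b → (a :* (κ 2 :- a) :+ b :* (κ 2 :- b)) :+ (a :- b) :* (a :- b) := a :* (κ 2 :- b) :+ b :* (κ 2 :- a)) refl (a i ∷ a (m ∸ i) ∷ [])) ⟩
      ∑₀ (suc m) (λ i → a i ⊗ (# 2 ⊖ a (m ∸ i)) ⊕ a (m ∸ i) ⊗ (# 2 ⊖ a i))
        ≡⟨ trans (∑₀-⊕ (suc m) _ _) (cong (E m ⊕_) (sym (E-symmetric m))) ⟩
      E m ⊕ E m
        ≡⟨ ring 1 (λ x → x :+ x := κ 2 :* x) refl (E m ∷ []) ⟩
      # 2 ⊗ E m ∎
      where open ≡-Reasoning

    -- (y - z)² ≤ 2 (x - y)² + 2 (x - z)², where x = aᵢ and y, z are its mirror images under i ↦ T -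
    -- i and i ↦ T + 1 - i, which are neighbours.
    jumps : ∑₀ (suc T) (λ i → (a i ⊖ a (suc i)) ⊗ (a i ⊖ a (suc i))) ≼ # 2 ⊗ S₂ T ⊕ # 2 ⊗ S₂ (suc T)
    jumps = ≼-trans (≡⇒≼ (∑₀-reverse T (λ i → (a i ⊖ a (suc i)) ⊗ (a i ⊖ a (suc i)))))
      (≼-trans (∑₀-mono (suc T) (λ i p → pointwise i (ℕ.≤-pred p)))
        (subst (_≼ # 2 ⊗ S₂ T ⊕ # 2 ⊗ S₂ (suc T)) (sym (trans (∑₀-⊕ (suc T) _ _) (cong₂ _⊕_ (∑₀-⊗ (suc T) (# 2) _) (∑₀-⊗ (suc T) (# 2) _))))
          (⊕-mono (≼-refl {# 2 ⊗ S₂ T}) (⊗-monoˡ (#-nonneg 2) (∑₀-grow _ (ℕ.n≤1+n (suc T)) (λ i _ _ → square-nonneg _))))))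
      where
      pointwise : ∀ i → i ≤ T → (a (T ∸ i) ⊖ a (suc (T ∸ i))) ⊗ (a (T ∸ i) ⊖ a (suc (T ∸ i))) ≼
        # 2 ⊗ ((a i ⊖ a (T ∸ i)) ⊗ (a i ⊖ a (T ∸ i))) ⊕ # 2 ⊗ ((a i ⊖ a (suc T ∸ i)) ⊗ (a i ⊖ a (suc T ∸ i)))
      pointwise i p = subst (λ t → (a (T ∸ i) ⊖ a (suc (T ∸ i))) ⊗ (a (T ∸ i) ⊖ a (suc (T ∸ i))) ≼ # 2 ⊗ ((a i ⊖ a (T ∸ i)) ⊗ (a i ⊖ a (T ∸ i))) ⊕ # 2 ⊗ ((a i ⊖ a t) ⊗ (a i ⊖ a t))) (sym (∸-suc p))
        (lin 3 (λ x y z → (κ 0 :≤ ((x :- y) :+ (x :- z)) :* ((x :- y) :+ (x :- z))) ∷ [] ⊢ ((y :- z) :* (y :- z) :≤ κ 2 :* ((x :- y) :* (x :- y)) :+ κ 2 :* ((x :- z) :* (x :- z)))) (1 ∷ []) refl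
          (a i ∷ a (T ∸ i) ∷ a (suc (T ∸ i)) ∷ []) (square-nonneg _))

    private
      ∑e : ℕ → R
      ∑e n = ∑₀ n e

      P≥ : ∀ {n} → n ≤ suc (suc T) → # 0 ≼ P n ⊕ ∑e (suc (suc T))
      P≥ {n} p = ≼-trans (subst (# 0 ≼_) (∑₀-⊕ n _ _) (∑₀-nonneg n (λ i q → defect i (ℕ.≤-pred (ℕ.≤-trans q p)))))
        (⊕-mono (≼-refl {P n}) (∑₀-grow e p (λ i _ _ → e-nonneg i)))

    -- `energy` bounds 2P + S₂ by twice E. As P is at least minus the sum of the corrections, P and
    -- S₂ are bounded separately, and `jumps` converts S₂ into jumps.
    ∑c-bound : ∑₀ (suc T) (λ i → c i ⊕ e i) ≼ # 4 ⊗ E T ⊕ # 4 ⊗ E (suc T) ⊕ # 8 ⊗ ∑e (suc (suc T))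
    ∑c-bound = subst (_≼ # 4 ⊗ E T ⊕ # 4 ⊗ E (suc T) ⊕ # 8 ⊗ ∑e (suc (suc T))) (sym (trans (∑₀-⊕ (suc T) c e) (cong (_⊕ ∑e (suc T)) (∑₀-⊕ (suc T) _ _))))
      (lin 9 (λ p p′ j s s′ E E′ ε ε′ → (j :≤ κ 2 :* s :+ κ 2 :* s′) ∷ (κ 2 :* p :+ s :≡ κ 2 :* E) ∷ (κ 2 :* p′ :+ s′ :≡ κ 2 :* E′) ∷ (κ 0 :≤ p :+ ε′) ∷ (κ 0 :≤ p′ :+ ε′) ∷ (ε :≤ ε′) ∷ [] ⊢ ((p :+ j) :+ ε :≤ κ 4 :* E :+ κ 4 :* E′ :+ κ 8 :* ε′)) (1 ∷ 2 ∷ 2 ∷ 3 ∷ 4 ∷ 1 ∷ []) refl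
        (P (suc T) ∷ P (suc (suc T)) ∷ ∑₀ (suc T) (λ i → (a i ⊖ a (suc i)) ⊗ (a i ⊖ a (suc i))) ∷ S₂ T ∷ S₂ (suc T) ∷ E T ∷ E (suc T) ∷ ∑e (suc T) ∷ ∑e (suc (suc T)) ∷ [])
        (jumps , energy T , energy (suc T) , P≥ (ℕ.n≤1+n (suc T)) , P≥ ℕ.≤-refl , ∑₀-grow e (ℕ.n≤1+n (suc T)) (λ i _ _ → e-nonneg i)))

    ∑e-bound : ∀ n → ∑e n ≼ # 240 ⊗ (# K ⊗ # K) ⊗ (w ⊗ # n) ⊕ # 120 ⊗ (# K ⊗ # K) ⊗ (V ⊕ # 2) ⊗ # K₁
    ∑e-bound n = subst (_≼ # 240 ⊗ (# K ⊗ # K) ⊗ (w ⊗ # n) ⊕ # 120 ⊗ (# K ⊗ # K) ⊗ (V ⊕ # 2) ⊗ # K₁) (sym eq)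
      (lin 6 (λ k w n V k₁ q → (κ 0 :≤ (κ 120 :* (k :* k) :* (V :+ κ 2)) :* (k₁ :- q)) ∷ [] ⊢ (κ 120 :* k :* (n :* (κ 2 :* k :* w) :+ (V :+ κ 2) :* k :* q) :≤ κ 240 :* (k :* k) :* (w :* n) :+ κ 120 :* (k :* k) :* (V :+ κ 2) :* k₁)) (1 ∷ []) refl
        (# K ∷ w ∷ # n ∷ V ∷ # K₁ ∷ ∑₀ n s ∷ []) (⊗-nonneg (⊗-nonneg (⊗-nonneg (#-nonneg 120) (⊗-nonneg (#-nonneg K) (#-nonneg K))) (⊕-nonneg (#-nonneg (threshold (suc j))) (#-nonneg 2))) (⊖-nonneg (∑s≤ n))))
      where
      eq : ∑e n ≡ # 120 ⊗ # K ⊗ (# n ⊗ (# 2 ⊗ # K ⊗ w) ⊕ (V ⊕ # 2) ⊗ # K ⊗ ∑₀ n s)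
      eq = trans (∑₀-⊗ n (# 120 ⊗ # K) δ) (cong (# 120 ⊗ # K ⊗_) (trans (∑₀-⊕ n _ _) (cong₂ _⊕_ (∑₀-const n _) (∑₀-⊗ n _ s))))

    -- Disjoint windows contribute one event each. The corrections `e` are added so that the
    -- remaining indices contribute nothing negative.
    windows : ∀ n → n * len ≤ suc T → # 7 ⊗ # n ≼ # 16 ⊗ ∑₀ (n * len) (λ i → c i ⊕ e i)
    windows zero _ = ≼-trans (≡⇒≼ (⊗-zeroʳ _)) (⊗-nonneg (#-nonneg 16) ≼-refl)
    windows (suc n) p with window-event 2≤X K₁≤X (n * len) (K₁^≤X (ℕ.≤-trans (subst (_≤ suc T) (ℕ.+-comm len (n * len)) p) (ℕ.≤-trans (ℕ.n≤1+n _) (ℕ.n≤1+n _))))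
    ... | i , i<len , ev = subst₂ _≼_ (cong (# 7 ⊗_) (sym (#-+ 1 n))) (cong (# 16 ⊗_) (trans (sym (∑₀-+ (n * len) len _)) (cong (λ t → ∑₀ t (λ i → c i ⊕ e i)) (ℕ.+-comm (n * len) len))))
      (lin 5 (λ n q r c e → (κ 7 :* n :≤ κ 16 :* q) ∷ (κ 7 :≤ κ 16 :* c) ∷ (c :+ e :≤ r) ∷ (κ 0 :≤ e) ∷ [] ⊢ (κ 7 :* (κ 1 :+ n) :≤ κ 16 :* (q :+ r))) (1 ∷ 1 ∷ 16 ∷ 16 ∷ []) refl
        (# n ∷ ∑₀ (n * len) (λ i → c i ⊕ e i) ∷ ∑₀ len (λ i → c (b + i) ⊕ e (b + i)) ∷ c (b + i) ∷ e (b + i) ∷ [])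
        (windows n (ℕ.≤-trans (ℕ.m≤n+m (n * len) len) p) , ev , single , e-nonneg (b + i)))
      where
      b = n * len
      nonneg : ∀ k → k < len → # 0 ≼ c (b + k) ⊕ e (b + k)
      nonneg k q = c-defect (b + k) (ℕ.≤-trans (ℕ.<⇒≤ (ℕ.+-monoʳ-< b q)) (subst (_≤ suc T) (ℕ.+-comm len b) p))
      single : c (b + i) ⊕ e (b + i) ≼ ∑₀ len (λ i → c (b + i) ⊕ e (b + i))
      single = ≼-trans (subst (_≼ ∑₀ (suc i) (λ i → c (b + i) ⊕ e (b + i))) (⊕-idˡ _) (⊕-mono (∑₀-nonneg i (λ k q → nonneg k (ℕ.<-trans q i<len))) ≼-refl)) (∑₀-grow _ i<len (λ k _ q → nonneg k q))

    bound : R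
    bound = # 64 ⊗ (# K ⊗ # K) ⊗ (# 12600 ⊕ # 120 ⊗ V) ⊕ # 960 ⊗ (# K ⊗ # K) ⊗ (V ⊕ # 2) ⊗ # K₁

    module _ (gap : ψ (g (3 + T)) ≡ ψ (g T)) where
      private
        sandwich : ∀ {i} → T ≤ i → i ≤ 3 + T → ψ (g i) ≡ ψ (g T)
        sandwich {i} p q = ≼-antisym (subst (ψ (g i) ≼_) gap (ψ-mono (g-mono q))) (ψ-mono (g-mono p))

        E₁ : E T ≼ # 4 ⊗ (# K ⊗ # K) ⊗ (# 12600 ⊕ # 120 ⊗ V ⊕ # 4 ⊗ (w ⊗ # T))
        E₁ = E-bound j T (g≤X (ℕ.n≤1+n (2 + T))) (sandwich (ℕ.m≤n+m T 2) (ℕ.n≤1+n (2 + T))) (ℓg≤ T 2≤X (2^≤X (ℕ.m≤n+m T 3)))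

        E₂ : E (suc T) ≼ # 4 ⊗ (# K ⊗ # K) ⊗ (# 12600 ⊕ # 120 ⊗ V ⊕ # 4 ⊗ (w ⊗ # (suc T)))
        E₂ = E-bound j (suc T) (g≤X ℕ.≤-refl) (trans gap (sym (sandwich (ℕ.n≤1+n T) (s≤s (ℕ.m≤n+m T 2))))) (ℓg≤ (suc T) 2≤X (2^≤X (s≤s (ℕ.m≤n+m T 2))))

      -- 2048 = 64 + 64 + 1920: the parts of 4 E(T) and 4 E(T + 1) that grow with T have coefficient
      -- 4 · 4 · 4 each, and the corrections give 8 · 240.
      total-bound : ∑₀ (suc T) (λ i → c i ⊕ e i) ≼ # 2048 ⊗ (# K ⊗ # K) ⊗ (w ⊗ # (2 + T)) ⊕ bound
      total-bound = subst (λ t → ∑₀ (suc T) (λ i → c i ⊕ e i) ≼ # 2048 ⊗ (# K ⊗ # K) ⊗ (w ⊗ t) ⊕ bound) (sym (#-+ 2 T))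
        (lin 11 (λ kk w t V k₁ E E′ ε q t₁ t₂ →
            (q :≤ κ 4 :* E :+ κ 4 :* E′ :+ κ 8 :* ε) ∷ (E :≤ κ 4 :* kk :* (κ 12600 :+ κ 120 :* V :+ κ 4 :* (w :* t))) ∷ (E′ :≤ κ 4 :* kk :* (κ 12600 :+ κ 120 :* V :+ κ 4 :* t₁)) ∷ (ε :≤ κ 240 :* kk :* t₂ :+ κ 120 :* kk :* (V :+ κ 2) :* k₁)
              ∷ (kk :* t₁ :≡ kk :* (w :* (κ 1 :+ t))) ∷ (kk :* t₂ :≡ kk :* (w :* (κ 2 :+ t))) ∷ (κ 0 :≤ kk :* w) ∷ (κ 0 :≤ kk) ∷ (κ 0 :≤ kk :* V) ∷ []
            ⊢ (q :≤ κ 2048 :* kk :* (w :* (κ 2 :+ t)) :+ (κ 64 :* kk :* (κ 12600 :+ κ 120 :* V) :+ κ 960 :* kk :* (V :+ κ 2) :* k₁)))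
          (1 ∷ 4 ∷ 4 ∷ 8 ∷ 64 ∷ 1920 ∷ 192 ∷ 403200 ∷ 3840 ∷ []) refl
          (# K ⊗ # K ∷ w ∷ # T ∷ V ∷ # K₁ ∷ E T ∷ E (suc T) ∷ ∑e (2 + T) ∷ ∑₀ (suc T) (λ i → c i ⊕ e i) ∷ w ⊗ # (suc T) ∷ w ⊗ # (2 + T) ∷ [])
          (∑c-bound , E₁ , E₂ , ∑e-bound (2 + T) , cong (λ t → (# K ⊗ # K) ⊗ (w ⊗ t)) (#-+ 1 T) , cong (λ t → (# K ⊗ # K) ⊗ (w ⊗ t)) (#-+ 2 T) ,
           ⊗-nonneg KK (inv-nonneg (suc j)) , KK , ⊗-nonneg KK (#-nonneg (threshold (suc j)))))
        where
        KK : # 0 ≼ # K ⊗ # K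
        KK = ⊗-nonneg (#-nonneg K) (#-nonneg K)

      windows-bound : ∀ n → n * len ≤ suc T → # 7 ⊗ # n ≼ # 16 ⊗ (# 2048 ⊗ (# K ⊗ # K) ⊗ (w ⊗ # (2 + T)) ⊕ bound)
      windows-bound n p = ≼-trans (windows n p) (⊗-monoˡ (#-nonneg 16) (≼-trans (∑₀-grow _ p (λ i _ q → c-defect i (ℕ.<⇒≤ q))) total-bound))

  #-scale : ∀ a k l → 1 ≤ a → 1 ≤ k → 1 ≤ l → # (suc (pred (a * (k * k) * l))) ≡ # a ⊗ (# k ⊗ # k) ⊗ # l
  #-scale a k l p q r = trans (cong # (ℕ.suc-pred (a * (k * k) * l) ⦃ >-nonZero (ℕ.*-mono-≤ (ℕ.*-mono-≤ p (ℕ.*-mono-≤ q q)) r) ⦄))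
    (trans (#-* (a * (k * k)) l) (cong (_⊗ # l) (trans (#-* a (k * k)) (cong (# a ⊗_) (#-* k k)))))

  #-excess : ∀ a b c d e k m V → # (a * (k * k) * (b + c * V) + d * (k * k) * (V + e) * m) ≡
    # a ⊗ (# k ⊗ # k) ⊗ (# b ⊕ # c ⊗ # V) ⊕ # d ⊗ (# k ⊗ # k) ⊗ (# V ⊕ # e) ⊗ # m
  #-excess a b c d e k m V = trans (#-+ (a * (k * k) * (b + c * V)) _) (cong₂ _⊕_
    (trans (#-* (a * (k * k)) _) (cong₂ _⊗_ (trans (#-* a (k * k)) (cong (# a ⊗_) (#-* k k))) (trans (#-+ b _) (cong (# b ⊕_) (#-* c V)))))
    (trans (#-* (d * (k * k) * (V + e)) m) (cong (_⊗ # m) (trans (#-* (d * (k * k)) (V + e)) (cong₂ _⊗_ (trans (#-* d (k * k)) (cong (# d ⊗_) (#-* k k))) (#-+ V e))))))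

  abstract
    -- With j + 1 = 32768 K² · `windowLength`, the growing term 16 · 2048 K² (T + 2)/(j + 1) is (T +
    -- 2)/`windowLength`, about one per window, against the 7 per window gained from events. The
    -- predecessor is there because inverses are taken at `suc j`.
    scale : ℕ → ℕ
    scale K = pred (32768 * (K * K) * windowLength K)

    #scale : ∀ K → 1 ≤ K → 1 ≤ windowLength K → # (suc (scale K)) ≡ # 32768 ⊗ (# K ⊗ # K) ⊗ # (windowLength K)
    #scale K p q = #-scale 32768 K (windowLength K) (s≤s z≤n) p q

    excess : ℕ → ℕ → ℕ
    excess K V = 64 * (K * K) * (12600 + 120 * V) + 960 * (K * K) * (V + 2) * suc K

    #excess : ∀ K V → # (excess K V) ≡ # 64 ⊗ (# K ⊗ # K) ⊗ (# 12600 ⊕ # 120 ⊗ # V) ⊕ # 960 ⊗ (# K ⊗ # K) ⊗ (# V ⊕ # 2) ⊗ # (suc K)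
    #excess K V = #-excess 64 12600 120 960 2 K (suc K) V

    -- Counted in windows. For n ≥ `start` windows the bounds give 7n ≤ (n + 2) + (n - 3), which is
    -- impossible.
    start : ℕ → ℕ
    start K = 16 * excess K (threshold (suc (scale K))) + 3

    #start : ∀ K → # (start K) ≡ # 16 ⊗ # (excess K (threshold (suc (scale K)))) ⊕ # 3
    #start K = trans (#-+ (16 * excess K (threshold (suc (scale K)))) 3) (cong (_⊕ # 3) (#-* 16 (excess K (threshold (suc (scale K))))))

  quotient-bounds : ∀ e l T → 1 ≤ l → e * l ≤ T → ∃ λ n → n * l ≤ T × T < suc n * l × e ≤ n
  quotient-bounds e l@(suc _) T _ p = T / l , m/n*n≤m T l , ℕ.≤-trans (s≤s (ℕ.≤-reflexive (m≡m%n+[m/n]*n T l))) (ℕ.+-monoˡ-≤ _ (m%n<n T l)) ,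
    subst (_≤ T / l) (m*n/n≡m e l) (/-monoˡ-≤ l p)

  no-gap : ∀ K′ (K≥8 : 8 ≤ suc K′) T {X} (L : LogApprox X) → 2 * suc (suc K′) ^ (3 + T) ≤ X → start (suc K′) * windowLength (suc K′) ≤ T →
    let open Grid K′ in Selberg.ψ L (g (3 + T)) ≢ Selberg.ψ L (g T)
  no-gap K′ K≥8 T L X≥ T≥ gap with quotient-bounds (start (suc K′)) (windowLength (suc K′)) T (windowLength≥1 K′) T≥
  ... | n , n≤ , T< , n≥ = ℕ.<⇒≱ (s≤s z≤n) (#-cancel-≤ 1 0
    (lin 3 (λ n b c → (κ 7 :* n :≤ κ 16 :* (c :+ b)) ∷ (κ 16 :* c :≤ n :+ κ 2) ∷ (κ 16 :* b :+ κ 3 :≤ n) ∷ (κ 0 :≤ n) ∷ [] ⊢ (κ 1 :≤ κ 0)) (1 ∷ 1 ∷ 1 ∷ 5 ∷ []) refl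
      (# n ∷ bound ∷ C ∷ []) (windows-bound gap n (ℕ.m≤n⇒m≤1+n n≤) , 16C≤ , n≥′ , #-nonneg n)))
    where
    open Grid K′
    j = scale K
    open Energy L K′ K≥8 j T X≥
    l = windowLength K
    w = inv (suc j)
    C = # 2048 ⊗ (# K ⊗ # K) ⊗ (w ⊗ # (2 + T))
    n≥′ : # 16 ⊗ bound ⊕ # 3 ≼ # n
    n≥′ = subst (_≼ # n) (trans (#start K) (cong (λ t → # 16 ⊗ t ⊕ # 3) (#excess K (threshold (suc j))))) (#-mono n≥)
    T≤ : 2 + T ≤ (n + 2) * l
    T≤ = ℕ.≤-trans (ℕ.+-mono-≤ (windowLength≥1 K′) T<) (ℕ.≤-reflexive (cong (_* l) (ℕ.+-comm 2 n)))
    16C≤ : # 16 ⊗ C ≼ # n ⊕ # 2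
    16C≤ = ⊗-cancel-pos (windowLength≥1 K′) (subst₂ _≼_ (sym eq) (trans (#-* (n + 2) l) (trans (⊗-comm _ _) (cong (# l ⊗_) (#-+ n 2)))) (#-mono T≤))
      where
      eq : # l ⊗ (# 16 ⊗ C) ≡ # (2 + T)
      eq = trans (ring 4 (λ l k w t → l :* (κ 16 :* (κ 2048 :* k :* (w :* t))) := (κ 32768 :* k :* l) :* w :* t) refl (# l ∷ # K ⊗ # K ∷ w ∷ # (2 + T) ∷ []))
        (trans (cong (λ x → x ⊗ w ⊗ # (2 + T)) (sym (#scale K (s≤s z≤n) (windowLength≥1 K′)))) (trans (cong (_⊗ # (2 + T)) (#⊗inv j)) (⊗-idˡ _)))

  primePowers-in-grid : ∀ K′ → 8 ≤ suc K′ → let open Grid K′ in ∃ λ T₀ → ∀ T → T₀ ≤ T → ∃ λ q → IsPrimePower q × g T < q × q ≤ g (3 + T)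
  primePowers-in-grid K′ K≥8 = start (suc K′) * windowLength (suc K′) , find
    where
    open Grid K′
    find : ∀ T → start (suc K′) * windowLength (suc K′) ≤ T → ∃ λ q → IsPrimePower q × g T < q × q ≤ g (3 + T)
    find T p with ℕ.anyUpTo? (λ q → (g T <? q) ×-dec primePower? q) (suc (g (3 + T)))
    ... | yes (q , q< , gT<q , pp) = q , pp , gT<q , ℕ.≤-pred q<
    ... | no none = ⊥-elim (no-gap K′ K≥8 T L (ℕ.n≤1+n _) p (∑₀-extend _ (g-mono (ℕ.m≤n+m T 3)) (λ i lo hi → Λ-support i (λ pp → none (suc i , s≤s hi , s≤s lo , pp)))))
      where
      -- The logarithm is built only once T is known and reaches just beyond the numbers in play;
      -- `start` does not depend on it.
      L = logApprox (2 * K₁ ^ (3 + T))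
      open VonMangoldt L

-- Frobenius maps in characteristic p, and roots of polynomials over domains.

module Frobenius where
  open Rings
  open import Level using (0ℓ)
  open import Algebra.Bundles using (CommutativeSemiring)
  open import Data.Nat as ℕ using (ℕ; zero; suc; _+_; _*_; _<_; _∸_; _!; z≤n; s≤s)
  import Data.Nat.Properties as ℕ
  open import Data.Nat.Combinatorics using (_C_; nCk≡n!/k![n-k]!; k![n∸k]!∣n!; nCn≡1)
  open import Data.Nat.DivMod using (m/n*n≡m)
  open import Data.Nat.Divisibility using (_∣_; divides; ∣⇒≤; m∣m*n)
  open import Data.Nat.Primality using (Prime; euclidsLemma; prime⇒nonZero; ¬prime[0]; ¬prime[1])
  open import Data.Fin as Fin using (Fin; toℕ; zero; suc; inject₁; fromℕ)
  import Data.Fin.Properties as Fin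
  open import Data.Vec using (Vec; []; _∷_; lookup; tabulate)
  open import Data.Vec.Functional using (init)
  open import Data.Product using (_,_)
  open import Data.Sum using (_⊎_; inj₁; inj₂)
  open import Data.Empty using (⊥-elim)
  open import Relation.Nullary using (¬_)
  open import Relation.Binary.PropositionalEquality

  prime∤! : ∀ {p} m → Prime p → m < p → ¬ (p ∣ m !)
  prime∤! zero pp _ d = ¬prime[1] (subst Prime (ℕ.≤-antisym (∣⇒≤ d) (ℕ.>-nonZero⁻¹ _ ⦃ prime⇒nonZero pp ⦄)) pp)
  prime∤! (suc m) pp m<p d with euclidsLemma (suc m) (m !) pp d
  ... | inj₁ x = ℕ.<⇒≱ m<p (∣⇒≤ x)
  ... | inj₂ y = prime∤! m pp (ℕ.<-trans (ℕ.n<1+n m) m<p) y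

  -- p divides p! = C(p, k) · k! · (p - k)!, but neither of the two factorials.
  prime∣C : ∀ {p} k → Prime p → 0 < k → k < p → p ∣ p C k
  prime∣C {zero} k pp = ⊥-elim (¬prime[0] pp)
  prime∣C {p@(suc p′)} k pp 0<k k<p with euclidsLemma (p C k) (k ! * (p ∸ k) !) pp (subst (p ∣_) (sym eq) (m∣m*n (p′ !)))
    where
    eq : (p C k) * (k ! * (p ∸ k) !) ≡ p !
    eq = trans (cong (_* (k ! * (p ∸ k) !)) (nCk≡n!/k![n-k]! (ℕ.<⇒≤ k<p))) (m/n*n≡m ⦃ ℕ._!*_!≢0 k (p ∸ k) ⦄ (k![n∸k]!∣n! (ℕ.<⇒≤ k<p)))
  ... | inj₁ x = x
  ... | inj₂ y with euclidsLemma (k !) ((p ∸ k) !) pp y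
  ... | inj₁ z = ⊥-elim (prime∤! k pp k<p z)
  ... | inj₂ z = ⊥-elim (prime∤! (p ∸ k) pp (ℕ.∸-monoʳ-< 0<k (ℕ.<⇒≤ k<p)) z)

  module RingTheory (𝓡 : CRing) where
    open CRing 𝓡
    open RingSolver 𝓡 public

    commutativeSemiring : CommutativeSemiring 0ℓ 0ℓ
    commutativeSemiring = record
      { Carrier = R ; _≈_ = _≡_ ; _+_ = _⊕_ ; _*_ = _⊗_ ; 0# = # 0 ; 1# = # 1
      ; isCommutativeSemiring = record
        { isSemiring = record
          { isSemiringWithoutAnnihilatingZero = record
            { +-isCommutativeMonoid = record
              { isMonoid = record
                { isSemigroup = record { isMagma = record { isEquivalence = isEquivalence ; ∙-cong = cong₂ _⊕_ } ; assoc = ⊕-assoc }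
                ; identity = ⊕-idˡ , ⊕-idʳ }
              ; comm = ⊕-comm }
            ; *-cong = cong₂ _⊗_
            ; *-assoc = ⊗-assoc
            ; *-identity = ⊗-idˡ , ⊗-idʳ
            ; distrib = ⊗-distˡ , λ x y z → ⊗-distʳ y z x }
          ; zero = ⊗-zeroˡ , ⊗-zeroʳ }
        ; *-comm = ⊗-comm } }

    open CommutativeSemiring commutativeSemiring using (semiring; +-monoid)
    open import Algebra.Properties.Semiring.Exp semiring public using (_^_; ^-homo-*; ^-assocʳ)
    open import Algebra.Properties.CommutativeSemiring.Exp commutativeSemiring public using (^-distrib-*)
    open import Algebra.Properties.Semiring.Mult semiring using (_×_)
    open import Algebra.Properties.Monoid.Sum +-monoid using (sum; sum-cong-≗; sum-init-last; sum-replicate-zero)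
    open import Algebra.Properties.CommutativeSemiring.Binomial commutativeSemiring using (theorem; binomialTerm)

    ^-zero : ∀ n → # 0 ^ suc n ≡ # 0
    ^-zero n = ⊗-zeroˡ _

    ^-one : ∀ n → # 1 ^ n ≡ # 1
    ^-one zero = refl
    ^-one (suc n) = trans (⊗-idˡ _) (^-one n)

    ×≡# : ∀ n x → n × x ≡ # n ⊗ x
    ×≡# zero x = sym (⊗-zeroˡ x)
    ×≡# (suc n) x = trans (cong (x ⊕_) (×≡# n x)) (trans (cong (_⊕ # n ⊗ x) (sym (⊗-idˡ x))) (trans (sym (⊗-distʳ (# 1) (# n) x)) (cong (_⊗ x) (sym (#-+ 1 n)))))

    multiple-zero : ∀ {p c} → # p ≡ # 0 → ∀ z → p ∣ c → c × z ≡ # 0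
    multiple-zero {p} {c} p≡0 z (divides q e) = trans (×≡# c z) (trans (cong (_⊗ z) (trans (cong # e) (trans (#-* q p) (trans (cong (# q ⊗_) p≡0) (⊗-zeroʳ _))))) (⊗-zeroˡ z))

    freshman : ∀ {p} → Prime p → # p ≡ # 0 → ∀ x y → (x ⊕ y) ^ p ≡ x ^ p ⊕ y ^ p
    freshman {zero} pp = ⊥-elim (¬prime[0] pp)
    freshman {suc zero} pp = ⊥-elim (¬prime[1] pp)
    freshman {p@(suc (suc m))} pp p≡0 x y = begin
      (x ⊕ y) ^ p                                         ≡⟨ theorem p x y ⟩
      t zero ⊕ sum (λ i → t (suc i))                      ≡⟨ cong (t zero ⊕_) (sum-init-last (λ i → t (suc i))) ⟩
      t zero ⊕ (sum (init (λ i → t (suc i))) ⊕ t (fromℕ p)) ≡⟨ cong (λ s → t zero ⊕ (s ⊕ t (fromℕ p))) (trans (sum-cong-≗ middle) (sum-replicate-zero (suc m))) ⟩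
      t zero ⊕ (# 0 ⊕ t (fromℕ p))                        ≡⟨ cong₂ _⊕_ first (trans (⊕-idˡ _) final) ⟩
      y ^ p ⊕ x ^ p                                       ≡⟨ ⊕-comm _ _ ⟩
      x ^ p ⊕ y ^ p                                       ∎
      where
      open ≡-Reasoning
      t : Fin (suc p) → R
      t = binomialTerm x y p
      first : t zero ≡ y ^ p
      first = trans (⊕-idʳ _) (⊗-idˡ _)
      final : t (fromℕ p) ≡ x ^ p
      final = trans (×≡# _ _) (trans (cong₂ (λ a b → # (p C a) ⊗ (x ^ a ⊗ y ^ b)) (Fin.toℕ-fromℕ p) (trans (cong (p ∸_) (Fin.toℕ-fromℕ p)) (ℕ.n∸n≡0 p)))
        (trans (cong (λ c → # c ⊗ (x ^ p ⊗ # 1)) (nCn≡1 p)) (trans (⊗-idˡ _) (⊗-idʳ _))))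
      middle : ∀ i → init (λ i → t (suc i)) i ≡ # 0
      middle i = multiple-zero p≡0 _ (prime∣C (toℕ (suc (inject₁ i))) pp (s≤s z≤n) (s≤s (subst (_< suc m) (sym (Fin.toℕ-inject₁ i)) (Fin.toℕ<n i))))

    frobenius : ∀ {p} → Prime p → # p ≡ # 0 → ∀ k x y → (x ⊕ y) ^ (p ℕ.^ k) ≡ x ^ (p ℕ.^ k) ⊕ y ^ (p ℕ.^ k)
    frobenius pp e zero x y = trans (⊗-idʳ _) (cong₂ _⊕_ (sym (⊗-idʳ x)) (sym (⊗-idʳ y)))
    frobenius {p} pp e (suc k) x y = trans (sym (^-assocʳ (x ⊕ y) p (p ℕ.^ k))) (trans (cong (_^ (p ℕ.^ k)) (freshman pp e x y))
      (trans (frobenius pp e k (x ^ p) (y ^ p)) (cong₂ _⊕_ (^-assocʳ x p (p ℕ.^ k)) (^-assocʳ y p (p ℕ.^ k)))))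

    -- Induction on c by additivity of Frobenius. It makes polynomials with coefficients in the
    -- prime field commute with Frobenius.
    fermat : ∀ {p} → Prime p → # p ≡ # 0 → ∀ k c → # c ^ (p ℕ.^ k) ≡ # c
    fermat {p} pp e k zero with p ℕ.^ k | ℕ.m^n>0 p ⦃ prime⇒nonZero pp ⦄ k
    ... | suc m | _ = ^-zero m
    fermat {p} pp e k (suc c) = trans (cong (_^ (p ℕ.^ k)) (#-+ 1 c)) (trans (frobenius pp e k (# 1) (# c)) (trans (cong₂ _⊕_ (^-one (p ℕ.^ k)) (fermat pp e k c)) (sym (#-+ 1 c))))

    -- Polynomials are vectors of coefficients, constant term first.
    eval : ∀ {n} → Vec R n → R → R
    eval [] x = # 0
    eval (c ∷ cs) x = c ⊕ x ⊗ eval cs x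

    eval-difference : ∀ {n} (f g : Fin n → R) x → eval (tabulate (λ j → f j ⊖ g j)) x ≡ eval (tabulate f) x ⊖ eval (tabulate g) x
    eval-difference {zero} f g x = sym (⊕-invʳ _)
    eval-difference {suc n} f g x = trans (cong (λ t → (f zero ⊖ g zero) ⊕ x ⊗ t) (eval-difference (λ j → f (suc j)) (λ j → g (suc j)) x))
      (ring 5 (λ a b x s t → (a :- b) :+ x :* (s :- t) := (a :+ x :* s) :- (b :+ x :* t)) refl (f zero ∷ g zero ∷ x ∷ eval (tabulate (λ j → f (suc j))) x ∷ eval (tabulate (λ j → g (suc j))) x ∷ []))

    Domain : Set
    Domain = ∀ x y → x ⊗ y ≡ # 0 → x ≡ # 0 ⊎ y ≡ # 0

    -- Synthetic division by x - r: the intermediate values of Horner's scheme at r are the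
    -- coefficients of the quotient.
    quotient : ∀ {n} → Vec R (suc n) → R → Vec R n
    quotient (c ∷ []) r = []
    quotient (c ∷ cs@(_ ∷ _)) r = eval cs r ∷ quotient cs r

    eval-quotient : ∀ {n} (cs : Vec R (suc n)) r x → eval cs x ≡ eval cs r ⊕ (x ⊖ r) ⊗ eval (quotient cs r) x
    eval-quotient (c ∷ []) r x = ring 3 (λ c r x → c :+ x :* κ 0 := (c :+ r :* κ 0) :+ (x :- r) :* κ 0) refl (c ∷ r ∷ x ∷ [])
    eval-quotient (c ∷ cs@(_ ∷ _)) r x = trans (cong (λ t → c ⊕ x ⊗ t) (eval-quotient cs r x))
      (ring 5 (λ c f r x q → c :+ x :* (f :+ (x :- r) :* q) := (c :+ r :* f) :+ (x :- r) :* (f :+ x :* q)) refl (c ∷ eval cs r ∷ r ∷ x ∷ eval (quotient cs r) x ∷ []))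

    quotient-zero : ∀ {n} (cs : Vec R (suc n)) r → eval cs r ≡ # 0 → (∀ i → lookup (quotient cs r) i ≡ # 0) → ∀ i → lookup cs i ≡ # 0
    quotient-zero (c ∷ []) r e _ zero = trans (ring 2 (λ c r → c := c :+ r :* κ 0) refl (c ∷ r ∷ [])) e
    quotient-zero (c ∷ cs@(_ ∷ _)) r e z zero = trans (trans (sym (⊕-idʳ c)) (cong (c ⊕_) (sym (trans (cong (r ⊗_) (z zero)) (⊗-zeroʳ r))))) e
    quotient-zero (c ∷ cs@(_ ∷ _)) r e z (suc i) = quotient-zero cs r (z zero) (λ j → z (suc j)) i

    -- Divide out one root; by the domain property the others are roots of the quotient, which has
    -- one coefficient fewer.
    too-many-roots : Domain → ∀ {n} (cs : Vec R n) (ρ : Fin n → R) → (∀ {i j} → ρ i ≡ ρ j → i ≡ j) → (∀ i → eval cs (ρ i) ≡ # 0) → ∀ i → lookup cs i ≡ # 0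
    too-many-roots dom {suc n} cs ρ inj root = quotient-zero cs r (root zero) (too-many-roots dom (quotient cs r) (λ i → ρ (suc i)) (λ e → Fin.suc-injective (inj e)) root′)
      where
      r = ρ zero
      root′ : ∀ i → eval (quotient cs r) (ρ (suc i)) ≡ # 0
      root′ i with dom (ρ (suc i) ⊖ r) (eval (quotient cs r) (ρ (suc i)))
        (trans (sym (⊕-idˡ _)) (trans (cong (_⊕ (ρ (suc i) ⊖ r) ⊗ eval (quotient cs r) (ρ (suc i))) (sym (root zero))) (trans (sym (eval-quotient cs r (ρ (suc i)))) (root (suc i)))))
      ... | inj₂ z = z
      ... | inj₁ z with inj (⊖-zero z)
      ... | ()

-- The algebra of the shift on periodic sequences modulo p.

module CyclicAlgebras where
  open Rings
  open Frobenius
  open import Data.Nat as ℕ using (ℕ; zero; suc; _+_; _*_; _≤_; _<_; z≤n; s≤s; _%_; _≟_)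
  import Data.Nat.Properties as ℕ
  open import Data.Nat.DivMod using (m%n<n; m<n⇒m%n≡m; %-distribˡ-+; %-distribˡ-*; [m+n]%n≡m%n; m*n%n≡0)
  open import Data.Fin as Fin using (Fin; toℕ; fromℕ<; zero; suc)
  import Data.Fin.Properties as Fin
  open import Data.Vec using (Vec; []; _∷_; lookup; tabulate)
  import Data.Vec.Properties as Vec
  open import Data.List using (List; []; _∷_; cartesianProductWith; allFin)
  open import Data.List.Membership.Propositional using (_∈_)
  open import Data.List.Membership.Propositional.Properties using (∈-cartesianProductWith⁺; ∈-allFin)
  open import Data.List.Relation.Unary.Any using (here)
  open import Data.Product using (_×_; _,_; proj₁; proj₂)
  open import Data.Empty using (⊥-elim)
  open import Relation.Nullary using (Dec; yes; no)
  open import Relation.Binary.PropositionalEquality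

  allVecs : ∀ {p} n → List (Vec (Fin p) n)
  allVecs zero = [] ∷ []
  allVecs {p} (suc n) = cartesianProductWith _∷_ (allFin p) (allVecs n)

  ∈-allVecs : ∀ {p n} (v : Vec (Fin p) n) → v ∈ allVecs n
  ∈-allVecs [] = here refl
  ∈-allVecs (x ∷ v) = ∈-cartesianProductWith⁺ _∷_ (∈-allFin x) (∈-allVecs v)

  -- The degree of `factors`: p + p² + ... + p^d.
  S : ℕ → ℕ → ℕ
  S p zero = 0
  S p (suc d) = p ℕ.^ suc d + S p d

  -- In a field where this product does not vanish at X, no Frobenius power p^i with 0 < i ≤ d fixes
  -- X.
  factors : (𝓡 : CRing) → ℕ → CRing.R 𝓡 → ℕ → CRing.R 𝓡
  factors 𝓡 p X zero = CRing.# 𝓡 1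
  factors 𝓡 p X (suc d) = ((X ^ (p ℕ.^ suc d)) ⊖ X) ⊗ factors 𝓡 p X d
    where
    open CRing 𝓡
    open RingTheory 𝓡

  -- Stands for 𝔽ₚ[X]/(X^N − 1).
  record CyclicAlgebra (p N : ℕ) : Set₁ where
    field
      𝓡 : CRing
    open CRing 𝓡
    open RingTheory 𝓡 using (_^_)
    field
      X : R
      characteristic : # p ≡ # 0
      X-periodic : X ^ suc N ≡ X
      generated : (Q : R → Set) → Q (# 0) → Q (# 1) → Q X → (∀ {x y} → Q x → Q y → Q (x ⊕ y)) → (∀ {x y} → Q x → Q y → Q (x ⊗ y)) → ∀ x → Q x
      _≟ᴿ_ : (x y : R) → Dec (x ≡ y)
      elements : List R
      complete : ∀ x → x ∈ elements
      factors≢0 : ∀ d → S p d < N → factors 𝓡 p X d ≢ # 0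

  -- Terms act on sequences, X as the shift; two terms are identified when they agree modulo p on all N-periodic sequences.
  module Shift (p″ N′ : ℕ) where
    p′ p N : ℕ
    p′ = suc p″
    p = suc p′
    N = suc N′

    infixl 6 _`+_
    infixl 7 _`*_
    data Term : Set where
      `X `0 `1 : Term
      _`+_ _`*_ : Term → Term → Term

    act : Term → (ℕ → ℕ) → ℕ → ℕ
    act `X u n = u (suc n)
    act `0 u n = 0
    act `1 u n = u n
    act (s `+ t) u n = act s u n + act t u n
    act (s `* t) u n = act s (act t u) n

    infix 4 _≡ₚ_ _≈_
    _≡ₚ_ : ℕ → ℕ → Set
    a ≡ₚ b = a % p ≡ b % p

    +-≡ₚ : ∀ a b c d → a ≡ₚ b → c ≡ₚ d → a + c ≡ₚ b + d
    +-≡ₚ a b c d e f = trans (%-distribˡ-+ a c p) (trans (cong₂ (λ x y → (x + y) % p) e f) (sym (%-distribˡ-+ b d p)))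

    *-≡ₚ : ∀ a b c d → a ≡ₚ b → c ≡ₚ d → a * c ≡ₚ b * d
    *-≡ₚ a b c d e f = trans (%-distribˡ-* a c p) (trans (cong₂ (λ x y → (x * y) % p) e f) (sym (%-distribˡ-* b d p)))

    act-cong : ∀ t {u v} → (∀ n → u n ≡ v n) → ∀ n → act t u n ≡ act t v n
    act-cong `X e n = e (suc n)
    act-cong `0 e n = refl
    act-cong `1 e n = e n
    act-cong (s `+ t) e n = cong₂ _+_ (act-cong s e n) (act-cong t e n)
    act-cong (s `* t) e n = act-cong s (act-cong t e) n

    act-≡ₚ : ∀ t {u v} → (∀ n → u n ≡ₚ v n) → ∀ n → act t u n ≡ₚ act t v n
    act-≡ₚ `X e n = e (suc n)
    act-≡ₚ `0 e n = refl
    act-≡ₚ `1 e n = e n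
    act-≡ₚ (s `+ t) {u} {v} e n = +-≡ₚ (act s u n) (act s v n) (act t u n) (act t v n) (act-≡ₚ s e n) (act-≡ₚ t e n)
    act-≡ₚ (s `* t) e n = act-≡ₚ s (act-≡ₚ t e) n

    interchange : ∀ a b c d → (a + b) + (c + d) ≡ (a + c) + (b + d)
    interchange a b c d = trans (ℕ.+-assoc a b (c + d)) (trans (cong (a +_) (trans (sym (ℕ.+-assoc b c d)) (trans (cong (_+ d) (ℕ.+-comm b c)) (ℕ.+-assoc c b d)))) (sym (ℕ.+-assoc a c (b + d))))

    act-zero : ∀ t n → act t (λ _ → 0) n ≡ 0
    act-zero `X n = refl
    act-zero `0 n = refl
    act-zero `1 n = refl
    act-zero (s `+ t) n = cong₂ _+_ (act-zero s n) (act-zero t n)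
    act-zero (s `* t) n = trans (act-cong s (act-zero t) n) (act-zero s n)

    act-+ : ∀ t u v n → act t (λ k → u k + v k) n ≡ act t u n + act t v n
    act-+ `X u v n = refl
    act-+ `0 u v n = refl
    act-+ `1 u v n = refl
    act-+ (s `+ t) u v n = trans (cong₂ _+_ (act-+ s u v n) (act-+ t u v n)) (interchange (act s u n) (act s v n) (act t u n) (act t v n))
    act-+ (s `* t) u v n = trans (act-cong s (act-+ t u v) n) (act-+ s (act t u) (act t v) n)

    act-scale : ∀ t c u n → act t (λ k → c * u k) n ≡ c * act t u n
    act-scale `X c u n = refl
    act-scale `0 c u n = sym (ℕ.*-zeroʳ c)
    act-scale `1 c u n = refl
    act-scale (s `+ t) c u n = trans (cong₂ _+_ (act-scale s c u n) (act-scale t c u n)) (sym (ℕ.*-distribˡ-+ c (act s u n) (act t u n)))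
    act-scale (s `* t) c u n = trans (act-cong s (act-scale t c u) n) (act-scale s c (act t u) n)

    -- Terms are polynomials in the shift, hence commute with it. Commutativity of the product rests
    -- on this; associativity holds by definition, as the product is composition.
    act-shift : ∀ t u m n → act t (λ k → u (m + k)) n ≡ act t u (m + n)
    act-shift `X u m n = cong u (ℕ.+-suc m n)
    act-shift `0 u m n = refl
    act-shift `1 u m n = refl
    act-shift (s `+ t) u m n = cong₂ _+_ (act-shift s u m n) (act-shift t u m n)
    act-shift (s `* t) u m n = trans (act-cong s (act-shift t u m) n) (act-shift s (act t u) m n)

    act-comm : ∀ s t u n → act s (act t u) n ≡ act t (act s u) n
    act-comm `X t u n = sym (act-shift t u 1 n)
    act-comm `0 t u n = sym (act-zero t n)
    act-comm `1 t u n = refl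
    act-comm (s₁ `+ s₂) t u n = trans (cong₂ _+_ (act-comm s₁ t u n) (act-comm s₂ t u n)) (sym (act-+ t (act s₁ u) (act s₂ u) n))
    act-comm (s₁ `* s₂) t u n = trans (act-cong s₁ (act-comm s₂ t u) n) (act-comm s₁ t (act s₂ u) n)

    Periodic : (ℕ → ℕ) → Set
    Periodic u = ∀ n → u (N + n) ≡ u n

    act-periodic : ∀ t {u} → Periodic u → Periodic (act t u)
    act-periodic t {u} per n = trans (sym (act-shift t u N n)) (act-cong t per n)

    shift-periodic : ∀ {u} m → Periodic u → Periodic (λ k → u (m + k))
    shift-periodic {u} m per n = trans (cong u (trans (sym (ℕ.+-assoc m N n)) (trans (cong (_+ n) (ℕ.+-comm m N)) (ℕ.+-assoc N m n)))) (per (m + n))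

    _≈_ : Term → Term → Set
    s ≈ t = ∀ u → Periodic u → ∀ n → act s u n ≡ₚ act t u n

    sum : ℕ → (ℕ → ℕ) → ℕ
    sum zero f = 0
    sum (suc m) f = sum m f + f m

    sum-≡ₚ : ∀ m {f g} → (∀ i → i < m → f i ≡ₚ g i) → sum m f ≡ₚ sum m g
    sum-≡ₚ zero e = refl
    sum-≡ₚ (suc m) {f} {g} e = +-≡ₚ (sum m f) (sum m g) (f m) (g m) (sum-≡ₚ m (λ i q → e i (ℕ.m<n⇒m<1+n q))) (e m ℕ.≤-refl)

    act-sum : ∀ t m (f : ℕ → ℕ) (w : ℕ → ℕ → ℕ) n → act t (λ k → sum m (λ c → f c * w c k)) n ≡ sum m (λ c → f c * act t (w c) n)
    act-sum t zero f w n = act-zero t n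
    act-sum t (suc m) f w n = trans (act-+ t (λ k → sum m (λ c → f c * w c k)) (λ k → f m * w m k) n) (cong₂ _+_ (act-sum t m f w n) (act-scale t (f m) (w m) n))

    δ : ∀ {P : Set} → Dec P → ℕ
    δ (yes _) = 1
    δ (no _) = 0

    ind : ℕ → ℕ → ℕ
    ind c n = δ (n % N ≟ c)

    ind-periodic : ∀ c → Periodic (ind c)
    ind-periodic c n = cong (λ k → δ (k ≟ c)) (trans (cong (_% N) (ℕ.+-comm N n)) ([m+n]%n≡m%n n N))

    ind-yes : ∀ {c n} → n < N → n ≡ c → ind c n ≡ 1
    ind-yes {c} {n} n<N refl with n % N ≟ n
    ... | yes _ = refl
    ... | no ne = ⊥-elim (ne (m<n⇒m%n≡m n<N))

    ind-no : ∀ {c n} → n < N → n ≢ c → ind c n ≡ 0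
    ind-no {c} {n} n<N ne with n % N ≟ c
    ... | yes e = ⊥-elim (ne (trans (sym (m<n⇒m%n≡m n<N)) e))
    ... | no _ = refl

    sum-ind : ∀ m (f : ℕ → ℕ) n → n % N < m → sum m (λ c → f c * ind c n) ≡ f (n % N)
    sum-ind-none : ∀ m (f : ℕ → ℕ) n → m ≤ n % N → sum m (λ c → f c * ind c n) ≡ 0
    sum-ind-none zero f n q = refl
    sum-ind-none (suc m) f n q with n % N ≟ m
    ... | yes e = ⊥-elim (ℕ.<-irrefl (sym e) q)
    ... | no _ = trans (cong (sum m (λ c → f c * ind c n) +_) (ℕ.*-zeroʳ (f m))) (trans (ℕ.+-identityʳ _) (sum-ind-none m f n (ℕ.<⇒≤ q)))
    sum-ind (suc m) f n q with n % N ≟ m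
    ... | yes refl = trans (cong₂ _+_ (sum-ind-none m f n ℕ.≤-refl) (ℕ.*-identityʳ (f m))) refl
    ... | no ne = trans (cong (sum m (λ c → f c * ind c n) +_) (ℕ.*-zeroʳ (f m))) (trans (ℕ.+-identityʳ _) (sum-ind m f n (ℕ.≤∧≢⇒< (ℕ.≤-pred q) ne)))

    periodic-mod : ∀ {u} → Periodic u → ∀ n → u (n % N) ≡ u n
    periodic-mod {u} per n = trans (sym (add (n ℕ./ N))) (cong u (trans (ℕ.+-comm (n ℕ./ N * N) (n % N)) (sym (m≡m%n+[m/n]*n n N))))
      where
      open import Data.Nat.DivMod using (m≡m%n+[m/n]*n)
      add : ∀ k → u (k * N + n % N) ≡ u (n % N)
      add zero = refl
      add (suc k) = trans (cong u (ℕ.+-assoc N (k * N) (n % N))) (trans (per _) (add k))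

    -- A periodic sequence is a combination of the indicators of the residue classes modulo N, and
    -- terms act linearly.
    expand : ∀ t {u} → Periodic u → act t u 0 ≡ sum N (λ c → u c * act t (ind c) 0)
    expand t {u} per = trans (act-cong t (λ k → sym (trans (sum-ind N u k (m%n<n k N)) (periodic-mod per k))) 0) (act-sum t N u ind 0)

    V : Set
    V = Vec (Fin p) N

    residue : ℕ → Fin p
    residue a = fromℕ< (m%n<n a p)

    toℕ-residue : ∀ a → toℕ (residue a) ≡ a % p
    toℕ-residue a = Fin.toℕ-fromℕ< (m%n<n a p)

    residue-cong : ∀ a b → a ≡ₚ b → residue a ≡ residue b
    residue-cong a b e = Fin.toℕ-injective (trans (toℕ-residue a) (trans e (sym (toℕ-residue b))))

    num : ℕ → Term
    num zero = `0
    num (suc n) = `1 `+ num n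

    act-num : ∀ c u n → act (num c) u n ≡ c * u n
    act-num zero u n = refl
    act-num (suc c) u n = cong (u n +_) (act-num c u n)

    ⌜_⌝ : ∀ {m} → Vec (Fin p) m → Term
    ⌜ [] ⌝ = `0
    ⌜ a ∷ v ⌝ = num (toℕ a) `+ `X `* ⌜ v ⌝

    below : ∀ {m} (v : Vec (Fin p) m) c n → c < n → n + m ≤ N → act ⌜ v ⌝ (ind c) n ≡ 0
    below [] c n _ _ = refl
    below (a ∷ v) c n c<n q = cong₂ _+_ (trans (act-num (toℕ a) (ind c) n) (trans (cong (toℕ a *_) (ind-no (ℕ.<-≤-trans (ℕ.m<m+n n (s≤s z≤n)) q) (λ e → ℕ.<-irrefl (sym e) c<n))) (ℕ.*-zeroʳ (toℕ a))))
      (below v c (suc n) (ℕ.m<n⇒m<1+n c<n) (subst (_≤ N) (ℕ.+-suc n _) q))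

    digit : ∀ {m} (v : Vec (Fin p) m) j n → n + m ≤ N → act ⌜ v ⌝ (ind (n + toℕ j)) n ≡ toℕ (lookup v j)
    digit (a ∷ v) zero n q = trans (cong₂ _+_ (trans (act-num (toℕ a) _ n) (trans (cong (toℕ a *_) (ind-yes (ℕ.<-≤-trans (ℕ.m<m+n n (s≤s z≤n)) q) (sym (ℕ.+-identityʳ n)))) (ℕ.*-identityʳ (toℕ a))))
      (below v (n + 0) (suc n) (s≤s (ℕ.≤-reflexive (ℕ.+-identityʳ n))) (subst (_≤ N) (ℕ.+-suc n _) q))) (ℕ.+-identityʳ (toℕ a))
    digit (a ∷ v) (suc j) n q = cong₂ _+_ (trans (act-num (toℕ a) _ n) (trans (cong (toℕ a *_) (ind-no (ℕ.<-≤-trans (ℕ.m<m+n n (s≤s z≤n)) q) (λ e → ℕ.<-irrefl e (ℕ.m<m+n n (s≤s z≤n))))) (ℕ.*-zeroʳ (toℕ a))))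
      (trans (cong (λ c → act ⌜ v ⌝ (ind c) (suc n)) (ℕ.+-suc n (toℕ j))) (digit v j (suc n) (subst (_≤ N) (ℕ.+-suc n _) q)))

    abstract
      -- Canonical form of a term: coordinate c, read off at 0 from the indicator of the class c, is
      -- the coefficient of X^c. It replaces a quotient by `≈` with a finite type that has decidable
      -- equality.
      κ′ : Term → V
      κ′ t = tabulate (λ c → residue (act t (ind (toℕ c)) 0))

      κ-cong : ∀ {s t} → s ≈ t → κ′ s ≡ κ′ t
      κ-cong {s} {t} e = Vec.tabulate-cong (λ c → residue-cong (act s (ind (toℕ c)) 0) (act t (ind (toℕ c)) 0) (e (ind (toℕ c)) (ind-periodic (toℕ c)) 0))

      -- The value at n is the value at 0 for the translated sequence, which `expand` reduces to the
      -- N indicators; so the coordinates determine the whole action.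
      κ-sound : ∀ {s t} → κ′ s ≡ κ′ t → s ≈ t
      κ-sound {s} {t} e u per n = subst₂ _≡ₚ_ (at s) (at t)
        (trans (cong (_% p) (expand s (shift-periodic n per))) (trans (sum-≡ₚ N (λ c q → *-≡ₚ (u (n + c)) (u (n + c)) (act s (ind c) 0) (act t (ind c) 0) refl (coordinate c q))) (sym (cong (_% p) (expand t (shift-periodic n per))))))
        where
        at : ∀ r → act r (λ k → u (n + k)) 0 ≡ act r u n
        at r = trans (act-shift r u n 0) (cong (act r u) (ℕ.+-identityʳ n))
        coordinate : ∀ c → c < N → act s (ind c) 0 ≡ₚ act t (ind c) 0
        coordinate c q = subst (λ d → act s (ind d) 0 ≡ₚ act t (ind d) 0) (Fin.toℕ-fromℕ< q)
          (trans (sym (toℕ-residue (act s (ind (toℕ i)) 0))) (trans (cong toℕ (trans (sym (Vec.lookup∘tabulate (λ c → residue (act s (ind (toℕ c)) 0)) i)) (trans (cong (λ v → lookup v i) e) (Vec.lookup∘tabulate (λ c → residue (act t (ind (toℕ c)) 0)) i)))) (toℕ-residue (act t (ind (toℕ i)) 0))))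
          where
          i : Fin N
          i = fromℕ< q

      κ⌜⌝ : ∀ v → κ′ ⌜ v ⌝ ≡ v
      κ⌜⌝ v = trans (Vec.tabulate-cong {f = λ c → residue (act ⌜ v ⌝ (ind (toℕ c)) 0)} {g = lookup v} (λ c → Fin.toℕ-injective (trans (toℕ-residue (act ⌜ v ⌝ (ind (toℕ c)) 0)) (trans (cong (_% p) (digit v c 0 ℕ.≤-refl)) (m<n⇒m%n≡m (Fin.toℕ<n (lookup v c))))))) (Vec.tabulate∘lookup v)

    ⌜κ⌝ : ∀ t → ⌜ κ′ t ⌝ ≈ t
    ⌜κ⌝ t = κ-sound (κ⌜⌝ (κ′ t))

    `+-cong : ∀ {s s′ t t′} → s ≈ s′ → t ≈ t′ → s `+ t ≈ s′ `+ t′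
    `+-cong {s} {s′} {t} {t′} e f u per n = +-≡ₚ (act s u n) (act s′ u n) (act t u n) (act t′ u n) (e u per n) (f u per n)

    `*-cong : ∀ {s s′ t t′} → s ≈ s′ → t ≈ t′ → s `* t ≈ s′ `* t′
    `*-cong {s} {s′} {t} e f u per n = trans (e (act t u) (act-periodic t per) n) (act-≡ₚ s′ (f u per) n)

    _⊕′_ _⊗′_ : V → V → V
    x ⊕′ y = κ′ (⌜ x ⌝ `+ ⌜ y ⌝)
    x ⊗′ y = κ′ (⌜ x ⌝ `* ⌜ y ⌝)

    κ-+ : ∀ s t → κ′ s ⊕′ κ′ t ≡ κ′ (s `+ t)
    κ-+ s t = κ-cong {⌜ κ′ s ⌝ `+ ⌜ κ′ t ⌝} {s `+ t} (`+-cong {⌜ κ′ s ⌝} {s} {⌜ κ′ t ⌝} {t} (⌜κ⌝ s) (⌜κ⌝ t))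

    κ-* : ∀ s t → κ′ s ⊗′ κ′ t ≡ κ′ (s `* t)
    κ-* s t = κ-cong {⌜ κ′ s ⌝ `* ⌜ κ′ t ⌝} {s `* t} (`*-cong {⌜ κ′ s ⌝} {s} {⌜ κ′ t ⌝} {t} (⌜κ⌝ s) (⌜κ⌝ t))

    -- Every element is κ′ of a term, so ring laws only need to be checked on terms.
    law₁ : (f g : V → V) (s t : Term → Term) → (∀ a → f (κ′ a) ≡ κ′ (s a)) → (∀ a → g (κ′ a) ≡ κ′ (t a)) → (∀ a → s a ≈ t a) → ∀ x → f x ≡ g x
    law₁ f g s t ef eg e x = subst (λ v → f v ≡ g v) (κ⌜⌝ x) (trans (ef ⌜ x ⌝) (trans (κ-cong {s ⌜ x ⌝} {t ⌜ x ⌝} (e ⌜ x ⌝)) (sym (eg ⌜ x ⌝))))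

    ring : CRing
    ring = record
      { R = V ; _⊕_ = _⊕′_ ; _⊗_ = _⊗′_ ; ⊝_ = λ x → κ′ (num p′ `* ⌜ x ⌝) ; # = λ n → κ′ (num n)
      ; ⊕-assoc = λ x y z → law₁ (λ x → (x ⊕′ y) ⊕′ z) (λ x → x ⊕′ (y ⊕′ z)) (λ a → (a `+ ⌜ y ⌝) `+ ⌜ z ⌝) (λ a → a `+ (⌜ y ⌝ `+ ⌜ z ⌝))
          (λ a → trans (cong₂ (λ y z → (κ′ a ⊕′ y) ⊕′ z) (sym (κ⌜⌝ y)) (sym (κ⌜⌝ z))) (trans (cong (_⊕′ κ′ ⌜ z ⌝) (κ-+ a ⌜ y ⌝)) (κ-+ (a `+ ⌜ y ⌝) ⌜ z ⌝)))
          (λ a → κ-+ a (⌜ y ⌝ `+ ⌜ z ⌝)) (λ a u _ n → cong (_% p) (ℕ.+-assoc (act a u n) (act ⌜ y ⌝ u n) (act ⌜ z ⌝ u n))) x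
      ; ⊕-comm = λ x y → κ-cong {⌜ x ⌝ `+ ⌜ y ⌝} {⌜ y ⌝ `+ ⌜ x ⌝} (λ u _ n → cong (_% p) (ℕ.+-comm (act ⌜ x ⌝ u n) (act ⌜ y ⌝ u n)))
      ; ⊕-idˡ = law₁ (λ x → κ′ `0 ⊕′ x) (λ x → x) (λ a → `0 `+ a) (λ a → a) (λ a → κ-+ `0 a) (λ a → refl) (λ a u _ n → refl)
      ; ⊕-invʳ = law₁ (λ x → x ⊕′ κ′ (num p′ `* ⌜ x ⌝)) (λ _ → κ′ `0) (λ a → a `+ num p′ `* a) (λ _ → `0)
          (λ a → trans (cong (κ′ a ⊕′_) (κ-cong {num p′ `* ⌜ κ′ a ⌝} {num p′ `* a} (`*-cong {num p′} {num p′} {⌜ κ′ a ⌝} {a} (λ _ _ _ → refl) (⌜κ⌝ a)))) (κ-+ a (num p′ `* a))) (λ _ → refl)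
          (λ a u _ n → trans (cong (λ t → (act a u n + t) % p) (act-num p′ (act a u) n)) (trans (cong (_% p) (ℕ.*-comm p (act a u n))) (m*n%n≡0 (act a u n) p)))
      ; ⊗-assoc = λ x y z → law₁ (λ x → (x ⊗′ y) ⊗′ z) (λ x → x ⊗′ (y ⊗′ z)) (λ a → (a `* ⌜ y ⌝) `* ⌜ z ⌝) (λ a → a `* (⌜ y ⌝ `* ⌜ z ⌝))
          (λ a → trans (cong₂ (λ y z → (κ′ a ⊗′ y) ⊗′ z) (sym (κ⌜⌝ y)) (sym (κ⌜⌝ z))) (trans (cong (_⊗′ κ′ ⌜ z ⌝) (κ-* a ⌜ y ⌝)) (κ-* (a `* ⌜ y ⌝) ⌜ z ⌝)))
          (λ a → κ-* a (⌜ y ⌝ `* ⌜ z ⌝)) (λ a u _ n → refl) x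
      ; ⊗-comm = λ x y → κ-cong {⌜ x ⌝ `* ⌜ y ⌝} {⌜ y ⌝ `* ⌜ x ⌝} (λ u _ n → cong (_% p) (act-comm ⌜ x ⌝ ⌜ y ⌝ u n))
      ; ⊗-idˡ = law₁ (λ x → κ′ (num 1) ⊗′ x) (λ x → x) (λ a → num 1 `* a) (λ a → a) (λ a → κ-* (num 1) a) (λ a → refl) (λ a u _ n → cong (_% p) (ℕ.+-identityʳ (act a u n)))
      ; ⊗-distˡ = λ x y z → law₁ (λ x → x ⊗′ (y ⊕′ z)) (λ x → (x ⊗′ y) ⊕′ (x ⊗′ z)) (λ a → a `* (⌜ y ⌝ `+ ⌜ z ⌝)) (λ a → a `* ⌜ y ⌝ `+ a `* ⌜ z ⌝)
          (λ a → κ-* a (⌜ y ⌝ `+ ⌜ z ⌝))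
          (λ a → trans (cong₂ (λ y z → (κ′ a ⊗′ y) ⊕′ (κ′ a ⊗′ z)) (sym (κ⌜⌝ y)) (sym (κ⌜⌝ z))) (trans (cong₂ _⊕′_ (κ-* a ⌜ y ⌝) (κ-* a ⌜ z ⌝)) (κ-+ (a `* ⌜ y ⌝) (a `* ⌜ z ⌝))))
          (λ a u _ n → cong (_% p) (act-+ a (act ⌜ y ⌝ u) (act ⌜ z ⌝ u) n)) x
      ; #-+ = λ m n → sym (trans (κ-+ (num m) (num n)) (κ-cong {num m `+ num n} {num (m + n)} (λ u _ k → cong (_% p)
          (trans (cong₂ _+_ (act-num m u k) (act-num n u k)) (trans (sym (ℕ.*-distribʳ-+ (u k) m n)) (sym (act-num (m + n) u k)))))))
      ; #-* = λ m n → sym (trans (κ-* (num m) (num n)) (κ-cong {num m `* num n} {num (m * n)} (λ u _ k → cong (_% p)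
          (trans (act-num m (act (num n) u) k) (trans (cong (m *_) (act-num n u k)) (trans (sym (ℕ.*-assoc m n (u k))) (sym (act-num (m * n) u k))))))))
      }

    open RingTheory ring using (_^_)

    _`^_ : Term → ℕ → Term
    t `^ zero = num 1
    t `^ suc n = t `* (t `^ n)

    κ-^ : ∀ t n → κ′ t ^ n ≡ κ′ (t `^ n)
    κ-^ t zero = refl
    κ-^ t (suc n) = trans (cong (κ′ t ⊗′_) (κ-^ t n)) (κ-* t (t `^ n))

    act-X^ : ∀ m u n → act (`X `^ m) u n ≡ u (m + n)
    act-X^ zero u n = ℕ.+-identityʳ (u n)
    act-X^ (suc m) u n = trans (act-X^ m u (suc n)) (cong u (ℕ.+-suc m n))

    `factors : ℕ → Term
    `factors zero = num 1
    `factors (suc d) = (`X `^ (p ℕ.^ suc d) `+ num p′ `* `X) `* `factors d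

    κ-factors : ∀ d → factors ring p (κ′ `X) d ≡ κ′ (`factors d)
    κ-factors zero = refl
    κ-factors (suc d) = trans (cong₂ _⊗′_ (trans (cong₂ _⊕′_ (κ-^ `X (p ℕ.^ suc d)) (κ-cong {num p′ `* ⌜ κ′ `X ⌝} {num p′ `* `X} (`*-cong {num p′} {num p′} {⌜ κ′ `X ⌝} {`X} (λ _ _ _ → refl) (⌜κ⌝ `X)))) (κ-+ (`X `^ (p ℕ.^ suc d)) (num p′ `* `X))) (κ-factors d))
      (κ-* (`X `^ (p ℕ.^ suc d) `+ num p′ `* `X) (`factors d))

    -- Multiplying by X^m − X, m ≥ 2, moves the first nonzero entry of a sequence down by m.
    leading : ∀ d M {u} → (∀ i → i < M + S p d → u i ≡ 0) → u (M + S p d) ≡ 1 → (∀ i → i < M → act (`factors d) u i ≡ₚ 0) × act (`factors d) u M ≡ₚ 1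
    leading zero M {u} z o = (λ i q → cong (_% p) (trans (ℕ.+-identityʳ (u i)) (z i (ℕ.<-≤-trans q (ℕ.m≤m+n M 0))))) , cong (_% p) (trans (ℕ.+-identityʳ (u M)) (trans (cong u (sym (ℕ.+-identityʳ M))) o))
    leading (suc d) M {u} z o = zeros , one
      where
      m = p ℕ.^ suc d
      w = act (`factors d) u
      2≤m : 2 ≤ m
      2≤m = ℕ.≤-trans (s≤s (s≤s z≤n)) (ℕ.m≤m*n p (p ℕ.^ d) ⦃ ℕ.m^n≢0 p d ⦄)
      ih = leading d (M + m) {u} (λ i q → z i (subst (i <_) (ℕ.+-assoc M m (S p d)) q)) (trans (cong u (ℕ.+-assoc M m (S p d))) o)
      step : ∀ i → act (`factors (suc d)) u i ≡ w (m + i) + p′ * w (suc i)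
      step i = cong₂ _+_ (act-X^ m w i) (act-num p′ (λ k → w (suc k)) i)
      suc<M+m : ∀ {i} → i ≤ M → suc i < M + m
      suc<M+m {i} q = ℕ.≤-trans (ℕ.≤-reflexive (ℕ.+-comm 2 i)) (ℕ.+-mono-≤ q 2≤m)
      second : ∀ i → i ≤ M → p′ * w (suc i) ≡ₚ 0
      second i q = trans (*-≡ₚ p′ p′ (w (suc i)) 0 refl (proj₁ ih (suc i) (suc<M+m q))) (cong (_% p) (ℕ.*-zeroʳ p′))
      zeros : ∀ i → i < M → act (`factors (suc d)) u i ≡ₚ 0
      zeros i q = trans (cong (_% p) (step i)) (+-≡ₚ (w (m + i)) 0 (p′ * w (suc i)) 0 (proj₁ ih (m + i) (subst (_< M + m) (ℕ.+-comm i m) (ℕ.+-monoˡ-< m q))) (second i (ℕ.<⇒≤ q)))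
      one : act (`factors (suc d)) u M ≡ₚ 1
      one = trans (cong (_% p) (step M)) (+-≡ₚ (w (m + M)) 1 (p′ * w (suc M)) 0 (trans (cong (λ t → w t % p) (ℕ.+-comm m M)) (proj₂ ih)) (second M ℕ.≤-refl))

    cyclicAlgebra : CyclicAlgebra p N
    cyclicAlgebra = record
      { 𝓡 = ring
      ; X = κ′ `X
      ; characteristic = κ-cong {num p} {num 0} (λ u _ n → trans (cong (_% p) (trans (act-num p u n) (ℕ.*-comm p (u n)))) (m*n%n≡0 (u n) p))
      ; X-periodic = trans (κ-^ `X (suc N)) (κ-cong {`X `^ suc N} {`X} (λ u per n → cong (_% p) (trans (act-X^ (suc N) u n) (trans (cong u (sym (ℕ.+-suc N n))) (per (suc n))))))
      ; generated = λ Q q0 q1 qX q+ q* x → subst Q (κ⌜⌝ x) (gen Q q0 q1 qX q+ q* ⌜ x ⌝)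
      ; _≟ᴿ_ = Vec.≡-dec Fin._≟_
      ; elements = allVecs N
      ; complete = ∈-allVecs
      ; factors≢0 = nonzero
      }
      where
      gen : ∀ Q → Q (κ′ `0) → Q (κ′ (num 1)) → Q (κ′ `X) → (∀ {x y} → Q x → Q y → Q (x ⊕′ y)) → (∀ {x y} → Q x → Q y → Q (x ⊗′ y)) → ∀ t → Q (κ′ t)
      gen Q q0 q1 qX q+ q* `X = qX
      gen Q q0 q1 qX q+ q* `0 = q0
      gen Q q0 q1 qX q+ q* `1 = subst Q (κ-cong {num 1} {`1} (λ u _ n → cong (_% p) (ℕ.+-identityʳ (u n)))) q1
      gen Q q0 q1 qX q+ q* (s `+ t) = subst Q (κ-+ s t) (q+ (gen Q q0 q1 qX q+ q* s) (gen Q q0 q1 qX q+ q* t))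
      gen Q q0 q1 qX q+ q* (s `* t) = subst Q (κ-* s t) (q* (gen Q q0 q1 qX q+ q* s) (gen Q q0 q1 qX q+ q* t))
      nonzero : ∀ d → S p d < N → factors ring p (κ′ `X) d ≢ κ′ `0
      -- On the indicator of the class S p d, `leading` with M = 0 evaluates the product to 1 at
      -- index 0, where the zero term gives 0.
      nonzero d q e with trans (sym (proj₂ (leading d 0 {ind (S p d)} (λ i r → ind-no (ℕ.<-trans r q) (λ e → ℕ.<-irrefl e r)) (ind-yes q refl))))
                           (κ-sound {`factors d} {`0} (trans (sym (κ-factors d)) e) (ind (S p d)) (ind-periodic (S p d)) 0)
      ... | ()

-- Finite fields of every prime power order, from primitive idempotents.

module GaloisFields where
  open Rings
  open Frobenius
  open CyclicAlgebras
  open import Defs using (IsPrimePower)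
  open import Data.Nat as ℕ using (ℕ; zero; suc; _+_; _*_; _≤_; _<_; _∸_; z≤n; s≤s)
  import Data.Nat.Properties as ℕ
  open import Data.Nat.Coprimality using (Coprime; coprime-Bézout)
  open import Data.Nat.GCD using (module Bézout)
  open import Data.Nat.Divisibility using (∣⇒≤)
  open import Data.Nat.Primality using (Prime; prime⇒nonTrivial; prime⇒irreducible)
  open import Data.Nat.Base using (nonTrivial⇒n>1)
  open import Data.Fin as Fin using (Fin; toℕ; zero; suc; finToFun; funToFin; fromℕ)
  import Data.Fin.Properties as Fin
  open import Data.Vec using (Vec; []; _∷_; lookup; tabulate)
  import Data.Vec.Properties as Vec
  open import Data.List using (List; []; _∷_)
  open import Data.List.Membership.Propositional using (_∈_)
  open import Data.List.Relation.Unary.Any using (here; there)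
  open import Data.Product using (Σ; _×_; _,_; proj₁; proj₂)
  open import Data.Sum using (_⊎_; inj₁; inj₂)
  open import Data.Empty using (⊥-elim)
  open import Relation.Nullary using (Dec; yes; no)
  open import Relation.Binary using (tri<; tri≈; tri>)
  open import Relation.Binary.PropositionalEquality

  record FiniteField (q : ℕ) : Set₁ where
    field
      𝓡 : CRing
    open CRing 𝓡
    field
      1≢0 : # 1 ≢ # 0
      inverse : ∀ x → x ≢ # 0 → Σ R λ y → x ⊗ y ≡ # 1
      elem : Fin q → R
      index : R → Fin q
      elem-index : ∀ x → elem (index x) ≡ x
      index-elem : ∀ i → index (elem i) ≡ i

    elem-injective : ∀ {i j} → elem i ≡ elem j → i ≡ j
    elem-injective {i} {j} e = trans (sym (index-elem i)) (trans (cong index e) (index-elem j))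

    _≟_ : (x y : R) → Dec (x ≡ y)
    x ≟ y with index x Fin.≟ index y
    ... | yes e = yes (trans (sym (elem-index x)) (trans (cong elem e) (elem-index y)))
    ... | no ne = no (λ e → ne (cong index e))

  finToFun-injective : ∀ k {p} {i j : Fin (p ℕ.^ k)} → (∀ m → finToFun {p} {k} i m ≡ finToFun {p} {k} j m) → i ≡ j
  finToFun-injective k {p} {i} {j} h = trans (sym (Fin.funToFin-finToFin {k} {p} i)) (trans (funToFin-cong h) (Fin.funToFin-finToFin {k} {p} j))
    where
    funToFin-cong : ∀ {n} {f g : Fin n → Fin p} → (∀ m → f m ≡ g m) → funToFin f ≡ funToFin g
    funToFin-cong {zero} _ = refl
    funToFin-cong {suc n} h = cong₂ Fin.combine (h zero) (funToFin-cong (λ m → h (suc m)))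

  uip : ∀ {A : Set} {x y : A} (p q : x ≡ y) → p ≡ q
  uip refl refl = refl

  field⇒domain : (𝓡 : CRing) → let open CRing 𝓡 in (∀ x → Dec (x ≡ # 0)) → (∀ x → x ≢ # 0 → Σ R λ y → x ⊗ y ≡ # 1) → RingTheory.Domain 𝓡
  field⇒domain 𝓡 zero? inverse x y e with zero? x
  ... | yes x≡0 = inj₁ x≡0
  ... | no x≢0 with inverse x x≢0
  ... | x⁻¹ , xx⁻¹ = inj₂ (trans (sym (⊗-idˡ y)) (trans (cong (_⊗ y) (sym xx⁻¹)) (trans (ring 3 (λ x i y → (x :* i) :* y := i :* (x :* y)) refl (x ∷ x⁻¹ ∷ y ∷ [])) (trans (cong (x⁻¹ ⊗_) e) (⊗-zeroʳ x⁻¹)))))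
    where
    open CRing 𝓡
    open RingTheory 𝓡

  -- For d = k - 1 this puts the degree of the product below N = q - 1, so the product is a nonzero
  -- element of the algebra.
  S< : ∀ p d → 1 < p → suc (S p d) < p ℕ.^ suc d
  S< p zero 1<p = subst (1 <_) (sym (ℕ.*-identityʳ p)) 1<p
  S< p (suc d) 1<p = begin-strict
    suc (p ℕ.^ suc d + S p d)       ≡⟨ ℕ.+-suc (p ℕ.^ suc d) (S p d) ⟨
    p ℕ.^ suc d + suc (S p d)       <⟨ ℕ.+-monoʳ-< (p ℕ.^ suc d) (S< p d 1<p) ⟩
    p ℕ.^ suc d + p ℕ.^ suc d       ≡⟨ cong (p ℕ.^ suc d +_) (ℕ.+-identityʳ _) ⟨
    2 * p ℕ.^ suc d                 ≤⟨ ℕ.*-monoˡ-≤ (p ℕ.^ suc d) 1<p ⟩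
    p * p ℕ.^ suc d                 ∎
    where open ℕ.≤-Reasoning

  -- A quotient field of the algebra in which the product of the X^(p^d) − X, 0 < d < k, stays invertible has exactly p^k elements.
  module Quotient (p k′ N′ : ℕ) (pp : Prime p) (q≡ : p ℕ.^ suc k′ ≡ suc (suc N′)) (A : CyclicAlgebra p (suc N′)) where
    open CyclicAlgebra A
    open CRing 𝓡
    open RingTheory 𝓡

    k q N : ℕ
    k = suc k′
    q = p ℕ.^ k
    N = suc N′

    1<p : 1 < p
    1<p = nonTrivial⇒n>1 p ⦃ prime⇒nonTrivial pp ⦄

    -- Raising to the power q = N + 1 is additive by Frobenius, multiplicative, and fixes X, hence
    -- fixes all that X generates. The modulus X^(q - 1) - 1 is chosen for this.
    power : ∀ x → x ^ suc N ≡ x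
    power = generated (λ x → x ^ suc N ≡ x) (^-zero N) (^-one (suc N)) X-periodic
      (λ {x} {y} ex ey → trans (subst (λ m → (x ⊕ y) ^ m ≡ x ^ m ⊕ y ^ m) q≡ (frobenius pp characteristic k x y)) (cong₂ _⊕_ ex ey))
      (λ {x} {y} ex ey → trans (^-distrib-* x y (suc N)) (cong₂ _⊗_ ex ey))

    unit : R → R
    unit x = x ^ N

    unit-idempotent : ∀ x → unit x ⊗ unit x ≡ unit x
    unit-idempotent x = trans (ring 2 (λ x y → (x :* y) :* (x :* y) := (x :* (x :* y)) :* y) refl (x ∷ x ^ N′ ∷ [])) (cong (_⊗ x ^ N′) (power x))

    Primitive : List R → R → R → Set
    Primitive xs e₀ e = e ⊗ e ≡ e × e ≢ # 0 × e ⊗ e₀ ≡ e × (∀ {x} → x ∈ xs → e ⊗ unit x ≡ # 0 ⊎ e ⊗ unit x ≡ e)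

    -- Multiplies e₀ by the idempotents x^N one after another, keeping each product that is nonzero.
    -- Alternatives settled earlier survive multiplication by an idempotent.
    refine : ∀ xs e₀ → e₀ ⊗ e₀ ≡ e₀ → e₀ ≢ # 0 → Σ R (Primitive xs e₀)
    refine [] e₀ ee e≢0 = e₀ , ee , e≢0 , ee , λ ()
    refine (x ∷ xs) e₀ ee e≢0 with refine xs e₀ ee e≢0
    ... | e , idem , nz , below , dich with (e ⊗ unit x) ≟ᴿ # 0
    ... | yes z = e , idem , nz , below , λ { (here refl) → inj₁ z ; (there y) → dich y }
    ... | no e′≢0 = e ⊗ u , idem′ , e′≢0 , below′ , λ { (here refl) → inj₂ (trans (⊗-assoc e u u) (cong (e ⊗_) (unit-idempotent x))) ; (there {y} m) → old m }
      where
      u = unit x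
      idem′ : (e ⊗ u) ⊗ (e ⊗ u) ≡ e ⊗ u
      idem′ = trans (ring 2 (λ e u → (e :* u) :* (e :* u) := (e :* e) :* (u :* u)) refl (e ∷ u ∷ [])) (cong₂ _⊗_ idem (unit-idempotent x))
      below′ : (e ⊗ u) ⊗ e₀ ≡ e ⊗ u
      below′ = trans (ring 3 (λ e u f → (e :* u) :* f := (e :* f) :* u) refl (e ∷ u ∷ e₀ ∷ [])) (cong (_⊗ u) below)
      commute : ∀ y → (e ⊗ u) ⊗ unit y ≡ (e ⊗ unit y) ⊗ u
      commute y = ring 3 (λ e u f → (e :* u) :* f := (e :* f) :* u) refl (e ∷ u ∷ unit y ∷ [])
      old : ∀ {y} → y ∈ xs → (e ⊗ u) ⊗ unit y ≡ # 0 ⊎ (e ⊗ u) ⊗ unit y ≡ e ⊗ u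
      old {y} m with dich m
      ... | inj₁ z = inj₁ (trans (commute y) (trans (cong (_⊗ u) z) (⊗-zeroˡ u)))
      ... | inj₂ z = inj₂ (trans (commute y) (cong (_⊗ u) z))

    P : R
    P = factors 𝓡 p X k′

    P≢0 : P ≢ # 0
    P≢0 = factors≢0 k′ (ℕ.≤-pred (subst (suc (S p k′) <_) q≡ (S< p k′ 1<p)))

    private
      found : Σ R (Primitive elements (unit P))
      found = refine elements (unit P) (unit-idempotent P) (λ z → P≢0 (trans (sym (power P)) (trans (cong (P ⊗_) z) (⊗-zeroʳ P))))

    abstract
      e : R
      e = proj₁ found

      e-idempotent : e ⊗ e ≡ e
      e-idempotent = proj₁ (proj₂ found)

      e≢0 : e ≢ # 0
      e≢0 = proj₁ (proj₂ (proj₂ found))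

      e-below : e ⊗ unit P ≡ e
      e-below = proj₁ (proj₂ (proj₂ (proj₂ found)))

      e-primitive : ∀ x → e ⊗ unit x ≡ # 0 ⊎ e ⊗ unit x ≡ e
      e-primitive x = proj₂ (proj₂ (proj₂ (proj₂ found))) (complete x)

    -- The field is realised as the ideal eR with unit e rather than as a quotient, so equality
    -- remains that of R.
    L : Set
    L = Σ R λ x → e ⊗ x ≡ x

    L-≡ : {x y : L} → proj₁ x ≡ proj₁ y → x ≡ y
    L-≡ {x , ex} {.x , ey} refl = cong (x ,_) (uip ex ey)

    π : R → L
    π x = e ⊗ x , trans (sym (⊗-assoc e e x)) (cong (_⊗ x) e-idempotent)

    quotientRing : CRing
    quotientRing = record
      { R = L
      ; _⊕_ = λ { (x , ex) (y , ey) → x ⊕ y , trans (⊗-distˡ e x y) (cong₂ _⊕_ ex ey) }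
      ; _⊗_ = λ { (x , ex) (y , ey) → x ⊗ y , trans (sym (⊗-assoc e x y)) (cong (_⊗ y) ex) }
      ; ⊝_ = λ { (x , ex) → ⊝ x , trans (cong (e ⊗_) (sym (⊕-idˡ (⊝ x)))) (trans (ring 2 (λ e x → e :* (κ 0 :- x) := κ 0 :- e :* x) refl (e ∷ x ∷ [])) (trans (cong (# 0 ⊖_) ex) (⊕-idˡ (⊝ x)))) }
      ; # = λ n → π (# n)
      ; ⊕-assoc = λ { (x , _) (y , _) (z , _) → L-≡ (⊕-assoc x y z) }
      ; ⊕-comm = λ { (x , _) (y , _) → L-≡ (⊕-comm x y) }
      ; ⊕-idˡ = λ { (x , _) → L-≡ (trans (cong (_⊕ x) (⊗-zeroʳ e)) (⊕-idˡ x)) }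
      ; ⊕-invʳ = λ { (x , _) → L-≡ (trans (⊕-invʳ x) (sym (⊗-zeroʳ e))) }
      ; ⊗-assoc = λ { (x , _) (y , _) (z , _) → L-≡ (⊗-assoc x y z) }
      ; ⊗-comm = λ { (x , _) (y , _) → L-≡ (⊗-comm x y) }
      ; ⊗-idˡ = λ { (x , ex) → L-≡ (trans (cong (_⊗ x) (⊗-idʳ e)) ex) }
      ; ⊗-distˡ = λ { (x , _) (y , _) (z , _) → L-≡ (⊗-distˡ x y z) }
      ; #-+ = λ m n → L-≡ (trans (cong (e ⊗_) (#-+ m n)) (⊗-distˡ e (# m) (# n)))
      ; #-* = λ m n → L-≡ (trans (cong₂ _⊗_ (sym e-idempotent) (#-* m n)) (ring 3 (λ e m n → (e :* e) :* (m :* n) := (e :* m) :* (e :* n)) refl (e ∷ # m ∷ # n ∷ [])))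
      }

    private
      module 𝓛 = CRing quotientRing
      module 𝓛T = RingTheory quotientRing

    π-⊗ : ∀ x y → π (x ⊗ y) ≡ π x 𝓛.⊗ π y
    π-⊗ x y = L-≡ (trans (cong (_⊗ (x ⊗ y)) (sym e-idempotent)) (ring 3 (λ e m n → (e :* e) :* (m :* n) := (e :* m) :* (e :* n)) refl (e ∷ x ∷ y ∷ [])))

    π-⊖ : ∀ x y → π (x ⊖ y) ≡ π x 𝓛.⊖ π y
    π-⊖ x y = L-≡ (ring 3 (λ e x y → e :* (x :- y) := e :* x :- e :* y) refl (e ∷ x ∷ y ∷ []))

    π-^ : ∀ x n → π (x ^ n) ≡ π x 𝓛T.^ n
    π-^ x zero = refl
    π-^ x (suc n) = trans (π-⊗ x (x ^ n)) (cong (π x 𝓛.⊗_) (π-^ x n))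

    L-characteristic : 𝓛.# p ≡ 𝓛.# 0
    L-characteristic = cong π characteristic

    proj-^ : ∀ (x : L) n → proj₁ (x 𝓛T.^ suc n) ≡ proj₁ x ^ suc n
    proj-^ x@(x′ , ex) zero = trans (cong (x′ ⊗_) (⊗-idʳ e)) (trans (⊗-comm x′ e) (trans ex (sym (⊗-idʳ x′))))
    proj-^ x (suc n) = cong (proj₁ x ⊗_) (proj-^ x n)

    L-power : ∀ (x : L) → x 𝓛T.^ q ≡ x
    L-power x = subst (λ m → x 𝓛T.^ m ≡ x) (sym q≡) (L-≡ (trans (proj-^ x N) (power (proj₁ x))))

    _≟ᴸ_ : (x y : L) → Dec (x ≡ y)
    (x , ex) ≟ᴸ (y , ey) with x ≟ᴿ y
    ... | yes x≡y = yes (L-≡ x≡y)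
    ... | no x≢y = no λ { refl → x≢y refl }

    L-1≢0 : 𝓛.# 1 ≢ 𝓛.# 0
    L-1≢0 z = e≢0 (trans (sym (⊗-idʳ e)) (trans (cong proj₁ z) (⊗-zeroʳ e)))

    -- If e x^N = e, then x^(N - 1) inverts x; if e x^N = 0, then x = e x = e x^N x = 0.
    L-inverse : ∀ x → x ≢ 𝓛.# 0 → Σ L λ y → x 𝓛.⊗ y ≡ 𝓛.# 1
    L-inverse x@(x′ , ex) x≢0 with e-primitive x′
    ... | inj₂ one = π (x′ ^ N′) , L-≡ (trans (ring 3 (λ e x y → x :* (e :* y) := e :* (x :* y)) refl (e ∷ x′ ∷ x′ ^ N′ ∷ [])) (trans one (sym (⊗-idʳ e))))
    ... | inj₁ z = ⊥-elim (x≢0 (L-≡ (trans (trans (sym ex) (trans (cong (e ⊗_) (sym (power x′))) (trans (ring 3 (λ e x y → e :* (x :* y) := x :* (e :* y)) refl (e ∷ x′ ∷ x′ ^ N ∷ [])) (trans (cong (x′ ⊗_) z) (⊗-zeroʳ x′))))) (sym (⊗-zeroʳ e)))))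

    L-domain : 𝓛T.Domain
    L-domain = field⇒domain quotientRing (_≟ᴸ 𝓛.# 0) L-inverse

    ξ : L
    ξ = π X

    private
      π-factors : ∀ d → π (factors 𝓡 p X d) ≡ factors quotientRing p ξ d
      π-factors zero = refl
      π-factors (suc d) = trans (π-⊗ _ _) (cong₂ 𝓛._⊗_ (trans (π-⊖ _ X) (cong (𝓛._⊖ ξ) (π-^ X (p ℕ.^ suc d)))) (π-factors d))

      πP≢0 : factors quotientRing p ξ k′ ≢ 𝓛.# 0
      πP≢0 z = e≢0 (trans (sym e-below) (trans (sym (⊗-assoc e P (P ^ N′))) (trans (cong (_⊗ P ^ N′) (trans (cong proj₁ (trans (π-factors k′) z)) (⊗-zeroʳ e))) (⊗-zeroˡ (P ^ N′)))))

      vanishing-factor : ∀ d m → suc m ≤ d → ξ 𝓛T.^ (p ℕ.^ suc m) ≡ ξ → factors quotientRing p ξ d ≡ 𝓛.# 0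
      vanishing-factor (suc d) m q eq with ℕ.m≤n⇒m<n∨m≡n q
      ... | inj₂ refl = trans (cong (𝓛._⊗ factors quotientRing p ξ d) (trans (cong (𝓛._⊖ ξ) eq) (𝓛.⊕-invʳ ξ))) (𝓛T.⊗-zeroˡ (factors quotientRing p ξ d))
      ... | inj₁ r = trans (cong (((ξ 𝓛T.^ (p ℕ.^ suc d)) 𝓛.⊖ ξ) 𝓛.⊗_) (vanishing-factor d m (ℕ.≤-pred r) eq)) (𝓛T.⊗-zeroʳ _)

    -- Such an equation would make a factor of P vanish in L, whereas e · P^N = e makes P invertible
    -- there.
    ξ-degree : ∀ m → suc m < k → ξ 𝓛T.^ (p ℕ.^ suc m) ≢ ξ
    ξ-degree m q eq = πP≢0 (vanishing-factor k′ m (ℕ.≤-pred q) eq)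

    conjugate : Fin k → L
    conjugate i = ξ 𝓛T.^ (p ℕ.^ toℕ i)

    private
      -- Raising both sides to the power p^(k - i) and using ξ^q = ξ turns the equation into ξ^(p^(j
      -- - i)) = ξ with 0 < j - i < k.
      conjugates-< : ∀ i j → i < j → j < k → ξ 𝓛T.^ (p ℕ.^ i) ≢ ξ 𝓛T.^ (p ℕ.^ j)
      conjugates-< i j i<j j<k eq with ℕ.m≤n⇒∃[o]m+o≡n i<j
      ... | d , refl = ξ-degree d (ℕ.≤-<-trans (s≤s (ℕ.m≤n+m d i)) j<k) (begin
        ξ ^ᴸ (p ℕ.^ suc d)                              ≡⟨ cong (_^ᴸ (p ℕ.^ suc d)) (L-power ξ) ⟨
        (ξ ^ᴸ q) ^ᴸ (p ℕ.^ suc d)                       ≡⟨ 𝓛T.^-assocʳ ξ q (p ℕ.^ suc d) ⟩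
        ξ ^ᴸ (q * p ℕ.^ suc d)                          ≡⟨ cong (ξ ^ᴸ_) (exponent) ⟩
        ξ ^ᴸ (p ℕ.^ (suc i + d) * p ℕ.^ (k ∸ i))        ≡⟨ 𝓛T.^-assocʳ ξ (p ℕ.^ (suc i + d)) (p ℕ.^ (k ∸ i)) ⟨
        (ξ ^ᴸ (p ℕ.^ (suc i + d))) ^ᴸ (p ℕ.^ (k ∸ i))   ≡⟨ cong (_^ᴸ (p ℕ.^ (k ∸ i))) eq ⟨
        (ξ ^ᴸ (p ℕ.^ i)) ^ᴸ (p ℕ.^ (k ∸ i))             ≡⟨ 𝓛T.^-assocʳ ξ (p ℕ.^ i) (p ℕ.^ (k ∸ i)) ⟩
        ξ ^ᴸ (p ℕ.^ i * p ℕ.^ (k ∸ i))                  ≡⟨ cong (ξ ^ᴸ_) (trans (sym (ℕ.^-distribˡ-+-* p i (k ∸ i))) (cong (p ℕ.^_) (ℕ.m+[n∸m]≡n i≤k))) ⟩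
        ξ ^ᴸ q                                          ≡⟨ L-power ξ ⟩
        ξ                                               ∎)
        where
        open ≡-Reasoning
        _^ᴸ_ = 𝓛T._^_
        i≤k : i ≤ k
        i≤k = ℕ.≤-trans (ℕ.≤-trans (ℕ.n≤1+n i) (ℕ.m≤m+n (suc i) d)) (ℕ.<⇒≤ j<k)
        exponent : q * p ℕ.^ suc d ≡ p ℕ.^ (suc i + d) * p ℕ.^ (k ∸ i)
        exponent = trans (sym (ℕ.^-distribˡ-+-* p k (suc d))) (trans (cong (p ℕ.^_) sums) (ℕ.^-distribˡ-+-* p (suc i + d) (k ∸ i)))
          where
          sums : k + suc d ≡ (suc i + d) + (k ∸ i)
          sums = trans (cong (_+ suc d) (sym (ℕ.m+[n∸m]≡n i≤k))) (trans (ℕ.+-assoc i (k ∸ i) (suc d)) (trans (cong (i +_) (ℕ.+-comm (k ∸ i) (suc d))) (trans (sym (ℕ.+-assoc i (suc d) (k ∸ i))) (cong (_+ (k ∸ i)) (ℕ.+-suc i d)))))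

    conjugate-injective : ∀ {i j} → conjugate i ≡ conjugate j → i ≡ j
    conjugate-injective {i} {j} eq with ℕ.<-cmp (toℕ i) (toℕ j)
    ... | tri< i<j _ _ = ⊥-elim (conjugates-< (toℕ i) (toℕ j) i<j (Fin.toℕ<n j) eq)
    ... | tri≈ _ i≡j _ = Fin.toℕ-injective i≡j
    ... | tri> _ _ j<i = ⊥-elim (conjugates-< (toℕ j) (toℕ i) j<i (Fin.toℕ<n i) (sym eq))

    private
      Fixed : L → Set
      Fixed c = ∀ m → c 𝓛T.^ (p ℕ.^ m) ≡ c

      ^-⊖ : ∀ m x y → (x 𝓛.⊖ y) 𝓛T.^ (p ℕ.^ m) ≡ (x 𝓛T.^ (p ℕ.^ m)) 𝓛.⊖ (y 𝓛T.^ (p ℕ.^ m))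
      ^-⊖ m x y = sym (𝓛T.⊖-unique (trans (sym (𝓛T.frobenius pp L-characteristic m (x 𝓛.⊖ y) y)) (cong (𝓛T._^ (p ℕ.^ m)) (𝓛T.⊖-⊕ x y))))

      eval-frobenius : ∀ {n} (cs : Vec L n) m x → (∀ i → Fixed (lookup cs i)) → 𝓛T.eval cs (x 𝓛T.^ (p ℕ.^ m)) ≡ 𝓛T.eval cs x 𝓛T.^ (p ℕ.^ m)
      eval-frobenius [] m x _ = sym (𝓛T.fermat pp L-characteristic m 0)
      eval-frobenius (c ∷ cs) m x fix = trans (cong₂ 𝓛._⊕_ (sym (fix zero m)) (trans (cong ((x 𝓛T.^ (p ℕ.^ m)) 𝓛.⊗_) (eval-frobenius cs m x (λ i → fix (suc i)))) (sym (𝓛T.^-distrib-* x (𝓛T.eval cs x) (p ℕ.^ m)))))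
        (sym (𝓛T.frobenius pp L-characteristic m c (x 𝓛.⊗ 𝓛T.eval cs x)))

      #-injective-< : ∀ a b → a < b → b < p → 𝓛.# a ≢ 𝓛.# b
      #-injective-< a b a<b b<p eq with ℕ.m≤n⇒∃[o]m+o≡n a<b
      ... | o , refl = L-1≢0 (bezout (coprime-Bézout coprime))
        where
        d = suc o
        #d≡0 : 𝓛.# d ≡ 𝓛.# 0
        #d≡0 = 𝓛T.⊕-cancelʳ (𝓛.# d) (𝓛.# 0) (𝓛.# a) (trans (sym (𝓛.#-+ d a)) (trans (cong 𝓛.# (trans (ℕ.+-comm d a) (ℕ.+-suc a o))) (trans (sym eq) (sym (𝓛.⊕-idˡ (𝓛.# a))))))
        coprime : Coprime p d
        coprime (x∣p , x∣d) with prime⇒irreducible pp x∣p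
        ... | inj₁ x≡1 = x≡1
        ... | inj₂ refl = ⊥-elim (ℕ.<⇒≱ (ℕ.≤-<-trans (s≤s (ℕ.m≤n+m o a)) b<p) (∣⇒≤ x∣d))
        multiple : ∀ x y → 𝓛.# y ≡ 𝓛.# 0 → 𝓛.# (x * y) ≡ 𝓛.# 0
        multiple x y z = trans (𝓛.#-* x y) (trans (cong (𝓛.# x 𝓛.⊗_) z) (𝓛T.⊗-zeroʳ (𝓛.# x)))
        one : ∀ u v → 𝓛.# u ≡ 𝓛.# 0 → 𝓛.# v ≡ 𝓛.# 0 → 1 + u ≡ v → 𝓛.# 1 ≡ 𝓛.# 0
        one u v zu zv s = trans (sym (𝓛T.⊕-idʳ (𝓛.# 1))) (trans (cong (𝓛.# 1 𝓛.⊕_) (sym zu)) (trans (sym (𝓛.#-+ 1 u)) (trans (cong 𝓛.# s) zv)))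
        bezout : Bézout.Identity 1 p d → 𝓛.# 1 ≡ 𝓛.# 0
        bezout (Bézout.+- x y s) = one (y * d) (x * p) (multiple y d #d≡0) (multiple x p L-characteristic) s
        bezout (Bézout.-+ x y s) = one (x * p) (y * d) (multiple x p L-characteristic) (multiple y d #d≡0) s

      #-injective : ∀ (a b : Fin p) → 𝓛.# (toℕ a) ≡ 𝓛.# (toℕ b) → a ≡ b
      #-injective a b eq with ℕ.<-cmp (toℕ a) (toℕ b)
      ... | tri< lt _ _ = ⊥-elim (#-injective-< (toℕ a) (toℕ b) lt (Fin.toℕ<n b) eq)
      ... | tri≈ _ a≡b _ = Fin.toℕ-injective a≡b
      ... | tri> _ _ gt = ⊥-elim (#-injective-< (toℕ b) (toℕ a) gt (Fin.toℕ<n a) (sym eq))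

      digits : Fin q → Fin k → L
      digits i j = 𝓛.# (toℕ (finToFun {p} {k} i j))

    elem : Fin q → L
    elem i = 𝓛T.eval (tabulate (digits i)) ξ

    -- A polynomial over 𝔽ₚ of degree below k that vanishes at ξ vanishes at its k conjugates.
    elem-injective : ∀ {i j} → elem i ≡ elem j → i ≡ j
    elem-injective {i} {j} eq = finToFun-injective k digit-eq
      where
      ds : Vec L k
      ds = tabulate (λ m → digits i m 𝓛.⊖ digits j m)
      fixed : ∀ m → Fixed (lookup ds m)
      fixed m l = subst (λ c → c 𝓛T.^ (p ℕ.^ l) ≡ c) (sym (Vec.lookup∘tabulate (λ m → digits i m 𝓛.⊖ digits j m) m))
        (trans (^-⊖ l (digits i m) (digits j m)) (cong₂ 𝓛._⊖_ (𝓛T.fermat pp L-characteristic l (toℕ (finToFun {p} {k} i m))) (𝓛T.fermat pp L-characteristic l (toℕ (finToFun {p} {k} j m)))))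
      root : 𝓛T.eval ds ξ ≡ 𝓛.# 0
      root = trans (𝓛T.eval-difference (digits i) (digits j) ξ) (trans (cong (𝓛._⊖ elem j) eq) (𝓛.⊕-invʳ (elem j)))
      roots : ∀ m → 𝓛T.eval ds (conjugate m) ≡ 𝓛.# 0
      roots m = trans (eval-frobenius ds (toℕ m) ξ fixed) (trans (cong (𝓛T._^ (p ℕ.^ toℕ m)) root) (𝓛T.fermat pp L-characteristic (toℕ m) 0))
      digit-eq : ∀ m → finToFun {p} {k} i m ≡ finToFun {p} {k} j m
      digit-eq m = #-injective _ _ (𝓛T.⊖-zero (trans (sym (Vec.lookup∘tabulate (λ m → digits i m 𝓛.⊖ digits j m) m)) (𝓛T.too-many-roots L-domain ds conjugate conjugate-injective roots m)))

    private
      monomial : ∀ n → Vec L (suc n)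
      monomial zero = 𝓛.# 1 ∷ []
      monomial (suc n) = 𝓛.# 0 ∷ monomial n

      eval-monomial : ∀ n x → 𝓛T.eval (monomial n) x ≡ x 𝓛T.^ n
      eval-monomial zero x = trans (cong (𝓛.# 1 𝓛.⊕_) (𝓛T.⊗-zeroʳ x)) (𝓛T.⊕-idʳ _)
      eval-monomial (suc n) x = trans (𝓛.⊕-idˡ _) (cong (x 𝓛.⊗_) (eval-monomial n x))

      lookup-monomial : ∀ n → lookup (monomial n) (fromℕ n) ≡ 𝓛.# 1
      lookup-monomial zero = refl
      lookup-monomial (suc n) = lookup-monomial n

      -- This is X^q - X, with q = N′ + 2. It has q + 1 coefficients, so q + 1 distinct roots would
      -- annihilate its leading coefficient 1.
      powerPoly : Vec L (suc (suc (suc N′)))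
      powerPoly = 𝓛.# 0 ∷ (𝓛.# 0 𝓛.⊖ 𝓛.# 1) ∷ monomial N′

      powerPoly-root : ∀ x → 𝓛T.eval powerPoly x ≡ 𝓛.# 0
      powerPoly-root x = trans (cong (λ t → 𝓛.# 0 𝓛.⊕ x 𝓛.⊗ ((𝓛.# 0 𝓛.⊖ 𝓛.# 1) 𝓛.⊕ x 𝓛.⊗ t)) (eval-monomial N′ x))
        (trans (𝓛T.ring 2 (λ x y → κ 0 :+ x :* ((κ 0 :- κ 1) :+ x :* y) := x :* (x :* y) :- x) refl (x ∷ x 𝓛T.^ N′ ∷ []))
          (trans (cong (𝓛._⊖ x) (subst (λ m → x 𝓛T.^ m ≡ x) q≡ (L-power x))) (𝓛.⊕-invʳ x)))

    -- An element y outside the image, together with the q values of `elem`, would be q + 1 roots of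
    -- X^q - X.
    elem-surjective : ∀ y → Σ (Fin q) λ i → elem i ≡ y
    elem-surjective y with Fin.any? (λ i → elem i ≟ᴸ y)
    ... | yes found′ = found′
    ... | no none = ⊥-elim (L-1≢0 (trans (sym (lookup-monomial N′)) (𝓛T.too-many-roots L-domain powerPoly ρ ρ-injective (λ i → powerPoly-root (ρ i)) (suc (suc (fromℕ N′))))))
      where
      ρ : Fin (suc (suc (suc N′))) → L
      ρ zero = y
      ρ (suc i) = elem (Fin.cast (sym q≡) i)
      ρ-injective : ∀ {i j} → ρ i ≡ ρ j → i ≡ j
      ρ-injective {zero} {zero} _ = refl
      ρ-injective {zero} {suc j} eq = ⊥-elim (none (_ , sym eq))
      ρ-injective {suc i} {zero} eq = ⊥-elim (none (_ , eq))
      ρ-injective {suc i} {suc j} eq = cong suc (Fin.toℕ-injective (trans (sym (Fin.toℕ-cast (sym q≡) i)) (trans (cong toℕ (elem-injective eq)) (Fin.toℕ-cast (sym q≡) j))))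

    finiteField : FiniteField q
    finiteField = record
      { 𝓡 = quotientRing
      ; 1≢0 = L-1≢0
      ; inverse = L-inverse
      ; elem = elem
      ; index = λ y → proj₁ (elem-surjective y)
      ; elem-index = λ y → proj₂ (elem-surjective y)
      ; index-elem = λ i → elem-injective (proj₂ (elem-surjective (elem i)))
      }

  abstract
    galoisField : ∀ {q} → IsPrimePower q → FiniteField q
    galoisField (zero , suc k , () , _ , refl)
    galoisField (suc zero , suc k , () , _ , refl)
    galoisField (p@(suc (suc p″)) , suc k , pp , _ , refl) = build (p ℕ.^ suc k) refl (S< p k (s≤s (s≤s z≤n)))
      where
      build : ∀ q → p ℕ.^ suc k ≡ q → suc (S p k) < p ℕ.^ suc k → FiniteField (p ℕ.^ suc k)
      build zero eq q = ⊥-elim (ℕ.n≮0 (subst (suc (S p k) <_) eq q))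
      build (suc zero) eq q = ⊥-elim (ℕ.<⇒≱ (subst (suc (S p k) <_) eq q) (s≤s z≤n))
      build (suc (suc N′)) eq _ = Quotient.finiteField p k N′ pp eq (Shift.cyclicAlgebra p″ N′)

-- Upper bounds for Zarankiewicz numbers by counting r-sets.

module Counting where
  open import Defs
  open import Data.Nat using (ℕ; zero; suc; _+_; _*_; _^_; _∸_; _≤_; _<_; _⊔_; z≤n; s≤s)
  import Data.Nat.Properties as ℕ
  open import Data.Nat.Base using (>-nonZero)
  open import Data.Nat.Combinatorics using (_C_; nCk+nC[k+1]≡[n+1]C[k+1]; nC1≡n; k>n⇒nCk≡0)
  open import Data.Nat.Tactic.RingSolver using (solve-∀)
  open import Data.Bool using (Bool; true; false; not)
  open import Data.Fin using (zero; suc)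
  open import Data.Fin.Subset using (Subset; _∈_; _⊆_; ∣_∣; inside; outside; ⁅_⁆)
  open import Data.Fin.Subset.Properties using (∣⁅x⁆∣≡1; x∈⁅y⁆⇒x≡y; drop-there)
  open import Data.Vec using ([]; _∷_; lookup; here; there)
  open import Data.List using (List; []; _∷_; map; foldr; filterᵇ)
  import Data.List.Membership.Propositional as List
  open import Data.List.Membership.Propositional.Properties using (∈-concatMap⁺; ∈-map⁺)
  open import Data.List.Relation.Unary.Any as Any using (Any; here; there)
  open import Data.Product using (∃; _,_)
  open import Data.Sum using (inj₁; inj₂)
  open import Data.Empty using (⊥-elim)
  open import Relation.Nullary using (¬_; yes; no)
  open import Relation.Nullary.Decidable using (isYes)
  open import Relation.Binary.PropositionalEquality

  ∈-allSubsets : ∀ {n} (S : Subset n) → S List.∈ allSubsets n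
  ∈-allSubsets [] = here refl
  ∈-allSubsets (x ∷ S) = ∈-concatMap⁺ (λ S → (inside ∷ S) ∷ (outside ∷ S) ∷ []) (Any.map (λ { refl → member x }) (∈-allSubsets S))
    where
    member : ∀ x → (x ∷ S) List.∈ ((inside ∷ S) ∷ (outside ∷ S) ∷ [])
    member true = here refl
    member false = there (here refl)

  ∈-allGraphs : ∀ {m n} (G : BipGraph m n) → G List.∈ allGraphs m n
  ∈-allGraphs [] = here refl
  ∈-allGraphs {n = n} (N ∷ G) = ∈-concatMap⁺ (λ G → map (λ N → N ∷ G) (allSubsets n)) (Any.map (λ { refl → ∈-map⁺ (_∷ G) (∈-allSubsets N) }) (∈-allGraphs G))

  module _ {A : Set} (f : A → ℕ) (p : A → Bool) where
    filtered-max : List A → ℕ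
    filtered-max xs = foldr _⊔_ 0 (map f (filterᵇ p xs))

    ≤filtered-max : ∀ {x xs} → x List.∈ xs → p x ≡ true → f x ≤ filtered-max xs
    ≤filtered-max {xs = y ∷ xs} (here refl) e with p y
    ≤filtered-max {xs = y ∷ xs} (here refl) refl | true = ℕ.m≤m⊔n (f y) _
    ≤filtered-max {xs = y ∷ xs} (there q) e with p y
    ... | true = ℕ.≤-trans (≤filtered-max q e) (ℕ.m≤n⊔m (f y) _)
    ... | false = ≤filtered-max q e

    filtered-max≤ : ∀ {B} xs → (∀ x → p x ≡ true → f x ≤ B) → filtered-max xs ≤ B
    filtered-max≤ [] h = z≤n
    filtered-max≤ (x ∷ xs) h with p x in e
    ... | true = ℕ.⊔-lub (h x e) (filtered-max≤ xs h)
    ... | false = filtered-max≤ xs h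

  ≤z : ∀ {m n s t} (G : BipGraph m n) → ¬ ContainsK G s t → edges G ≤ z m n s t
  ≤z {m} {n} {s} {t} G ¬K = ≤filtered-max edges (λ G → not (isYes (containsK? G s t))) (∈-allGraphs G) free
    where
    free : not (isYes (containsK? G s t)) ≡ true
    free with containsK? G s t
    ... | yes k = ⊥-elim (¬K k)
    ... | no _ = refl

  z≤ : ∀ {m n s t B} → (∀ (G : BipGraph m n) → ¬ ContainsK G s t → edges G ≤ B) → z m n s t ≤ B
  z≤ {m} {n} {s} {t} h = filtered-max≤ edges (λ G → not (isYes (containsK? G s t))) (allGraphs m n) bound
    where
    bound : ∀ G → not (isYes (containsK? G s t)) ≡ true → edges G ≤ _
    bound G e with containsK? G s t
    bound G () | yes _
    ... | no ¬k = h G ¬k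

  -- The sum over the r-element subsets, organised along Pascal's rule so that it meets the binomial
  -- coefficients by parallel recursion.
  subsetSum : ∀ n → ℕ → (Subset n → ℕ) → ℕ
  subsetSum zero zero f = f []
  subsetSum zero (suc r) f = 0
  subsetSum (suc n) zero f = subsetSum n zero (λ T → f (outside ∷ T))
  subsetSum (suc n) (suc r) f = subsetSum n r (λ T → f (inside ∷ T)) + subsetSum n (suc r) (λ T → f (outside ∷ T))

  pascal : ∀ n k → suc n C suc k ≡ n C k + n C suc k
  pascal n k = sym (nCk+nC[k+1]≡[n+1]C[k+1] n k)

  subsetSum-mono : ∀ n r {f g : Subset n → ℕ} → (∀ T → ∣ T ∣ ≡ r → f T ≤ g T) → subsetSum n r f ≤ subsetSum n r g
  subsetSum-mono zero zero h = h [] refl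
  subsetSum-mono zero (suc r) h = z≤n
  subsetSum-mono (suc n) zero h = subsetSum-mono n zero (λ T e → h (outside ∷ T) e)
  subsetSum-mono (suc n) (suc r) h = ℕ.+-mono-≤ (subsetSum-mono n r (λ T e → h (inside ∷ T) (cong suc e))) (subsetSum-mono n (suc r) (λ T e → h (outside ∷ T) e))

  interchange : ∀ a b c d → (a + b) + (c + d) ≡ (a + c) + (b + d)
  interchange a b c d = trans (ℕ.+-assoc a b (c + d)) (trans (cong (a +_) (trans (sym (ℕ.+-assoc b c d)) (trans (cong (_+ d) (ℕ.+-comm b c)) (ℕ.+-assoc c b d)))) (sym (ℕ.+-assoc a c (b + d))))

  subsetSum-+ : ∀ n r (f g : Subset n → ℕ) → subsetSum n r (λ T → f T + g T) ≡ subsetSum n r f + subsetSum n r g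
  subsetSum-+ zero zero f g = refl
  subsetSum-+ zero (suc r) f g = refl
  subsetSum-+ (suc n) zero f g = subsetSum-+ n zero _ _
  subsetSum-+ (suc n) (suc r) f g = trans (cong₂ _+_ (subsetSum-+ n r _ _) (subsetSum-+ n (suc r) _ _))
    (interchange (subsetSum n r (λ T → f (inside ∷ T))) (subsetSum n r (λ T → g (inside ∷ T))) (subsetSum n (suc r) (λ T → f (outside ∷ T))) (subsetSum n (suc r) (λ T → g (outside ∷ T))))

  subsetSum-one : ∀ n r → subsetSum n r (λ _ → 1) ≡ n C r
  subsetSum-one zero zero = refl
  subsetSum-one zero (suc r) = sym (k>n⇒nCk≡0 {0} {suc r} (s≤s z≤n))
  subsetSum-one (suc n) zero = trans (subsetSum-one n zero) (C-zero n)
    where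
    C-zero : ∀ n → n C 0 ≡ suc n C 0
    C-zero n = refl
  subsetSum-one (suc n) (suc r) = trans (cong₂ _+_ (subsetSum-one n r) (subsetSum-one n (suc r))) (sym (pascal n r))

  contained : ∀ {n} → Subset n → Subset n → ℕ
  contained [] [] = 1
  contained (true ∷ T) (true ∷ N) = contained T N
  contained (true ∷ T) (false ∷ N) = 0
  contained (false ∷ T) (_ ∷ N) = contained T N

  contained≤1 : ∀ {n} (T N : Subset n) → contained T N ≤ 1
  contained≤1 [] [] = ℕ.≤-refl
  contained≤1 (true ∷ T) (true ∷ N) = contained≤1 T N
  contained≤1 (true ∷ T) (false ∷ N) = z≤n
  contained≤1 (false ∷ T) (_ ∷ N) = contained≤1 T N

  contained⇒⊆ : ∀ {n} (T N : Subset n) → 1 ≤ contained T N → T ⊆ N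
  contained⇒⊆ (true ∷ T) (true ∷ N) p here = here
  contained⇒⊆ (true ∷ T) (true ∷ N) p (there q) = there (contained⇒⊆ T N p q)
  contained⇒⊆ (false ∷ T) (_ ∷ N) p (there q) = there (contained⇒⊆ T N p q)

  subsetSum-zero : ∀ n r → subsetSum n r (λ _ → 0) ≡ 0
  subsetSum-zero zero zero = refl
  subsetSum-zero zero (suc r) = refl
  subsetSum-zero (suc n) zero = subsetSum-zero n zero
  subsetSum-zero (suc n) (suc r) = cong₂ _+_ (subsetSum-zero n r) (subsetSum-zero n (suc r))

  subsetSum-contained : ∀ n r (N : Subset n) → subsetSum n r (λ T → contained T N) ≡ ∣ N ∣ C r
  subsetSum-contained zero zero [] = refl
  subsetSum-contained zero (suc r) [] = sym (k>n⇒nCk≡0 {0} {suc r} (s≤s z≤n))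
  subsetSum-contained (suc n) zero (true ∷ N) = subsetSum-contained n zero N
  subsetSum-contained (suc n) zero (false ∷ N) = subsetSum-contained n zero N
  subsetSum-contained (suc n) (suc r) (true ∷ N) = trans (cong₂ _+_ (subsetSum-contained n r N) (subsetSum-contained n (suc r) N)) (sym (pascal ∣ N ∣ r))
  subsetSum-contained (suc n) (suc r) (false ∷ N) = trans (cong (_+ subsetSum n (suc r) (λ T → contained T N)) (subsetSum-zero n r)) (subsetSum-contained n (suc r) N)

  coverage : ∀ {m n} → Subset n → BipGraph m n → ℕ
  coverage T [] = 0
  coverage T (N ∷ G) = contained T N + coverage T G

  covered : ∀ {m n} (T : Subset n) (G : BipGraph m n) → 1 ≤ coverage T G → ∃ λ i → T ⊆ lookup G i
  covered T (N ∷ G) p with contained T N in e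
  ... | suc _ = zero , contained⇒⊆ T N (subst (1 ≤_) (sym e) (s≤s z≤n))
  ... | zero with covered T G p
  ... | i , s = suc i , s

  -- The first row that contains T is paired with a later row that contains it.
  doubly-covered : ∀ {m n r} (T : Subset n) (G : BipGraph m n) → ∣ T ∣ ≡ r → 2 ≤ coverage T G → ContainsK G 2 r
  doubly-covered T (N ∷ G) e p with contained T N in c
  doubly-covered T (N ∷ G) e p | zero with doubly-covered T G e p
  ... | S , T′ , ∣S∣ , ∣T∣ , h = (outside ∷ S) , T′ , ∣S∣ , ∣T∣ , λ { zero j () _ ; (suc i) j (there q) t → h i j q t }
  doubly-covered T (N ∷ G) e p | suc (suc _) = ⊥-elim (ℕ.<⇒≱ (s≤s (s≤s z≤n)) (subst (_≤ 1) c (contained≤1 T N)))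
  doubly-covered T (N ∷ G) e p | suc zero with covered T G (ℕ.≤-pred p)
  ... | i , T⊆ = (inside ∷ ⁅ i ⁆) , T , cong suc (∣⁅x⁆∣≡1 i) , e , adjacent
    where
    adjacent : ∀ k j → k ∈ (inside ∷ ⁅ i ⁆) → j ∈ T → adj (N ∷ G) k j
    adjacent zero j _ t = contained⇒⊆ T N (subst (1 ≤_) (sym c) (s≤s z≤n)) t
    adjacent (suc k) j q t with x∈⁅y⁆⇒x≡y i (drop-there q)
    ... | refl = T⊆ t

  ∑C : ∀ {m n} → ℕ → BipGraph m n → ℕ
  ∑C r [] = 0
  ∑C r (N ∷ G) = ∣ N ∣ C r + ∑C r G

  ∑C≡ : ∀ {m n} r (G : BipGraph m n) → ∑C r G ≡ subsetSum n r (λ T → coverage T G)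
  ∑C≡ {n = n} r [] = sym (subsetSum-zero n r)
  ∑C≡ {n = n} r (N ∷ G) = trans (cong₂ _+_ (sym (subsetSum-contained n r N)) (∑C≡ r G)) (sym (subsetSum-+ n r (λ T → contained T N) (λ T → coverage T G)))

  packing-bound : ∀ {m n} r (G : BipGraph m n) → ¬ ContainsK G 2 r → ∑C r G ≤ n C r
  packing-bound {n = n} r G ¬K = subst₂ _≤_ (sym (∑C≡ r G)) (subsetSum-one n r) (subsetSum-mono n r (λ T e → ℕ.≮⇒≥ (λ two → ¬K (doubly-covered T G e two))))

  C-mono : ∀ n k → n C k ≤ suc n C k
  C-mono n zero = ℕ.≤-refl
  C-mono n (suc k) = subst (n C suc k ≤_) (sym (pascal n k)) (ℕ.m≤n+m (n C suc k) (n C k))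

  C-mono-+ : ∀ n d k → n C k ≤ (d + n) C k
  C-mono-+ n zero k = ℕ.≤-refl
  C-mono-+ n (suc d) k = ℕ.≤-trans (C-mono-+ n d k) (C-mono (d + n) k)

  -- Convexity of the binomial coefficient: it lies above its tangent at a.
  tangent-right : ∀ a d r → a C suc r + (a C r) * d ≤ (d + a) C suc r
  tangent-right a zero r = ℕ.≤-reflexive (trans (cong (a C suc r +_) (ℕ.*-zeroʳ (a C r))) (ℕ.+-identityʳ _))
  tangent-right a (suc d) r = begin
    a C suc r + (a C r) * suc d           ≡⟨ cong (a C suc r +_) (ℕ.*-suc (a C r) d) ⟩
    a C suc r + (a C r + (a C r) * d)     ≡⟨ trans (sym (ℕ.+-assoc (a C suc r) (a C r) ((a C r) * d))) (trans (cong (_+ (a C r) * d) (ℕ.+-comm (a C suc r) (a C r))) (ℕ.+-assoc (a C r) (a C suc r) ((a C r) * d))) ⟩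
    a C r + (a C suc r + (a C r) * d)     ≤⟨ ℕ.+-mono-≤ (C-mono-+ a d r) (tangent-right a d r) ⟩
    (d + a) C r + (d + a) C suc r       ≡⟨ pascal (d + a) r ⟨
    suc (d + a) C suc r                 ∎
    where open ℕ.≤-Reasoning

  tangent-left : ∀ k d r → (d + k) C suc r ≤ k C suc r + ((d + k) C r) * d
  tangent-left k zero r = ℕ.m≤m+n _ _
  tangent-left k (suc d) r = begin
    suc (d + k) C suc r                                   ≡⟨ pascal (d + k) r ⟩
    (d + k) C r + (d + k) C suc r                         ≤⟨ ℕ.+-monoʳ-≤ ((d + k) C r) (tangent-left k d r) ⟩
    (d + k) C r + (k C suc r + ((d + k) C r) * d)           ≤⟨ ℕ.+-mono-≤ (C-mono (d + k) r) (ℕ.+-monoʳ-≤ (k C suc r) (ℕ.*-monoˡ-≤ d (C-mono (d + k) r))) ⟩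
    c + (k C suc r + c * d)                               ≡⟨ trans (sym (ℕ.+-assoc c (k C suc r) (c * d))) (trans (cong (_+ c * d) (ℕ.+-comm c (k C suc r))) (ℕ.+-assoc (k C suc r) c (c * d))) ⟩
    k C suc r + (c + c * d)                               ≡⟨ cong (k C suc r +_) (ℕ.*-suc c d) ⟨
    k C suc r + c * suc d                                 ∎
    where
    open ℕ.≤-Reasoning
    c = suc (d + k) C r

  tangent : ∀ a k r → a C suc r + (a C r) * k ≤ k C suc r + (a C r) * a
  tangent a k r with ℕ.≤-total a k
  ... | inj₁ p = let (d , e) = ℕ.m≤n⇒∃[o]m+o≡n p in right d (trans (ℕ.+-comm d a) e)
    where

    right : ∀ d → d + a ≡ k → a C suc r + (a C r) * k ≤ k C suc r + (a C r) * a
    right d refl = begin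
      a C suc r + (a C r) * (d + a)             ≡⟨ cong (a C suc r +_) (ℕ.*-distribˡ-+ (a C r) d a) ⟩
      a C suc r + ((a C r) * d + (a C r) * a)     ≡⟨ ℕ.+-assoc (a C suc r) ((a C r) * d) ((a C r) * a) ⟨
      a C suc r + (a C r) * d + (a C r) * a       ≤⟨ ℕ.+-monoˡ-≤ ((a C r) * a) (tangent-right a d r) ⟩
      (d + a) C suc r + (a C r) * a             ∎
      where open ℕ.≤-Reasoning
  ... | inj₂ p = let (d , e) = ℕ.m≤n⇒∃[o]m+o≡n p in left d (trans (ℕ.+-comm d k) e)
    where
    left : ∀ d → d + k ≡ a → a C suc r + (a C r) * k ≤ k C suc r + (a C r) * a
    left d refl = begin
      (d + k) C suc r + ((d + k) C r) * k                       ≤⟨ ℕ.+-monoˡ-≤ _ (tangent-left k d r) ⟩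
      k C suc r + ((d + k) C r) * d + ((d + k) C r) * k           ≡⟨ ℕ.+-assoc (k C suc r) _ _ ⟩
      k C suc r + (((d + k) C r) * d + ((d + k) C r) * k)         ≡⟨ cong (k C suc r +_) (ℕ.*-distribˡ-+ ((d + k) C r) d k) ⟨
      k C suc r + ((d + k) C r) * (d + k)                       ∎
      where open ℕ.≤-Reasoning

  tangent-sum : ∀ {m n} a r (G : BipGraph m n) → m * (a C suc r) + (a C r) * edges G ≤ ∑C (suc r) G + (a C r) * (m * a)
  tangent-sum a r [] = ℕ.≤-refl
  tangent-sum {suc m} a r (N ∷ G) = begin
    (x + m * x) + c * (∣ N ∣ + edges G)                         ≡⟨ cong ((x + m * x) +_) (ℕ.*-distribˡ-+ c ∣ N ∣ (edges G)) ⟩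
    (x + m * x) + (c * ∣ N ∣ + c * edges G)                     ≡⟨ interchange x (m * x) (c * ∣ N ∣) (c * edges G) ⟩
    (x + c * ∣ N ∣) + (m * x + c * edges G)                     ≤⟨ ℕ.+-mono-≤ (tangent a ∣ N ∣ r) (tangent-sum a r G) ⟩
    (∣ N ∣ C suc r + c * a) + (∑C (suc r) G + c * (m * a))      ≡⟨ interchange (∣ N ∣ C suc r) (c * a) (∑C (suc r) G) (c * (m * a)) ⟩
    (∣ N ∣ C suc r + ∑C (suc r) G) + (c * a + c * (m * a))      ≡⟨ cong ((∣ N ∣ C suc r + ∑C (suc r) G) +_) (ℕ.*-distribˡ-+ c a (m * a)) ⟨
    (∣ N ∣ C suc r + ∑C (suc r) G) + c * (a + m * a)            ∎
    where
    open ℕ.≤-Reasoning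
    x = a C suc r
    c = a C r

  C-positive : ∀ {n k} → k ≤ n → 1 ≤ n C k
  C-positive {n} {zero} _ = ℕ.≤-refl
  C-positive {suc n} {suc k} (s≤s p) = subst (1 ≤_) (sym (pascal n k)) (ℕ.≤-trans (C-positive p) (ℕ.m≤m+n _ _))

  -- In the summed tangent inequality the constant parts compare by the hypothesis; the slope C(a,
  -- r), positive as r ≤ a, then cancels.
  z-upper : ∀ m n a r → r ≤ a → n C suc r ≤ m * (a C suc r) → z m n 2 (suc r) ≤ m * a
  z-upper m n a r r≤a h = z≤ {m} {n} {2} {suc r} (λ G ¬K → ℕ.*-cancelˡ-≤ (a C r) ⦃ >-nonZero (C-positive r≤a) ⦄ (ℕ.+-cancelˡ-≤ (m * (a C suc r)) _ _ (begin
    m * (a C suc r) + (a C r) * edges G   ≤⟨ tangent-sum a r G ⟩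
    ∑C (suc r) G + (a C r) * (m * a)      ≤⟨ ℕ.+-monoˡ-≤ _ (ℕ.≤-trans (packing-bound (suc r) G ¬K) h) ⟩
    m * (a C suc r) + (a C r) * (m * a)   ∎)))
    where open ℕ.≤-Reasoning

  absorption : ∀ n r → suc r * (suc n C suc r) ≡ suc n * (n C r)
  absorption n zero = trans (ℕ.*-identityˡ _) (trans (nC1≡n (suc n)) (sym (ℕ.*-identityʳ (suc n))))
  absorption zero (suc r) = trans (cong (suc (suc r) *_) (k>n⇒nCk≡0 {1} {suc (suc r)} (s≤s (s≤s z≤n)))) (trans (ℕ.*-zeroʳ (suc (suc r))) (sym (trans (ℕ.*-identityˡ _) (k>n⇒nCk≡0 {0} {suc r} (s≤s z≤n)))))
  absorption (suc n) (suc r) = begin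
    suc (suc r) * (suc (suc n) C suc (suc r))                     ≡⟨ cong (suc (suc r) *_) (pascal (suc n) (suc r)) ⟩
    suc (suc r) * (x + y)                                         ≡⟨ ℕ.*-distribˡ-+ (suc (suc r)) x y ⟩
    (x + suc r * x) + suc (suc r) * y                             ≡⟨ cong₂ (λ u v → (x + u) + v) (absorption n r) (absorption n (suc r)) ⟩
    (x + suc n * (n C r)) + suc n * (n C suc r)                   ≡⟨ ℕ.+-assoc x _ _ ⟩
    x + (suc n * (n C r) + suc n * (n C suc r))                   ≡⟨ cong (x +_) (ℕ.*-distribˡ-+ (suc n) (n C r) (n C suc r)) ⟨
    x + suc n * (n C r + n C suc r)                               ≡⟨ cong (λ t → x + suc n * t) (pascal n r) ⟨
    x + suc n * x                                                 ∎
    where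
    open ≡-Reasoning
    x = suc n C suc r
    y = suc n C suc (suc r)

  -- Compares falling factorials factor by factor: those of n are at most n, those of a are at least
  -- a - r. `absorption` peels off one factor at a time.
  C-ratio : ∀ r n a → (n C r) * (a ∸ r) ^ r ≤ (a C r) * n ^ r
  C-ratio zero n a = ℕ.≤-refl
  C-ratio (suc r) zero a = subst (_≤ (a C suc r) * 0 ^ suc r) (sym (cong (_* (a ∸ suc r) ^ suc r) (k>n⇒nCk≡0 {0} {suc r} (s≤s z≤n)))) z≤n
  C-ratio (suc r) (suc n) zero = subst (_≤ (0 C suc r) * suc n ^ suc r) (sym (ℕ.*-zeroʳ (suc n C suc r))) z≤n
  C-ratio (suc r) (suc n) (suc a) = ℕ.*-cancelˡ-≤ (suc r) (begin
    suc r * (x * (b * b ^ r))                     ≡⟨ ℕ.*-assoc (suc r) x _ ⟨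
    (suc r * x) * (b * b ^ r)                     ≡⟨ cong (_* (b * b ^ r)) (absorption n r) ⟩
    (suc n * (n C r)) * (b * b ^ r)               ≡⟨ rearrange (suc n) (n C r) b (b ^ r) ⟩
    (suc n * b) * ((n C r) * b ^ r)               ≤⟨ ℕ.*-mono-≤ (ℕ.*-monoʳ-≤ (suc n) (ℕ.≤-trans (ℕ.m∸n≤m a r) (ℕ.n≤1+n a))) (ℕ.≤-trans (C-ratio r n a) (ℕ.*-monoʳ-≤ (a C r) (ℕ.^-monoˡ-≤ r (ℕ.n≤1+n n)))) ⟩
    (suc n * suc a) * ((a C r) * suc n ^ r)       ≡⟨ rearrange′ (suc n) (suc a) (a C r) (suc n ^ r) ⟩
    (suc a * (a C r)) * (suc n * suc n ^ r)       ≡⟨ cong (_* (suc n * suc n ^ r)) (absorption a r) ⟨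
    (suc r * y) * (suc n * suc n ^ r)             ≡⟨ ℕ.*-assoc (suc r) y _ ⟩
    suc r * (y * (suc n * suc n ^ r))             ∎)
    where
    open ℕ.≤-Reasoning
    b = a ∸ r
    x = suc n C suc r
    y = suc a C suc r
    rearrange : ∀ n c b e → (n * c) * (b * e) ≡ (n * b) * (c * e)
    rearrange = solve-∀
    rearrange′ : ∀ n a c e → (n * a) * (c * e) ≡ (a * c) * (n * e)
    rearrange′ = solve-∀

  z-upper-power : ∀ m n a r → suc r < a → n ^ suc r ≤ m * (a ∸ suc r) ^ suc r → z m n 2 (suc r) ≤ m * a
  z-upper-power m n a r r<a h = z-upper m n a r (ℕ.<⇒≤ (ℕ.<-trans (ℕ.n<1+n r) r<a)) (ℕ.*-cancelʳ-≤ _ _ d ⦃ ℕ.m^n≢0 (a ∸ suc r) (suc r) ⦃ >-nonZero (ℕ.m<n⇒0<n∸m r<a) ⦄ ⦄ (begin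
    (n C suc r) * d                   ≤⟨ C-ratio (suc r) n a ⟩
    (a C suc r) * n ^ suc r           ≤⟨ ℕ.*-monoʳ-≤ (a C suc r) h ⟩
    (a C suc r) * (m * d)             ≡⟨ trans (sym (ℕ.*-assoc (a C suc r) m d)) (cong (_* d) (ℕ.*-comm (a C suc r) m)) ⟩
    m * (a C suc r) * d               ∎))
    where
    open ℕ.≤-Reasoning
    d = (a ∸ suc r) ^ suc r

-- Sums over finite types, and lower bounds from incidence structures.

module Zarankiewicz where
  open import Defs
  open Counting using (≤z)
  open import Data.Nat using (ℕ; zero; suc; _+_; _*_; _≤_; z≤n)
  import Data.Nat.Properties as ℕ
  open import Data.Bool using (Bool; true; false)
  open import Data.Fin as Fin using (Fin; zero; suc; splitAt; remQuot; combine)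
  import Data.Fin.Properties as Fin
  open import Data.Fin.Subset using (Subset; _∈_; ∣_∣)
  open import Data.Vec using (Vec; []; _∷_; tabulate; here; there)
  import Data.Vec.Properties as Vec
  open import Data.Product using (Σ; _×_; _,_; proj₁; proj₂)
  open import Data.Sum using (_⊎_; inj₁; inj₂; [_,_])
  open import Data.Empty using (⊥; ⊥-elim)
  open import Relation.Nullary using (¬_)
  open import Relation.Binary.PropositionalEquality hiding ([_])
  open import Algebra.Properties.CommutativeMonoid.Sum ℕ.+-0-commutativeMonoid public using (sum; sum-cong-≗; ∑-distrib-+; ∑-comm)

  bit : Bool → ℕ
  bit true = 1
  bit false = 0

  sum-mono : ∀ {n} {f g : Fin n → ℕ} → (∀ i → f i ≤ g i) → sum f ≤ sum g
  sum-mono {zero} h = z≤n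
  sum-mono {suc n} h = ℕ.+-mono-≤ (h zero) (sum-mono (λ i → h (suc i)))

  sum-const : ∀ n c → sum {n} (λ _ → c) ≡ n * c
  sum-const zero c = refl
  sum-const (suc n) c = cong (c +_) (sum-const n c)

  term≤sum : ∀ {n} (f : Fin n → ℕ) i → f i ≤ sum f
  term≤sum f zero = ℕ.m≤m+n _ _
  term≤sum f (suc i) = ℕ.≤-trans (term≤sum (λ i → f (suc i)) i) (ℕ.m≤n+m _ _)

  two-terms≤sum : ∀ {n} (f : Fin n → ℕ) {i j} → i ≢ j → f i + f j ≤ sum f
  two-terms≤sum f {zero} {zero} ne = ⊥-elim (ne refl)
  two-terms≤sum f {zero} {suc j} ne = ℕ.+-monoʳ-≤ (f zero) (term≤sum (λ i → f (suc i)) j)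
  two-terms≤sum f {suc i} {zero} ne = subst (_≤ sum f) (ℕ.+-comm (f zero) (f (suc i))) (ℕ.+-monoʳ-≤ (f zero) (term≤sum (λ i → f (suc i)) i))
  two-terms≤sum f {suc i} {suc j} ne = ℕ.≤-trans (two-terms≤sum (λ i → f (suc i)) (λ e → ne (cong suc e))) (ℕ.m≤n+m _ _)

  sum-splitAt : ∀ m {n} (f : Fin m ⊎ Fin n → ℕ) → sum (λ k → f (splitAt m k)) ≡ sum (λ i → f (inj₁ i)) + sum (λ j → f (inj₂ j))
  sum-splitAt zero f = refl
  sum-splitAt (suc m) {n} f = trans (cong (f (inj₁ zero) +_) (trans (sum-cong-≗ shift) (sum-splitAt m f′))) (sym (ℕ.+-assoc (f (inj₁ zero)) _ _))
    where
    f′ : Fin m ⊎ Fin n → ℕ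
    f′ = [ (λ i → f (inj₁ (suc i))) , (λ j → f (inj₂ j)) ]
    shift : ∀ k → f (splitAt (suc m) (suc k)) ≡ f′ (splitAt m {n} k)
    shift k with splitAt m k
    ... | inj₁ i = refl
    ... | inj₂ j = refl

  sum-remQuot : ∀ m n (f : Fin m × Fin n → ℕ) → sum (λ k → f (remQuot n k)) ≡ sum (λ i → sum (λ j → f (i , j)))
  sum-remQuot zero n f = refl
  sum-remQuot (suc m) n f = trans (sum-cong-≗ split) (trans (sum-splitAt n f′)
      (cong (sum (λ j → f (zero , j)) +_) (sum-remQuot m n (λ p → f (suc (proj₁ p) , proj₂ p)))))
    where
    f′ : Fin n ⊎ Fin (m * n) → ℕ
    f′ = [ (λ j → f (zero , j)) , (λ k → f (suc (proj₁ (remQuot {m} n k)) , proj₂ (remQuot {m} n k))) ]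
    split : ∀ k → f (remQuot {suc m} n k) ≡ f′ (splitAt n k)
    split k with splitAt n k
    ... | inj₁ j = refl
    ... | inj₂ j = refl

  remQuot-injective : ∀ {m} n {i j : Fin (m * n)} → remQuot {m} n i ≡ remQuot {m} n j → i ≡ j
  remQuot-injective {m} n {i} {j} e = trans (sym (Fin.combine-remQuot {m} n i)) (trans (cong (λ p → combine (proj₁ p) (proj₂ p)) e) (Fin.combine-remQuot {m} n j))

  splitAt-injective : ∀ m {n} {i j : Fin (m + n)} → splitAt m i ≡ splitAt m j → i ≡ j
  splitAt-injective m {n} {i} {j} e = trans (sym (Fin.join-splitAt m n i)) (trans (cong (Fin.join m n) e) (Fin.join-splitAt m n j))

  ∣tabulate∣ : ∀ {n} (P : Fin n → Bool) → ∣ tabulate P ∣ ≡ sum (λ j → bit (P j))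
  ∣tabulate∣ {zero} P = refl
  ∣tabulate∣ {suc n} P with P zero
  ... | true = cong suc (∣tabulate∣ (λ j → P (suc j)))
  ... | false = ∣tabulate∣ (λ j → P (suc j))

  ∈-tabulate⁻ : ∀ {n} (P : Fin n → Bool) {j} → j ∈ tabulate P → P j ≡ true
  ∈-tabulate⁻ P {j} q = trans (sym (Vec.lookup∘tabulate P j)) (Vec.[]=⇒lookup q)

  edges-tabulate : ∀ {m n} (f : Fin m → Subset n) → edges (tabulate f) ≡ sum (λ i → ∣ f i ∣)
  edges-tabulate {zero} f = refl
  edges-tabulate {suc m} f = cong (∣ f zero ∣ +_) (edges-tabulate (λ i → f (suc i)))

  enumerate : ∀ {n} (T : Subset n) → Σ (Fin ∣ T ∣ → Fin n) λ φ → (∀ {i j} → φ i ≡ φ j → i ≡ j) × (∀ i → φ i ∈ T)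
  enumerate [] = (λ ()) , (λ { {()} }) , λ ()
  enumerate (false ∷ T) with enumerate T
  ... | φ , inj , mem = (λ i → suc (φ i)) , (λ e → inj (Fin.suc-injective e)) , λ i → there (mem i)
  enumerate (true ∷ T) with enumerate T
  ... | φ , inj , mem = ψ , ψ-injective , λ { zero → here ; (suc i) → there (mem i) }
    where
    ψ : Fin (suc ∣ T ∣) → Fin _
    ψ zero = zero
    ψ (suc i) = suc (φ i)
    ψ-injective : ∀ {i j} → ψ i ≡ ψ j → i ≡ j
    ψ-injective {zero} {zero} _ = refl
    ψ-injective {suc i} {suc j} e = cong suc (inj (Fin.suc-injective e))

  enumerate-size : ∀ {n t} (T : Subset n) → ∣ T ∣ ≡ t → Σ (Fin t → Fin n) λ φ → (∀ {i j} → φ i ≡ φ j → i ≡ j) × (∀ i → φ i ∈ T)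
  enumerate-size T refl = enumerate T

  -- The t common neighbours are given by an injection from `Fin t` instead of a subset, the form in
  -- which geometric and polynomial arguments consume points.
  incidence-bound : ∀ {m n t} (inc : Fin m → Fin n → Bool) →
    (∀ {i i′} → i ≢ i′ → (φ : Fin t → Fin n) → (∀ {k l} → φ k ≡ φ l → k ≡ l) → (∀ k → inc i (φ k) ≡ true) → (∀ k → inc i′ (φ k) ≡ true) → ⊥) →
    sum (λ i → sum (λ j → bit (inc i j))) ≤ z m n 2 t
  incidence-bound {m} {n} {t} inc free = subst (_≤ z m n 2 t) (trans (edges-tabulate (λ i → tabulate (inc i))) (sum-cong-≗ (λ i → ∣tabulate∣ (inc i)))) (≤z (tabulate (λ i → tabulate (inc i))) noK)
    where
    noK : ¬ ContainsK (tabulate (λ i → tabulate (inc i))) 2 t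
    noK (S , T , ∣S∣ , ∣T∣ , h) with enumerate-size S ∣S∣ | enumerate-size T ∣T∣
    ... | σ , σ-inj , σ∈ | φ , φ-inj , φ∈ = free distinct φ φ-inj (mem zero) (mem (suc zero))
      where
      distinct : σ zero ≢ σ (suc zero)
      distinct e with σ-inj e
      ... | ()
      mem : ∀ s k → inc (σ s) (φ k) ≡ true
      mem s k = ∈-tabulate⁻ (inc (σ s)) (subst (φ k ∈_) (Vec.lookup∘tabulate (λ i → tabulate (inc i)) (σ s)) (h (σ s) (φ k) (σ∈ s) (φ∈ k)))

-- Möbius planes over finite fields and the exact value in (a).

module MobiusPlanes where
  open import Defs
  open Rings
  open Frobenius
  open GaloisFields
  open Counting using (z-upper; absorption)
  open Zarankiewicz
  open Windows using (primePower>1)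
  open import Data.Nat as ℕ using (ℕ; zero; suc; _+_; _*_; _≤_; z≤n; s≤s)
  import Data.Nat.Properties as ℕ
  open import Data.Nat.Combinatorics using (_C_; nC1≡n)
  open import Data.Nat.Tactic.RingSolver using (solve-∀)
  open import Data.Bool using (Bool; true; false; if_then_else_)
  open import Data.Fin as Fin using (Fin; zero; suc; splitAt; remQuot; punchOut)
  import Data.Fin.Properties as Fin
  open import Data.Vec using (Vec; []; _∷_)
  open import Data.Product using (Σ; ∃; _×_; _,_; proj₁; proj₂)
  open import Data.Sum using (_⊎_; inj₁; inj₂)
  open import Data.Empty using (⊥; ⊥-elim)
  open import Relation.Nullary using (¬_; Dec; yes; no; does)
  open import Relation.Nullary.Decidable using (dec-true; dec-false)
  open import Relation.Binary.PropositionalEquality hiding ([_])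

  abstract
    -- If no value were missed, there would be a section of h; being injective it omits neither i
    -- nor j, yet both lie over the same value.
    non-injective⇒missed : ∀ {n} (h : Fin n → Fin n) {i j} → i ≢ j → h i ≡ h j → ∃ λ y → ∀ x → h x ≢ y
    non-injective⇒missed {zero} h {()}
    non-injective⇒missed {suc n} h {i} {j} i≢j hi≡hj with Fin.any? (λ y → Fin.all? (λ x → ¬? (h x Fin.≟ y)))
      where open import Relation.Nullary.Decidable using (¬?)
    ... | yes missed = missed
    ... | no ¬missed = ⊥-elim (missing (Fin.any? (λ y → section y Fin.≟ i)) (Fin.any? (λ y → section y Fin.≟ j)))
      where
      preimage : ∀ y → ∃ λ x → h x ≡ y
      preimage y with Fin.any? (λ x → h x Fin.≟ y)
      ... | yes p = p
      ... | no ¬p = ⊥-elim (¬missed (y , λ x e → ¬p (x , e)))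
      section : Fin (suc n) → Fin (suc n)
      section y = proj₁ (preimage y)
      section-injective : ∀ {y y′} → section y ≡ section y′ → y ≡ y′
      section-injective {y} {y′} e = trans (sym (proj₂ (preimage y))) (trans (cong h e) (proj₂ (preimage y′)))
      omits : ∀ k → (∀ y → section y ≢ k) → ⊥
      omits k ne = ℕ.1+n≰n (Fin.injective⇒≤ {f = λ y → punchOut (apart y)} (λ {y} {y′} e → section-injective (Fin.punchOut-injective (apart y) (apart y′) e)))
        where
        apart : ∀ y → k ≢ section y
        apart y e = ne y (sym e)
      missing : Dec (∃ λ y → section y ≡ i) → Dec (∃ λ y → section y ≡ j) → ⊥
      missing (no ¬p) _ = omits i (λ y e → ¬p (y , e))
      missing (yes _) (no ¬p) = omits j (λ y e → ¬p (y , e))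
      missing (yes (y , e)) (yes (y′ , e′)) = i≢j (trans (sym e) (trans (cong section y≡y′) e′))
        where
        y≡y′ : y ≡ y′
        y≡y′ = trans (sym (proj₂ (preimage y))) (trans (cong h e) (trans hi≡hj (trans (cong h (sym e′)) (proj₂ (preimage y′)))))

  module Mobius {q} (F : FiniteField q) where
    open FiniteField F
    open CRing 𝓡
    open RingTheory 𝓡

    domain : Domain
    domain = field⇒domain 𝓡 (_≟ # 0) inverse

    abstract
      -- The map t ↦ -(t² + t) takes the value 0 at 0 and at -1, so on a finite field it misses some
      -- c. This yields an irreducible quadratic in every characteristic, 2 included.
      no-root : ∃ λ c → ∀ t → t ⊗ t ⊕ t ⊕ c ≢ # 0
      no-root = elem y , λ t e → proj₂ missed (index t) (trans (cong (λ t → index (# 0 ⊖ (t ⊗ t ⊕ t))) (elem-index t)) (trans (cong index (rearrange t e)) (index-elem y)))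
        where
        h : Fin q → Fin q
        h i = index (# 0 ⊖ (elem i ⊗ elem i ⊕ elem i))
        missed : ∃ λ y → ∀ x → h x ≢ y
        missed = non-injective⇒missed h {index (# 0)} {index (# 0 ⊖ # 1)} (λ e → 1≢0 (unit-zero (trans (sym (elem-index (# 0))) (trans (cong elem e) (elem-index (# 0 ⊖ # 1))))))
          (cong index (trans (cong (λ t → # 0 ⊖ (t ⊗ t ⊕ t)) (elem-index (# 0))) (trans (ring 0 (κ 0 :- (κ 0 :* κ 0 :+ κ 0) := κ 0 :- ((κ 0 :- κ 1) :* (κ 0 :- κ 1) :+ (κ 0 :- κ 1))) refl [])
            (cong (λ t → # 0 ⊖ (t ⊗ t ⊕ t)) (sym (elem-index (# 0 ⊖ # 1)))))))
          where
          unit-zero : # 0 ≡ # 0 ⊖ # 1 → # 1 ≡ # 0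
          unit-zero e = trans (ring 0 (κ 1 := κ 0 :- (κ 0 :- κ 1)) refl []) (trans (cong (# 0 ⊖_) (sym e)) (ring 0 (κ 0 :- κ 0 := κ 0) refl []))
        y : Fin q
        y = proj₁ missed
        rearrange : ∀ t → t ⊗ t ⊕ t ⊕ elem y ≡ # 0 → # 0 ⊖ (t ⊗ t ⊕ t) ≡ elem y
        rearrange t e = trans (cong (_⊖ (t ⊗ t ⊕ t)) (sym e)) (ring 2 (λ t y → (t :* t :+ t :+ y) :- (t :* t :+ t) := y) refl (t ∷ elem y ∷ []))

    c : R
    c = proj₁ no-root

    form : R → R → R
    form x y = x ⊗ x ⊕ x ⊗ y ⊕ c ⊗ (y ⊗ y)

    -- A zero with y ≠ 0 would make x/y a root of t² + t + c.
    norm-anisotropic : ∀ x y → form x y ≡ # 0 → x ≡ # 0 × y ≡ # 0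
    norm-anisotropic x y e with y ≟ # 0
    ... | yes refl = x≡0 , refl
      where
      x≡0 : x ≡ # 0
      x≡0 with domain x x (trans (ring 2 (λ x c → x :* x := x :* x :+ x :* κ 0 :+ c :* (κ 0 :* κ 0)) refl (x ∷ c ∷ [])) e)
      ... | inj₁ p = p
      ... | inj₂ p = p
    ... | no y≢0 with inverse y y≢0
    ... | i , yi≡1 = ⊥-elim (proj₂ no-root (x ⊗ i) (begin
      x ⊗ i ⊗ (x ⊗ i) ⊕ x ⊗ i ⊕ c                          ≡⟨ ring 2 (λ t c → t :* t :+ t :+ c := t :* t :+ t :* κ 1 :+ c :* (κ 1 :* κ 1)) refl (x ⊗ i ∷ c ∷ []) ⟩
      x ⊗ i ⊗ (x ⊗ i) ⊕ x ⊗ i ⊗ # 1 ⊕ c ⊗ (# 1 ⊗ # 1)      ≡⟨ cong (λ s → x ⊗ i ⊗ (x ⊗ i) ⊕ x ⊗ i ⊗ s ⊕ c ⊗ (s ⊗ s)) yi≡1 ⟨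
      x ⊗ i ⊗ (x ⊗ i) ⊕ x ⊗ i ⊗ (y ⊗ i) ⊕ c ⊗ (y ⊗ i ⊗ (y ⊗ i)) ≡⟨ ring 4 (λ x y i c → x :* i :* (x :* i) :+ x :* i :* (y :* i) :+ c :* (y :* i :* (y :* i)) := i :* i :* (x :* x :+ x :* y :+ c :* (y :* y))) refl (x ∷ y ∷ i ∷ c ∷ []) ⟩
      i ⊗ i ⊗ form x y                                 ≡⟨ cong (i ⊗ i ⊗_) e ⟩
      i ⊗ i ⊗ # 0                                          ≡⟨ ⊗-zeroʳ (i ⊗ i) ⟩
      # 0                                                  ∎))
      where open ≡-Reasoning

    -- The discriminant 1 - 4c cannot vanish: otherwise -1/2 would be a double root, while in
    -- characteristic 2 it equals 1.
    4c≢1 : # 4 ⊗ c ≢ # 1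
    4c≢1 e with # 2 ≟ # 0
    ... | yes 2≡0 = 1≢0 (trans (sym e) (trans (cong (_⊗ c) (#-+ 2 2)) (trans (cong (_⊗ c) (trans (cong₂ _⊕_ 2≡0 2≡0) (⊕-idˡ (# 0)))) (⊗-zeroˡ c))))
    ... | no 2≢0 with inverse (# 2) 2≢0
    ... | i , 2i≡1 = proj₂ no-root (# 0 ⊖ i) (begin
      (# 0 ⊖ i) ⊗ (# 0 ⊖ i) ⊕ (# 0 ⊖ i) ⊕ c                 ≡⟨ ring 2 (λ i c → (κ 0 :- i) :* (κ 0 :- i) :+ (κ 0 :- i) :+ c := i :* i :- i :* κ 1 :+ κ 1 :* κ 1 :* c) refl (i ∷ c ∷ []) ⟩
      i ⊗ i ⊖ i ⊗ # 1 ⊕ # 1 ⊗ # 1 ⊗ c                       ≡⟨ cong (λ s → i ⊗ i ⊖ i ⊗ s ⊕ s ⊗ s ⊗ c) 2i≡1 ⟨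
      i ⊗ i ⊖ i ⊗ (# 2 ⊗ i) ⊕ # 2 ⊗ i ⊗ (# 2 ⊗ i) ⊗ c       ≡⟨ ring 2 (λ i c → i :* i :- i :* (κ 2 :* i) :+ κ 2 :* i :* (κ 2 :* i) :* c := i :* i :* (κ 4 :* c :- κ 1)) refl (i ∷ c ∷ []) ⟩
      i ⊗ i ⊗ (# 4 ⊗ c ⊖ # 1)                               ≡⟨ cong (λ s → i ⊗ i ⊗ (s ⊖ # 1)) e ⟩
      i ⊗ i ⊗ (# 1 ⊖ # 1)                                   ≡⟨ ring 1 (λ i → i :* i :* (κ 1 :- κ 1) := κ 0) refl (i ∷ []) ⟩
      # 0                                                   ∎)
      where open ≡-Reasoning

    -- On the line y = m x + k the circle of centre (a, b) and norm r is cut out by a quadratic with leading coefficient N(1, m) ≠ 0.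
    circle-meets-graph : ∀ a b r m k (x : Fin 3 → R) → (∀ {i j} → x i ≡ x j → i ≡ j) → ¬ (∀ i → form (x i ⊖ a) (m ⊗ x i ⊕ k ⊖ b) ≡ r)
    circle-meets-graph a b r m k x x-injective h = 1≢0 (proj₁ (norm-anisotropic (# 1) m (too-many-roots domain coefficients x x-injective root (suc (suc zero)))))
      where
      u = k ⊖ b
      coefficients : Vec R 3
      coefficients = a ⊗ a ⊖ a ⊗ u ⊕ c ⊗ (u ⊗ u) ⊖ r ∷ u ⊖ # 2 ⊗ a ⊖ a ⊗ m ⊕ # 2 ⊗ c ⊗ m ⊗ u ∷ form (# 1) m ∷ []
      root : ∀ i → eval coefficients (x i) ≡ # 0
      root i = trans (ring 7 (λ a b r m k c x → (a :* a :- a :* (k :- b) :+ c :* ((k :- b) :* (k :- b)) :- r) :+ x :* (((k :- b) :- κ 2 :* a :- a :* m :+ κ 2 :* c :* m :* (k :- b)) :+ x :* ((κ 1 :* κ 1 :+ κ 1 :* m :+ c :* (m :* m)) :+ x :* κ 0))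
          := ((x :- a) :* (x :- a) :+ (x :- a) :* (m :* x :+ k :- b) :+ c :* ((m :* x :+ k :- b) :* (m :* x :+ k :- b))) :- r) refl (a ∷ b ∷ r ∷ m ∷ k ∷ c ∷ x i ∷ []))
        (trans (cong (_⊖ r) (h i)) (⊕-invʳ r))

    circle-meets-cograph : ∀ a b r m k (y : Fin 3 → R) → (∀ {i j} → y i ≡ y j → i ≡ j) → ¬ (∀ i → form (m ⊗ y i ⊕ k ⊖ a) (y i ⊖ b) ≡ r)
    circle-meets-cograph a b r m k y y-injective h = 1≢0 (proj₂ (norm-anisotropic m (# 1) (too-many-roots domain coefficients y y-injective root (suc (suc zero)))))
      where
      u = k ⊖ a
      coefficients : Vec R 3
      coefficients = u ⊗ u ⊖ b ⊗ u ⊕ c ⊗ (b ⊗ b) ⊖ r ∷ # 2 ⊗ m ⊗ u ⊕ u ⊖ m ⊗ b ⊖ # 2 ⊗ c ⊗ b ∷ form m (# 1) ∷ []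
      root : ∀ i → eval coefficients (y i) ≡ # 0
      root i = trans (ring 7 (λ a b r m k c y → ((k :- a) :* (k :- a) :- b :* (k :- a) :+ c :* (b :* b) :- r) :+ y :* ((κ 2 :* m :* (k :- a) :+ (k :- a) :- m :* b :- κ 2 :* c :* b) :+ y :* ((m :* m :+ m :* κ 1 :+ c :* (κ 1 :* κ 1)) :+ y :* κ 0))
          := ((m :* y :+ k :- a) :* (m :* y :+ k :- a) :+ (m :* y :+ k :- a) :* (y :- b) :+ c :* ((y :- b) :* (y :- b))) :- r) refl (a ∷ b ∷ r ∷ m ∷ k ∷ c ∷ y i ∷ []))
        (trans (cong (_⊖ r) (h i)) (⊕-invʳ r))

    circle-meets-line : ∀ a b r α β γ → ¬ (α ≡ # 0 × β ≡ # 0) → (P : Fin 3 → R × R) → (∀ {i j} → P i ≡ P j → i ≡ j) →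
      (∀ i → α ⊗ proj₁ (P i) ⊕ β ⊗ proj₂ (P i) ≡ γ) → ¬ (∀ i → form (proj₁ (P i) ⊖ a) (proj₂ (P i) ⊖ b) ≡ r)
    circle-meets-line a b r α β γ ne P P-injective on circ with β ≟ # 0
    ... | no β≢0 = circle-meets-graph a b r m k (λ i → proj₁ (P i)) (λ {i} {j} e → P-injective (cong₂ _,_ e (trans (graph i) (trans (cong (λ t → m ⊗ t ⊕ k) e) (sym (graph j))))))
        (λ i → trans (cong (λ t → form (proj₁ (P i) ⊖ a) (t ⊖ b)) (sym (graph i))) (circ i))
      where
      β⁻¹ = proj₁ (inverse β β≢0)
      m = # 0 ⊖ α ⊗ β⁻¹
      k = γ ⊗ β⁻¹
      graph : ∀ i → proj₂ (P i) ≡ m ⊗ proj₁ (P i) ⊕ k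
      graph i = begin
        y                                       ≡⟨ ring 4 (λ y α x i → y := (κ 0 :- α :* i) :* x :+ (α :* x :* i :+ y :* κ 1)) refl (y ∷ α ∷ x ∷ β⁻¹ ∷ []) ⟩
        m ⊗ x ⊕ (α ⊗ x ⊗ β⁻¹ ⊕ y ⊗ # 1)         ≡⟨ cong (λ s → m ⊗ x ⊕ (α ⊗ x ⊗ β⁻¹ ⊕ y ⊗ s)) (proj₂ (inverse β β≢0)) ⟨
        m ⊗ x ⊕ (α ⊗ x ⊗ β⁻¹ ⊕ y ⊗ (β ⊗ β⁻¹))   ≡⟨ cong (m ⊗ x ⊕_) (ring 5 (λ y α x i β → α :* x :* i :+ y :* (β :* i) := (α :* x :+ β :* y) :* i) refl (y ∷ α ∷ x ∷ β⁻¹ ∷ β ∷ [])) ⟩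
        m ⊗ x ⊕ (α ⊗ x ⊕ β ⊗ y) ⊗ β⁻¹           ≡⟨ cong (λ s → m ⊗ x ⊕ s ⊗ β⁻¹) (on i) ⟩
        m ⊗ x ⊕ k                               ∎
        where
        open ≡-Reasoning
        x = proj₁ (P i)
        y = proj₂ (P i)
    ... | yes β≡0 with α ≟ # 0
    ... | yes α≡0 = ne (α≡0 , β≡0)
    ... | no α≢0 = circle-meets-cograph a b r m k (λ i → proj₂ (P i)) (λ {i} {j} e → P-injective (cong₂ _,_ (trans (graph i) (trans (cong (λ t → m ⊗ t ⊕ k) e) (sym (graph j)))) e))
        (λ i → trans (cong (λ t → form (t ⊖ a) (proj₂ (P i) ⊖ b)) (sym (graph i))) (circ i))
      where
      α⁻¹ = proj₁ (inverse α α≢0)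
      m = # 0 ⊖ β ⊗ α⁻¹
      k = γ ⊗ α⁻¹
      graph : ∀ i → proj₁ (P i) ≡ m ⊗ proj₂ (P i) ⊕ k
      graph i = begin
        x                                       ≡⟨ ring 4 (λ y β x i → x := (κ 0 :- β :* i) :* y :+ (β :* y :* i :+ x :* κ 1)) refl (y ∷ β ∷ x ∷ α⁻¹ ∷ []) ⟩
        m ⊗ y ⊕ (β ⊗ y ⊗ α⁻¹ ⊕ x ⊗ # 1)         ≡⟨ cong (λ s → m ⊗ y ⊕ (β ⊗ y ⊗ α⁻¹ ⊕ x ⊗ s)) (proj₂ (inverse α α≢0)) ⟨
        m ⊗ y ⊕ (β ⊗ y ⊗ α⁻¹ ⊕ x ⊗ (α ⊗ α⁻¹))   ≡⟨ cong (m ⊗ y ⊕_) (ring 5 (λ y α x i β → β :* y :* i :+ x :* (α :* i) := (α :* x :+ β :* y) :* i) refl (y ∷ α ∷ x ∷ α⁻¹ ∷ β ∷ [])) ⟩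
        m ⊗ y ⊕ (α ⊗ x ⊕ β ⊗ y) ⊗ α⁻¹           ≡⟨ cong (λ s → m ⊗ y ⊕ s ⊗ α⁻¹) (on i) ⟩
        m ⊗ y ⊕ k                               ∎
        where
        open ≡-Reasoning
        x = proj₁ (P i)
        y = proj₂ (P i)

    -- The two linear forms in (a′ - a, b′ - b) have determinant 4c - 1 ≠ 0. So for distinct centres
    -- the difference of the circle equations is the equation of a genuine line.
    radical-axis : ∀ a b a′ b′ → (# 2 ⊗ (a′ ⊖ a) ⊕ (b′ ⊖ b)) ≡ # 0 → ((a′ ⊖ a) ⊕ # 2 ⊗ c ⊗ (b′ ⊖ b)) ≡ # 0 → a ≡ a′ × b ≡ b′
    radical-axis a b a′ b′ α≡0 β≡0 = sym (⊖-zero (cancel d (begin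
        (# 4 ⊗ c ⊖ # 1) ⊗ d   ≡⟨ ring 3 (λ c d e → (κ 4 :* c :- κ 1) :* d := κ 2 :* c :* (κ 2 :* d :+ e) :- (d :+ κ 2 :* c :* e)) refl (c ∷ d ∷ e ∷ []) ⟩
        # 2 ⊗ c ⊗ (# 2 ⊗ d ⊕ e) ⊖ (d ⊕ # 2 ⊗ c ⊗ e) ≡⟨ cong₂ (λ s t → # 2 ⊗ c ⊗ s ⊖ t) α≡0 β≡0 ⟩
        # 2 ⊗ c ⊗ # 0 ⊖ # 0 ≡⟨ ring 1 (λ c → κ 2 :* c :* κ 0 :- κ 0 := κ 0) refl (c ∷ []) ⟩
        # 0 ∎))) , sym (⊖-zero (cancel e (begin
        (# 4 ⊗ c ⊖ # 1) ⊗ e   ≡⟨ ring 3 (λ c d e → (κ 4 :* c :- κ 1) :* e := κ 2 :* (d :+ κ 2 :* c :* e) :- (κ 2 :* d :+ e)) refl (c ∷ d ∷ e ∷ []) ⟩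
        # 2 ⊗ (d ⊕ # 2 ⊗ c ⊗ e) ⊖ (# 2 ⊗ d ⊕ e) ≡⟨ cong₂ (λ s t → # 2 ⊗ t ⊖ s) α≡0 β≡0 ⟩
        # 2 ⊗ # 0 ⊖ # 0 ≡⟨ ring 0 (κ 2 :* κ 0 :- κ 0 := κ 0) refl [] ⟩
        # 0 ∎)))
      where
      open ≡-Reasoning
      d = a′ ⊖ a
      e = b′ ⊖ b
      cancel : ∀ x → (# 4 ⊗ c ⊖ # 1) ⊗ x ≡ # 0 → x ≡ # 0
      cancel x p with domain (# 4 ⊗ c ⊖ # 1) x p
      ... | inj₁ z = ⊥-elim (4c≢1 (⊖-zero z))
      ... | inj₂ z = z

    radical-axis-equation : ∀ {a b r a′ b′ r′ x y} → form (x ⊖ a) (y ⊖ b) ≡ r → form (x ⊖ a′) (y ⊖ b′) ≡ r′ →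
      (# 2 ⊗ (a′ ⊖ a) ⊕ (b′ ⊖ b)) ⊗ x ⊕ ((a′ ⊖ a) ⊕ # 2 ⊗ c ⊗ (b′ ⊖ b)) ⊗ y ≡
        r ⊖ r′ ⊕ form (a′ ⊖ a) (b′ ⊖ b) ⊕ (# 2 ⊗ (a′ ⊖ a) ⊕ (b′ ⊖ b)) ⊗ a ⊕ ((a′ ⊖ a) ⊕ # 2 ⊗ c ⊗ (b′ ⊖ b)) ⊗ b
    radical-axis-equation {a} {b} {a′ = a′} {b′} {x = x} {y} refl refl = ring 7 (λ a b d e x y c → let
        α = κ 2 :* (d :- a) :+ (e :- b)
        β = (d :- a) :+ κ 2 :* c :* (e :- b)
        N = λ x y → x :* x :+ x :* y :+ c :* (y :* y) in
        α :* x :+ β :* y := N (x :- a) (y :- b) :- N (x :- d) (y :- e) :+ N (d :- a) (e :- b) :+ α :* a :+ β :* b) refl (a ∷ b ∷ a′ ∷ b′ ∷ x ∷ y ∷ c ∷ [])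

    -- For distinct centres, three common points would lie on the radical axis, which meets a circle
    -- at most twice. For equal centres one point already determines the norm.
    two-circles : ∀ {a b r a′ b′ r′} → (P : Fin 3 → R × R) → (∀ {i j} → P i ≡ P j → i ≡ j) →
      (∀ i → form (proj₁ (P i) ⊖ a) (proj₂ (P i) ⊖ b) ≡ r) → (∀ i → form (proj₁ (P i) ⊖ a′) (proj₂ (P i) ⊖ b′) ≡ r′) → a ≡ a′ × b ≡ b′ × r ≡ r′
    two-circles {a} {b} {r} {a′} {b′} {r′} P P-injective on on′ = concentric (a ≟ a′) (b ≟ b′)
      where
      distinct-centres : ¬ (a ≡ a′ × b ≡ b′) → ⊥
      distinct-centres ne = circle-meets-line a b r _ _ _ (λ { (p , p′) → ne (radical-axis a b a′ b′ p p′) }) P P-injective (λ i → radical-axis-equation (on i) (on′ i)) on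
      concentric : Dec (a ≡ a′) → Dec (b ≡ b′) → a ≡ a′ × b ≡ b′ × r ≡ r′
      concentric (yes refl) (yes refl) = refl , refl , trans (sym (on zero)) (on′ zero)
      concentric (no ne) _ = ⊥-elim (distinct-centres (λ e → ne (proj₁ e)))
      concentric _ (no ne) = ⊥-elim (distinct-centres (λ e → ne (proj₂ e)))

    data Point : Set where
      ∞ : Point
      affine : R × R → Point

    -- circle (a , b) r is the circle with centre (a , b) and norm r, but the non-vertical line y = a x + b if r = 0.
    data Block : Set where
      circle : R × R → R → Block
      vertical : R → Block

    graph : R → R → R → R → Bool
    graph a b x y = does (y ≟ (a ⊗ x ⊕ b))

    incident : Block → Point → Bool
    incident (circle _ r) ∞ = does (r ≟ # 0)
    incident (circle (a , b) r) (affine (x , y)) = if does (r ≟ # 0) then graph a b x y else does (form (x ⊖ a) (y ⊖ b) ≟ r)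
    incident (vertical d) ∞ = true
    incident (vertical d) (affine (x , y)) = does (x ≟ d)

    does-true : ∀ {A : Set} (d : Dec A) → does d ≡ true → A
    does-true (yes a) _ = a

    -- Equations behind the Boolean incidence relation; the constructors undo the double role of
    -- `circle` at r = 0.
    data Shape : Block → Set where
      line : ∀ {a b r} → r ≡ # 0 → (∀ {x y} → incident (circle (a , b) r) (affine (x , y)) ≡ true → y ≡ a ⊗ x ⊕ b) → Shape (circle (a , b) r)
      round : ∀ {a b r} → incident (circle (a , b) r) ∞ ≡ false → (∀ {x y} → incident (circle (a , b) r) (affine (x , y)) ≡ true → form (x ⊖ a) (y ⊖ b) ≡ r) → Shape (circle (a , b) r)
      upright : ∀ {d} → (∀ {x y} → incident (vertical d) (affine (x , y)) ≡ true → x ≡ d) → Shape (vertical d)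

    shape : ∀ ℓ → Shape ℓ
    shape (vertical d) = upright (λ {x} {y} e → does-true (x ≟ d) e)
    shape (circle (a , b) r) = cases (r ≟ # 0) refl
      where
      cases : (d : Dec (r ≡ # 0)) → does d ≡ does (r ≟ # 0) → Shape (circle (a , b) r)
      cases (yes r≡0) e = line r≡0 (λ {x} {y} h → does-true (y ≟ (a ⊗ x ⊕ b)) (trans (cong (λ t → if t then graph a b x y else does (form (x ⊖ a) (y ⊖ b) ≟ r)) e) h))
      cases (no _) e = round (sym e) (λ {x} {y} h → does-true (form (x ⊖ a) (y ⊖ b) ≟ r) (trans (cong (λ t → if t then graph a b x y else does (form (x ⊖ a) (y ⊖ b) ≟ r)) e) h))

    affine-injective : ∀ {p p′} → affine p ≡ affine p′ → p ≡ p′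
    affine-injective refl = refl

    TwoAffinePoints : (Fin 3 → Point) → Set
    TwoAffinePoints P = Σ R λ x → Σ R λ y → Σ R λ x′ → Σ R λ y′ → (x , y) ≢ (x′ , y′) × (∃ λ i → P i ≡ affine (x , y)) × (∃ λ j → P j ≡ affine (x′ , y′))

    two-affine-points : (P : Fin 3 → Point) → (∀ {i j} → P i ≡ P j → i ≡ j) → TwoAffinePoints P
    two-affine-points P P-injective = cases (P zero) (P (suc zero)) (P (suc (suc zero))) refl refl refl
      where
      pair : ∀ i j → i ≢ j → ∀ {p p′} → P i ≡ affine p → P j ≡ affine p′ → TwoAffinePoints P
      pair i j ne {x , y} {x′ , y′} e e′ = x , y , x′ , y′ , (λ q → ne (P-injective (trans e (trans (cong affine q) (sym e′))))) , (i , e) , (j , e′)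
      cases : (p₀ p₁ p₂ : Point) → P zero ≡ p₀ → P (suc zero) ≡ p₁ → P (suc (suc zero)) ≡ p₂ → TwoAffinePoints P
      cases (affine _) (affine _) _ e₀ e₁ _ = pair zero (suc zero) (λ ()) e₀ e₁
      cases (affine _) ∞ (affine _) e₀ _ e₂ = pair zero (suc (suc zero)) (λ ()) e₀ e₂
      cases ∞ (affine _) (affine _) _ e₁ e₂ = pair (suc zero) (suc (suc zero)) (λ ()) e₁ e₂
      cases ∞ ∞ _ e₀ e₁ _ with P-injective (trans e₀ (sym e₁))
      ... | ()
      cases ∞ (affine _) ∞ e₀ _ e₂ with P-injective (trans e₀ (sym e₂))
      ... | ()
      cases (affine _) ∞ ∞ _ e₁ e₂ with P-injective (trans e₁ (sym e₂))
      ... | ()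

    all-affine : ∀ {ℓ} (P : Fin 3 → Point) → incident ℓ ∞ ≡ false → (∀ i → incident ℓ (P i) ≡ true) → ∃ λ (p : Fin 3 → R × R) → ∀ i → P i ≡ affine (p i)
    all-affine {ℓ} P no∞ on = (λ i → proj₁ (point i (P i) refl)) , λ i → proj₂ (point i (P i) refl)
      where
      point : ∀ i Q → P i ≡ Q → ∃ λ p → P i ≡ affine p
      point i ∞ e with trans (sym no∞) (trans (cong (incident ℓ) (sym e)) (on i))
      ... | ()
      point i (affine p) e = p , e

    lines-meet : ∀ {a b a′ b′ x y x′ y′} → (x , y) ≢ (x′ , y′) → y ≡ a ⊗ x ⊕ b → y′ ≡ a ⊗ x′ ⊕ b → y ≡ a′ ⊗ x ⊕ b′ → y′ ≡ a′ ⊗ x′ ⊕ b′ → a ≡ a′ × b ≡ b′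
    lines-meet {a} {b} {a′} {b′} {x} {y} {x′} {y′} ne e₁ e₂ e₃ e₄ with domain (a ⊖ a′) (x ⊖ x′) (trans (ring 6 (λ a b c d x y → (a :- c) :* (x :- y) := (a :* x :+ b) :- (a :* y :+ b) :- (c :* x :+ d) :+ (c :* y :+ d)) refl (a ∷ b ∷ a′ ∷ b′ ∷ x ∷ x′ ∷ []))
      (trans (cong₂ (λ s t → s ⊖ t ⊖ (a′ ⊗ x ⊕ b′) ⊕ (a′ ⊗ x′ ⊕ b′)) (trans (sym e₁) e₃) (trans (sym e₂) e₄)) (ring 2 (λ s t → s :- t :- s :+ t := κ 0) refl (a′ ⊗ x ⊕ b′ ∷ a′ ⊗ x′ ⊕ b′ ∷ []))))
    ... | inj₁ z = a≡a′ , ⊕-cancelʳ b b′ (a ⊗ x) (trans (⊕-comm b (a ⊗ x)) (trans (trans (sym e₁) e₃) (trans (cong (λ s → s ⊗ x ⊕ b′) (sym a≡a′)) (⊕-comm (a ⊗ x) b′))))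
      where
      a≡a′ : a ≡ a′
      a≡a′ = ⊖-zero z
    ... | inj₂ z = ⊥-elim (ne (cong₂ _,_ (⊖-zero z) (trans e₁ (trans (cong (λ s → a ⊗ s ⊕ b) (⊖-zero z)) (sym e₂)))))

    -- Between two lines the point ∞ may be shared, so only two affine points are available, and
    -- these suffice. A round block omits ∞, so then all three points are affine.
    two-blocks : ∀ ℓ ℓ′ (P : Fin 3 → Point) → (∀ {i j} → P i ≡ P j → i ≡ j) → (∀ i → incident ℓ (P i) ≡ true) → (∀ i → incident ℓ′ (P i) ≡ true) → ℓ ≡ ℓ′
    two-blocks ℓ ℓ′ P P-injective on on′ = cases (shape ℓ) (shape ℓ′) on on′
      where
      affine-incident : ∀ {m p} → (∀ i → incident m (P i) ≡ true) → (∃ λ i → P i ≡ affine p) → incident m (affine p) ≡ true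
      affine-incident {m} h (i , e) = trans (cong (incident m) (sym e)) (h i)
      line-round : ∀ {α β γ a b r} → ¬ (α ≡ # 0 × β ≡ # 0) → ∀ {ℓ ℓ′} → (∀ {x y} → incident ℓ (affine (x , y)) ≡ true → α ⊗ x ⊕ β ⊗ y ≡ γ) →
        incident ℓ′ ∞ ≡ false → (∀ {x y} → incident ℓ′ (affine (x , y)) ≡ true → form (x ⊖ a) (y ⊖ b) ≡ r) → (∀ i → incident ℓ (P i) ≡ true) → (∀ i → incident ℓ′ (P i) ≡ true) → ⊥
      line-round ne {ℓ} {ℓ′} l no∞ c on on′ with all-affine {ℓ′} P no∞ on′
      ... | p , e = circle-meets-line _ _ _ _ _ _ ne p (λ {i} {j} q → P-injective (trans (e i) (trans (cong affine q) (sym (e j))))) (λ i → l (affine-incident {ℓ} on (i , e i))) (λ i → c (affine-incident {ℓ′} on′ (i , e i)))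
      graph-form : ∀ {a b x y} → y ≡ a ⊗ x ⊕ b → a ⊗ x ⊕ (# 0 ⊖ # 1) ⊗ y ≡ # 0 ⊖ b
      graph-form {a} {b} {x} refl = ring 3 (λ a b x → a :* x :+ (κ 0 :- κ 1) :* (a :* x :+ b) := κ 0 :- b) refl (a ∷ b ∷ x ∷ [])
      graph-proper : ∀ {a} → ¬ (a ≡ # 0 × # 0 ⊖ # 1 ≡ # 0)
      graph-proper (_ , e) = 1≢0 (trans (ring 0 (κ 1 := κ 0 :- (κ 0 :- κ 1)) refl []) (trans (cong (# 0 ⊖_) e) (ring 0 (κ 0 :- κ 0 := κ 0) refl [])))
      vertical-form : ∀ {d x y} → x ≡ d → # 1 ⊗ x ⊕ # 0 ⊗ y ≡ d
      vertical-form {x = x} {y} refl = ring 2 (λ x y → κ 1 :* x :+ κ 0 :* y := x) refl (x ∷ y ∷ [])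
      vertical-proper : ¬ (# 1 ≡ # 0 × # 0 ≡ # 0)
      vertical-proper (e , _) = 1≢0 e
      line-upright : ∀ {ℓ ℓ′ a b d} → (∀ {x y} → incident ℓ (affine (x , y)) ≡ true → y ≡ a ⊗ x ⊕ b) → (∀ {x y} → incident ℓ′ (affine (x , y)) ≡ true → x ≡ d) →
        (∀ i → incident ℓ (P i) ≡ true) → (∀ i → incident ℓ′ (P i) ≡ true) → ⊥
      line-upright {ℓ} {ℓ′} l v on on′ with two-affine-points P P-injective
      ... | x , y , x′ , y′ , ne , i , j = ne (graph-vertical (l (affine-incident {ℓ} on i)) (l (affine-incident {ℓ} on j)) (v (affine-incident {ℓ′} on′ i)) (v (affine-incident {ℓ′} on′ j)))
        where
        graph-vertical : ∀ {a b d x y x′ y′} → y ≡ a ⊗ x ⊕ b → y′ ≡ a ⊗ x′ ⊕ b → x ≡ d → x′ ≡ d → (x , y) ≡ (x′ , y′)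
        graph-vertical refl refl refl refl = refl
      cases : ∀ {ℓ ℓ′} → Shape ℓ → Shape ℓ′ → (∀ i → incident ℓ (P i) ≡ true) → (∀ i → incident ℓ′ (P i) ≡ true) → ℓ ≡ ℓ′
      cases {ℓ} {ℓ′} (line refl l) (line refl l′) on on′ with two-affine-points P P-injective
      ... | x , y , x′ , y′ , ne , i , j with lines-meet ne (l (affine-incident {ℓ} on i)) (l (affine-incident {ℓ} on j)) (l′ (affine-incident {ℓ′} on′ i)) (l′ (affine-incident {ℓ′} on′ j))
      ... | refl , refl = refl
      cases {ℓ} {ℓ′} (upright v) (upright v′) on on′ with two-affine-points P P-injective
      ... | x , y , x′ , y′ , ne , i , j = cong vertical (trans (sym (v {x} {y} (affine-incident {ℓ} on i))) (v′ {x} {y} (affine-incident {ℓ′} on′ i)))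
      cases {ℓ} {ℓ′} (line refl l) (upright v) on on′ = ⊥-elim (line-upright {ℓ} {ℓ′} l (λ {x} {y} → v {x} {y}) on on′)
      cases {ℓ} {ℓ′} (upright v) (line refl l) on on′ = ⊥-elim (line-upright {ℓ′} {ℓ} l (λ {x} {y} → v {x} {y}) on′ on)
      cases {ℓ} {ℓ′} (round no∞ c) (round no∞′ c′) on on′ with all-affine {ℓ} P no∞ on
      ... | p , e with two-circles p (λ {i} {j} q → P-injective (trans (e i) (trans (cong affine q) (sym (e j))))) (λ i → c (affine-incident {ℓ} on (i , e i))) (λ i → c′ (affine-incident {ℓ′} on′ (i , e i)))
      ... | refl , refl , refl = refl
      cases {ℓ} {ℓ′} (line {a} {b} _ l) (round no∞ c) on on′ = ⊥-elim (line-round graph-proper {ℓ} {ℓ′} (λ h → graph-form (l h)) no∞ c on on′)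
      cases {ℓ} {ℓ′} (round no∞ c) (line {a} {b} _ l) on on′ = ⊥-elim (line-round graph-proper {ℓ′} {ℓ} (λ h → graph-form (l h)) no∞ c on′ on)
      cases {ℓ} {ℓ′} (upright v) (round no∞ c) on on′ = ⊥-elim (line-round vertical-proper {ℓ} {ℓ′} (λ {x} {y} h → vertical-form (v {x} {y} h)) no∞ c on on′)
      cases {ℓ} {ℓ′} (round no∞ c) (upright v) on on′ = ⊥-elim (line-round vertical-proper {ℓ′} {ℓ} (λ {x} {y} h → vertical-form (v {x} {y} h)) no∞ c on′ on)

    pair : Fin (q * q) → R × R
    pair k = elem (proj₁ (remQuot {q} q k)) , elem (proj₂ (remQuot {q} q k))

    point : Fin (suc (q * q)) → Point
    point zero = ∞
    point (suc k) = affine (pair k)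

    block′ : Fin (q * q * q) ⊎ Fin q → Block
    block′ (inj₁ k) = circle (pair (proj₁ (remQuot {q * q} q k))) (elem (proj₂ (remQuot {q * q} q k)))
    block′ (inj₂ i) = vertical (elem i)

    block : Fin (q * q * q + q) → Block
    block k = block′ (splitAt (q * q * q) k)

    pair-injective : ∀ {k l} → pair k ≡ pair l → k ≡ l
    pair-injective {k} {l} e = remQuot-injective {q} q (cong₂ _,_ (elem-injective (cong proj₁ e)) (elem-injective (cong proj₂ e)))

    point-injective : ∀ {k l} → point k ≡ point l → k ≡ l
    point-injective {zero} {zero} _ = refl
    point-injective {suc k} {suc l} e = cong suc (pair-injective (affine-injective e))

    block-injective : ∀ {k l} → block k ≡ block l → k ≡ l
    block-injective {k} {l} e = splitAt-injective (q * q * q) (inner (splitAt (q * q * q) k) (splitAt (q * q * q) l) e)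
      where
      centre : ∀ {p r p′ r′} → circle p r ≡ circle p′ r′ → p ≡ p′ × r ≡ r′
      centre refl = refl , refl
      abscissa : ∀ {d d′} → vertical d ≡ vertical d′ → d ≡ d′
      abscissa refl = refl
      inner : ∀ s t → block′ s ≡ block′ t → s ≡ t
      inner (inj₁ k) (inj₁ l) e = cong inj₁ (remQuot-injective {q * q} q (cong₂ _,_ (pair-injective (proj₁ (centre e))) (elem-injective (proj₂ (centre e)))))
      inner (inj₂ i) (inj₂ j) e = cong inj₂ (elem-injective (abscissa e))

    degree : Block → ℕ
    degree ℓ = sum (λ k → bit (incident ℓ (point k)))

    bit-true : ∀ {A : Set} (d : Dec A) → A → 1 ≤ bit (does d)
    bit-true d a = ℕ.≤-reflexive (sym (cong bit (dec-true d a)))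

    sum-pairs : (f : R × R → ℕ) → sum (λ k → f (pair k)) ≡ sum (λ i → sum (λ j → f (elem i , elem j)))
    sum-pairs f = sum-remQuot q q (λ { (i , j) → f (elem i , elem j) })

    degree-vertical : ∀ i → 1 + q ≤ degree (vertical (elem i))
    degree-vertical i = s≤s (begin
      q                                                             ≡⟨ trans (sum-const q 1) (ℕ.*-identityʳ q) ⟨
      sum {q} (λ _ → 1)                                             ≤⟨ sum-mono {q} (λ _ → bit-true (elem i ≟ elem i) refl) ⟩
      sum {q} (λ j → bit (does (elem i ≟ elem i)))                  ≤⟨ term≤sum (λ l → sum {q} (λ j → bit (does (elem l ≟ elem i)))) i ⟩
      sum (λ l → sum {q} (λ j → bit (does (elem l ≟ elem i))))      ≡⟨ sum-pairs (λ p → bit (does (proj₁ p ≟ elem i))) ⟨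
      sum (λ k → bit (does (proj₁ (pair k) ≟ elem i)))              ∎)
      where open ℕ.≤-Reasoning

    sum-delta : ∀ {n} (i : Fin n) → sum (λ k → bit (does (k Fin.≟ i))) ≡ 1
    sum-delta {suc n} zero = cong suc (trans (sum-const n 0) (ℕ.*-zeroʳ n))
    sum-delta {suc n} (suc i) = sum-delta i

    incident-line : ∀ a b x y → incident (circle (a , b) (# 0)) (affine (x , y)) ≡ graph a b x y
    incident-line a b x y = cong (λ t → if t then graph a b x y else does (form (x ⊖ a) (y ⊖ b) ≟ # 0)) (dec-true (# 0 ≟ # 0) refl)

    incident-circle : ∀ a b x y → form (x ⊖ a) (y ⊖ b) ≢ # 0 → incident (circle (a , b) (form (x ⊖ a) (y ⊖ b))) (affine (x , y)) ≡ true
    incident-circle a b x y ne = trans (cong (λ t → if t then graph a b x y else does (form (x ⊖ a) (y ⊖ b) ≟ form (x ⊖ a) (y ⊖ b))) (dec-false (form (x ⊖ a) (y ⊖ b) ≟ # 0) ne)) (dec-true (form (x ⊖ a) (y ⊖ b) ≟ form (x ⊖ a) (y ⊖ b)) refl)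

    lines : Fin (q * q) → R × R → ℕ
    lines i (x , y) = bit (graph (proj₁ (pair i)) (proj₂ (pair i)) x y)

    -- Through a point other than (a , b) passes exactly one circle with centre (a , b).
    pencil-at-point : ∀ i k → lines i (pair k) + 1 ≤ sum (λ r → bit (incident (circle (pair i) (elem r)) (affine (pair k)))) + bit (does (k Fin.≟ i))
    pencil-at-point i k = cases (N ≟ # 0)
      where
      a = proj₁ (pair i)
      b = proj₂ (pair i)
      x = proj₁ (pair k)
      y = proj₂ (pair k)
      N : R
      N = form (x ⊖ a) (y ⊖ b)
      f : Fin q → ℕ
      f r = bit (incident (circle (a , b) (elem r)) (affine (x , y)))
      at-zero : f (index (# 0)) ≡ lines i (pair k)
      at-zero = cong bit (trans (cong (λ r → incident (circle (a , b) r) (affine (x , y))) (elem-index (# 0))) (incident-line a b x y))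
      cases : Dec (N ≡ # 0) → lines i (pair k) + 1 ≤ sum f + bit (does (k Fin.≟ i))
      cases (yes N≡0) = ℕ.+-mono-≤ (subst (_≤ sum f) at-zero (term≤sum f (index (# 0)))) (bit-true (k Fin.≟ i) (pair-injective (cong₂ _,_ (⊖-zero (proj₁ centre)) (⊖-zero (proj₂ centre)))))
        where
        centre : x ⊖ a ≡ # 0 × y ⊖ b ≡ # 0
        centre = norm-anisotropic (x ⊖ a) (y ⊖ b) N≡0
      cases (no N≢0) = ℕ.≤-trans (subst (_≤ sum f) (cong₂ _+_ at-zero at-N) (two-terms≤sum f (λ e → N≢0 (trans (sym (elem-index N)) (trans (cong elem (sym e)) (elem-index (# 0))))))) (ℕ.m≤m+n _ _)
        where
        at-N : f (index N) ≡ 1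
        at-N = cong bit (trans (cong (λ r → incident (circle (a , b) r) (affine (x , y))) (elem-index N)) (incident-circle a b x y N≢0))

    lines-count : ∀ i → q ≤ sum (λ k → lines i (pair k))
    lines-count i = begin
      q                                                    ≡⟨ trans (sum-const q 1) (ℕ.*-identityʳ q) ⟨
      sum {q} (λ _ → 1)                                    ≤⟨ sum-mono {q} (λ x → ℕ.≤-trans (bit-true (_ ≟ _) (elem-index (a ⊗ elem x ⊕ b))) (term≤sum (λ y → lines i (elem x , elem y)) (index (a ⊗ elem x ⊕ b)))) ⟩
      sum (λ x → sum (λ y → lines i (elem x , elem y)))    ≡⟨ sum-pairs (lines i) ⟨
      sum (λ k → lines i (pair k))                         ∎
      where
      open ℕ.≤-Reasoning
      a = proj₁ (pair i)
      b = proj₂ (pair i)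

    degree-pencil : ∀ i → q + q * q ≤ sum (λ r → degree (circle (pair i) (elem r)))
    -- The 1 added on both sides stands for the centre, which lies on no circle of the pencil;
    -- `sum-delta` counts it.
    degree-pencil i = ℕ.+-cancelʳ-≤ 1 (q + q * q) total (begin
        q + q * q + 1                                              ≡⟨ cong (λ t → q + t + 1) (trans (sum-const (q * q) 1) (ℕ.*-identityʳ (q * q))) ⟨
        q + sum {q * q} (λ _ → 1) + 1                              ≤⟨ ℕ.+-monoˡ-≤ 1 (ℕ.+-monoˡ-≤ _ (lines-count i)) ⟩
        sum (λ k → lines i (pair k)) + sum {q * q} (λ _ → 1) + 1   ≡⟨ cong (_+ 1) (∑-distrib-+ (λ k → lines i (pair k)) (λ _ → 1)) ⟨
        sum (λ k → lines i (pair k) + 1) + 1                       ≤⟨ ℕ.+-monoˡ-≤ 1 (sum-mono (pencil-at-point i)) ⟩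
        sum (λ k → sum (λ r → f r k) + bit (does (k Fin.≟ i))) + 1 ≡⟨ cong (_+ 1) (∑-distrib-+ (λ k → sum (λ r → f r k)) (λ k → bit (does (k Fin.≟ i)))) ⟩
        sum (λ k → sum (λ r → f r k)) + sum (λ k → bit (does (k Fin.≟ i))) + 1  ≡⟨ cong₂ (λ s t → s + t + 1) (∑-comm (λ k r → f r k)) (sum-delta i) ⟩
        sum (λ r → sum (λ k → f r k)) + 1 + 1                      ≡⟨ cong (_+ 1) (ℕ.+-comm _ 1) ⟩
        1 + sum (λ r → sum (λ k → f r k)) + 1                      ≤⟨ ℕ.+-monoˡ-≤ 1 (ℕ.+-monoˡ-≤ _ line-at-∞) ⟩
        sum (λ r → bit (does (elem r ≟ # 0))) + sum (λ r → sum (λ k → f r k)) + 1 ≡⟨ cong (_+ 1) (∑-distrib-+ (λ r → bit (does (elem r ≟ # 0))) (λ r → sum (λ k → f r k))) ⟨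
        total + 1                                                  ∎)
      where
      open ℕ.≤-Reasoning
      f : Fin q → Fin (q * q) → ℕ
      f r k = bit (incident (circle (pair i) (elem r)) (affine (pair k)))
      total : ℕ
      total = sum (λ r → degree (circle (pair i) (elem r)))
      line-at-∞ : 1 ≤ sum (λ r → bit (does (elem r ≟ # 0)))
      line-at-∞ = ℕ.≤-trans (bit-true (elem (index (# 0)) ≟ # 0) (elem-index (# 0))) (term≤sum (λ r → bit (does (elem r ≟ # 0))) (index (# 0)))

    total-degree : q * q * (q + q * q) + q * (1 + q) ≤ sum (λ k → degree (block k))
    total-degree = begin
      q * q * (q + q * q) + q * (1 + q)                                                  ≡⟨ cong₂ _+_ (sum-const (q * q) (q + q * q)) (sum-const q (1 + q)) ⟨
      sum {q * q} (λ _ → q + q * q) + sum {q} (λ _ → 1 + q)                              ≤⟨ ℕ.+-mono-≤ (sum-mono degree-pencil) (sum-mono degree-vertical) ⟩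
      sum (λ i → sum (λ r → degree (circle (pair i) (elem r)))) + sum (λ i → degree (vertical (elem i))) ≡⟨ cong (_+ sum (λ i → degree (vertical (elem i)))) (sum-remQuot (q * q) q (λ p → degree (circle (pair (proj₁ p)) (elem (proj₂ p))))) ⟨
      sum (λ k → degree (block′ (inj₁ k))) + sum (λ i → degree (vertical (elem i)))      ≡⟨ sum-splitAt (q * q * q) (λ s → degree (block′ s)) ⟨
      sum (λ k → degree (block k))                                                       ∎
      where open ℕ.≤-Reasoning

    mobius-lower : q * q * (q + q * q) + q * (1 + q) ≤ z (q * q * q + q) (suc (q * q)) 2 3
    mobius-lower = ℕ.≤-trans total-degree (incidence-bound (λ k l → incident (block k) (point l))
      (λ {k} {l} ne φ φ-injective on on′ → ne (block-injective (two-blocks (block k) (block l) (λ i → point (φ i)) (λ e → φ-injective (point-injective e)) on on′))))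

  -- The balance that makes the tangent bound at q + 1 exact: the q(q² + 1) blocks of size q + 1
  -- have room for each triple of points once. After multiplication by 6, `absorption` reduces it to
  -- a polynomial identity.
  triples : ∀ p → let q = suc p in suc (q * q) C 3 ≡ q * suc (q * q) * (suc q C 3)
  triples p = ℕ.*-cancelˡ-≡ _ _ 6 (begin
    6 * (suc (q * q) C 3)                       ≡⟨ ℕ.*-assoc 2 3 (suc (q * q) C 3) ⟩
    2 * (3 * (suc (q * q) C 3))                 ≡⟨ cong (2 *_) (absorption (q * q) 2) ⟩
    2 * (suc (q * q) * (q * q C 2))             ≡⟨ swap 2 (suc (q * q)) (q * q C 2) ⟩
    suc (q * q) * (2 * (q * q C 2))             ≡⟨ cong (suc (q * q) *_) (absorption (p + p * q) 1) ⟩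
    suc (q * q) * (q * q * ((p + p * q) C 1))   ≡⟨ cong (λ t → suc (q * q) * (q * q * t)) (nC1≡n (p + p * q)) ⟩
    suc (q * q) * (q * q * (p + p * q))         ≡⟨ identity p ⟩
    q * suc (q * q) * (suc q * (q * p))         ≡⟨ cong (λ t → q * suc (q * q) * (suc q * (q * t))) (nC1≡n p) ⟨
    q * suc (q * q) * (suc q * (q * (p C 1)))   ≡⟨ cong (λ t → q * suc (q * q) * (suc q * t)) (absorption p 1) ⟨
    q * suc (q * q) * (suc q * (2 * (q C 2)))   ≡⟨ cong (q * suc (q * q) *_) (swap 2 (suc q) (q C 2)) ⟨
    q * suc (q * q) * (2 * (suc q * (q C 2)))   ≡⟨ cong (λ t → q * suc (q * q) * (2 * t)) (absorption q 2) ⟨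
    q * suc (q * q) * (2 * (3 * (suc q C 3)))   ≡⟨ cong (q * suc (q * q) *_) (ℕ.*-assoc 2 3 (suc q C 3)) ⟨
    q * suc (q * q) * (6 * (suc q C 3))         ≡⟨ swap 6 (q * suc (q * q)) (suc q C 3) ⟨
    6 * (q * suc (q * q) * (suc q C 3))         ∎)
    where
    open ≡-Reasoning
    q : ℕ
    q = suc p
    swap : ∀ a b c → a * (b * c) ≡ b * (a * c)
    swap a b c = trans (sym (ℕ.*-assoc a b c)) (trans (cong (_* c) (ℕ.*-comm a b)) (ℕ.*-assoc b a c))
    identity : ∀ p → suc (suc p * suc p) * (suc p * suc p * (p + p * suc p)) ≡ suc p * suc (suc p * suc p) * (suc (suc p) * (suc p * p))
    identity = solve-∀

  mobius-upper : ∀ q → 1 ≤ q → z (q * suc (q * q)) (suc (q * q)) 2 3 ≤ q * suc (q * q) * suc q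
  mobius-upper (suc p) _ = z-upper (suc p * suc (suc p * suc p)) (suc (suc p * suc p)) (suc (suc p)) 2 (s≤s (s≤s z≤n)) (ℕ.≤-reflexive (triples p))

  mobius : ∀ q → IsPrimePower q → z (q * (q ℕ.^ 2 + 1)) (q ℕ.^ 2 + 1) 2 3 ≡ (q ℕ.^ 2 + q) * (q ℕ.^ 2 + 1)
  mobius q pq = subst₂ (λ m n → z m n 2 3 ≡ (q ℕ.^ 2 + q) * (q ℕ.^ 2 + 1)) (sym (rows q)) (sym (columns q)) (ℕ.≤-antisym
      (subst₂ (λ m k → z m (suc (q * q)) 2 3 ≤ k) (rows′ q) (upper q) (mobius-upper q (ℕ.<⇒≤ (primePower>1 pq))))
      (subst (_≤ z (q * q * q + q) (suc (q * q)) 2 3) (lower q) (Mobius.mobius-lower (galoisField pq))))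
    where
    rows : ∀ q → q * (q * (q * 1) + 1) ≡ q * q * q + q
    rows = solve-∀
    rows′ : ∀ q → q * suc (q * q) ≡ q * q * q + q
    rows′ = solve-∀
    columns : ∀ q → q * (q * 1) + 1 ≡ suc (q * q)
    columns = solve-∀
    upper : ∀ q → q * suc (q * q) * suc q ≡ (q * (q * 1) + q) * (q * (q * 1) + 1)
    upper = solve-∀
    lower : ∀ q → q * q * (q + q * q) + q * (1 + q) ≡ (q * (q * 1) + q) * (q * (q * 1) + 1)
    lower = solve-∀

-- Lower bounds from Reed-Solomon codes.

module PolynomialCodes where
  open import Defs
  open Rings
  open Frobenius
  open GaloisFields
  open Zarankiewicz
  open import Data.Nat as ℕ using (ℕ; zero; suc; _+_; _*_; _^_; _≤_)
  import Data.Nat.Properties as ℕ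
  open import Data.Bool using (Bool; true; false)
  open import Data.Fin as Fin using (Fin; zero; suc; splitAt; remQuot; finToFun; inject≤)
  import Data.Fin.Properties as Fin
  open import Data.Vec using (tabulate)
  import Data.Vec.Properties as Vec
  open import Data.Product using (Σ; _×_; _,_; proj₁; proj₂)
  open import Data.Sum using (_⊎_; inj₁; inj₂)
  open import Data.Empty using (⊥)
  open import Relation.Nullary using (yes; does)
  open import Relation.Nullary.Decidable using (dec-true)
  open import Relation.Binary.PropositionalEquality hiding ([_])

  -- Rows are the graphs of the first M polynomials of degree below r over a field with q elements, padded by empty rows and columns.
  module Code {q} (F : FiniteField q) (r M : ℕ) (M≤ : M ≤ q ^ suc r) (m′ n′ : ℕ) where
    open FiniteField F
    open CRing 𝓡
    open RingTheory 𝓡 hiding (_^_)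

    coefficients : Fin M → Fin (suc r) → R
    coefficients i k = elem (finToFun {q} {suc r} (inject≤ i M≤) k)

    value : Fin M → R → R
    value i x = eval (tabulate (coefficients i)) x

    incident : Fin M → R → R → Bool
    incident i x y = does (value i x ≟ y)

    inc′ : Fin M ⊎ Fin m′ → Fin (q * q) ⊎ Fin n′ → Bool
    inc′ (inj₁ i) (inj₁ j) = incident i (elem (proj₁ (remQuot {q} q j))) (elem (proj₂ (remQuot {q} q j)))
    inc′ (inj₁ _) (inj₂ _) = false
    inc′ (inj₂ _) _ = false

    on-graph : ∀ {s t} → inc′ s t ≡ true → Σ (Fin M) λ i → Σ (Fin (q * q)) λ j → s ≡ inj₁ i × t ≡ inj₁ j × value i (elem (proj₁ (remQuot {q} q j))) ≡ elem (proj₂ (remQuot {q} q j))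
    on-graph {inj₁ i} {inj₁ j} e with value i (elem (proj₁ (remQuot {q} q j))) ≟ elem (proj₂ (remQuot {q} q j))
    ... | yes p = i , j , refl , refl , p

    -- The difference of the two polynomials has r + 1 coefficients and r + 1 roots, so the base-q
    -- digits of the two row numbers agree.
    agree⇒equal : ∀ {i i′} (x : Fin (suc r) → R) → (∀ {k l} → x k ≡ x l → k ≡ l) → (∀ k → value i (x k) ≡ value i′ (x k)) → i ≡ i′
    agree⇒equal {i} {i′} x x-injective e = Fin.inject≤-injective M≤ M≤ i i′ (finToFun-injective (suc r) {q} (λ k → elem-injective (⊖-zero (trans (sym (Vec.lookup∘tabulate difference k)) (too-many-roots domain (tabulate difference) x x-injective root k)))))
      where
      domain : Domain
      domain = field⇒domain 𝓡 (_≟ # 0) inverse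
      difference : Fin (suc r) → R
      difference k = coefficients i k ⊖ coefficients i′ k
      root : ∀ k → eval (tabulate difference) (x k) ≡ # 0
      root k = trans (eval-difference (coefficients i) (coefficients i′) (x k)) (trans (cong (_⊖ value i′ (x k)) (e k)) (⊕-invʳ (value i′ (x k))))

    -- Points of one graph with equal abscissa coincide, so r + 1 distinct common columns have r + 1
    -- distinct abscissae. Padding rows and columns carry no incidence.
    free′ : ∀ {s s′} → s ≢ s′ → (φ : Fin (suc r) → Fin (q * q) ⊎ Fin n′) → (∀ {k l} → φ k ≡ φ l → k ≡ l) → (∀ k → inc′ s (φ k) ≡ true) → (∀ k → inc′ s′ (φ k) ≡ true) → ⊥
    free′ {s} {s′} ne φ φ-injective on on′ = clash (on-graph {s} {φ zero} (on zero)) (on-graph {s′} {φ zero} (on′ zero))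
      where
      inj₁-injective : ∀ {A B : Set} {a a′ : A} → inj₁ {B = B} a ≡ inj₁ a′ → a ≡ a′
      inj₁-injective refl = refl
      clash : (Σ (Fin M) λ i → Σ (Fin (q * q)) λ j → s ≡ inj₁ i × φ zero ≡ inj₁ j × value i (elem (proj₁ (remQuot {q} q j))) ≡ elem (proj₂ (remQuot {q} q j))) →
        (Σ (Fin M) λ i → Σ (Fin (q * q)) λ j → s′ ≡ inj₁ i × φ zero ≡ inj₁ j × value i (elem (proj₁ (remQuot {q} q j))) ≡ elem (proj₂ (remQuot {q} q j))) → ⊥
      clash (i , _ , s≡ , _) (i′ , _ , s′≡ , _) = ne (trans s≡ (trans (cong inj₁ (agree⇒equal abscissa abscissa-injective (λ k → trans (proj₂ (proj₂ (common k))) (sym (value′ k))))) (sym s′≡)))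
        where
        common : ∀ k → Σ (Fin (q * q)) λ j → φ k ≡ inj₁ j × value i (elem (proj₁ (remQuot {q} q j))) ≡ elem (proj₂ (remQuot {q} q j))
        common k with on-graph {s} {φ k} (on k)
        ... | i₁ , j , e , e′ , v = j , e′ , subst (λ i → value i (elem (proj₁ (remQuot {q} q j))) ≡ elem (proj₂ (remQuot {q} q j))) (inj₁-injective (trans (sym e) s≡)) v
        column : Fin (suc r) → Fin (q * q)
        column k = proj₁ (common k)
        abscissa ordinate : Fin (suc r) → R
        abscissa k = elem (proj₁ (remQuot {q} q (column k)))
        ordinate k = elem (proj₂ (remQuot {q} q (column k)))
        value′ : ∀ k → value i′ (abscissa k) ≡ ordinate k
        value′ k with on-graph {s′} {φ k} (on′ k)
        ... | i₁ , j , e , e′ , v = subst₂ (λ i j → value i (elem (proj₁ (remQuot {q} q j))) ≡ elem (proj₂ (remQuot {q} q j))) (inj₁-injective (trans (sym e) s′≡)) (inj₁-injective (trans (sym e′) (proj₁ (proj₂ (common k))))) v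
        abscissa-injective : ∀ {k l} → abscissa k ≡ abscissa l → k ≡ l
        abscissa-injective {k} {l} e = φ-injective (trans (proj₁ (proj₂ (common k))) (trans (cong inj₁ (remQuot-injective {q} q (cong₂ _,_ (elem-injective e) (elem-injective same)))) (sym (proj₁ (proj₂ (common l))))))
          where
          same : ordinate k ≡ ordinate l
          same = trans (sym (proj₂ (proj₂ (common k)))) (trans (cong (value i) e) (proj₂ (proj₂ (common l))))

    inc : Fin (M + m′) → Fin (q * q + n′) → Bool
    inc i j = inc′ (splitAt M i) (splitAt (q * q) j)

    row-weight : ∀ i → q ≤ sum (λ j → bit (inc′ (inj₁ i) (splitAt (q * q) j)))
    row-weight i = begin
      q                                                                     ≡⟨ trans (sum-const q 1) (ℕ.*-identityʳ q) ⟨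
      sum {q} (λ _ → 1)                                                     ≤⟨ sum-mono {q} (λ x → ℕ.≤-trans (ℕ.≤-reflexive (sym (cong bit (dec-true (value i (elem x) ≟ elem (index (value i (elem x)))) (sym (elem-index (value i (elem x)))))))) (term≤sum (λ y → bit (incident i (elem x) (elem y))) (index (value i (elem x))))) ⟩
      sum (λ x → sum (λ y → bit (incident i (elem x) (elem y))))            ≡⟨ sum-remQuot q q (λ p → bit (incident i (elem (proj₁ p)) (elem (proj₂ p)))) ⟨
      sum (λ j → bit (inc′ (inj₁ i) (inj₁ j)))                              ≤⟨ ℕ.m≤m+n _ _ ⟩
      sum (λ j → bit (inc′ (inj₁ i) (inj₁ j))) + sum {n′} (λ j → 0)         ≡⟨ sum-splitAt (q * q) (λ t → bit (inc′ (inj₁ i) t)) ⟨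
      sum (λ j → bit (inc′ (inj₁ i) (splitAt (q * q) j)))                   ∎
      where open ℕ.≤-Reasoning

    lower : M * q ≤ z (M + m′) (q * q + n′) 2 (suc r)
    lower = begin
      M * q                                                                 ≡⟨ sum-const M q ⟨
      sum {M} (λ _ → q)                                                     ≤⟨ sum-mono row-weight ⟩
      sum (λ i → weight (inj₁ i))                                           ≤⟨ ℕ.m≤m+n _ _ ⟩
      sum (λ i → weight (inj₁ i)) + sum (λ i → weight (inj₂ i))             ≡⟨ sum-splitAt M weight ⟨
      sum (λ i → sum (λ j → bit (inc i j)))                                 ≤⟨ incidence-bound inc (λ ne φ φ-injective on on′ → free′ (λ e → ne (splitAt-injective M e)) (λ k → splitAt (q * q) (φ k)) (λ e → φ-injective (splitAt-injective (q * q) e)) on on′) ⟩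
      z (M + m′) (q * q + n′) 2 (suc r)                                     ∎
      where
      open ℕ.≤-Reasoning
      weight : Fin M ⊎ Fin m′ → ℕ
      weight s = sum (λ j → bit (inc′ s (splitAt (q * q) j)))

  code-lower : ∀ {q} → IsPrimePower q → ∀ r M m n → M ≤ q ^ suc r → M ≤ m → q * q ≤ n → M * q ≤ z m n 2 (suc r)
  code-lower {q} pq r M m n M≤ M≤m qq≤n = subst₂ (λ m n → M * q ≤ z m n 2 (suc r)) (ℕ.m+[n∸m]≡n M≤m) (ℕ.m+[n∸m]≡n qq≤n) (Code.lower (galoisField pq) r M M≤ (m ℕ.∸ M) (n ℕ.∸ q * q))

-- The asymptotic statement (b), in integer inequalities between squares.

module Asymptotics where
  open import Defs
  open GeometricGrid using (*-interchange; ^-distrib-*; module Grid)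
  open PrimePowers using (primePowers-in-grid)
  open Counting using (z-upper-power)
  open PolynomialCodes using (code-lower)
  open import Data.Nat as ℕ using (ℕ; zero; suc; _+_; _*_; _^_; _∸_; _≤_; _<_; _⊓_; _⊔_; ∣_-_∣; z≤n; s≤s; NonZero)
  import Data.Nat.Properties as ℕ
  open import Data.Nat.Base using (>-nonZero)
  open import Data.Nat.Tactic.RingSolver using (solve-∀)
  open import Data.Product using (Σ; ∃; _×_; _,_; proj₁; proj₂)
  open import Data.Sum using (_⊎_; inj₁; inj₂)
  open import Data.Empty using (⊥-elim)
  open import Relation.Nullary using (yes; no)
  open import Relation.Binary.PropositionalEquality

  square-cancel-≤ : ∀ {x y} → x * x ≤ y * y → x ≤ y
  square-cancel-≤ h = ℕ.≮⇒≥ (λ y<x → ℕ.<⇒≱ (ℕ.*-mono-< y<x y<x) h)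

  square-cancel-< : ∀ {x y} → x * x < y * y → x < y
  square-cancel-< h = ℕ.≰⇒> (λ y≤x → ℕ.<⇒≱ h (ℕ.*-mono-≤ y≤x y≤x))

  crossing : ∀ (f : ℕ → ℕ) X → f 0 ≤ X → ∀ N → X < f N → ∃ λ u → f u ≤ X × X < f (suc u)
  crossing f X h zero q = ⊥-elim (ℕ.<⇒≱ q h)
  crossing f X h (suc N) q with f N ℕ.≤? X
  ... | yes p = N , p , q
  ... | no ¬p = crossing f X h N (ℕ.≰⇒> ¬p)

  *-swap : ∀ a b c → a * (b * c) ≡ b * (a * c)
  *-swap a b c = trans (sym (ℕ.*-assoc a b c)) (trans (cong (_* c) (ℕ.*-comm a b)) (ℕ.*-assoc b a c))

  ^-positive : ∀ {a} n → 1 ≤ a → NonZero (a ^ n)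
  ^-positive {suc a} n _ = ℕ.m^n≢0 (suc a) n

  -- The factor 1 + 1/k lost in the comparison of n^(r + 1) with m² is regained from (1 + 1/k) n ≤
  -- b², since (1 + 1/k)^(r + 1) ≥ 1 + 1/k.
  column-bound : ∀ {k n m b} r → 1 ≤ k → k * n ^ suc r ≤ suc k * (m * m) → suc k * n ≤ k * (b * b) → n ^ suc r ≤ m * b ^ suc r
  column-bound {k} {n} {m} {b} r 1≤k h₁ h₂ = square-cancel-≤ (ℕ.*-cancelˡ-≤ (k * suc k) ⦃ ℕ.m*n≢0 k (suc k) ⦃ >-nonZero 1≤k ⦄ ⦄ (begin
    k * suc k * (X * X)             ≡⟨ *-interchange k (suc k) X X ⟩
    k * X * (suc k * X)             ≤⟨ ℕ.*-mono-≤ h₁ powered ⟩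
    suc k * (m * m) * (k * W)       ≡⟨ *-interchange (suc k) (m * m) k W ⟩
    suc k * k * (m * m * W)         ≡⟨ cong₂ _*_ (ℕ.*-comm (suc k) k) (trans (cong (m * m *_) (^-distrib-* b b (suc r))) (*-interchange m m (b ^ suc r) (b ^ suc r))) ⟩
    k * suc k * (m * b ^ suc r * (m * b ^ suc r)) ∎))
    where
    open ℕ.≤-Reasoning
    X W : ℕ
    X = n ^ suc r
    W = (b * b) ^ suc r
    powered : suc k * X ≤ k * W
    powered = ℕ.*-cancelˡ-≤ (k ^ r) ⦃ ^-positive r 1≤k ⦄ (begin
      k ^ r * (suc k * X)         ≤⟨ ℕ.*-monoˡ-≤ (suc k * X) (ℕ.^-monoˡ-≤ r (ℕ.n≤1+n k)) ⟩
      suc k ^ r * (suc k * X)     ≡⟨ trans (sym (ℕ.*-assoc (suc k ^ r) (suc k) X)) (cong (_* X) (ℕ.*-comm (suc k ^ r) (suc k))) ⟩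
      suc k ^ suc r * X           ≡⟨ ^-distrib-* (suc k) n (suc r) ⟨
      (suc k * n) ^ suc r         ≤⟨ ℕ.^-monoˡ-≤ (suc r) h₂ ⟩
      (k * (b * b)) ^ suc r       ≡⟨ ^-distrib-* k (b * b) (suc r) ⟩
      k ^ suc r * W               ≡⟨ trans (ℕ.*-assoc k (k ^ r) W) (*-swap k (k ^ r) W) ⟩
      k ^ r * (k * W)             ∎)

  -- Since 3kw ≤ u, widening u by w costs one factor 1 + 1/k in the square; the comparison of u²
  -- with n costs another.
  widened-square : ∀ {k u w n J} → 1 ≤ k → k * (u * u) ≤ suc k * n → 3 * k * w ≤ u → J * (suc k * suc k) ≤ suc J * (k * k) →
    J * ((u + w) * (u + w)) ≤ suc J * n
  widened-square {k} {u} {w} {n} {J} 1≤k h₁ h₂ h₃ = ℕ.*-cancelˡ-≤ (k * k) ⦃ ℕ.m*n≢0 k k ⦃ >-nonZero 1≤k ⦄ ⦃ >-nonZero 1≤k ⦄ ⦄ (begin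
    k * k * (J * S)             ≡⟨ *-swap (k * k) J S ⟩
    J * (k * k * S)             ≡⟨ cong (J *_) (ℕ.*-assoc k k S) ⟩
    J * (k * (k * S))           ≤⟨ ℕ.*-monoʳ-≤ J (ℕ.*-monoʳ-≤ k expand) ⟩
    J * (k * (suc k * (u * u))) ≡⟨ cong (J *_) (*-swap k (suc k) (u * u)) ⟩
    J * (suc k * (k * (u * u))) ≤⟨ ℕ.*-monoʳ-≤ J (ℕ.*-monoʳ-≤ (suc k) h₁) ⟩
    J * (suc k * (suc k * n))   ≡⟨ trans (cong (J *_) (sym (ℕ.*-assoc (suc k) (suc k) n))) (sym (ℕ.*-assoc J (suc k * suc k) n)) ⟩
    J * (suc k * suc k) * n     ≤⟨ ℕ.*-monoˡ-≤ n h₃ ⟩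
    suc J * (k * k) * n         ≡⟨ trans (cong (_* n) (ℕ.*-comm (suc J) (k * k))) (ℕ.*-assoc (k * k) (suc J) n) ⟩
    k * k * (suc J * n)         ∎)
    where
    open ℕ.≤-Reasoning
    S : ℕ
    S = (u + w) * (u + w)
    w≤u : w ≤ u
    w≤u = ℕ.≤-trans (ℕ.m≤n*m w (3 * k) ⦃ ℕ.m*n≢0 3 k ⦃ _ ⦄ ⦃ >-nonZero 1≤k ⦄ ⦄) h₂
    square : ∀ k u w → k * ((u + w) * (u + w)) ≡ k * (u * u) + k * (2 * (u * w) + w * w)
    square = solve-∀
    collect : ∀ k u w → k * (2 * (u * w) + u * w) ≡ u * (3 * k * w)
    collect = solve-∀
    expand : k * S ≤ suc k * (u * u)
    expand = begin
      k * S                                          ≡⟨ square k u w ⟩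
      k * (u * u) + k * (2 * (u * w) + w * w)        ≤⟨ ℕ.+-monoʳ-≤ (k * (u * u)) (ℕ.*-monoʳ-≤ k (ℕ.+-monoʳ-≤ (2 * (u * w)) (ℕ.*-monoˡ-≤ w w≤u))) ⟩
      k * (u * u) + k * (2 * (u * w) + u * w)        ≡⟨ cong (k * (u * u) +_) (collect k u w) ⟩
      k * (u * u) + u * (3 * k * w)                  ≤⟨ ℕ.+-monoʳ-≤ (k * (u * u)) (ℕ.*-monoʳ-≤ u h₂) ⟩
      k * (u * u) + u * u                            ≡⟨ ℕ.+-comm (k * (u * u)) (u * u) ⟩
      suc k * (u * u)                                ∎

  -- For k = 3 (j + 1) one has (1 + 1/k)² ≤ 1 + 3/k = 1 + 1/(j + 1), so two losses of 1 + 1/k are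
  -- affordable.
  precision : ℕ → ℕ
  precision j = 3 * suc j

  precision-above : ∀ j → suc j * (suc (precision j) * suc (precision j)) ≤ suc (suc j) * (precision j * precision j)
  precision-above j = ℕ.≤-trans (ℕ.m≤m+n _ (3 * (j * j) + 5 * j + 2)) (ℕ.≤-reflexive (identity j))
    where
    identity : ∀ j → suc j * (suc (3 * suc j) * suc (3 * suc j)) + (3 * (j * j) + 5 * j + 2) ≡ suc (suc j) * (3 * suc j * (3 * suc j))
    identity = solve-∀

  precision-below : ∀ j → j * (suc (precision j) * suc (precision j)) ≤ suc j * (precision j * precision j)
  precision-below j = ℕ.≤-trans (ℕ.m≤m+n _ (3 * (suc j * suc j) + 5 * suc j + 1)) (ℕ.≤-reflexive (identity j))
    where
    identity : ∀ j → j * (suc (3 * suc j) * suc (3 * suc j)) + (3 * (suc j * suc j) + 5 * suc j + 1) ≡ suc j * (3 * suc j * (3 * suc j))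
    identity = solve-∀

  -- The tangent is taken at u + r + 2, where u is the integer part of √((1 + 1/k) n): r + 1 is what
  -- `z-upper-power` subtracts, and 1 makes up for the rounding.
  asymptotic-upper : ∀ r j → ∃ λ N → ∀ n → N ≤ n → ∀ m → precision j * n ^ suc r ≤ suc (precision j) * (m * m) →
    suc j * (z m n 2 (suc r) * z m n 2 (suc r)) ≤ suc (suc j) * (n * (m * m))
  asymptotic-upper r j = t * t , bound
    where
    open ℕ.≤-Reasoning
    k w t : ℕ
    k = precision j
    w = suc (suc r)
    t = 3 * k * w
    bound : ∀ n → t * t ≤ n → ∀ m → k * n ^ suc r ≤ suc k * (m * m) → suc j * (z m n 2 (suc r) * z m n 2 (suc r)) ≤ suc (suc j) * (n * (m * m))
    bound n t²≤n m h with crossing (λ u → k * (u * u)) (suc k * n) (ℕ.≤-trans (ℕ.≤-reflexive (ℕ.*-zeroʳ k)) z≤n) (suc (suc k * n)) (ℕ.≤-trans (ℕ.m≤m*n (suc (suc k * n)) (suc (suc k * n))) (ℕ.m≤n*m (suc (suc k * n) * suc (suc k * n)) k))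
    ... | u , below , above = begin
      suc j * (Z * Z)                             ≤⟨ ℕ.*-monoʳ-≤ (suc j) (ℕ.*-mono-≤ Z≤ Z≤) ⟩
      suc j * (m * (u + w) * (m * (u + w)))       ≡⟨ cong (suc j *_) (trans (*-interchange m (u + w) m (u + w)) (ℕ.*-comm (m * m) ((u + w) * (u + w)))) ⟩
      suc j * ((u + w) * (u + w) * (m * m))       ≡⟨ ℕ.*-assoc (suc j) ((u + w) * (u + w)) (m * m) ⟨
      suc j * ((u + w) * (u + w)) * (m * m)       ≤⟨ ℕ.*-monoˡ-≤ (m * m) (widened-square {k} {u} {w} {n} {suc j} (s≤s z≤n) below t≤u (precision-above j)) ⟩
      suc (suc j) * n * (m * m)                   ≡⟨ ℕ.*-assoc (suc (suc j)) n (m * m) ⟩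
      suc (suc j) * (n * (m * m))                 ∎
      where
      Z : ℕ
      Z = z m n 2 (suc r)
      n<b² : n < suc u * suc u
      n<b² = ℕ.*-cancelˡ-< k n (suc u * suc u) (ℕ.≤-<-trans (ℕ.m≤n+m (k * n) n) above)
      t≤u : t ≤ u
      t≤u = ℕ.≤-pred (square-cancel-< (ℕ.≤-<-trans t²≤n n<b²))
      width : suc r + suc u ≡ u + w
      width = trans (ℕ.+-comm (suc r) (suc u)) (sym (ℕ.+-suc u (suc r)))
      Z≤ : Z ≤ m * (u + w)
      Z≤ = subst (λ a → Z ≤ m * a) width (z-upper-power m n (suc r + suc u) r (ℕ.m<m+n (suc r) (s≤s z≤n))
        (subst (λ b → n ^ suc r ≤ m * b ^ suc r) (sym (ℕ.m+n∸m≡n (suc r) (suc u))) (column-bound {k} {n} {m} {suc u} r (s≤s z≤n) h (ℕ.<⇒≤ above))))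

  bernoulli-below : ∀ K b → suc K ^ suc b ≤ K ^ suc b + suc b * suc K ^ b
  bernoulli-below K zero = ℕ.≤-reflexive (identity K)
    where
    identity : ∀ K → suc K * 1 ≡ K * 1 + 1 * 1
    identity = solve-∀
  bernoulli-below K (suc b) = begin
    suc K * suc K ^ suc b                                        ≤⟨ ℕ.+-monoʳ-≤ (suc K ^ suc b) (ℕ.*-monoʳ-≤ K (bernoulli-below K b)) ⟩
    suc K ^ suc b + K * (K ^ suc b + suc b * suc K ^ b)          ≡⟨ cong (suc K ^ suc b +_) (ℕ.*-distribˡ-+ K (K ^ suc b) (suc b * suc K ^ b)) ⟩
    suc K ^ suc b + (K ^ suc (suc b) + K * (suc b * suc K ^ b))  ≡⟨ trans (cong (λ t → suc K ^ suc b + (K ^ suc (suc b) + t)) (*-swap K (suc b) (suc K ^ b))) (rotate (suc K ^ suc b) (K ^ suc (suc b)) (suc b * (K * suc K ^ b))) ⟩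
    K ^ suc (suc b) + (suc K ^ suc b + suc b * (K * suc K ^ b))  ≤⟨ ℕ.+-monoʳ-≤ (K ^ suc (suc b)) (ℕ.+-monoʳ-≤ (suc K ^ suc b) (ℕ.*-monoʳ-≤ (suc b) (ℕ.m≤n+m (K * suc K ^ b) (suc K ^ b)))) ⟩
    K ^ suc (suc b) + suc (suc b) * suc K ^ suc b                ∎
    where
    open ℕ.≤-Reasoning
    rotate : ∀ x y z → x + (y + z) ≡ y + (x + z)
    rotate x y z = trans (sym (ℕ.+-assoc x y z)) (trans (cong (_+ z) (ℕ.+-comm x y)) (ℕ.+-assoc y x z))

  -- By `bernoulli-below` the power changes by at most the fraction (b + 1)/(K + 1) = 1/(e + 1)
  -- between K + 1 and K.
  bernoulli-ratio : ∀ K b e → suc K ≡ suc b * suc e → e * suc K ^ suc b ≤ suc e * K ^ suc b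
  bernoulli-ratio K b e eq = ℕ.+-cancelˡ-≤ (suc K ^ suc b) (e * suc K ^ suc b) (suc e * K ^ suc b) (begin
    suc e * suc K ^ suc b                                     ≤⟨ ℕ.*-monoʳ-≤ (suc e) (bernoulli-below K b) ⟩
    suc e * (K ^ suc b + suc b * suc K ^ b)                   ≡⟨ ℕ.*-distribˡ-+ (suc e) (K ^ suc b) (suc b * suc K ^ b) ⟩
    suc e * K ^ suc b + suc e * (suc b * suc K ^ b)           ≡⟨ cong (suc e * K ^ suc b +_) (trans (sym (ℕ.*-assoc (suc e) (suc b) (suc K ^ b))) (cong (_* suc K ^ b) (trans (ℕ.*-comm (suc e) (suc b)) (sym eq)))) ⟩
    suc e * K ^ suc b + suc K ^ suc b                         ≡⟨ ℕ.+-comm (suc e * K ^ suc b) (suc K ^ suc b) ⟩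
    suc K ^ suc b + suc e * K ^ suc b                         ∎)
    where open ℕ.≤-Reasoning

  bernoulli-above : ∀ K i → K ^ i * (K + i) ≤ suc K ^ i * K
  bernoulli-above K zero = ℕ.≤-reflexive (cong (1 *_) (ℕ.+-identityʳ K))
  bernoulli-above K (suc i) = begin
    K * K ^ i * (K + suc i)                        ≡⟨ trans (cong (K * K ^ i *_) (ℕ.+-suc K i)) (identity K (K ^ i) i) ⟩
    K ^ i * K + K * (K ^ i * (K + i))              ≤⟨ ℕ.+-monoˡ-≤ _ (ℕ.*-monoʳ-≤ (K ^ i) (ℕ.m≤m+n K i)) ⟩
    suc K * (K ^ i * (K + i))                      ≤⟨ ℕ.*-monoʳ-≤ (suc K) (bernoulli-above K i) ⟩
    suc K * (suc K ^ i * K)                        ≡⟨ ℕ.*-assoc (suc K) (suc K ^ i) K ⟨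
    suc K ^ suc i * K                              ∎
    where
    open ℕ.≤-Reasoning
    identity : ∀ K x i → K * x * suc (K + i) ≡ x * K + K * (x * (K + i))
    identity = solve-∀

  -- With ρ = K₁/K the hypotheses give s + 1 ≤ ρ^(T + 4) and ρ^T ≤ q, so s + 1 ≤ ρ⁴ q; squaring
  -- yields the eighth power.
  ratio-bound : ∀ {K K₁ s q n} T → 1 ≤ K → n < suc s * suc s → suc s * K ^ (4 + T) ≤ K₁ ^ (4 + T) → K₁ ^ T ≤ q * K ^ T → n * K ^ 8 ≤ K₁ ^ 8 * (q * q)
  ratio-bound {K} {K₁} {s} {q} {n} T 1≤K n< h₁ h₂ = begin
    n * K ^ 8                                   ≤⟨ ℕ.*-monoˡ-≤ (K ^ 8) (ℕ.<⇒≤ n<) ⟩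
    suc s * suc s * K ^ 8                       ≡⟨ cong (suc s * suc s *_) (ℕ.^-distribˡ-+-* K 4 4) ⟩
    suc s * suc s * (K ^ 4 * K ^ 4)             ≡⟨ *-interchange (suc s) (suc s) (K ^ 4) (K ^ 4) ⟩
    suc s * K ^ 4 * (suc s * K ^ 4)             ≤⟨ ℕ.*-mono-≤ fourth fourth ⟩
    K₁ ^ 4 * q * (K₁ ^ 4 * q)                   ≡⟨ *-interchange (K₁ ^ 4) q (K₁ ^ 4) q ⟩
    K₁ ^ 4 * K₁ ^ 4 * (q * q)                   ≡⟨ cong (_* (q * q)) (ℕ.^-distribˡ-+-* K₁ 4 4) ⟨
    K₁ ^ 8 * (q * q)                            ∎
    where
    open ℕ.≤-Reasoning
    fourth : suc s * K ^ 4 ≤ K₁ ^ 4 * q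
    fourth = ℕ.*-cancelʳ-≤ (suc s * K ^ 4) (K₁ ^ 4 * q) (K ^ T) ⦃ ^-positive T 1≤K ⦄ (begin
      suc s * K ^ 4 * K ^ T     ≡⟨ trans (ℕ.*-assoc (suc s) (K ^ 4) (K ^ T)) (cong (suc s *_) (sym (ℕ.^-distribˡ-+-* K 4 T))) ⟩
      suc s * K ^ (4 + T)       ≤⟨ h₁ ⟩
      K₁ ^ (4 + T)              ≡⟨ ℕ.^-distribˡ-+-* K₁ 4 T ⟩
      K₁ ^ 4 * K₁ ^ T           ≤⟨ ℕ.*-monoʳ-≤ (K₁ ^ 4) h₂ ⟩
      K₁ ^ 4 * (q * K ^ T)      ≡⟨ ℕ.*-assoc (K₁ ^ 4) q (K ^ T) ⟨
      K₁ ^ 4 * q * K ^ T        ∎)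

  primePower-near-root : ∀ K′ → 8 ≤ suc K′ → ∃ λ N → ∀ n → N ≤ n → ∃ λ q → IsPrimePower q × q * q ≤ n × n * suc K′ ^ 8 ≤ suc (suc K′) ^ 8 * (q * q)
  primePower-near-root K′ 8≤K = g (3 + T₀) * g (3 + T₀) , search
    where
    open Grid K′
    T₀ : ℕ
    T₀ = proj₁ (primePowers-in-grid K′ 8≤K)
    -- Bernoulli's inequality ρ^i ≥ 1 + i/K makes the exponent i = K (s + 1) large enough.
    unbounded : ∀ s → suc s ≤ g (3 + K * suc s)
    unbounded s = ℕ.≤-trans (≤g⁺ i (ℕ.*-cancelʳ-≤ (suc s * K ^ i) (K₁ ^ i) K (begin
      suc s * K ^ i * K         ≡⟨ trans (cong (_* K) (ℕ.*-comm (suc s) (K ^ i))) (trans (ℕ.*-assoc (K ^ i) (suc s) K) (cong (K ^ i *_) (ℕ.*-comm (suc s) K))) ⟩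
      K ^ i * i                 ≤⟨ ℕ.*-monoʳ-≤ (K ^ i) (ℕ.m≤n+m i K) ⟩
      K ^ i * (K + i)           ≤⟨ bernoulli-above K i ⟩
      K₁ ^ i * K                ∎))) (g-mono (ℕ.m≤n+m i 3))
      where
      open ℕ.≤-Reasoning
      i : ℕ
      i = K * suc s
    search : ∀ n → g (3 + T₀) * g (3 + T₀) ≤ n → ∃ λ q → IsPrimePower q × q * q ≤ n × n * K ^ 8 ≤ K₁ ^ 8 * (q * q)
    search n N≤n with crossing (λ u → u * u) n z≤n (suc n) (ℕ.m≤m*n (suc n) (suc n))
    ... | s , s²≤n , n<s² = near (crossing (λ T → g (3 + T)) s (ℕ.≤-trans (g-mono (ℕ.m≤m+n 3 T₀)) g≤s) (K * suc s) (unbounded s))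
      where
      g≤s : g (3 + T₀) ≤ s
      g≤s = ℕ.≤-pred (square-cancel-< (ℕ.≤-<-trans N≤n n<s²))
      near : (∃ λ T → g (3 + T) ≤ s × s < g (4 + T)) → ∃ λ q → IsPrimePower q × q * q ≤ n × n * K ^ 8 ≤ K₁ ^ 8 * (q * q)
      -- T is at least T₀, since otherwise g(4 + T) ≤ g(3 + T₀) ≤ s.
      near (T , lower , upper) with proj₂ (primePowers-in-grid K′ 8≤K) T (ℕ.≮⇒≥ (λ T<T₀ → ℕ.<⇒≱ upper (ℕ.≤-trans (g-mono (ℕ.+-monoʳ-≤ 3 T<T₀)) g≤s)))
      ... | q , pq , gT<q , q≤g = q , pq , ℕ.≤-trans (ℕ.*-mono-≤ q≤s q≤s) s²≤n , ratio-bound {K} {K₁} {s} {q} {n} T (s≤s z≤n) n<s² (≤g⁻ (4 + T) upper) (ℕ.<⇒≤ (<g⁻ T gT<q))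
        where
        q≤s : q ≤ s
        q≤s = ℕ.≤-trans q≤g lower

  powered-ratio : ∀ {K K₁ Q n e} r → 1 ≤ K → n * K ^ 8 ≤ K₁ ^ 8 * Q → e * K₁ ^ (8 * r) ≤ suc e * K ^ (8 * r) → e * n ^ r ≤ suc e * Q ^ r
  powered-ratio {K} {K₁} {Q} {n} {e} r 1≤K h₁ h₂ = ℕ.*-cancelʳ-≤ (e * n ^ r) (suc e * Q ^ r) (K ^ (8 * r)) ⦃ ^-positive (8 * r) 1≤K ⦄ (begin
    e * n ^ r * K ^ (8 * r)           ≡⟨ ℕ.*-assoc e (n ^ r) (K ^ (8 * r)) ⟩
    e * (n ^ r * K ^ (8 * r))         ≡⟨ cong (λ t → e * (n ^ r * t)) (ℕ.^-*-assoc K 8 r) ⟨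
    e * (n ^ r * (K ^ 8) ^ r)         ≡⟨ cong (e *_) (^-distrib-* n (K ^ 8) r) ⟨
    e * (n * K ^ 8) ^ r               ≤⟨ ℕ.*-monoʳ-≤ e (ℕ.^-monoˡ-≤ r h₁) ⟩
    e * (K₁ ^ 8 * Q) ^ r              ≡⟨ cong (e *_) (^-distrib-* (K₁ ^ 8) Q r) ⟩
    e * ((K₁ ^ 8) ^ r * Q ^ r)        ≡⟨ cong (λ t → e * (t * Q ^ r)) (ℕ.^-*-assoc K₁ 8 r) ⟩
    e * (K₁ ^ (8 * r) * Q ^ r)        ≡⟨ ℕ.*-assoc e (K₁ ^ (8 * r)) (Q ^ r) ⟨
    e * K₁ ^ (8 * r) * Q ^ r          ≤⟨ ℕ.*-monoˡ-≤ (Q ^ r) h₂ ⟩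
    suc e * K ^ (8 * r) * Q ^ r       ≡⟨ trans (ℕ.*-assoc (suc e) (K ^ (8 * r)) (Q ^ r)) (trans (cong (suc e *_) (ℕ.*-comm (K ^ (8 * r)) (Q ^ r))) (sym (ℕ.*-assoc (suc e) (Q ^ r) (K ^ (8 * r))))) ⟩
    suc e * Q ^ r * K ^ (8 * r)       ∎)
    where open ℕ.≤-Reasoning

  -- Because q² ≤ n, all but one of the factors q² in the hypothesis may be replaced by n and
  -- cancelled, leaving e n ≤ (e + 1) q².
  full-rows : ∀ {j e n m q} r → 1 ≤ n → j < e → q * q ≤ n → e * n ^ suc r ≤ suc e * (q * q) ^ suc r → j * (n * (m * m)) ≤ suc j * (m * q * (m * q))
  full-rows {j} {e} {n} {m} {q} r 1≤n j<e q²≤n h = begin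
    j * (n * (m * m))           ≡⟨ ℕ.*-assoc j n (m * m) ⟨
    j * n * (m * m)             ≤⟨ ℕ.*-monoˡ-≤ (m * m) (ℕ.*-cancelˡ-≤ e ⦃ >-nonZero (ℕ.≤-trans (s≤s z≤n) j<e) ⦄ (begin
      e * (j * n)               ≡⟨ *-swap e j n ⟩
      j * (e * n)               ≤⟨ ℕ.*-monoʳ-≤ j linear ⟩
      j * (suc e * Q)           ≡⟨ ℕ.*-assoc j (suc e) Q ⟨
      j * suc e * Q             ≤⟨ ℕ.*-monoˡ-≤ Q coefficient ⟩
      e * suc j * Q             ≡⟨ ℕ.*-assoc e (suc j) Q ⟩
      e * (suc j * Q)           ∎)) ⟩
    suc j * Q * (m * m)         ≡⟨ ℕ.*-assoc (suc j) Q (m * m) ⟩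
    suc j * (Q * (m * m))       ≡⟨ cong (suc j *_) (trans (ℕ.*-comm Q (m * m)) (*-interchange m m q q)) ⟩
    suc j * (m * q * (m * q))   ∎
    where
    open ℕ.≤-Reasoning
    Q : ℕ
    Q = q * q
    coefficient : j * suc e ≤ e * suc j
    coefficient = begin
      j * suc e     ≡⟨ ℕ.*-suc j e ⟩
      j + j * e     ≤⟨ ℕ.+-monoˡ-≤ (j * e) (ℕ.<⇒≤ j<e) ⟩
      e + j * e     ≡⟨ cong (e +_) (ℕ.*-comm j e) ⟩
      e + e * j     ≡⟨ ℕ.*-suc e j ⟨
      e * suc j     ∎
    linear : e * n ≤ suc e * Q
    linear = ℕ.*-cancelʳ-≤ (e * n) (suc e * Q) (n ^ r) ⦃ ^-positive r 1≤n ⦄ (begin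
      e * n * n ^ r             ≡⟨ ℕ.*-assoc e n (n ^ r) ⟩
      e * n ^ suc r             ≤⟨ h ⟩
      suc e * (Q * Q ^ r)       ≤⟨ ℕ.*-monoʳ-≤ (suc e) (ℕ.*-monoʳ-≤ Q (ℕ.^-monoˡ-≤ r q²≤n)) ⟩
      suc e * (Q * n ^ r)       ≡⟨ ℕ.*-assoc (suc e) Q (n ^ r) ⟨
      suc e * Q * n ^ r         ∎)

  -- Two losses of 1 + 1/e are combined: m² against n^r, and n^(r + 1) against q^(2r + 2).
  full-code : ∀ {j e n m q} r → 1 ≤ e → j * (suc e * suc e) ≤ suc j * (e * e) → e * (m * m) ≤ suc e * n ^ r → e * n ^ suc r ≤ suc e * (q * q) ^ suc r →
    j * (n * (m * m)) ≤ suc j * (q ^ r * q * (q ^ r * q))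
  full-code {j} {e} {n} {m} {q} r 1≤e h₁ h₂ h₃ = ℕ.*-cancelˡ-≤ (e * e) ⦃ ℕ.m*n≢0 e e ⦃ >-nonZero 1≤e ⦄ ⦃ >-nonZero 1≤e ⦄ ⦄ (begin
    e * e * (j * Y)                   ≡⟨ *-swap (e * e) j Y ⟩
    j * (e * e * Y)                   ≡⟨ cong (j *_) (ℕ.*-assoc e e Y) ⟩
    j * (e * (e * Y))                 ≤⟨ ℕ.*-monoʳ-≤ j (ℕ.*-monoʳ-≤ e scaled) ⟩
    j * (e * (suc e * n ^ suc r))     ≡⟨ cong (j *_) (*-swap e (suc e) (n ^ suc r)) ⟩
    j * (suc e * (e * n ^ suc r))     ≤⟨ ℕ.*-monoʳ-≤ j (ℕ.*-monoʳ-≤ (suc e) h₃) ⟩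
    j * (suc e * (suc e * Q))         ≡⟨ trans (cong (j *_) (sym (ℕ.*-assoc (suc e) (suc e) Q))) (sym (ℕ.*-assoc j (suc e * suc e) Q)) ⟩
    j * (suc e * suc e) * Q           ≤⟨ ℕ.*-monoˡ-≤ Q h₁ ⟩
    suc j * (e * e) * Q               ≡⟨ trans (cong (_* Q) (ℕ.*-comm (suc j) (e * e))) (ℕ.*-assoc (e * e) (suc j) Q) ⟩
    e * e * (suc j * Q)               ≡⟨ cong (λ t → e * e * (suc j * t)) (trans (^-distrib-* q q (suc r)) (cong (λ t → t * t) (ℕ.*-comm q (q ^ r)))) ⟩
    e * e * (suc j * (q ^ r * q * (q ^ r * q))) ∎)
    where
    open ℕ.≤-Reasoning
    Y Q : ℕ
    Y = n * (m * m)
    Q = (q * q) ^ suc r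
    scaled : e * Y ≤ suc e * n ^ suc r
    scaled = begin
      e * (n * (m * m))         ≡⟨ *-swap e n (m * m) ⟩
      n * (e * (m * m))         ≤⟨ ℕ.*-monoʳ-≤ n h₂ ⟩
      n * (suc e * n ^ r)       ≡⟨ *-swap n (suc e) (n ^ r) ⟩
      suc e * n ^ suc r         ∎

  -- The code has min(m, q^(r + 1)) rows, as m may lie on either side of the number of polynomials;
  -- `full-rows` and `full-code` treat the two cases.
  asymptotic-lower : ∀ r j → ∃ λ N → ∀ n → N ≤ n → ∀ m → precision j * (m * m) ≤ suc (precision j) * n ^ suc r →
    j * (n * (m * m)) ≤ suc j * (z m n 2 (suc r) * z m n 2 (suc r))
  asymptotic-lower r j = suc (proj₁ near) , bound
    where
    e b K′ : ℕ
    e = precision j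
    -- b + 1 = 8 (r + 2) is the exponent to which the grid ratio gets raised, and the grid is taken
    -- with K + 1 = (b + 1)(e + 1) to fit `bernoulli-ratio`.
    b = suc r + 7 * suc (suc r)
    K′ = suc b * suc e ∸ 2
    size : 9 ≤ suc b * suc e
    size = ℕ.≤-trans (ℕ.≤-trans (s≤s (s≤s (s≤s (s≤s (s≤s (s≤s (s≤s (s≤s (s≤s z≤n))))))))) (ℕ.m≤m+n 16 (8 * r))) (ℕ.≤-trans (ℕ.≤-reflexive (identity r)) (ℕ.m≤m*n (suc b) (suc e)))
      where
      identity : ∀ r → 16 + 8 * r ≡ suc (suc r + 7 * suc (suc r))
      identity = solve-∀
    K₁≡ : suc (suc K′) ≡ suc b * suc e
    K₁≡ = ℕ.m+[n∸m]≡n (ℕ.≤-trans (s≤s (s≤s z≤n)) size)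
    near : ∃ λ N → ∀ n → N ≤ n → ∃ λ q → IsPrimePower q × q * q ≤ n × n * suc K′ ^ 8 ≤ suc (suc K′) ^ 8 * (q * q)
    near = primePower-near-root K′ (ℕ.≤-pred (subst (9 ≤_) (sym K₁≡) size))
    bound : ∀ n → suc (proj₁ near) ≤ n → ∀ m → e * (m * m) ≤ suc e * n ^ suc r → j * (n * (m * m)) ≤ suc j * (z m n 2 (suc r) * z m n 2 (suc r))
    bound n N<n m h = from-primePower (proj₂ near n (ℕ.<⇒≤ N<n))
      where
      from-primePower : (∃ λ q → IsPrimePower q × q * q ≤ n × n * suc K′ ^ 8 ≤ suc (suc K′) ^ 8 * (q * q)) → j * (n * (m * m)) ≤ suc j * (z m n 2 (suc r) * z m n 2 (suc r))
      from-primePower (q , pq , q²≤n , ratio) = ℕ.≤-trans (cases (ℕ.⊓-sel m (q ^ suc r))) (ℕ.*-monoʳ-≤ (suc j) (ℕ.*-mono-≤ code code))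
        where
        M : ℕ
        M = m ⊓ q ^ suc r
        code : M * q ≤ z m n 2 (suc r)
        code = code-lower pq r M m n (ℕ.m⊓n≤n m (q ^ suc r)) (ℕ.m⊓n≤m m (q ^ suc r)) q²≤n
        powered : e * n ^ suc (suc r) ≤ suc e * (q * q) ^ suc (suc r)
        powered = powered-ratio {suc K′} {suc (suc K′)} {q * q} {n} {e} (suc (suc r)) (s≤s z≤n) ratio (bernoulli-ratio (suc K′) b e K₁≡)
        cases : M ≡ m ⊎ M ≡ q ^ suc r → j * (n * (m * m)) ≤ suc j * (M * q * (M * q))
        cases (inj₁ M≡m) = subst (λ M → j * (n * (m * m)) ≤ suc j * (M * q * (M * q))) (sym M≡m) (full-rows {j} {e} {n} {m} {q} (suc r) (ℕ.≤-trans (s≤s z≤n) N<n) (ℕ.m≤n*m (suc j) 3) q²≤n powered)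
        cases (inj₂ M≡) = subst (λ M → j * (n * (m * m)) ≤ suc j * (M * q * (M * q))) (sym M≡) (full-code {j} {e} {n} {m} {q} (suc r) (s≤s z≤n) (precision-below j) h powered)

  within-≤ : ∀ {k x y} → suc k * ∣ x - y ∣ ≤ y → k * x ≤ suc k * y
  within-≤ {k} {x} {y} h = begin
    k * x                       ≤⟨ ℕ.*-monoʳ-≤ k (ℕ.m≤n+∣m-n∣ x y) ⟩
    k * (y + d)                 ≡⟨ ℕ.*-distribˡ-+ k y d ⟩
    k * y + k * d               ≤⟨ ℕ.+-monoʳ-≤ (k * y) (ℕ.≤-trans (ℕ.m≤n+m (k * d) d) h) ⟩
    k * y + y                   ≡⟨ ℕ.+-comm (k * y) y ⟩
    suc k * y                   ∎
    where
    open ℕ.≤-Reasoning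
    d : ℕ
    d = ∣ x - y ∣

  within-≥ : ∀ {k x y} → suc k * ∣ x - y ∣ ≤ y → k * y ≤ suc k * x
  within-≥ {k} {x} {y} h = ℕ.+-cancelˡ-≤ y (k * y) (suc k * x) (begin
    suc k * y                   ≤⟨ ℕ.*-monoʳ-≤ (suc k) (ℕ.m≤n+∣n-m∣ y x) ⟩
    suc k * (x + ∣ x - y ∣)     ≡⟨ ℕ.*-distribˡ-+ (suc k) x (∣ x - y ∣) ⟩
    suc k * x + suc k * ∣ x - y ∣ ≤⟨ ℕ.+-monoʳ-≤ (suc k * x) h ⟩
    suc k * x + y               ≡⟨ ℕ.+-comm (suc k * x) y ⟩
    y + suc k * x               ∎)
    where open ℕ.≤-Reasoning

  within : ∀ {j x y} → suc j * x ≤ suc (suc j) * y → j * y ≤ suc j * x → suc j * ∣ x - y ∣ ≤ y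
  within {j} {x} {y} h₁ h₂ with ℕ.≤-total x y
  ... | inj₁ x≤y = ℕ.+-cancelˡ-≤ (suc j * x) (suc j * ∣ x - y ∣) y (begin
    suc j * x + suc j * ∣ x - y ∣   ≡⟨ ℕ.*-distribˡ-+ (suc j) x (∣ x - y ∣) ⟨
    suc j * (x + ∣ x - y ∣)         ≡⟨ cong (λ d → suc j * (x + d)) (ℕ.m≤n⇒∣m-n∣≡n∸m x≤y) ⟩
    suc j * (x + (y ∸ x))           ≡⟨ cong (suc j *_) (ℕ.m+[n∸m]≡n x≤y) ⟩
    y + j * y                       ≤⟨ ℕ.+-monoʳ-≤ y h₂ ⟩
    y + suc j * x                   ≡⟨ ℕ.+-comm y (suc j * x) ⟩
    suc j * x + y                   ∎)
    where open ℕ.≤-Reasoning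
  ... | inj₂ y≤x = ℕ.+-cancelˡ-≤ (suc j * y) (suc j * ∣ x - y ∣) y (begin
    suc j * y + suc j * ∣ x - y ∣   ≡⟨ ℕ.*-distribˡ-+ (suc j) y (∣ x - y ∣) ⟨
    suc j * (y + ∣ x - y ∣)         ≡⟨ cong (λ d → suc j * (y + d)) (ℕ.m≤n⇒∣n-m∣≡n∸m y≤x) ⟩
    suc j * (y + (x ∸ y))           ≡⟨ cong (suc j *_) (ℕ.m+[n∸m]≡n y≤x) ⟩
    suc j * x                       ≤⟨ h₁ ⟩
    y + suc j * y                   ≡⟨ ℕ.+-comm y (suc j * y) ⟩
    suc j * y + y                   ∎)
    where open ℕ.≤-Reasoning

  square : ∀ x → x ^ 2 ≡ x * x
  square x = cong (x *_) (ℕ.*-identityʳ x)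

  -- The hypothesis on m is used at `precision j`, finer than the target by a factor of about three,
  -- because its error and that of the construction both enter.
  asymptotics : ∀ r → (m : ℕ → ℕ) →
    ((j : ℕ) → Σ ℕ λ N → (n : ℕ) → N ≤ n → suc j * ∣ m n ^ 2 - n ^ suc r ∣ ≤ n ^ suc r) →
    (j : ℕ) → Σ ℕ λ N → (n : ℕ) → N ≤ n → suc j * ∣ z (m n) n 2 (suc r) ^ 2 - n * m n ^ 2 ∣ ≤ n * m n ^ 2
  asymptotics r m h j = N₁ ⊔ N₂ ⊔ N₃ , bound
    where
    N₁ N₂ N₃ : ℕ
    N₁ = proj₁ (h (precision j))
    N₂ = proj₁ (asymptotic-upper r j)
    N₃ = proj₁ (asymptotic-lower r j)
    bound : ∀ n → N₁ ⊔ N₂ ⊔ N₃ ≤ n → suc j * ∣ z (m n) n 2 (suc r) ^ 2 - n * m n ^ 2 ∣ ≤ n * m n ^ 2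
    bound n N≤n = subst₂ (λ x y → suc j * ∣ x - n * y ∣ ≤ n * y) (sym (square (z (m n) n 2 (suc r)))) (sym (square (m n)))
      (within {j} (proj₂ (asymptotic-upper r j) n (ℕ.≤-trans (ℕ.m≤n⊔m N₁ N₂) N₁₂≤n) (m n) (within-≥ {precision j} {m n * m n} {n ^ suc r} close))
        (proj₂ (asymptotic-lower r j) n (ℕ.≤-trans (ℕ.m≤n⊔m (N₁ ⊔ N₂) N₃) N≤n) (m n) (within-≤ {precision j} {m n * m n} {n ^ suc r} close)))
      where
      N₁₂≤n : N₁ ⊔ N₂ ≤ n
      N₁₂≤n = ℕ.≤-trans (ℕ.m≤m⊔n (N₁ ⊔ N₂) N₃) N≤n
      close : suc (precision j) * ∣ m n * m n - n ^ suc r ∣ ≤ n ^ suc r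
      close = subst (λ x → suc (precision j) * ∣ x - n ^ suc r ∣ ≤ n ^ suc r) (square (m n)) (proj₂ (h (precision j)) n (ℕ.≤-trans (ℕ.m≤m⊔n N₁ N₂) N₁₂≤n))

open import Defs
open import Data.Nat using (ℕ; suc; _+_; _*_; _^_; _≤_; ∣_-_∣)
open import Data.Product using (_×_; Σ; _,_)
open import Relation.Binary.PropositionalEquality using (_≡_)

theorem10 :
  -- (a)
  ((q : ℕ) → IsPrimePower q →
    z (q * (q ^ 2 + 1)) (q ^ 2 + 1) 2 3 ≡ (q ^ 2 + q) * (q ^ 2 + 1))
  ×
  -- (b)  (asymptotics stated with squared quantities, epsilon = 1/(j+1))
  ((r : ℕ) → 4 ≤ r → (m : ℕ → ℕ) →
    ((j : ℕ) → Σ ℕ λ N → (n : ℕ) → N ≤ n →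
       suc j * ∣ m n ^ 2 - n ^ r ∣ ≤ n ^ r) →
    ((j : ℕ) → Σ ℕ λ N → (n : ℕ) → N ≤ n →
       suc j * ∣ z (m n) n 2 r ^ 2 - n * m n ^ 2 ∣ ≤ n * m n ^ 2))
theorem10 = MobiusPlanes.mobius , λ { (suc r) _ → Asymptotics.asymptotics r }
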